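{- Let $G$ be an abelian group, let $s,n$ be positive integers, let $K$ be a real number with $2\leq K< 2^{ -36}\frac{s}{(\log n)^3}$, and let $Y\subset G$ with $|Y|=n$. Then the number of sets $J\subset Y$ with $|J|=s$ and $|J+J|\leq K|J|$ is at most \[ \exp\Big(2^9\lambda K^{1/6}s^{5/6}\sqrt{\log n}\Big)\binom{\frac{1}{2}(Ks+\beta)}{s},\] where $\beta:= \beta\big(Ks+2^6K^{7/6}s^{5/6}\sqrt{\log n}\big)$ and $\lambda:=\min\big\{\frac{K}{K-2},\log s\big\}$ (with $\frac{K}{K-2}=\infty$ when $K=2$).
   Context: $J+J=\{a+b: a,b\in J\}$. For a positive real $t$, $\beta(t)=\max\{|H|: H \text{ a subgroup of } G,\ |H|\leq t\}$ is the size of the largest subgroup of $G$ of size at most $t$. $\log$ denotes the natural logarithm; binomial coefficients $\binom{x}{s}$ with real $x$ are the generalized binomial coefficients $x(x-1)\cdots(x-s+1)/s!$. -}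

module Defs where

open import Algebra.Bundles using (AbelianGroup)
open import Data.Fin.Base using (Fin)
open import Data.Integer.Base as ℤ using (+_; -[1+_])
import Data.Integer.Properties as ℤₚ
open import Data.Nat.Coprimality as Coprime using (1-coprimeTo)
open import Data.Nat.Base as ℕ using (ℕ; zero; suc; _!)
import Data.Nat.Properties as ℕₚ
open import Data.Nat.Properties using (_!≢0)
open import Data.Product.Base using (Σ-syntax; ∃-syntax; _×_; _,_; proj₁; proj₂)
open import Data.Rational.Base as ℚ using (ℚ; mkℚ; 0ℚ; 1ℚ; ½; ∣_∣; toℚᵘ)
import Data.Rational.Properties as ℚₚ
open import Data.Rational.Solver using (module +-*-Solver)
import Data.Rational.Unnormalised.Base as ℚᵘ
import Data.Rational.Unnormalised.Properties as ℚᵘₚ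
open import Data.Sum.Base using (_⊎_; inj₁; inj₂)
open import Function.Base using (_∘_)
open import Function.Bundles using (_⇔_)
open import Level using (_⊔_)
open import Relation.Binary.PropositionalEquality
open import Relation.Nullary.Negation.Core using (¬_)
open import Relation.Unary using (Pred; _≐_; _∈_)

ι : ℕ → ℚ
ι n = mkℚ (+ n) 0 (Coprime.sym (1-coprimeTo n))

-- 1 / (i + 1)
recip : ℕ → ℚ
recip i = mkℚ (+ 1) i (1-coprimeTo (suc i))

Cauchy : (ℕ → ℚ) → Set
Cauchy x = ∀ ε → 0ℚ ℚ.< ε → ∃[ N ] (∀ m n → N ℕ.≤ m → N ℕ.≤ n → ∣ x m ℚ.- x n ∣ ℚ.≤ ε)

record ℝ : Set where
  constructor mkℝ
  field
    seq    : ℕ → ℚ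
    cauchy : Cauchy seq

open ℝ public

-- The partial sums Σ_{i ≤ k} q^i / i! of the exponential series.

expTerm : ℚ → ℕ → ℚ
expTerm q zero    = 1ℚ
expTerm q (suc i) = expTerm q i ℚ.* (q ℚ.* recip i)

expSum : ℚ → ℕ → ℚ
expSum q zero    = expTerm q zero
expSum q (suc k) = expSum q k ℚ.+ expTerm q (suc k)

module CauchyLemmas where

  open ℚₚ.≤-Reasoning

  0≤1 : 0ℚ ℚ.≤ 1ℚ
  0≤1 = ℚₚ.nonNegative⁻¹ 1ℚ

  0<1 : 0ℚ ℚ.< 1ℚ
  0<1 = ℚₚ.positive⁻¹ 1ℚ

  *-monoʳ : ∀ {r p q} → 0ℚ ℚ.≤ r → p ℚ.≤ q → r ℚ.* p ℚ.≤ r ℚ.* q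
  *-monoʳ {r} h = ℚₚ.*-monoˡ-≤-nonNeg r {{ℚ.nonNegative h}}

  *-monoˡ : ∀ {r p q} → 0ℚ ℚ.≤ r → p ℚ.≤ q → p ℚ.* r ℚ.≤ q ℚ.* r
  *-monoˡ {r} h = ℚₚ.*-monoʳ-≤-nonNeg r {{ℚ.nonNegative h}}

  *-mono : ∀ {p q r s} → 0ℚ ℚ.≤ p → 0ℚ ℚ.≤ s → p ℚ.≤ q → r ℚ.≤ s → p ℚ.* r ℚ.≤ q ℚ.* s
  *-mono hp hs p≤q r≤s = ℚₚ.≤-trans (*-monoʳ hp r≤s) (*-monoˡ hs p≤q)

  0≤* : ∀ {p q} → 0ℚ ℚ.≤ p → 0ℚ ℚ.≤ q → 0ℚ ℚ.≤ p ℚ.* q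
  0≤* {p} {q} hp hq = subst (ℚ._≤ p ℚ.* q) (ℚₚ.*-zeroʳ p) (*-monoʳ hp hq)

  0<* : ∀ {p q} → 0ℚ ℚ.< p → 0ℚ ℚ.< q → 0ℚ ℚ.< p ℚ.* q
  0<* {p} {q} hp hq =
    ℚₚ.positive⁻¹ _ {{ℚₚ.pos*pos⇒pos p {{ℚ.positive hp}} q {{ℚ.positive hq}}}}

  p≤p+q : ∀ {p q} → 0ℚ ℚ.≤ q → p ℚ.≤ p ℚ.+ q
  p≤p+q {p} {q} hq = subst (ℚ._≤ p ℚ.+ q) (ℚₚ.+-identityʳ p) (ℚₚ.+-monoʳ-≤ p hq)

  p≤∣p∣ : ∀ p → p ℚ.≤ ∣ p ∣
  p≤∣p∣ p with ℚₚ.≤-total 0ℚ p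
  ... | inj₁ h = ℚₚ.≤-reflexive (sym (ℚₚ.0≤p⇒∣p∣≡p h))
  ... | inj₂ h = ℚₚ.≤-trans h (ℚₚ.0≤∣p∣ p)

  -p≤∣p∣ : ∀ p → ℚ.- p ℚ.≤ ∣ p ∣
  -p≤∣p∣ p = subst (ℚ.- p ℚ.≤_) (ℚₚ.∣-p∣≡∣p∣ p) (p≤∣p∣ (ℚ.- p))

  ∣∣-≤ : ∀ {p r} → p ℚ.≤ r → ℚ.- p ℚ.≤ r → ∣ p ∣ ℚ.≤ r
  ∣∣-≤ {p} h₁ h₂ with ℚₚ.∣p∣≡p∨∣p∣≡-p p
  ... | inj₁ e = subst (ℚ._≤ _) (sym e) h₁
  ... | inj₂ e = subst (ℚ._≤ _) (sym e) h₂

  -‿flip : ∀ p q → ℚ.- (p ℚ.- q) ≡ q ℚ.- p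
  -‿flip = solve 2 (λ p q → :- (p :- q) := q :- p) refl
    where open +-*-Solver

  ∣-∣-sym : ∀ p q → ∣ p ℚ.- q ∣ ≡ ∣ q ℚ.- p ∣
  ∣-∣-sym p q = trans (sym (ℚₚ.∣-p∣≡∣p∣ (p ℚ.- q))) (cong ∣_∣ (-‿flip p q))

  1/⁺ : (q : ℚ) → 0ℚ ℚ.< q → ℚ
  1/⁺ q h = (ℚ.1/ q) {{ℚ.>-nonZero h}}

  *-1/⁺ : ∀ q h → q ℚ.* 1/⁺ q h ≡ 1ℚ
  *-1/⁺ q h = ℚₚ.*-inverseʳ q {{ℚ.>-nonZero h}}

  0<1/⁺ : ∀ q h → 0ℚ ℚ.< 1/⁺ q h
  0<1/⁺ q h = ℚₚ.positive⁻¹ _ {{ℚₚ.1/pos⇒pos q {{ℚ.positive h}}}}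

  ι-suc : ∀ n → ι (suc n) ≡ 1ℚ ℚ.+ ι n
  ι-suc n = ℚₚ.toℚᵘ-injective (ℚᵘₚ.≃-sym (ℚᵘₚ.≃-trans (ℚₚ.toℚᵘ-homo-+ 1ℚ (ι n))
    (ℚᵘ.*≡* (cong (ℤ._* + 1) (cong (ℤ._+_ (+ 1)) (ℤₚ.*-identityʳ (+ n)))))))

  0≤ι : ∀ n → 0ℚ ℚ.≤ ι n
  0≤ι n = ℚₚ.nonNegative⁻¹ _ 

  ι-mono : ∀ {m n} → m ℕ.≤ n → ι m ℚ.≤ ι n
  ι-mono {n = n} ℕ.z≤n = 0≤ι n
  ι-mono (ℕ.s≤s {m} {n} h) =
    subst₂ ℚ._≤_ (sym (ι-suc m)) (sym (ι-suc n)) (ℚₚ.+-monoʳ-≤ 1ℚ (ι-mono h))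

  0≤recip : ∀ i → 0ℚ ℚ.≤ recip i
  0≤recip i = ℚₚ.nonNegative⁻¹ _ 

  ι*recip : ∀ i → ι (suc i) ℚ.* recip i ≡ 1ℚ
  ι*recip i = ℚₚ.toℚᵘ-injective (ℚᵘₚ.≃-trans (ℚₚ.toℚᵘ-homo-* (ι (suc i)) (recip i))
    (ℚᵘₚ.*-inverseʳ (ℚᵘ.mkℚᵘ (+ suc i) 0)))

  archimedean : ∀ q → ∃[ n ] (q ℚ.≤ ι n)
  archimedean q@(mkℚ n d c) = ℤ.∣ n ∣ , ℚₚ.toℚᵘ-cancel-≤
    (ℚᵘ.*≤* (lem n))
    where
    lem : ∀ n → n ℤ.* + 1 ℤ.≤ + ℤ.∣ n ∣ ℤ.* + suc d
    lem (+ n)    = subst₂ ℤ._≤_ (sym (ℤₚ.*-identityʳ (+ n))) (ℤₚ.pos-* n (suc d))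
                     (ℤ.+≤+ (ℕₚ.m≤m*n n (suc d)))
    lem -[1+ n ] = ℤ.-≤+

  archimedean* : ∀ q ε → 0ℚ ℚ.< ε → ∃[ n ] (q ℚ.≤ ι n ℚ.* ε)
  archimedean* q ε h with archimedean (q ℚ.* 1/⁺ ε h)
  ... | n , le = n , (begin
    q                            ≡⟨ ℚₚ.*-identityʳ q ⟨
    q ℚ.* 1ℚ                     ≡⟨ cong (q ℚ.*_) (*-1/⁺ ε h) ⟨
    q ℚ.* (ε ℚ.* 1/⁺ ε h)        ≡⟨ solve 3 (λ q e i → q :* (e :* i) := (q :* i) :* e) refl q ε (1/⁺ ε h) ⟩
    (q ℚ.* 1/⁺ ε h) ℚ.* ε        ≤⟨ *-monoˡ (ℚₚ.<⇒≤ h) le ⟩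
    ι n ℚ.* ε                    ∎)
    where open +-*-Solver

  const-cauchy : ∀ q → Cauchy (λ _ → q)
  const-cauchy q ε h = 0 , λ _ _ _ _ →
    subst (ℚ._≤ ε) (sym (cong ∣_∣ (ℚₚ.+-inverseʳ q))) (ℚₚ.<⇒≤ h)

  dominate : ∀ {x y z : ℕ → ℚ} A B → 0ℚ ℚ.< A → 0ℚ ℚ.< B → ∀ N →
             (∀ m n → N ℕ.≤ m → N ℕ.≤ n →
               ∣ z m ℚ.- z n ∣ ℚ.≤ A ℚ.* ∣ x m ℚ.- x n ∣ ℚ.+ B ℚ.* ∣ y m ℚ.- y n ∣) →
             Cauchy x → Cauchy y → Cauchy z
  dominate {x} {y} {z} A B 0<A 0<B N₀ est cx cy ε 0<ε =
    N₀ ℕ.⊔ (proj₁ X ℕ.⊔ proj₁ Y) , λ m n hm hn → begin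
      ∣ z m ℚ.- z n ∣
        ≤⟨ est m n (l₀ hm) (l₀ hn) ⟩
      A ℚ.* ∣ x m ℚ.- x n ∣ ℚ.+ B ℚ.* ∣ y m ℚ.- y n ∣
        ≤⟨ ℚₚ.+-mono-≤ (*-monoʳ (ℚₚ.<⇒≤ 0<A) (proj₂ X m n (l₁ hm) (l₁ hn)))
                       (*-monoʳ (ℚₚ.<⇒≤ 0<B) (proj₂ Y m n (l₂ hm) (l₂ hn))) ⟩
      A ℚ.* share A 0<A ℚ.+ B ℚ.* share B 0<B
        ≡⟨ cong₂ ℚ._+_ (shared A 0<A) (shared B 0<B) ⟩
      ½ ℚ.* ε ℚ.+ ½ ℚ.* ε
        ≡⟨ ℚₚ.*-distribʳ-+ ε ½ ½ ⟨
      1ℚ ℚ.* ε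
        ≡⟨ ℚₚ.*-identityˡ ε ⟩
      ε ∎
    where
    share : ∀ C → 0ℚ ℚ.< C → ℚ
    share C h = 1/⁺ C h ℚ.* (½ ℚ.* ε)
    0<share : ∀ C h → 0ℚ ℚ.< share C h
    0<share C h = 0<* (0<1/⁺ C h) (0<* (ℚₚ.positive⁻¹ ½) 0<ε)
    shared : ∀ C h → C ℚ.* share C h ≡ ½ ℚ.* ε
    shared C h = trans (sym (ℚₚ.*-assoc C (1/⁺ C h) _))
                   (trans (cong (ℚ._* (½ ℚ.* ε)) (*-1/⁺ C h)) (ℚₚ.*-identityˡ _))
    X = cx (share A 0<A) (0<share A 0<A)
    Y = cy (share B 0<B) (0<share B 0<B)
    l₀ : ∀ {m} → N₀ ℕ.⊔ (proj₁ X ℕ.⊔ proj₁ Y) ℕ.≤ m → N₀ ℕ.≤ m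
    l₀ = ℕₚ.m⊔n≤o⇒m≤o N₀ _
    l₁ : ∀ {m} → N₀ ℕ.⊔ (proj₁ X ℕ.⊔ proj₁ Y) ℕ.≤ m → proj₁ X ℕ.≤ m
    l₁ = ℕₚ.m⊔n≤o⇒m≤o (proj₁ X) (proj₁ Y) ∘ ℕₚ.m⊔n≤o⇒n≤o N₀ _
    l₂ : ∀ {m} → N₀ ℕ.⊔ (proj₁ X ℕ.⊔ proj₁ Y) ℕ.≤ m → proj₁ Y ℕ.≤ m
    l₂ = ℕₚ.m⊔n≤o⇒n≤o (proj₁ X) (proj₁ Y) ∘ ℕₚ.m⊔n≤o⇒n≤o N₀ _

  dominate₁ : ∀ {x y z : ℕ → ℚ} →
              (∀ m n → ∣ z m ℚ.- z n ∣ ℚ.≤ ∣ x m ℚ.- x n ∣ ℚ.+ ∣ y m ℚ.- y n ∣) →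
              Cauchy x → Cauchy y → Cauchy z
  dominate₁ {x} {y} {z} est = dominate {x} {y} {z} 1ℚ 1ℚ 0<1 0<1 0 λ m n _ _ → ℚₚ.≤-trans (est m n)
    (ℚₚ.≤-reflexive (sym (cong₂ ℚ._+_ (ℚₚ.*-identityˡ ∣ x m ℚ.- x n ∣) (ℚₚ.*-identityˡ ∣ y m ℚ.- y n ∣))))

  +-cauchy : ∀ {x y} → Cauchy x → Cauchy y → Cauchy (λ k → x k ℚ.+ y k)
  +-cauchy {x} {y} = dominate₁ {x} {y} {λ k → x k ℚ.+ y k} λ m n → begin
    ∣ (x m ℚ.+ y m) ℚ.- (x n ℚ.+ y n) ∣
      ≡⟨ cong ∣_∣ (solve 4 (λ a b c d → (a :+ b) :- (c :+ d) := (a :- c) :+ (b :- d)) refl (x m) (y m) (x n) (y n)) ⟩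
    ∣ (x m ℚ.- x n) ℚ.+ (y m ℚ.- y n) ∣
      ≤⟨ ℚₚ.∣p+q∣≤∣p∣+∣q∣ (x m ℚ.- x n) (y m ℚ.- y n) ⟩
    ∣ x m ℚ.- x n ∣ ℚ.+ ∣ y m ℚ.- y n ∣ ∎
    where open +-*-Solver

  neg-cauchy : ∀ {x} → Cauchy x → Cauchy (λ k → ℚ.- x k)
  neg-cauchy {x} cx ε h with cx ε h
  ... | N , f = N , λ m n hm hn → subst (ℚ._≤ ε) (trans (∣-∣-sym (x m) (x n)) (cong ∣_∣
          (solve 2 (λ a b → b :- a := (:- a) :- (:- b)) refl (x m) (x n)))) (f m n hm hn)
    where open +-*-Solver

  ⊓-lipschitz : ∀ a b c d → (a ℚ.⊓ b) ℚ.- (c ℚ.⊓ d) ℚ.≤ ∣ a ℚ.- c ∣ ℚ.+ ∣ b ℚ.- d ∣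
  ⊓-lipschitz a b c d with ℚₚ.≤-total c d
  ... | inj₁ c≤d rewrite ℚₚ.p≤q⇒p⊓q≡p c≤d = begin
    (a ℚ.⊓ b) ℚ.- c                  ≤⟨ ℚₚ.+-monoˡ-≤ (ℚ.- c) (ℚₚ.p⊓q≤p a b) ⟩
    a ℚ.- c                          ≤⟨ p≤∣p∣ _ ⟩
    ∣ a ℚ.- c ∣                      ≤⟨ p≤p+q (ℚₚ.0≤∣p∣ _) ⟩
    ∣ a ℚ.- c ∣ ℚ.+ ∣ b ℚ.- d ∣      ∎
  ... | inj₂ d≤c rewrite ℚₚ.p≥q⇒p⊓q≡q d≤c = begin
    (a ℚ.⊓ b) ℚ.- d                  ≤⟨ ℚₚ.+-monoˡ-≤ (ℚ.- d) (ℚₚ.p⊓q≤q a b) ⟩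
    b ℚ.- d                          ≤⟨ p≤∣p∣ _ ⟩
    ∣ b ℚ.- d ∣                      ≤⟨ p≤p+q (ℚₚ.0≤∣p∣ _) ⟩
    ∣ b ℚ.- d ∣ ℚ.+ ∣ a ℚ.- c ∣      ≡⟨ ℚₚ.+-comm ∣ b ℚ.- d ∣ _ ⟩
    ∣ a ℚ.- c ∣ ℚ.+ ∣ b ℚ.- d ∣      ∎

  ⊓-cauchy : ∀ {x y} → Cauchy x → Cauchy y → Cauchy (λ k → x k ℚ.⊓ y k)
  ⊓-cauchy {x} {y} = dominate₁ {x} {y} {λ k → x k ℚ.⊓ y k} λ m n → ∣∣-≤ (⊓-lipschitz (x m) (y m) (x n) (y n))
    (subst₂ ℚ._≤_ (sym (-‿flip (x m ℚ.⊓ y m) (x n ℚ.⊓ y n))) (cong₂ ℚ._+_ (∣-∣-sym (x n) (x m)) (∣-∣-sym (y n) (y m)))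
      (⊓-lipschitz (x n) (y n) (x m) (y m)))

  boundedℕ : ∀ {x} → Cauchy x → ∃[ B ] ∃[ N ] (∀ k → N ℕ.≤ k → ∣ x k ∣ ℚ.≤ ι (suc B))
  boundedℕ {x} cx with cx 1ℚ 0<1
  ... | N , f with archimedean ∣ x N ∣
  ... | B , le = B , N , λ k hk → begin
    ∣ x k ∣                          ≡⟨ cong ∣_∣ (solve 2 (λ a b → a := (a :- b) :+ b) refl (x k) (x N)) ⟩
    ∣ (x k ℚ.- x N) ℚ.+ x N ∣        ≤⟨ ℚₚ.∣p+q∣≤∣p∣+∣q∣ (x k ℚ.- x N) (x N) ⟩
    ∣ x k ℚ.- x N ∣ ℚ.+ ∣ x N ∣      ≤⟨ ℚₚ.+-mono-≤ (f k N hk ℕₚ.≤-refl) le ⟩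
    1ℚ ℚ.+ ι B                       ≡⟨ ι-suc B ⟨
    ι (suc B)                        ∎
    where open +-*-Solver

  0<ι : ∀ n → 0ℚ ℚ.< ι (suc n)
  0<ι n = ℚₚ.positive⁻¹ _

  bounded : ∀ {x} → Cauchy x → ∃[ C ] (0ℚ ℚ.< C × ∃[ N ] (∀ k → N ℕ.≤ k → ∣ x k ∣ ℚ.≤ C))
  bounded {x} cx = let B , N , f = boundedℕ {x} cx in ι (suc B) , 0<ι B , N , f

  *-cauchy : ∀ {x y} → Cauchy x → Cauchy y → Cauchy (λ k → x k ℚ.* y k)
  *-cauchy {x} {y} cx cy = go (bounded {x} cx) (bounded {y} cy)
    where
    open +-*-Solver
    go : ∃[ C ] (0ℚ ℚ.< C × ∃[ N ] (∀ k → N ℕ.≤ k → ∣ x k ∣ ℚ.≤ C)) →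
         ∃[ C ] (0ℚ ℚ.< C × ∃[ N ] (∀ k → N ℕ.≤ k → ∣ y k ∣ ℚ.≤ C)) →
         Cauchy (λ k → x k ℚ.* y k)
    go (A , 0<A , M , f) (B , 0<B , N , g) = dominate {x} {y} {λ k → x k ℚ.* y k} B A 0<B 0<A (M ℕ.⊔ N)
      (λ m n hm hn → begin
        ∣ x m ℚ.* y m ℚ.- x n ℚ.* y n ∣
          ≡⟨ cong ∣_∣ (solve 4 (λ a b c d → a :* b :- c :* d := d :* (a :- c) :+ a :* (b :- d)) refl (x m) (y m) (x n) (y n)) ⟩
        ∣ y n ℚ.* (x m ℚ.- x n) ℚ.+ x m ℚ.* (y m ℚ.- y n) ∣
          ≤⟨ ℚₚ.∣p+q∣≤∣p∣+∣q∣ (y n ℚ.* (x m ℚ.- x n)) (x m ℚ.* (y m ℚ.- y n)) ⟩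
        ∣ y n ℚ.* (x m ℚ.- x n) ∣ ℚ.+ ∣ x m ℚ.* (y m ℚ.- y n) ∣
          ≡⟨ cong₂ ℚ._+_ (ℚₚ.∣p*q∣≡∣p∣*∣q∣ (y n) (x m ℚ.- x n)) (ℚₚ.∣p*q∣≡∣p∣*∣q∣ (x m) (y m ℚ.- y n)) ⟩
        ∣ y n ∣ ℚ.* ∣ x m ℚ.- x n ∣ ℚ.+ ∣ x m ∣ ℚ.* ∣ y m ℚ.- y n ∣
          ≤⟨ ℚₚ.+-mono-≤ (*-monoˡ (ℚₚ.0≤∣p∣ (x m ℚ.- x n)) (g n (ℕₚ.m⊔n≤o⇒n≤o M N hn)))
                         (*-monoˡ (ℚₚ.0≤∣p∣ (y m ℚ.- y n)) (f m (ℕₚ.m⊔n≤o⇒m≤o M N hm))) ⟩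
        B ℚ.* ∣ x m ℚ.- x n ∣ ℚ.+ A ℚ.* ∣ y m ℚ.- y n ∣ ∎)
      cx cy

  0<⊔ : ∀ q ε → 0ℚ ℚ.< ε → 0ℚ ℚ.< q ℚ.⊔ ε
  0<⊔ q ε h = ℚₚ.<-≤-trans h (ℚₚ.p≤q⊔p q ε)

  1/⁺-antimono : ∀ {p q} hp hq → p ℚ.≤ q → 1/⁺ q hq ℚ.≤ 1/⁺ p hp
  1/⁺-antimono {p} {q} hp hq p≤q = begin
    q′                     ≡⟨ ℚₚ.*-identityˡ _ ⟨
    1ℚ ℚ.* q′              ≡⟨ cong (ℚ._* q′) (*-1/⁺ p hp) ⟨
    (p ℚ.* p′) ℚ.* q′      ≡⟨ solve 3 (λ p p′ q′ → (p :* p′) :* q′ := p :* (p′ :* q′)) refl p p′ q′ ⟩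
    p ℚ.* (p′ ℚ.* q′)      ≤⟨ *-monoˡ (ℚₚ.<⇒≤ (0<* (0<1/⁺ p hp) (0<1/⁺ q hq))) p≤q ⟩
    q ℚ.* (p′ ℚ.* q′)      ≡⟨ solve 3 (λ q p′ q′ → q :* (p′ :* q′) := (q :* q′) :* p′) refl q p′ q′ ⟩
    (q ℚ.* q′) ℚ.* p′      ≡⟨ cong (ℚ._* p′) (*-1/⁺ q hq) ⟩
    1ℚ ℚ.* p′              ≡⟨ ℚₚ.*-identityˡ _ ⟩
    p′                     ∎
    where
    open +-*-Solver
    p′ = 1/⁺ p hp
    q′ = 1/⁺ q hq

  1/⁺-lipschitz : ∀ {ε p q} hε hp hq → ε ℚ.≤ p → ε ℚ.≤ q →
                  ∣ 1/⁺ p hp ℚ.- 1/⁺ q hq ∣ ℚ.≤ (1/⁺ ε hε ℚ.* 1/⁺ ε hε) ℚ.* ∣ p ℚ.- q ∣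
  1/⁺-lipschitz {ε} {p} {q} hε hp hq ε≤p ε≤q = begin
    ∣ p′ ℚ.- q′ ∣
      ≡⟨ cong ∣_∣ (cong₂ ℚ._-_ (trans (sym (ℚₚ.*-identityˡ p′)) (cong (ℚ._* p′) (sym (*-1/⁺ q hq))))
                               (trans (sym (ℚₚ.*-identityˡ q′)) (cong (ℚ._* q′) (sym (*-1/⁺ p hp))))) ⟩
    ∣ (q ℚ.* q′) ℚ.* p′ ℚ.- (p ℚ.* p′) ℚ.* q′ ∣
      ≡⟨ cong ∣_∣ (solve 4 (λ p q p′ q′ → (q :* q′) :* p′ :- (p :* p′) :* q′ := (p′ :* q′) :* (q :- p)) refl p q p′ q′) ⟩
    ∣ (p′ ℚ.* q′) ℚ.* (q ℚ.- p) ∣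
      ≡⟨ ℚₚ.∣p*q∣≡∣p∣*∣q∣ (p′ ℚ.* q′) (q ℚ.- p) ⟩
    ∣ p′ ℚ.* q′ ∣ ℚ.* ∣ q ℚ.- p ∣
      ≡⟨ cong₂ ℚ._*_ (ℚₚ.0≤p⇒∣p∣≡p (0≤* 0≤p′ 0≤q′)) (∣-∣-sym q p) ⟩
    (p′ ℚ.* q′) ℚ.* ∣ p ℚ.- q ∣
      ≤⟨ *-monoˡ (ℚₚ.0≤∣p∣ _) (*-mono 0≤p′ (ℚₚ.<⇒≤ (0<1/⁺ ε hε))
           (1/⁺-antimono hε hp ε≤p) (1/⁺-antimono hε hq ε≤q)) ⟩
    (1/⁺ ε hε ℚ.* 1/⁺ ε hε) ℚ.* ∣ p ℚ.- q ∣ ∎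
    where
    open +-*-Solver
    p′ = 1/⁺ p hp
    q′ = 1/⁺ q hq
    0≤p′ = ℚₚ.<⇒≤ (0<1/⁺ p hp)
    0≤q′ = ℚₚ.<⇒≤ (0<1/⁺ q hq)

  1/-cauchy : ∀ {x} ε (hε : 0ℚ ℚ.< ε) N → (∀ k → N ℕ.≤ k → ε ℚ.≤ x k) → Cauchy x →
              Cauchy (λ k → 1/⁺ (x k ℚ.⊔ ε) (0<⊔ (x k) ε hε))
  1/-cauchy {x} ε hε N low cx =
    dominate {x} {λ _ → 0ℚ} {λ k → 1/⁺ (x k ℚ.⊔ ε) (0<⊔ (x k) ε hε)} (i ℚ.* i) 1ℚ (0<* (0<1/⁺ ε hε) (0<1/⁺ ε hε)) 0<1 N
      (λ m n hm hn → begin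
        ∣ 1/⁺ (x m ℚ.⊔ ε) (hx m) ℚ.- 1/⁺ (x n ℚ.⊔ ε) (hx n) ∣
          ≤⟨ 1/⁺-lipschitz hε (hx m) (hx n) (ℚₚ.p≤q⊔p (x m) ε) (ℚₚ.p≤q⊔p (x n) ε) ⟩
        (i ℚ.* i) ℚ.* ∣ (x m ℚ.⊔ ε) ℚ.- (x n ℚ.⊔ ε) ∣
          ≡⟨ cong₂ (λ a b → (i ℚ.* i) ℚ.* ∣ a ℚ.- b ∣) (ℚₚ.p≥q⇒p⊔q≡p (low m hm)) (ℚₚ.p≥q⇒p⊔q≡p (low n hn)) ⟩
        (i ℚ.* i) ℚ.* ∣ x m ℚ.- x n ∣
          ≤⟨ p≤p+q (0≤* 0≤1 (ℚₚ.0≤∣p∣ (0ℚ ℚ.- 0ℚ))) ⟩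
        (i ℚ.* i) ℚ.* ∣ x m ℚ.- x n ∣ ℚ.+ 1ℚ ℚ.* ∣ 0ℚ ℚ.- 0ℚ ∣ ∎)
      cx (const-cauchy 0ℚ)
    where
    i : ℚ
    i = 1/⁺ ε hε
    hx : ∀ k → 0ℚ ℚ.< x k ℚ.⊔ ε
    hx k = 0<⊔ (x k) ε hε

  module ExpSeries (B : ℕ) where

    b : ℚ
    b = ι B

    T : ℕ → ℚ
    T = expTerm b

    0≤T : ∀ i → 0ℚ ℚ.≤ T i
    0≤T zero    = 0≤1
    0≤T (suc i) = 0≤* (0≤T i) (0≤* (0≤ι B) (0≤recip i))

    T-step : ∀ i → ι (suc i) ℚ.* T (suc i) ≡ b ℚ.* T i
    T-step i = begin-equality
      ι (suc i) ℚ.* (T i ℚ.* (b ℚ.* recip i))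
        ≡⟨ solve 4 (λ s t b r → s :* (t :* (b :* r)) := (s :* r) :* (b :* t)) refl (ι (suc i)) (T i) b (recip i) ⟩
      (ι (suc i) ℚ.* recip i) ℚ.* (b ℚ.* T i)
        ≡⟨ cong (ℚ._* (b ℚ.* T i)) (ι*recip i) ⟩
      1ℚ ℚ.* (b ℚ.* T i)
        ≡⟨ ℚₚ.*-identityˡ _ ⟩
      b ℚ.* T i ∎
      where open +-*-Solver

    expTerm-≤ : ∀ q → ∣ q ∣ ℚ.≤ b → ∀ i → ∣ expTerm q i ∣ ℚ.≤ T i
    expTerm-≤ q h zero    = ℚₚ.≤-refl
    expTerm-≤ q h (suc i) = begin
      ∣ expTerm q i ℚ.* (q ℚ.* recip i) ∣
        ≡⟨ trans (ℚₚ.∣p*q∣≡∣p∣*∣q∣ (expTerm q i) _) (cong (∣ expTerm q i ∣ ℚ.*_) (ℚₚ.∣p*q∣≡∣p∣*∣q∣ q (recip i))) ⟩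
      ∣ expTerm q i ∣ ℚ.* (∣ q ∣ ℚ.* ∣ recip i ∣)
        ≡⟨ cong (λ r → ∣ expTerm q i ∣ ℚ.* (∣ q ∣ ℚ.* r)) (ℚₚ.0≤p⇒∣p∣≡p (0≤recip i)) ⟩
      ∣ expTerm q i ∣ ℚ.* (∣ q ∣ ℚ.* recip i)
        ≤⟨ *-mono (ℚₚ.0≤∣p∣ _) (0≤* (0≤ι B) (0≤recip i)) (expTerm-≤ q h i) (*-monoˡ (0≤recip i) h) ⟩
      T i ℚ.* (b ℚ.* recip i) ∎

    -- With D i = T (i - 1):  ∣ pⁱ/i! - qⁱ/i! ∣ ≤ D i * ∣ p - q ∣  whenever ∣p∣, ∣q∣ ≤ b.

    D : ℕ → ℚ
    D zero    = 0ℚ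
    D (suc i) = T i

    D-step : ∀ i → b ℚ.* D i ≡ ι i ℚ.* T i
    D-step zero    = trans (ℚₚ.*-zeroʳ b) (sym (ℚₚ.*-zeroˡ 1ℚ))
    D-step (suc i) = sym (T-step i)

    expTerm-lipschitz : ∀ p q → ∣ p ∣ ℚ.≤ b → ∣ q ∣ ℚ.≤ b → ∀ i →
                        ∣ expTerm p i ℚ.- expTerm q i ∣ ℚ.≤ D i ℚ.* ∣ p ℚ.- q ∣
    expTerm-lipschitz p q hp hq zero    = ℚₚ.≤-reflexive (sym (ℚₚ.*-zeroˡ ∣ p ℚ.- q ∣))
    expTerm-lipschitz p q hp hq (suc i) = begin
      ∣ P ℚ.* (p ℚ.* r) ℚ.- Q ℚ.* (q ℚ.* r) ∣
        ≡⟨ cong ∣_∣ (solve 5 (λ P Q p q r → P :* (p :* r) :- Q :* (q :* r)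
             := (P :* (p :- q) :+ q :* (P :- Q)) :* r) refl P Q p q r) ⟩
      ∣ (P ℚ.* (p ℚ.- q) ℚ.+ q ℚ.* (P ℚ.- Q)) ℚ.* r ∣
        ≡⟨ trans (ℚₚ.∣p*q∣≡∣p∣*∣q∣ (P ℚ.* (p ℚ.- q) ℚ.+ q ℚ.* (P ℚ.- Q)) r) (cong (∣ P ℚ.* (p ℚ.- q) ℚ.+ q ℚ.* (P ℚ.- Q) ∣ ℚ.*_) (ℚₚ.0≤p⇒∣p∣≡p (0≤recip i))) ⟩
      ∣ P ℚ.* (p ℚ.- q) ℚ.+ q ℚ.* (P ℚ.- Q) ∣ ℚ.* r
        ≤⟨ *-monoˡ (0≤recip i) (ℚₚ.∣p+q∣≤∣p∣+∣q∣ (P ℚ.* (p ℚ.- q)) _) ⟩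
      (∣ P ℚ.* (p ℚ.- q) ∣ ℚ.+ ∣ q ℚ.* (P ℚ.- Q) ∣) ℚ.* r
        ≡⟨ cong (ℚ._* r) (cong₂ ℚ._+_ (ℚₚ.∣p*q∣≡∣p∣*∣q∣ P _) (ℚₚ.∣p*q∣≡∣p∣*∣q∣ q _)) ⟩
      (∣ P ∣ ℚ.* d ℚ.+ ∣ q ∣ ℚ.* ∣ P ℚ.- Q ∣) ℚ.* r
        ≤⟨ *-monoˡ (0≤recip i) (ℚₚ.+-mono-≤ (*-monoˡ (ℚₚ.0≤∣p∣ _) (expTerm-≤ p hp i))
             (*-mono (ℚₚ.0≤∣p∣ q) (ℚₚ.≤-trans (ℚₚ.0≤∣p∣ (P ℚ.- Q)) (expTerm-lipschitz p q hp hq i)) hq (expTerm-lipschitz p q hp hq i))) ⟩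
      (T i ℚ.* d ℚ.+ b ℚ.* (D i ℚ.* d)) ℚ.* r
        ≡⟨ solve 5 (λ t d b D r → (t :* d :+ b :* (D :* d)) :* r := ((t :+ b :* D) :* r) :* d) refl (T i) d b (D i) r ⟩
      ((T i ℚ.+ b ℚ.* D i) ℚ.* r) ℚ.* d
        ≡⟨ cong (λ z → ((T i ℚ.+ z) ℚ.* r) ℚ.* d) (D-step i) ⟩
      ((T i ℚ.+ ι i ℚ.* T i) ℚ.* r) ℚ.* d
        ≡⟨ solve 4 (λ t n r d → ((t :+ n :* t) :* r) :* d := (((con 1ℚ :+ n) :* r) :* t) :* d) refl (T i) (ι i) r d ⟩
      (((1ℚ ℚ.+ ι i) ℚ.* r) ℚ.* T i) ℚ.* d
        ≡⟨ cong (λ z → ((z ℚ.* r) ℚ.* T i) ℚ.* d) (ι-suc i) ⟨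
      ((ι (suc i) ℚ.* r) ℚ.* T i) ℚ.* d
        ≡⟨ cong (λ z → (z ℚ.* T i) ℚ.* d) (ι*recip i) ⟩
      (1ℚ ℚ.* T i) ℚ.* d
        ≡⟨ cong (ℚ._* d) (ℚₚ.*-identityˡ (T i)) ⟩
      T i ℚ.* d ∎
      where
      open +-*-Solver
      P = expTerm p i
      Q = expTerm q i
      r = recip i
      d = ∣ p ℚ.- q ∣

    S : ℕ → ℚ
    S = expSum b

    S-mono : ∀ k d → S k ℚ.≤ S (d ℕ.+ k)
    S-mono k zero    = ℚₚ.≤-refl
    S-mono k (suc d) = ℚₚ.≤-trans (S-mono k d) (p≤p+q (0≤T (suc (d ℕ.+ k))))

    expSum-lipschitz : ∀ p q → ∣ p ∣ ℚ.≤ b → ∣ q ∣ ℚ.≤ b → ∀ k →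
                       ∣ expSum p k ℚ.- expSum q k ∣ ℚ.≤ S k ℚ.* ∣ p ℚ.- q ∣
    expSum-lipschitz p q hp hq k = ℚₚ.≤-trans (go k) (*-monoˡ (ℚₚ.0≤∣p∣ _) (ΣD≤S k))
      where
      open +-*-Solver
      ΣD : ℕ → ℚ
      ΣD zero    = 0ℚ
      ΣD (suc k) = ΣD k ℚ.+ D (suc k)
      ΣD-suc : ∀ k → ΣD (suc k) ≡ S k
      ΣD-suc zero    = refl
      ΣD-suc (suc k) = cong (ℚ._+ T (suc k)) (ΣD-suc k)
      ΣD≤S : ∀ k → ΣD k ℚ.≤ S k
      ΣD≤S k = subst (ΣD k ℚ.≤_) (ΣD-suc k) (p≤p+q (0≤T k))
      go : ∀ k → ∣ expSum p k ℚ.- expSum q k ∣ ℚ.≤ ΣD k ℚ.* ∣ p ℚ.- q ∣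
      go zero    = ℚₚ.≤-reflexive (sym (ℚₚ.*-zeroˡ ∣ p ℚ.- q ∣))
      go (suc k) = begin
        ∣ (expSum p k ℚ.+ expTerm p (suc k)) ℚ.- (expSum q k ℚ.+ expTerm q (suc k)) ∣
          ≡⟨ cong ∣_∣ (solve 4 (λ a b c d → (a :+ b) :- (c :+ d) := (a :- c) :+ (b :- d)) refl
               (expSum p k) (expTerm p (suc k)) (expSum q k) (expTerm q (suc k))) ⟩
        ∣ (expSum p k ℚ.- expSum q k) ℚ.+ (expTerm p (suc k) ℚ.- expTerm q (suc k)) ∣
          ≤⟨ ℚₚ.∣p+q∣≤∣p∣+∣q∣ (expSum p k ℚ.- expSum q k) _ ⟩
        ∣ expSum p k ℚ.- expSum q k ∣ ℚ.+ ∣ expTerm p (suc k) ℚ.- expTerm q (suc k) ∣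
          ≤⟨ ℚₚ.+-mono-≤ (go k) (expTerm-lipschitz p q hp hq (suc k)) ⟩
        ΣD k ℚ.* ∣ p ℚ.- q ∣ ℚ.+ T k ℚ.* ∣ p ℚ.- q ∣
          ≡⟨ ℚₚ.*-distribʳ-+ ∣ p ℚ.- q ∣ (ΣD k) (T k) ⟨
        ΣD (suc k) ℚ.* ∣ p ℚ.- q ∣ ∎

    expSum-tail : ∀ q → ∣ q ∣ ℚ.≤ b → ∀ k d →
                  ∣ expSum q (d ℕ.+ k) ℚ.- expSum q k ∣ ℚ.≤ S (d ℕ.+ k) ℚ.- S k
    expSum-tail q h k zero = ℚₚ.≤-reflexive
      (trans (cong ∣_∣ (ℚₚ.+-inverseʳ (expSum q k))) (sym (ℚₚ.+-inverseʳ (S k))))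
    expSum-tail q h k (suc d) = begin
      ∣ (expSum q (d ℕ.+ k) ℚ.+ t) ℚ.- expSum q k ∣
        ≡⟨ cong ∣_∣ (solve 3 (λ a t c → (a :+ t) :- c := (a :- c) :+ t) refl (expSum q (d ℕ.+ k)) t (expSum q k)) ⟩
      ∣ (expSum q (d ℕ.+ k) ℚ.- expSum q k) ℚ.+ t ∣
        ≤⟨ ℚₚ.∣p+q∣≤∣p∣+∣q∣ (expSum q (d ℕ.+ k) ℚ.- expSum q k) t ⟩
      ∣ expSum q (d ℕ.+ k) ℚ.- expSum q k ∣ ℚ.+ ∣ t ∣
        ≤⟨ ℚₚ.+-mono-≤ (expSum-tail q h k d) (expTerm-≤ q h (suc (d ℕ.+ k))) ⟩
      (S (d ℕ.+ k) ℚ.- S k) ℚ.+ T (suc (d ℕ.+ k))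
        ≡⟨ solve 3 (λ a t c → (a :- c) :+ t := (a :+ t) :- c) refl (S (d ℕ.+ k)) (T (suc (d ℕ.+ k))) (S k) ⟩
      S (suc (d ℕ.+ k)) ℚ.- S k ∎
      where
      open +-*-Solver
      t = expTerm q (suc (d ℕ.+ k))

    -- From index 2B on, consecutive terms at least halve.

    T-halves : ∀ i → B ℕ.+ B ℕ.≤ i → T (suc i) ℚ.+ T (suc i) ℚ.≤ T i
    T-halves i h = begin
      T i ℚ.* (b ℚ.* r) ℚ.+ T i ℚ.* (b ℚ.* r)
        ≡⟨ solve 3 (λ t b r → t :* (b :* r) :+ t :* (b :* r) := t :* ((b :+ b) :* r)) refl (T i) b r ⟩
      T i ℚ.* ((b ℚ.+ b) ℚ.* r)
        ≡⟨ cong (λ z → T i ℚ.* (z ℚ.* r)) (ι-+ B B) ⟨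
      T i ℚ.* (ι (B ℕ.+ B) ℚ.* r)
        ≤⟨ *-monoʳ (0≤T i) (*-monoˡ (0≤recip i) (ι-mono (ℕₚ.m≤n⇒m≤1+n h))) ⟩
      T i ℚ.* (ι (suc i) ℚ.* r)
        ≡⟨ cong (T i ℚ.*_) (ι*recip i) ⟩
      T i ℚ.* 1ℚ
        ≡⟨ ℚₚ.*-identityʳ (T i) ⟩
      T i ∎
      where
      open +-*-Solver
      r = recip i
      ι-+ : ∀ m n → ι (m ℕ.+ n) ≡ ι m ℚ.+ ι n
      ι-+ zero    n = sym (ℚₚ.+-identityˡ (ι n))
      ι-+ (suc m) n = trans (ι-suc (m ℕ.+ n)) (trans (cong (1ℚ ℚ.+_) (ι-+ m n))
        (trans (sym (ℚₚ.+-assoc 1ℚ (ι m) (ι n))) (cong (ℚ._+ ι n) (sym (ι-suc m)))))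

    S-tail : ∀ k → B ℕ.+ B ℕ.≤ k → ∀ d → (S (d ℕ.+ k) ℚ.- S k) ℚ.+ T (d ℕ.+ k) ℚ.≤ T k
    S-tail k h zero = ℚₚ.≤-reflexive
      (solve 2 (λ s t → (s :- s) :+ t := t) refl (S k) (T k))
      where open +-*-Solver
    S-tail k h (suc d) = begin
      ((s ℚ.+ t) ℚ.- S k) ℚ.+ t    ≡⟨ solve 3 (λ s t c → ((s :+ t) :- c) :+ t := (s :- c) :+ (t :+ t)) refl s t (S k) ⟩
      (s ℚ.- S k) ℚ.+ (t ℚ.+ t)    ≤⟨ ℚₚ.+-monoʳ-≤ (s ℚ.- S k) (T-halves (d ℕ.+ k) (ℕₚ.≤-trans h (ℕₚ.m≤n+m k d))) ⟩
      (s ℚ.- S k) ℚ.+ T (d ℕ.+ k)  ≤⟨ S-tail k h d ⟩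
      T k                          ∎
      where
      open +-*-Solver
      s = S (d ℕ.+ k)
      t = T (suc (d ℕ.+ k))

    T-small : ∀ d → ι (suc d) ℚ.* T (d ℕ.+ (B ℕ.+ B)) ℚ.≤ T (B ℕ.+ B)
    T-small zero    = ℚₚ.≤-reflexive (ℚₚ.*-identityˡ _)
    T-small (suc d) = begin
      ι (suc (suc d)) ℚ.* t              ≡⟨ cong (ℚ._* t) (ι-suc (suc d)) ⟩
      (1ℚ ℚ.+ n) ℚ.* t                   ≤⟨ *-monoˡ (0≤T (suc i)) (ℚₚ.+-monoˡ-≤ n (ι-mono {1} {suc d} (ℕ.s≤s ℕ.z≤n))) ⟩
      (n ℚ.+ n) ℚ.* t                    ≡⟨ solve 2 (λ n t → (n :+ n) :* t := n :* (t :+ t)) refl n t ⟩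
      n ℚ.* (t ℚ.+ t)                    ≤⟨ *-monoʳ (0≤ι (suc d)) (T-halves i (ℕₚ.m≤n+m (B ℕ.+ B) d)) ⟩
      n ℚ.* T i                          ≤⟨ T-small d ⟩
      T (B ℕ.+ B)                        ∎
      where
      open +-*-Solver
      i = d ℕ.+ (B ℕ.+ B)
      t = T (suc i)
      n = ι (suc d)

    S-diff : ∀ k l → B ℕ.+ B ℕ.≤ k → k ℕ.≤ l → ∣ S k ℚ.- S l ∣ ℚ.≤ T k
    S-diff k l h k≤l = subst (λ l → ∣ S k ℚ.- S l ∣ ℚ.≤ T k) (ℕₚ.m∸n+n≡m k≤l) (begin
      ∣ S k ℚ.- S (d ℕ.+ k) ∣                    ≡⟨ ∣-∣-sym (S k) _ ⟩
      ∣ S (d ℕ.+ k) ℚ.- S k ∣                    ≤⟨ expSum-tail b (ℚₚ.≤-reflexive (ℚₚ.0≤p⇒∣p∣≡p (0≤ι B))) k d ⟩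
      S (d ℕ.+ k) ℚ.- S k                        ≤⟨ p≤p+q (0≤T (d ℕ.+ k)) ⟩
      (S (d ℕ.+ k) ℚ.- S k) ℚ.+ T (d ℕ.+ k)      ≤⟨ S-tail k h d ⟩
      T k                                        ∎)
      where d = l ℕ.∸ k

    S-cauchy : Cauchy S
    S-cauchy ε hε = d ℕ.+ B+B , λ m n hm hn → go m n hm hn (ℕₚ.≤-total m n)
      where
      B+B d : ℕ
      B+B = B ℕ.+ B
      d   = proj₁ (archimedean* (T B+B) ε hε)
      le : T B+B ℚ.≤ ι d ℚ.* ε
      le = proj₂ (archimedean* (T B+B) ε hε)
      T≤ε′ : ∀ e → d ℕ.≤ suc e → T (e ℕ.+ B+B) ℚ.≤ ε
      T≤ε′ e h = ℚₚ.*-cancelˡ-≤-pos (ι (suc e)) (begin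
        ι (suc e) ℚ.* T (e ℕ.+ B+B)    ≤⟨ T-small e ⟩
        T B+B                          ≤⟨ le ⟩
        ι d ℚ.* ε                      ≤⟨ *-monoˡ (ℚₚ.<⇒≤ hε) (ι-mono h) ⟩
        ι (suc e) ℚ.* ε                ∎)
      T≤ε : ∀ k → d ℕ.+ B+B ℕ.≤ k → T k ℚ.≤ ε
      T≤ε k h = subst (λ k → T k ℚ.≤ ε) (ℕₚ.m∸n+n≡m (ℕₚ.m+n≤o⇒n≤o d h))
        (T≤ε′ (k ℕ.∸ B+B) (ℕₚ.m≤n⇒m≤1+n (ℕₚ.m+n≤o⇒m≤o∸n d h)))
      go : ∀ m n → d ℕ.+ B+B ℕ.≤ m → d ℕ.+ B+B ℕ.≤ n → m ℕ.≤ n ⊎ n ℕ.≤ m → ∣ S m ℚ.- S n ∣ ℚ.≤ ε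
      go m n hm hn (inj₁ m≤n) = ℚₚ.≤-trans (S-diff m n (ℕₚ.m+n≤o⇒n≤o d hm) m≤n) (T≤ε m hm)
      go m n hm hn (inj₂ n≤m) = subst (ℚ._≤ ε) (∣-∣-sym (S n) (S m))
        (ℚₚ.≤-trans (S-diff n m (ℕₚ.m+n≤o⇒n≤o d hn) n≤m) (T≤ε n hn))

    expSum-≤ : ∀ q → ∣ q ∣ ℚ.≤ b → ∀ k l → ∣ expSum q k ℚ.- expSum q l ∣ ℚ.≤ ∣ S k ℚ.- S l ∣
    expSum-≤ q h k l with ℕₚ.≤-total k l
    ... | inj₂ l≤k = ℚₚ.≤-trans (subst (λ k → ∣ expSum q k ℚ.- expSum q l ∣ ℚ.≤ S k ℚ.- S l)
                       (ℕₚ.m∸n+n≡m l≤k) (expSum-tail q h l (k ℕ.∸ l))) (p≤∣p∣ _)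
    ... | inj₁ k≤l = subst₂ ℚ._≤_ (∣-∣-sym (expSum q l) _) (∣-∣-sym (S l) _)
                       (ℚₚ.≤-trans (subst (λ l → ∣ expSum q l ℚ.- expSum q k ∣ ℚ.≤ S l ℚ.- S k)
                       (ℕₚ.m∸n+n≡m k≤l) (expSum-tail q h k (l ℕ.∸ k))) (p≤∣p∣ _))

  exp-cauchy : ∀ {x} → Cauchy x → Cauchy (λ k → expSum (x k) k)
  exp-cauchy {x} cx = go (boundedℕ {x} cx)
    where
    open +-*-Solver
    go : ∃[ B ] ∃[ N ] (∀ k → N ℕ.≤ k → ∣ x k ∣ ℚ.≤ ι (suc B)) → Cauchy (λ k → expSum (x k) k)
    go (B , N , f) = go′ (bounded {S} S-cauchy)
      where
      open ExpSeries (suc B)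
      go′ : ∃[ C ] (0ℚ ℚ.< C × ∃[ N ] (∀ k → N ℕ.≤ k → ∣ S k ∣ ℚ.≤ C)) → Cauchy (λ k → expSum (x k) k)
      go′ (M , 0<M , N′ , g) = dominate {x} {S} {λ k → expSum (x k) k} M 1ℚ 0<M 0<1 (N ℕ.⊔ N′)
        (λ m n hm hn →
          let bm = f m (ℕₚ.m⊔n≤o⇒m≤o N N′ hm)
              bn = f n (ℕₚ.m⊔n≤o⇒m≤o N N′ hn) in begin
          ∣ expSum (x m) m ℚ.- expSum (x n) n ∣
            ≡⟨ cong ∣_∣ (solve 3 (λ a b c → a :- c := (a :- b) :+ (b :- c)) refl (expSum (x m) m) (expSum (x n) m) (expSum (x n) n)) ⟩
          ∣ (expSum (x m) m ℚ.- expSum (x n) m) ℚ.+ (expSum (x n) m ℚ.- expSum (x n) n) ∣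
            ≤⟨ ℚₚ.∣p+q∣≤∣p∣+∣q∣ (expSum (x m) m ℚ.- expSum (x n) m) _ ⟩
          ∣ expSum (x m) m ℚ.- expSum (x n) m ∣ ℚ.+ ∣ expSum (x n) m ℚ.- expSum (x n) n ∣
            ≤⟨ ℚₚ.+-mono-≤ (expSum-lipschitz (x m) (x n) bm bn m) (expSum-≤ (x n) bn m n) ⟩
          S m ℚ.* ∣ x m ℚ.- x n ∣ ℚ.+ ∣ S m ℚ.- S n ∣
            ≤⟨ ℚₚ.+-mono-≤ (*-monoˡ (ℚₚ.0≤∣p∣ _) (ℚₚ.≤-trans (p≤∣p∣ (S m)) (g m (ℕₚ.m⊔n≤o⇒n≤o N N′ hm))))
                 (ℚₚ.≤-reflexive (sym (ℚₚ.*-identityˡ _))) ⟩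
          M ℚ.* ∣ x m ℚ.- x n ∣ ℚ.+ 1ℚ ℚ.* ∣ S m ℚ.- S n ∣ ∎)
        cx S-cauchy

open CauchyLemmas

infix  8 -_
infixr 8 _^_
infixl 7 _*_ _÷_[_] _⊓_
infixl 6 _+_ _-_
infix  4 _<_ _≤_ _≈_

_<_ : ℝ → ℝ → Set
x < y = ∃[ ε ] (0ℚ ℚ.< ε × ∃[ N ] (∀ k → N ℕ.≤ k → seq x k ℚ.+ ε ℚ.≤ seq y k))

_≤_ : ℝ → ℝ → Set
x ≤ y = ¬ (y < x)

_≈_ : ℝ → ℝ → Set
x ≈ y = x ≤ y × y ≤ x

fromℚ : ℚ → ℝ
fromℚ q = mkℝ (λ _ → q) (const-cauchy q)

fromℕ : ℕ → ℝ
fromℕ n = fromℚ (ι n)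

0ℝ 1ℝ 2ℝ ½ℝ : ℝ
0ℝ = fromℚ 0ℚ
1ℝ = fromℚ 1ℚ
2ℝ = fromℕ 2
½ℝ = fromℚ ½

_+_ : ℝ → ℝ → ℝ
x + y = mkℝ (λ k → seq x k ℚ.+ seq y k) (+-cauchy {seq x} {seq y} (cauchy x) (cauchy y))

-_ : ℝ → ℝ
- x = mkℝ (λ k → ℚ.- seq x k) (neg-cauchy {seq x} (cauchy x))

_-_ : ℝ → ℝ → ℝ
x - y = x + (- y)

_*_ : ℝ → ℝ → ℝ
x * y = mkℝ (λ k → seq x k ℚ.* seq y k) (*-cauchy {seq x} {seq y} (cauchy x) (cauchy y))

_⊓_ : ℝ → ℝ → ℝ
x ⊓ y = mkℝ (λ k → seq x k ℚ.⊓ seq y k) (⊓-cauchy {seq x} {seq y} (cauchy x) (cauchy y))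

_^_ : ℝ → ℕ → ℝ
x ^ zero  = 1ℝ
x ^ suc k = x * x ^ k

-- If ε is the positive lower bound on a tail of x supplied by the proof of 0 < x, then
-- x k ⊔ ε is positive for every k and equals x k on that tail.
recipℝ : (x : ℝ) → 0ℝ < x → ℝ
recipℝ x (ε , 0<ε , N , low) = mkℝ (λ k → 1/⁺ (seq x k ℚ.⊔ ε) (0<⊔ (seq x k) ε 0<ε))
  (1/-cauchy {seq x} ε 0<ε N (λ k h → subst (ℚ._≤ seq x k) (ℚₚ.+-identityˡ ε) (low k h)) (cauchy x))

_÷_[_] : (x y : ℝ) → 0ℝ < y → ℝ
x ÷ y [ 0<y ] = x * recipℝ y 0<y

exp : ℝ → ℝ
exp x = mkℝ (λ k → expSum (seq x k) k) (exp-cauchy {seq x} (cauchy x))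

-- y = log x
IsLog : ℝ → ℝ → Set
IsLog x y = exp y ≈ x

-- y = x^(1/k), for x ≥ 0 and k ≥ 1
IsRoot : ℕ → ℝ → ℝ → Set
IsRoot k x y = 0ℝ ≤ y × y ^ k ≈ x

-- y = min {K / (K - 2), L} for K ≥ 2, where K / (K - 2) = ∞ when K = 2
IsMinQuotient : ℝ → ℝ → ℝ → Set
IsMinQuotient K L y =
    (K ≈ 2ℝ → y ≈ L)
  × ((K>2 : 0ℝ < K - 2ℝ) → y ≈ (K ÷ (K - 2ℝ) [ K>2 ]) ⊓ L)

fallingFactorial : ℝ → ℕ → ℝ
fallingFactorial x zero    = 1ℝ
fallingFactorial x (suc k) = fallingFactorial x k * (x - fromℕ k)

binomial : ℝ → ℕ → ℝ
binomial x s = fallingFactorial x s * fromℚ ((+ 1 ℚ./ (s !)) {{s !≢0}})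

module Sets {c ℓ} (G : AbelianGroup c ℓ) where

  open AbelianGroup G using (Carrier; _∙_; ε; _⁻¹) renaming (_≈_ to _≈ᴳ_)

  -- Every finite set of elements of G, up to ≈ᴳ, is a predicate of level ℓ, so
  -- quantifying over predicates of that level reaches all of them.
  Subset : Set _
  Subset = Pred Carrier ℓ

  HasCard : ∀ {p} → Pred Carrier p → ℕ → Set _
  HasCard A m = Σ[ e ∈ (Fin m → Carrier) ]
      (∀ i j → e i ≈ᴳ e j → i ≡ j)
    × (∀ x → x ∈ A ⇔ (∃[ i ] (x ≈ᴳ e i)))

  _⊞_ : ∀ {p q} → Pred Carrier p → Pred Carrier q → Pred Carrier _
  (A ⊞ B) x = ∃[ a ] ∃[ b ] (a ∈ A × b ∈ B × x ≈ᴳ a ∙ b)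

  record IsSubgroup (H : Subset) : Set (c ⊔ ℓ) where
    field
      ∈-resp-≈  : ∀ {x y} → x ≈ᴳ y → x ∈ H → y ∈ H
      ε-closed  : ε ∈ H
      ∙-closed  : ∀ {x y} → x ∈ H → y ∈ H → x ∙ y ∈ H
      ⁻¹-closed : ∀ {x} → x ∈ H → x ⁻¹ ∈ H

  SubgroupOrder : ℕ → Set _
  SubgroupOrder m = Σ[ H ∈ Subset ] (IsSubgroup H × HasCard H m)

  -- b = β(t)
  IsBeta : ℝ → ℕ → Set _
  IsBeta t b =
      (SubgroupOrder b × fromℕ b ≤ t)
    × (∀ m → SubgroupOrder m → fromℕ m ≤ t → m ℕ.≤ b)

  -- The number of A with P A is at most x: no more than x pairwise distinct (up to
  -- extensional equality) such A can be listed.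
  NumberAtMost : ∀ {q} → (Subset → Set q) → ℝ → Set _
  NumberAtMost P x = ∀ m (A : Fin m → Subset) → (∀ i → P (A i)) →
    (∀ i j → A i ≐ A j → i ≡ j) → fromℕ m ≤ x

{-# OPTIONS --safe #-}
module Submission where

-- Let m = ⌊Ks⌋. For a set J with |J| = s and |J + J| ≤ m keep a set A ⊆ J + J and a set
-- B ⊇ J, starting from ∅ and Y. A round first asks for elements v ∈ J such that v + B has
-- many elements outside A, until a set T of b of them is found; then it asks for elements
-- i ∈ J such that i + T has at least D elements outside A, and adds i + T to A. An element
-- that turns out not to lie in J is removed from B. A round decreases |B| + m - |A| by a
-- constant factor, so few questions are answered positively, and since a negative answer
-- shrinks B the number of possible final sets B is at most (n + 1)^Φ, where Φ bounds the
-- number of positive answers. The process only stops when |B| ≤ N ≈ (1 + 2/E)(m + β)/2.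
--
-- It does not stop earlier by a version of Pollard's theorem: if every finite subgroup has
-- order at most β or at least M, then there are t · min(M, |U| + |V| - t - β) pairs in
-- U × V no t + 1 of which have the same sum. This is proved with Dyson's transform, applied
-- to a translate of V that meets U but is not contained in U. If there is no such
-- translate, then V lies in a coset of the stabiliser of U.
--
-- What remains is to compare binomial coefficients factor by factor, with 1 + θ ≤ exp θ.
--
-- The conclusion is negative, so single propositions may be decided. This suffices to
-- decide equality in the subgroup generated by Y: add the generators g one by one, and use
-- the least d > 0 for which d · g lies in the subgroup generated so far.

open import Algebra.Bundles using (AbelianGroup; CommutativeRing)
import Algebra.Properties.AbelianGroup as AbelianGroupProperties
import Algebra.Properties.CommutativeSemigroup as CommutativeSemigroupProperties
import Algebra.Properties.Monoid.Mult as MonoidMult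
import Algebra.Solver.Ring as RingSolver
import Algebra.Solver.Ring.AlmostCommutativeRing as ACR
open import Data.Empty using (⊥; ⊥-elim)
open import Data.Fin.Base as Fin using (Fin)
import Data.Fin.Properties as Finₚ
open import Data.Integer.Base using (+_)
open import Data.List.Base using (List; []; _∷_; _++_; length; map; filter; cartesianProduct; take; allFin; tabulate; lookup)
import Data.List.Membership.Propositional as PropMembership
import Data.List.Membership.Propositional.Properties as PropMembershipₚ
import Data.List.Membership.Setoid as Membership
import Data.List.Membership.Setoid.Properties as Membershipₚ
import Data.List.Properties as Listₚ
open import Data.List.Relation.Unary.All as All using (All; []; _∷_)
import Data.List.Relation.Unary.All.Properties as Allₚ
open import Data.List.Relation.Unary.AllPairs using ([]; _∷_)
open import Data.List.Relation.Unary.Any as Any using (Any; here; there)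
import Data.List.Relation.Unary.Any.Properties as Anyₚ
import Data.List.Relation.Unary.Unique.Propositional.Properties as PropUniqueₚ
import Data.List.Relation.Unary.Unique.Setoid as UniqueS
import Data.List.Relation.Unary.Unique.Setoid.Properties as Uniqueₚ
open import Data.Maybe.Base using (Maybe; just; nothing)
open import Data.Nat.Base as ℕ using (ℕ; zero; suc; z≤n; s≤s; NonZero; _!)
open import Data.Nat.Combinatorics using (_C_; nCn≡1; nCk≡nC[n∸k]; nCk+nC[k+1]≡[n+1]C[k+1])
open import Data.Nat.Combinatorics.Specification using (k>n⇒nCk≡0)
open import Data.Nat.Coprimality using (1-coprimeTo)
open import Data.Nat.DivMod using (m/n*n≤m; m≡m%n+[m/n]*n; m%n<n)
open import Data.Nat.Induction using (<-rec)
open import Data.Nat.ListAction using (sum)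
import Data.Nat.Properties as ℕₚ
open import Data.Nat.Tactic.RingSolver using (solve-∀)
open import Data.Product.Base as Product using (∃-syntax; ∃₂; _×_; _,_; proj₁; proj₂)
open import Data.Product.Relation.Binary.Pointwise.NonDependent using (_×ₛ_)
open import Data.Rational.Base as ℚ using (ℚ; 0ℚ; 1ℚ; ½; ∣_∣)
import Data.Rational.Properties as ℚₚ
open import Data.Rational.Solver using () renaming (module +-*-Solver to ℚ-Solver)
open import Data.Sum.Base using (_⊎_; inj₁; inj₂)
import Defs as D
open import Function.Base using (_∘_; id)
open import Function.Bundles using (Equivalence; mk⇔)
open import Level using (Level; _⊔_; 0ℓ)
open import Relation.Binary.Bundles using (Poset; Setoid)
open import Relation.Binary.Definitions using () renaming (Decidable to Decidable₂)
open import Relation.Binary.PropositionalEquality as ≡ using (_≡_)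
import Relation.Binary.Reasoning.PartialOrder as PartialOrderReasoning
import Relation.Binary.Reasoning.Setoid as SetoidReasoning
open import Relation.Nullary using (Dec; yes; no; ¬_; ¬?; contradiction)
open import Relation.Nullary.Decidable using (_×-dec_; map′; decidable-stable; ¬¬-excluded-middle)
open import Relation.Unary using (Pred; Decidable; _≐_) renaming (_⊆_ to _⊆ᵖ_)

-- Only elements of `J + J` may enter `A`. A positive answer about one `v` certifies no sum in
-- `v + B`, as it is unknown which elements of `B` lie in `J`; hence a round collects `T` and then
-- looks for an `i` completing many sums with it. Call `v`, `i` an edge if their sum lies outside
-- `A`. For `N < |B| < 2m` Pollard's theorem gives at least `|B|² / (2E²)` edges, whence the density
-- `1/κ` with `κ = 4E²`.
--
-- The exponents 1/6 and 5/6 come from two balances. Second phases give about `m / D` positive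
-- answers and first phases about `κ² D log n`, so `D` is near `√(Ks) / (κ √(log n))`, and the
-- number of final sets costs an exponent near `E² √(Ks) (log n)^(3/2)`. The excess `1/E` in `N`
-- costs about `λ s / E` in the binomial coefficient. For `E` near `s^(1/6) / (K^(1/6) √(log n))`
-- both are `K^(1/6) s^(5/6) √(log n)`, up to `λ` and constants. For `n ≥ 2` the hypothesis on `K`
-- says that this quotient exceeds 64. The argument of `β` bounds `M`, which is near `(1 + 4/E) m`:
-- no subgroup order lies strictly between `β` and `M`.

private variable
  ℓa ℓb ℓp ℓq ℓr : Level
  A : Set ℓa
  B : Set ℓb

-- Counting in lists

module _ {P : Pred A ℓp} (P? : Decidable P) where

  length-filter-split : ∀ xs → length xs ≡ length (filter P? xs) ℕ.+ length (filter (¬? ∘ P?) xs)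
  length-filter-split [] = ≡.refl
  length-filter-split (x ∷ xs) with P? x
  ... | yes _ = ≡.cong suc (length-filter-split xs)
  ... | no _  = ≡.trans (≡.cong suc (length-filter-split xs)) (≡.sym (ℕₚ.+-suc (length (filter P? xs)) _))

  length-filter-map : (f : B → A) → ∀ xs → length (filter P? (map f xs)) ≡ length (filter (P? ∘ f) xs)
  length-filter-map f [] = ≡.refl
  length-filter-map f (x ∷ xs) with P? (f x)
  ... | yes _ = ≡.cong suc (length-filter-map f xs)
  ... | no _  = length-filter-map f xs

  length-filter-++ : ∀ xs ys → length (filter P? (xs ++ ys)) ≡ length (filter P? xs) ℕ.+ length (filter P? ys)
  length-filter-++ xs ys = ≡.trans (≡.cong length (Listₚ.filter-++ P? xs ys)) (Listₚ.length-++ (filter P? xs))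

  module _ {Q : Pred A ℓq} (Q? : Decidable Q) where

    length-filter-mono : (∀ x → P x → Q x) → ∀ xs → length (filter P? xs) ℕ.≤ length (filter Q? xs)
    length-filter-mono f [] = z≤n
    length-filter-mono f (x ∷ xs) with P? x | Q? x
    ... | yes _ | yes _ = s≤s (length-filter-mono f xs)
    ... | yes h | no ¬h = ⊥-elim (¬h (f x h))
    ... | no _  | yes _ = ℕₚ.m≤n⇒m≤1+n (length-filter-mono f xs)
    ... | no _  | no _  = length-filter-mono f xs

    length-filter-cover : {R : Pred A ℓr} (R? : Decidable R) → (∀ x → P x → Q x ⊎ R x) →
      ∀ xs → length (filter P? xs) ℕ.≤ length (filter Q? xs) ℕ.+ length (filter R? xs)
    length-filter-cover R? f [] = z≤n
    length-filter-cover R? f (x ∷ xs) with ih ← length-filter-cover R? f xs | P? x | Q? x | R? x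
    ... | yes _ | yes _ | yes _ = s≤s (ℕₚ.≤-trans ih (ℕₚ.+-monoʳ-≤ _ (ℕₚ.n≤1+n _)))
    ... | yes _ | yes _ | no _  = s≤s ih
    ... | yes _ | no _  | yes _ = ℕₚ.≤-trans (s≤s ih) (ℕₚ.≤-reflexive (≡.sym (ℕₚ.+-suc _ _)))
    ... | yes h | no ¬q | no ¬r = contradiction (f x h) λ where (inj₁ y) → ¬q y; (inj₂ y) → ¬r y
    ... | no _  | yes _ | yes _ = ℕₚ.m≤n⇒m≤1+n (ℕₚ.≤-trans ih (ℕₚ.+-monoʳ-≤ _ (ℕₚ.n≤1+n _)))
    ... | no _  | yes _ | no _  = ℕₚ.m≤n⇒m≤1+n ih
    ... | no _  | no _  | yes _ = ℕₚ.≤-trans ih (ℕₚ.+-monoʳ-≤ _ (ℕₚ.n≤1+n _))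
    ... | no _  | no _  | no _  = ih

length-cartesianProduct : (xs : List A) (ys : List B) → length (cartesianProduct xs ys) ≡ length xs ℕ.* length ys
length-cartesianProduct [] ys = ≡.refl
length-cartesianProduct (x ∷ xs) ys = ≡.trans (Listₚ.length-++ (map (x ,_) ys))
  (≡.cong₂ ℕ._+_ (Listₚ.length-map (x ,_) ys) (length-cartesianProduct xs ys))

-- Repetition-free lists in a setoid

module SetoidLists {c ℓ} (S : Setoid c ℓ) where

  open Setoid S renaming (Carrier to 𝔾)
  open Membership S
  open UniqueS S using (Unique)

  ∈-remove : ∀ {x z ys} (x∈ys : x ∈ ys) → z ∈ ys → ¬ z ≈ x → z ∈ (ys Any.─ x∈ys)
  ∈-remove (here x≈y) (here z≈y) z≉x = contradiction (trans z≈y (sym x≈y)) z≉x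
  ∈-remove (here x≈y) (there z∈) z≉x = z∈
  ∈-remove (there p)  (here z≈y) z≉x = here z≈y
  ∈-remove (there p)  (there z∈) z≉x = there (∈-remove p z∈ z≉x)

  length-remove : ∀ {x ys} (x∈ys : x ∈ ys) → suc (length (ys Any.─ x∈ys)) ≡ length ys
  length-remove (here _)  = ≡.refl
  length-remove (there p) = ≡.cong suc (length-remove p)

  pigeonhole : ∀ {xs ys} → Unique xs → (∀ {x} → x ∈ xs → x ∈ ys) → length xs ℕ.≤ length ys
  pigeonhole [] sub = z≤n
  pigeonhole {x ∷ xs} {ys} (x∉xs ∷ xs!) sub = ≡.subst (suc (length xs) ℕ.≤_) (length-remove x∈ys)
    (s≤s (pigeonhole xs! λ z∈ → ∈-remove x∈ys (sub (there z∈))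
      λ z≈x → All.lookupₛ S (λ {u} {v} u≈v ¬h x≈v → ¬h (trans x≈v (sym u≈v))) x∉xs z∈ (sym z≈x)))
    where
    x∈ys : x ∈ ys
    x∈ys = sub (here refl)

  -- An element of `ys` missing from `xs` could be put in front of `xs`, which would give a
  -- repetition-free list inside `ys` that is too long.
  pigeonhole-surjective : Decidable₂ _≈_ → ∀ {xs ys} → Unique xs → (∀ {x} → x ∈ xs → x ∈ ys) →
    length ys ℕ.≤ length xs → ∀ {y} → y ∈ ys → y ∈ xs
  pigeonhole-surjective _≟_ {xs} {ys} xs! sub le {y} y∈ys with Any.any? (y ≟_) xs
  ... | yes y∈xs = y∈xs
  ... | no y∉xs  = contradiction (pigeonhole (Allₚ.¬Any⇒All¬ xs y∉xs ∷ xs!) sub′) (ℕₚ.<⇒≱ (s≤s le))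
    where
    sub′ : ∀ {x} → x ∈ (y ∷ xs) → x ∈ ys
    sub′ (here x≈y) = Membershipₚ.∈-resp-≈ S (sym x≈y) y∈ys
    sub′ (there x∈) = sub x∈

  module _ {c′ ℓ′} (T : Setoid c′ ℓ′) where
    open Setoid T using () renaming (Carrier to C′; _≈_ to _≈′_)

    -- Injectivity is required on `D` only: the projection of a fibre and Dyson's map are injective
    -- just on the pairs that matter.
    Unique-map-on : ∀ {d} {D : Pred 𝔾 d} {f : 𝔾 → C′} → (∀ {x y} → D x → D y → f x ≈′ f y → x ≈ y) →
      ∀ {xs} → All D xs → Unique xs → UniqueS.Unique T (map f xs)
    Unique-map-on inj [] [] = []
    Unique-map-on {D = D} {f} inj {x ∷ xs} (dx ∷ dxs) (x∉ ∷ xs!) = go dxs x∉ ∷ Unique-map-on inj dxs xs!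
      where
      go : ∀ {ys} → All D ys → All (λ y → ¬ x ≈ y) ys → All (λ z → ¬ f x ≈′ z) (map f ys)
      go [] [] = []
      go (dy ∷ dys) (n ∷ ns) = (λ e → n (inj dx dy e)) ∷ go dys ns

-- Pollard's theorem in abelian groups

module Pollard {c ℓ} (G : AbelianGroup c ℓ) (_≟_ : Decidable₂ (AbelianGroup._≈_ G)) where

  open AbelianGroup G renaming (Carrier to 𝔾)
  open AbelianGroupProperties G
  open Membership setoid
  open UniqueS setoid using (Unique)
  open SetoidLists setoid

  C² : Setoid _ _
  C² = setoid ×ₛ setoid

  _∈?_ : (x : 𝔾) (xs : List 𝔾) → Dec (x ∈ xs)
  x ∈? xs = Any.any? (x ≟_) xs

  record FiniteSubgroup (H : List 𝔾) : Set (c ⊔ ℓ) where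
    field
      unique    : Unique H
      ε-closed  : ε ∈ H
      ∙-closed  : ∀ {x y} → x ∈ H → y ∈ H → x ∙ y ∈ H
      ⁻¹-closed : ∀ {x} → x ∈ H → x ⁻¹ ∈ H

  module Stabiliser (U : List 𝔾) (U! : Unique U) {u₀ : 𝔾} (u₀∈U : u₀ ∈ U) where

    Fixes : 𝔾 → Set _
    Fixes h = All (λ u → u ∙ h ∈ U) U

    fixes? : ∀ h → Dec (Fixes h)
    fixes? h = All.all? (λ u → (u ∙ h) ∈? U) U

    Fixes-resp : ∀ {g h} → g ≈ h → Fixes g → Fixes h
    Fixes-resp g≈h = All.map (Membershipₚ.∈-resp-≈ setoid (∙-congˡ g≈h))

    apply : ∀ {h} → Fixes h → ∀ {u} → u ∈ U → u ∙ h ∈ U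
    apply fix = All.lookupₛ setoid (λ u≈v → Membershipₚ.∈-resp-≈ setoid (∙-congʳ u≈v)) fix

    -- The stabiliser of `U` as a list. A period moves `u₀` into `U`, so all periods are among the
    -- differences `u - u₀`, and there are at most `|U|` of them.
    H : List 𝔾
    H = filter fixes? (map (_∙ u₀ ⁻¹) U)

    ∈H⁻ : ∀ {h} → h ∈ H → Fixes h
    ∈H⁻ h∈ = proj₂ (Membershipₚ.∈-filter⁻ setoid fixes? Fixes-resp {xs = map (_∙ u₀ ⁻¹) U} h∈)

    ∈H⁺ : ∀ {h} → Fixes h → h ∈ H
    ∈H⁺ {h} fix = Membershipₚ.∈-filter⁺ setoid fixes? Fixes-resp
      (Membershipₚ.∈-resp-≈ setoid (trans (∙-congʳ (comm u₀ h)) (//-rightDividesʳ u₀ h))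
        (Membershipₚ.∈-map⁺ setoid setoid ∙-congʳ (apply fix u₀∈U))) fix

    length-H : length H ℕ.≤ length U
    length-H = ℕₚ.≤-trans (Listₚ.length-filter fixes? (map (_∙ u₀ ⁻¹) U)) (ℕₚ.≤-reflexive (Listₚ.length-map _ U))

    -- `Fixes` only says that translation by `h` maps `U` into itself. The map is injective and `U`
    -- is finite, so it is onto, and each `u` is some `v + h` with `v` in `U`.
    Fixes-⁻¹ : ∀ {h} → Fixes h → Fixes (h ⁻¹)
    Fixes-⁻¹ {h} fix = All.tabulateₛ setoid λ {u} u∈U →
      let v , v∈U , u≈vh = Membershipₚ.∈-map⁻ setoid setoid
            (pigeonhole-surjective _≟_ {map (_∙ h) U} {U}
              (Uniqueₚ.map⁺ setoid setoid (λ {x} {y} → ∙-cancelʳ h x y) U!) image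
              (ℕₚ.≤-reflexive (≡.sym (Listₚ.length-map _ U))) u∈U)
      in Membershipₚ.∈-resp-≈ setoid (sym (trans (∙-congʳ u≈vh) (//-rightDividesʳ h v))) v∈U
      where
      image : ∀ {x} → x ∈ map (_∙ h) U → x ∈ U
      image x∈ = let v , v∈U , x≈ = Membershipₚ.∈-map⁻ setoid setoid x∈
                 in Membershipₚ.∈-resp-≈ setoid (sym x≈) (apply fix v∈U)

    H-subgroup : FiniteSubgroup H
    H-subgroup = record
      { unique  = Uniqueₚ.filter⁺ setoid fixes? (Uniqueₚ.map⁺ setoid setoid (λ {x} {y} → ∙-cancelʳ (u₀ ⁻¹) x y) U!)
      ; ε-closed  = ∈H⁺ (All.tabulateₛ setoid λ u∈ → Membershipₚ.∈-resp-≈ setoid (sym (identityʳ _)) u∈)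
      ; ∙-closed  = λ {x} {y} x∈ y∈ → ∈H⁺ (All.tabulateₛ setoid λ {u} u∈ →
          Membershipₚ.∈-resp-≈ setoid (assoc u x y) (apply (∈H⁻ y∈) (apply (∈H⁻ x∈) u∈)))
      ; ⁻¹-closed = λ x∈ → ∈H⁺ (Fixes-⁻¹ (∈H⁻ x∈))
      }

  total : 𝔾 × 𝔾 → 𝔾
  total (x , y) = x ∙ y

  total-cong : ∀ {p q} → Setoid._≈_ C² p q → total p ≈ total q
  total-cong (e , f) = ∙-cong e f

  fibre : 𝔾 → List (𝔾 × 𝔾) → ℕ
  fibre x P = length (filter (λ p → total p ≟ x) P)

  -- With `r x` the number of representations of `x` in `U + V`, such a family exists exactly when
  -- the sum over `x` of `min (r x) t` is at least `z`. An explicit family can be carried through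
  -- translations and transforms.
  record SpreadPairs (U V : List 𝔾) (t z : ℕ) : Set (c ⊔ ℓ) where
    field
      pairs   : List (𝔾 × 𝔾)
      unique  : UniqueS.Unique C² pairs
      inside  : All (λ p → proj₁ p ∈ U × proj₂ p ∈ V) pairs
      fibres  : ∀ x → fibre x pairs ℕ.≤ t
      size    : z ℕ.≤ length pairs

  open SpreadPairs

  fibre-map : ∀ (φ : 𝔾 × 𝔾 → 𝔾 × 𝔾) e → (∀ p → total (φ p) ∙ e ≈ total p) →
              ∀ x P → fibre x (map φ P) ℕ.≤ fibre (x ∙ e) P
  fibre-map φ e shift x P = ℕₚ.≤-trans (ℕₚ.≤-reflexive (length-filter-map (λ p → total p ≟ x) φ P))
    (length-filter-mono _ _ (λ p eq → trans (sym (shift p)) (∙-congʳ eq)) P)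

  translate : ∀ {U V t z} e → SpreadPairs U (map (_∙ e) V) t z → SpreadPairs U V t z
  translate {U} {V} e S = record
    { pairs  = map φ (pairs S)
    ; unique = Uniqueₚ.map⁺ C² C² (λ {x} {y} (g , h) → g , ∙-cancelʳ (e ⁻¹) (proj₂ x) (proj₂ y) h) (unique S)
    ; inside = Allₚ.map⁺ (All.map (λ {p} → ok {p}) (inside S))
    ; fibres = λ x → ℕₚ.≤-trans (fibre-map φ e shift x (pairs S)) (fibres S (x ∙ e))
    ; size   = ℕₚ.≤-trans (size S) (ℕₚ.≤-reflexive (≡.sym (Listₚ.length-map φ (pairs S))))
    }
    where
    φ : 𝔾 × 𝔾 → 𝔾 × 𝔾
    φ (x , y) = x , y ∙ e ⁻¹
    shift : ∀ p → total (φ p) ∙ e ≈ total p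
    shift (x , y) = trans (assoc x _ e) (∙-congˡ (//-rightDividesˡ e y))
    ok : ∀ {p} → proj₁ p ∈ U × proj₂ p ∈ map (_∙ e) V → proj₁ (φ p) ∈ U × proj₂ (φ p) ∈ V
    ok {x , y} (x∈ , y∈) = let v , v∈ , y≈ = Membershipₚ.∈-map⁻ setoid setoid y∈
      in x∈ , Membershipₚ.∈-resp-≈ setoid (sym (trans (∙-congʳ y≈) (//-rightDividesʳ e v))) v∈

  -- In the fibre over `x` the second coordinate determines the first, so the fibre injects into
  -- `V`.
  fibre-bound : ∀ U V → Unique U → Unique V → ∀ x → fibre x (cartesianProduct U V) ℕ.≤ length V
  fibre-bound U V U! V! x = ≡.subst (ℕ._≤ length V) (Listₚ.length-map proj₂ F) (pigeonhole {map proj₂ F} {V}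
      (SetoidLists.Unique-map-on C² setoid {D = λ p → total p ≈ x} inj (Allₚ.all-filter (λ p → total p ≟ x) (cartesianProduct U V))
        (Uniqueₚ.filter⁺ C² (λ p → total p ≟ x) (Uniqueₚ.cartesianProduct⁺ setoid setoid U! V!)))
      λ y∈ → let _ , p∈ , y≈ = Membershipₚ.∈-map⁻ C² setoid y∈
                 p∈′ , _ = Membershipₚ.∈-filter⁻ C² (λ p → total p ≟ x) (λ p≈q e → trans (sym (total-cong p≈q)) e) {xs = cartesianProduct U V} p∈
             in Membershipₚ.∈-resp-≈ setoid (sym y≈) (proj₂ (Membershipₚ.∈-cartesianProduct⁻ setoid setoid U V p∈′)))
    where
    F = filter (λ p → total p ≟ x) (cartesianProduct U V)
    inj : ∀ {p q} → total p ≈ x → total q ≈ x → proj₂ p ≈ proj₂ q → Setoid._≈_ C² p q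
    inj {w , i} {w′ , i′} e e′ i≈ = ∙-cancelʳ i w w′ (trans e (trans (sym e′) (∙-congˡ (sym i≈)))) , i≈

  -- Dyson's transform: `W` is the union of `U` and `V`, `I` their intersection

  module Transform (U V : List 𝔾) (U! : Unique U) (V! : Unique V) where

    resp-∈ : ∀ (X : List 𝔾) {x y} → x ≈ y → x ∈ X → y ∈ X
    resp-∈ X = Membershipₚ.∈-resp-≈ setoid

    resp-∉ : ∀ (X : List 𝔾) {x y} → x ≈ y → ¬ x ∈ X → ¬ y ∈ X
    resp-∉ X = Membershipₚ.∉-resp-≈ setoid

    I V∖U U∖V W : List 𝔾
    I   = filter (_∈? U) V
    V∖U = filter (¬? ∘ (_∈? U)) V
    U∖V = filter (¬? ∘ (_∈? V)) U
    W   = U ++ V∖U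

    ∈I⁻ : ∀ {x} → x ∈ I → x ∈ V × x ∈ U
    ∈I⁻ = Membershipₚ.∈-filter⁻ setoid (_∈? U) (resp-∈ U)

    ∈V∖U⁻ : ∀ {x} → x ∈ V∖U → x ∈ V × ¬ x ∈ U
    ∈V∖U⁻ = Membershipₚ.∈-filter⁻ setoid (¬? ∘ (_∈? U)) (resp-∉ U)

    ∈U∖V⁻ : ∀ {x} → x ∈ U∖V → x ∈ U × ¬ x ∈ V
    ∈U∖V⁻ = Membershipₚ.∈-filter⁻ setoid (¬? ∘ (_∈? V)) (resp-∉ V)

    I! : Unique I
    I! = Uniqueₚ.filter⁺ setoid (_∈? U) V!

    V∖U! : Unique V∖U
    V∖U! = Uniqueₚ.filter⁺ setoid (¬? ∘ (_∈? U)) V!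

    U∖V! : Unique U∖V
    U∖V! = Uniqueₚ.filter⁺ setoid (¬? ∘ (_∈? V)) U!

    W! : Unique W
    W! = Uniqueₚ.++⁺ setoid U! V∖U! λ (x∈U , x∈) → proj₂ (∈V∖U⁻ x∈) x∈U

    length-V : length V ≡ length I ℕ.+ length V∖U
    length-V = length-filter-split (_∈? U) V

    length-W : length W ≡ length U ℕ.+ length V∖U
    length-W = Listₚ.length-++ U

    length-U : length U ℕ.≤ length I ℕ.+ length U∖V
    length-U = ℕₚ.≤-trans (ℕₚ.≤-reflexive (length-filter-split (_∈? V) U))
      (ℕₚ.+-monoˡ-≤ _ (pigeonhole (Uniqueₚ.filter⁺ setoid (_∈? V) U!) λ x∈ →
        let x∈U , x∈V = Membershipₚ.∈-filter⁻ setoid (_∈? V) (resp-∈ V) x∈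
        in Membershipₚ.∈-filter⁺ setoid (_∈? U) (resp-∈ U) x∈V x∈U))

    -- Carries `W × I` into `U × V` without changing sums: if `w` is not in `U` it is in `V`, and
    -- `i` lies in both sets, so the two may be exchanged.
    φ : 𝔾 × 𝔾 → 𝔾 × 𝔾
    φ (w , i) with w ∈? U
    ... | yes _ = w , i
    ... | no _  = i , w

    φ-total : ∀ p → total (φ p) ∙ ε ≈ total p
    φ-total (w , i) with w ∈? U
    ... | yes _ = identityʳ _
    ... | no _  = trans (identityʳ _) (comm i w)

    Dom : 𝔾 × 𝔾 → Set _
    Dom (w , i) = w ∈ W × i ∈ I

    -- A kept pair has its second coordinate in `U`, an exchanged one has it outside `U`, so images
    -- of the two kinds never coincide.
    φ-injective : ∀ {p q} → Dom p → Dom q → Setoid._≈_ C² (φ p) (φ q) → Setoid._≈_ C² p q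
    φ-injective {w , i} {w′ , i′} (_ , i∈) (_ , i′∈) e with w ∈? U | w′ ∈? U
    ... | yes _ | yes _    = e
    ... | yes _ | no w′∉   = contradiction (resp-∈ U (proj₂ e) (proj₂ (∈I⁻ i∈))) w′∉
    ... | no w∉ | yes _    = contradiction (resp-∈ U (sym (proj₂ e)) (proj₂ (∈I⁻ i′∈))) w∉
    ... | no _  | no _     = proj₂ e , proj₁ e

    φ-inside : ∀ {p} → Dom p → proj₁ (φ p) ∈ U × proj₂ (φ p) ∈ V
    φ-inside {w , i} (w∈ , i∈) with w ∈? U
    ... | yes w∈U = w∈U , proj₁ (∈I⁻ i∈)
    ... | no w∉U with Membershipₚ.∈-++⁻ setoid U w∈
    ...   | inj₁ w∈U = contradiction w∈U w∉U
    ...   | inj₂ w∈′ = proj₂ (∈I⁻ i∈) , proj₁ (∈V∖U⁻ w∈′)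

    -- Separates these images from the pairs in `U∖V × V∖U` when `split` joins the two families.
    φ-meets-I : ∀ {p} → Dom p → proj₁ (φ p) ∈ V ⊎ proj₂ (φ p) ∈ U
    φ-meets-I {w , i} (w∈ , i∈) with w ∈? U
    ... | yes _ = inj₂ (proj₂ (∈I⁻ i∈))
    ... | no _  = inj₁ (proj₁ (∈I⁻ i∈))

    fibre-φ : ∀ x P → fibre x (map φ P) ℕ.≤ fibre (x ∙ ε) P
    fibre-φ = fibre-map φ ε φ-total

    dyson : ∀ {t z} → SpreadPairs W I t z → SpreadPairs U V t z
    dyson S = record
      { pairs  = map φ (pairs S)
      ; unique = SetoidLists.Unique-map-on C² C² {D = Dom} φ-injective (inside S) (unique S)
      ; inside = Allₚ.map⁺ (All.map (λ {p} → φ-inside {p}) (inside S))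
      ; fibres = λ x → ℕₚ.≤-trans (fibre-φ x (pairs S)) (fibres S (x ∙ ε))
      ; size   = ℕₚ.≤-trans (size S) (ℕₚ.≤-reflexive (≡.sym (Listₚ.length-map φ (pairs S))))
      }

    W×I : SpreadPairs W I (length I) (length W ℕ.* length I)
    W×I = record
      { pairs  = cartesianProduct W I
      ; unique = Uniqueₚ.cartesianProduct⁺ setoid setoid W! I!
      ; inside = All.tabulateₛ C² λ p∈ → Membershipₚ.∈-cartesianProduct⁻ setoid setoid W I p∈
      ; fibres = fibre-bound W I W! I!
      ; size   = ℕₚ.≤-reflexive (≡.sym (length-cartesianProduct W I))
      }

    -- All of `W × I` can be used at the price of multiplicity `|I|`. The remaining multiplicity `t`
    -- goes to pairs with no coordinate in `I`, and fibres add up.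
    split : ∀ {t z} → SpreadPairs U∖V V∖U t z → SpreadPairs U V (length I ℕ.+ t) (length W ℕ.* length I ℕ.+ z)
    split S = record
      { pairs  = pairs S₁ ++ pairs S
      ; unique = Uniqueₚ.++⁺ C² (unique S₁) (unique S) disj
      ; inside = Allₚ.++⁺ (inside S₁) (All.map (λ (h , k) → proj₁ (∈U∖V⁻ h) , proj₁ (∈V∖U⁻ k)) (inside S))
      ; fibres = λ x → ℕₚ.≤-trans (ℕₚ.≤-reflexive (length-filter-++ (λ p → total p ≟ x) (pairs S₁) (pairs S)))
                         (ℕₚ.+-mono-≤ (fibres S₁ x) (fibres S x))
      ; size  = ℕₚ.≤-trans (ℕₚ.+-mono-≤ (size S₁) (size S)) (ℕₚ.≤-reflexive (≡.sym (Listₚ.length-++ (pairs S₁))))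
      }
      where
      S₁ = dyson W×I
      disj : ∀ {p} → Any (Setoid._≈_ C² p) (pairs S₁) × Any (Setoid._≈_ C² p) (pairs S) → ⊥
      disj (p∈₁ , p∈₂) with Membershipₚ.∈-map⁻ C² C² {f = φ} p∈₁
      ... | q , q∈ , p≈ with Membershipₚ.∈-cartesianProduct⁻ setoid setoid W I q∈
                           | All.lookupₛ C² (λ (e , f) (h , k) → resp-∈ U∖V e h , resp-∈ V∖U f k) (inside S) p∈₂
      ...   | q-dom | h , k with φ-meets-I {q} q-dom
      ...     | inj₁ m = proj₂ (∈U∖V⁻ h) (resp-∈ V (sym (proj₁ p≈)) m)
      ...     | inj₂ m = proj₂ (∈V∖U⁻ k) (resp-∈ U (sym (proj₂ p≈)) m)

  -- The arithmetic behind `split`, with `i = |I|`, `v = |V∖U|`, `u′ = |U∖V|`, `w = |W|` and `t` the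
  -- multiplicity that is left. If `M ≤ X`, then `z ≤ w` serves the `i` copies and `z ≤ M` the `t`
  -- copies. Otherwise `z ≤ i + X` gives `(i + t) z ≤ i (z + t) + t X`, and `z + t ≤ w`.
  splitting-bound : ∀ i t M β u u′ v → u ℕ.≤ i ℕ.+ u′ →
    (i ℕ.+ t) ℕ.* (M ℕ.⊓ ((u ℕ.+ (i ℕ.+ v)) ℕ.∸ (i ℕ.+ t ℕ.+ β)))
      ℕ.≤ (u ℕ.+ v) ℕ.* i ℕ.+ t ℕ.* (M ℕ.⊓ ((u′ ℕ.+ v) ℕ.∸ (t ℕ.+ β)))
  splitting-bound i t M β u u′ v u≤ = go (ℕₚ.≤-total M X)
    where
    open ℕₚ.≤-Reasoning
    w X Z z : ℕ
    w = u ℕ.+ v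
    X = (u′ ℕ.+ v) ℕ.∸ (t ℕ.+ β)
    Z = (u ℕ.+ (i ℕ.+ v)) ℕ.∸ (i ℕ.+ t ℕ.+ β)
    z = M ℕ.⊓ Z
    Z≡ : Z ≡ w ℕ.∸ (t ℕ.+ β)
    Z≡ = ≡.trans (≡.cong₂ ℕ._∸_ (≡.trans (≡.sym (ℕₚ.+-assoc u i v))
           (≡.trans (≡.cong (ℕ._+ v) (ℕₚ.+-comm u i)) (ℕₚ.+-assoc i u v))) (ℕₚ.+-assoc i t β))
           (ℕₚ.[m+n]∸[m+o]≡n∸o i w (t ℕ.+ β))
    z≤w∸ : z ℕ.≤ w ℕ.∸ (t ℕ.+ β)
    z≤w∸ = ℕₚ.≤-trans (ℕₚ.m⊓n≤n M Z) (ℕₚ.≤-reflexive Z≡)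
    z≤i+X : z ℕ.≤ i ℕ.+ X
    z≤i+X = begin
      z                                          ≤⟨ z≤w∸ ⟩
      w ℕ.∸ (t ℕ.+ β)                            ≤⟨ ℕₚ.∸-monoˡ-≤ (t ℕ.+ β) (ℕₚ.+-monoˡ-≤ v u≤) ⟩
      (i ℕ.+ u′ ℕ.+ v) ℕ.∸ (t ℕ.+ β)             ≡⟨ ≡.cong (ℕ._∸ (t ℕ.+ β)) (ℕₚ.+-assoc i u′ v) ⟩
      (i ℕ.+ (u′ ℕ.+ v)) ℕ.∸ (t ℕ.+ β)           ≤⟨ ℕₚ.m≤n+o⇒m∸n≤o _ (t ℕ.+ β) (begin
        i ℕ.+ (u′ ℕ.+ v)                            ≤⟨ ℕₚ.+-monoʳ-≤ i (ℕₚ.m≤n+m∸n (u′ ℕ.+ v) (t ℕ.+ β)) ⟩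
        i ℕ.+ (t ℕ.+ β ℕ.+ X)                       ≡⟨ ℕₚ.+-comm i _ ⟩
        t ℕ.+ β ℕ.+ X ℕ.+ i                         ≡⟨ ℕₚ.+-assoc (t ℕ.+ β) X i ⟩
        t ℕ.+ β ℕ.+ (X ℕ.+ i)                       ≡⟨ ≡.cong (t ℕ.+ β ℕ.+_) (ℕₚ.+-comm X i) ⟩
        t ℕ.+ β ℕ.+ (i ℕ.+ X)                       ∎) ⟩
      i ℕ.+ X                                    ∎
    room : ∀ z → z ℕ.≤ w ℕ.∸ (t ℕ.+ β) → i ℕ.* z ℕ.+ t ℕ.* z ℕ.≤ i ℕ.* (z ℕ.+ t) ℕ.+ t ℕ.* X → (i ℕ.+ t) ℕ.* z ℕ.≤ w ℕ.* i ℕ.+ t ℕ.* X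
    -- The subtraction is truncated: only a positive `z` forces `t + β ≤ w`, from which `z + t ≤ w`
    -- follows.
    room zero _ _ = ≡.subst (ℕ._≤ w ℕ.* i ℕ.+ t ℕ.* X) (≡.sym (ℕₚ.*-zeroʳ (i ℕ.+ t))) z≤n
    room z@(suc z′) z≤ le = begin
      (i ℕ.+ t) ℕ.* z                 ≡⟨ ℕₚ.*-distribʳ-+ z i t ⟩
      i ℕ.* z ℕ.+ t ℕ.* z             ≤⟨ le ⟩
      i ℕ.* (z ℕ.+ t) ℕ.+ t ℕ.* X     ≤⟨ ℕₚ.+-monoˡ-≤ (t ℕ.* X) (ℕₚ.*-monoʳ-≤ i z+t≤w) ⟩
      i ℕ.* w ℕ.+ t ℕ.* X             ≡⟨ ≡.cong (ℕ._+ t ℕ.* X) (ℕₚ.*-comm i w) ⟩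
      w ℕ.* i ℕ.+ t ℕ.* X             ∎
      where
      t+β≤w : t ℕ.+ β ℕ.≤ w
      t+β≤w = ℕₚ.<⇒≤ (ℕₚ.m∸n≢0⇒n<m {w} λ e → contradiction (≡.subst (z ℕ.≤_) e z≤) λ ())
      z+t≤w : z ℕ.+ t ℕ.≤ w
      z+t≤w = ℕₚ.≤-trans (ℕₚ.+-monoʳ-≤ z (ℕₚ.m≤m+n t β)) (ℕₚ.m≤o∸n⇒m+n≤o z t+β≤w z≤)
    go : M ℕ.≤ X ⊎ X ℕ.≤ M → (i ℕ.+ t) ℕ.* z ℕ.≤ w ℕ.* i ℕ.+ t ℕ.* (M ℕ.⊓ X)
    go (inj₁ M≤X) rewrite ℕₚ.m≤n⇒m⊓n≡m M≤X = begin
      (i ℕ.+ t) ℕ.* z                 ≡⟨ ℕₚ.*-distribʳ-+ z i t ⟩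
      i ℕ.* z ℕ.+ t ℕ.* z  ≤⟨ ℕₚ.+-mono-≤ (ℕₚ.*-monoʳ-≤ i (ℕₚ.≤-trans z≤w∸ (ℕₚ.m∸n≤m w (t ℕ.+ β)))) (ℕₚ.*-monoʳ-≤ t (ℕₚ.m⊓n≤m M Z)) ⟩
      i ℕ.* w ℕ.+ t ℕ.* M             ≡⟨ ≡.cong (ℕ._+ t ℕ.* M) (ℕₚ.*-comm i w) ⟩
      w ℕ.* i ℕ.+ t ℕ.* M             ∎
    go (inj₂ X≤M) rewrite ℕₚ.m≥n⇒m⊓n≡n X≤M = room z z≤w∸ (begin
      i ℕ.* z ℕ.+ t ℕ.* z                    ≤⟨ ℕₚ.+-monoʳ-≤ (i ℕ.* z) (ℕₚ.*-monoʳ-≤ t z≤i+X) ⟩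
      i ℕ.* z ℕ.+ t ℕ.* (i ℕ.+ X)            ≡⟨ ≡.cong (i ℕ.* z ℕ.+_) (ℕₚ.*-distribˡ-+ t i X) ⟩
      i ℕ.* z ℕ.+ (t ℕ.* i ℕ.+ t ℕ.* X)      ≡⟨ ℕₚ.+-assoc (i ℕ.* z) _ _ ⟨
      i ℕ.* z ℕ.+ t ℕ.* i ℕ.+ t ℕ.* X        ≡⟨ ≡.cong (λ y → i ℕ.* z ℕ.+ y ℕ.+ t ℕ.* X) (ℕₚ.*-comm t i) ⟩
      i ℕ.* z ℕ.+ i ℕ.* t ℕ.+ t ℕ.* X        ≡⟨ ≡.cong (ℕ._+ t ℕ.* X) (ℕₚ.*-distribˡ-+ i z t) ⟨
      i ℕ.* (z ℕ.+ t) ℕ.+ t ℕ.* X            ∎)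

  weaken : ∀ {U V t z z′} → z′ ℕ.≤ z → SpreadPairs U V t z → SpreadPairs U V t z′
  weaken le S = record { SpreadPairs S ; size = ℕₚ.≤-trans le (size S) }

  module _ (M β : ℕ) (gap : ∀ {H} → FiniteSubgroup H → length H ℕ.≤ β ⊎ M ℕ.≤ length H) where

    -- If every translate of V that meets U lies in U, then V lies in a coset of the stabiliser of U.
    saturated : ∀ U V t → Unique U → Unique V → 1 ℕ.≤ length U → t ℕ.≤ length V →
      (∀ {u v v′} → u ∈ U → v ∈ V → v′ ∈ V → v′ ∙ (u ∙ v ⁻¹) ∈ U) →
      SpreadPairs U V t (t ℕ.* (M ℕ.⊓ ((length U ℕ.+ length V) ℕ.∸ (t ℕ.+ β))))
    saturated U@(u₀ ∷ _) V t U! V! _ t≤V closed = record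
      { pairs  = cartesianProduct U V₀
      ; unique = Uniqueₚ.cartesianProduct⁺ setoid setoid U! V₀!
      ; inside = All.tabulateₛ C² λ p∈ → let u∈ , v∈ = Membershipₚ.∈-cartesianProduct⁻ setoid setoid U V₀ p∈ in u∈ , take⊆ v∈
      ; fibres = λ x → ℕₚ.≤-trans (fibre-bound U V₀ U! V₀! x) (ℕₚ.≤-reflexive length-V₀)
      ; size   = ℕₚ.≤-trans (ℕₚ.≤-trans (ℕₚ.*-monoʳ-≤ t bound) (ℕₚ.≤-reflexive (ℕₚ.*-comm t (length U))))
                   (ℕₚ.≤-reflexive (≡.sym (≡.trans (length-cartesianProduct U V₀) (≡.cong (length U ℕ.*_) length-V₀))))
      }
      where
      V₀ : List 𝔾
      V₀ = take t V
      V₀! : Unique V₀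
      V₀! = Uniqueₚ.take⁺ setoid t V!
      length-V₀ : length V₀ ≡ t
      length-V₀ = ≡.trans (Listₚ.length-take t V) (ℕₚ.m≤n⇒m⊓n≡m t≤V)
      take⊆ : ∀ {x} → x ∈ V₀ → x ∈ V
      take⊆ x∈ = ≡.subst (_ ∈_) (Listₚ.take++drop≡id t V) (Membershipₚ.∈-++⁺ˡ setoid x∈)
      open Stabiliser U U! (here refl)
      -- `closed`, with the first element `v₀` in the role of `v`, says that each `v - v₀` is a
      -- period of `U`.
      V≤H : ∀ V → Unique V → (∀ {u v v′} → u ∈ U → v ∈ V → v′ ∈ V → v′ ∙ (u ∙ v ⁻¹) ∈ U) → length V ℕ.≤ length H
      V≤H [] _ _ = z≤n
      V≤H V@(v₀ ∷ _) V! closed = ≡.subst (ℕ._≤ length H) (Listₚ.length-map (_∙ v₀ ⁻¹) V)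
        (pigeonhole (Uniqueₚ.map⁺ setoid setoid (λ {x} {y} → ∙-cancelʳ (v₀ ⁻¹) x y) V!) λ x∈ →
          let v , v∈ , x≈ = Membershipₚ.∈-map⁻ setoid setoid x∈
          in ∈H⁺ (All.tabulateₛ setoid λ {u} u∈ → Membershipₚ.∈-resp-≈ setoid
               (trans (trans (sym (assoc v u _)) (trans (∙-congʳ (comm v u)) (assoc u v _))) (∙-congˡ (sym x≈)))
               (closed u∈ (here refl) v∈)))
      -- The family `U × V₀` has `t |U|` pairs, so the minimum need only be at most `|U|`. If
      -- `|H| ≥ M`, then `M ≤ |H| ≤ |U|`. If `|H| ≤ β`, then `|V| ≤ β`, and the second entry is at
      -- most `|U|`.
      bound : M ℕ.⊓ ((length U ℕ.+ length V) ℕ.∸ (t ℕ.+ β)) ℕ.≤ length U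
      bound with gap H-subgroup
      ... | inj₂ M≤H = ℕₚ.≤-trans (ℕₚ.m⊓n≤m M _) (ℕₚ.≤-trans M≤H length-H)
      ... | inj₁ H≤β = ℕₚ.≤-trans (ℕₚ.m⊓n≤n M _) (ℕₚ.m≤n+o⇒m∸n≤o _ (t ℕ.+ β)
        (ℕₚ.≤-trans (ℕₚ.+-monoʳ-≤ (length U) (ℕₚ.≤-trans (V≤H V V! closed) (ℕₚ.≤-trans H≤β (ℕₚ.m≤n+m β t))))
          (ℕₚ.≤-reflexive (ℕₚ.+-comm (length U) _))))

    -- The translate of `V` that takes `v` to `u` meets `U` in `u`, but `v′` leaves `U` under it.
    Open : List 𝔾 → List 𝔾 → Set _
    Open U V = ∃₂ λ u v → u ∈ U × v ∈ V × ∃[ v′ ] (v′ ∈ V × ¬ v′ ∙ (u ∙ v ⁻¹) ∈ U)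

    open-or-saturated : ∀ U V → Open U V ⊎ (∀ {u v v′} → u ∈ U → v ∈ V → v′ ∈ V → v′ ∙ (u ∙ v ⁻¹) ∈ U)
    open-or-saturated U V with All.all? (λ u → All.all? (λ v → All.all? (λ v′ → (v′ ∙ (u ∙ v ⁻¹)) ∈? U) V) V) U
    ... | yes h = inj₂ λ {u} {v} {v′} u∈ v∈ v′∈ →
          All.lookupₛ setoid (λ e → resp (∙-congʳ e))
            (All.lookupₛ setoid (λ e → All.map (resp (∙-congˡ (∙-congˡ (⁻¹-cong e)))))
              (All.lookupₛ setoid (λ e → All.map (All.map (resp (∙-congˡ (∙-congʳ e))))) h u∈) v∈) v′∈
      where
      resp : ∀ {x y} → x ≈ y → x ∈ U → y ∈ U
      resp = Membershipₚ.∈-resp-≈ setoid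
    ... | no ¬h = inj₁ (
      let u , u∈ , ¬h₁ = find (Allₚ.¬All⇒Any¬ (λ u → All.all? (λ v → All.all? (λ v′ → (v′ ∙ (u ∙ v ⁻¹)) ∈? U) V) V) U ¬h)
          v , v∈ , ¬h₂ = find (Allₚ.¬All⇒Any¬ (λ v → All.all? (λ v′ → (v′ ∙ (u ∙ v ⁻¹)) ∈? U) V) V ¬h₁)
          v′ , v′∈ , ¬h₃ = find (Allₚ.¬All⇒Any¬ (λ v′ → (v′ ∙ (u ∙ v ⁻¹)) ∈? U) V ¬h₂)
      in u , v , u∈ , v∈ , v′ , v′∈ , ¬h₃)

    -- Induction on the bound `f` for `|V|`. Both `I` and `V∖U` are shorter than `V`: the translate
    -- leaves `U`, and it meets `U`. If `t ≤ |I|`, the transform alone suffices because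
    -- `|W| + |I| = |U| + |V′|`; otherwise `split` recurses on the two differences with multiplicity
    -- `t - |I|`.
    pollard : ∀ f U V t → length V ℕ.≤ f → Unique U → Unique V → t ℕ.≤ length U → t ℕ.≤ length V →
      SpreadPairs U V t (t ℕ.* (M ℕ.⊓ ((length U ℕ.+ length V) ℕ.∸ (t ℕ.+ β))))
    pollard f U V zero V≤f U! V! t≤U t≤V = record
      { pairs = [] ; unique = [] ; inside = [] ; fibres = λ _ → z≤n ; size = z≤n }
    pollard zero U V (suc t) V≤f U! V! t≤U t≤V = contradiction (ℕₚ.≤-trans t≤V V≤f) λ ()
    pollard (suc f) U V t@(suc _) V≤f U! V! t≤U t≤V with open-or-saturated U V
    ... | inj₂ closed = saturated U V t U! V! (ℕₚ.≤-trans (s≤s z≤n) t≤U) t≤V closed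
    ... | inj₁ (u , v , u∈ , v∈ , v′ , v′∈ , out) = translate e (≡.subst
            (λ l → SpreadPairs U V′ t (t ℕ.* (M ℕ.⊓ ((length U ℕ.+ l) ℕ.∸ (t ℕ.+ β))))) (Listₚ.length-map (_∙ e) V) (go (ℕₚ.≤-total t (length I))))
      where
      e : 𝔾
      e = u ∙ v ⁻¹
      V′ : List 𝔾
      V′ = map (_∙ e) V
      V′! : Unique V′
      V′! = Uniqueₚ.map⁺ setoid setoid (λ {x} {y} → ∙-cancelʳ e x y) V!
      open Transform U V′ U! V′!
      V′≤f : length V′ ℕ.≤ suc f
      V′≤f = ℕₚ.≤-trans (ℕₚ.≤-reflexive (Listₚ.length-map (_∙ e) V)) V≤f
      0<V∖U : 1 ℕ.≤ length V∖U
      0<V∖U = Membershipₚ.∈-length setoid (Membershipₚ.∈-filter⁺ setoid (¬? ∘ (_∈? U)) (resp-∉ U)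
                (Membershipₚ.∈-map⁺ setoid setoid ∙-congʳ v′∈) out)
      0<I : 1 ℕ.≤ length I
      0<I = Membershipₚ.∈-length setoid (Membershipₚ.∈-filter⁺ setoid (_∈? U) (resp-∈ U)
                (Membershipₚ.∈-resp-≈ setoid (trans (comm v e) (//-rightDividesˡ v u)) (Membershipₚ.∈-map⁺ setoid setoid ∙-congʳ v∈)) u∈)
      I≤f : length I ℕ.≤ f
      I≤f = ℕₚ.≤-pred (ℕₚ.≤-trans (ℕₚ.≤-trans (≡.subst (ℕ._≤ length I ℕ.+ length V∖U) (ℕₚ.+-comm (length I) 1) (ℕₚ.+-monoʳ-≤ (length I) 0<V∖U)) (ℕₚ.≤-reflexive (≡.sym length-V))) V′≤f)
      V∖U≤f : length V∖U ℕ.≤ f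
      V∖U≤f = ℕₚ.≤-pred (ℕₚ.≤-trans (ℕₚ.≤-trans (ℕₚ.+-monoˡ-≤ (length V∖U) 0<I) (ℕₚ.≤-reflexive (≡.sym length-V))) V′≤f)
      t≤V′ : t ℕ.≤ length I ℕ.+ length V∖U
      t≤V′ = ℕₚ.≤-trans t≤V (ℕₚ.≤-reflexive (≡.trans (≡.sym (Listₚ.length-map (_∙ e) V)) length-V))
      W+I : length W ℕ.+ length I ≡ length U ℕ.+ length V′
      W+I = ≡.trans (≡.cong (ℕ._+ length I) length-W) (≡.trans (ℕₚ.+-assoc (length U) _ _)
              (≡.cong (length U ℕ.+_) (≡.trans (ℕₚ.+-comm _ (length I)) (≡.sym length-V))))
      go : t ℕ.≤ length I ⊎ length I ℕ.≤ t → SpreadPairs U V′ t (t ℕ.* (M ℕ.⊓ ((length U ℕ.+ length V′) ℕ.∸ (t ℕ.+ β))))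
      go (inj₁ t≤I) = ≡.subst (λ l → SpreadPairs U V′ t (t ℕ.* (M ℕ.⊓ (l ℕ.∸ (t ℕ.+ β))))) W+I
        (dyson (pollard f W I t I≤f W! I! (ℕₚ.≤-trans t≤U (ℕₚ.≤-trans (ℕₚ.m≤m+n _ _) (ℕₚ.≤-reflexive (≡.sym length-W)))) t≤I))
      go (inj₂ I≤t) = weaken (≡.subst₂ (λ l y → t ℕ.* (M ℕ.⊓ ((length U ℕ.+ l) ℕ.∸ (t ℕ.+ β))) ℕ.≤ y ℕ.* i ℕ.+ rest)
            (≡.sym length-V) (≡.sym length-W)
            (≡.subst (λ y → y ℕ.* (M ℕ.⊓ ((length U ℕ.+ (i ℕ.+ length V∖U)) ℕ.∸ (y ℕ.+ β))) ℕ.≤ (length U ℕ.+ length V∖U) ℕ.* i ℕ.+ t′ ℕ.* (M ℕ.⊓ ((length U∖V ℕ.+ length V∖U) ℕ.∸ (t′ ℕ.+ β)))) i+t′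
              (splitting-bound i t′ M β (length U) (length U∖V) (length V∖U) length-U)))
          (≡.subst (λ y → SpreadPairs U V′ y (length W ℕ.* i ℕ.+ t′ ℕ.* (M ℕ.⊓ ((length U∖V ℕ.+ length V∖U) ℕ.∸ (t′ ℕ.+ β))))) i+t′
            (split (pollard f U∖V V∖U t′ V∖U≤f U∖V! V∖U! (ℕₚ.m≤n+o⇒m∸n≤o t i (ℕₚ.≤-trans t≤U length-U)) (ℕₚ.m≤n+o⇒m∸n≤o t i t≤V′))))
        where
        i t′ rest : ℕ
        i = length I
        t′ = t ℕ.∸ i
        rest = t′ ℕ.* (M ℕ.⊓ ((length U∖V ℕ.+ length V∖U) ℕ.∸ (t′ ℕ.+ β)))
        i+t′ : i ℕ.+ t′ ≡ t
        i+t′ = ℕₚ.m+[n∸m]≡n I≤t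

-- Containers for sets with small doubling

module Counting {k n : ℕ} (J : Fin k → List (Fin n)) where

  open PropMembership using (_∈_)
  open UniqueS (≡.setoid (Fin n)) using (Unique)
  open SetoidLists (≡.setoid (Fin n))

  _∈?_ : (v : Fin n) (xs : List (Fin n)) → Dec (v ∈ xs)
  v ∈? xs = Any.any? (v Finₚ.≟_) xs

  _⊆_ : List (Fin n) → List (Fin n) → Set
  xs ⊆ ys = ∀ {v} → v ∈ xs → v ∈ ys

  -- Quantifying over repetition-free lists of indices makes sense of the bound also where `P` is
  -- not decided.
  AtMost : ∀ {p} → (Fin k → Set p) → ℕ → Set p
  AtMost P x = ∀ L → UniqueS.Unique (≡.setoid (Fin k)) L → All P L → length L ℕ.≤ x

  module _ {p q} {P : Fin k → Set p} {Q : Fin k → Set q} where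

    AtMost-⊆ : ∀ {x y} → (∀ j → P j → Q j) → x ℕ.≤ y → AtMost Q x → AtMost P y
    AtMost-⊆ f x≤y h L L! ps = ℕₚ.≤-trans (h L L! (All.map (λ {j} → f j) ps)) x≤y

  AtMost-empty : ∀ {p} {P : Fin k → Set p} x → (∀ j → ¬ P j) → AtMost P x
  AtMost-empty x none [] _ _ = z≤n
  AtMost-empty x none (j ∷ _) _ (p ∷ _) = contradiction p (none j)

  AtMost-split : ∀ {p} {P : Fin k → Set p} v {x y} →
    AtMost (λ j → P j × ¬ v ∈ J j) x → AtMost (λ j → P j × v ∈ J j) y → AtMost P (x ℕ.+ y)
  AtMost-split {P = P} v {x} {y} out in′ L L! ps = begin
    length L                                                            ≡⟨ length-filter-split v∈J? L ⟩
    length (filter v∈J? L) ℕ.+ length (filter (¬? ∘ v∈J?) L)            ≤⟨ ℕₚ.+-mono-≤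
      (in′ _ (Uniqueₚ.filter⁺ (≡.setoid (Fin k)) v∈J? L!) (All.zip (Allₚ.filter⁺ v∈J? ps , Allₚ.all-filter v∈J? L)))
      (out _ (Uniqueₚ.filter⁺ (≡.setoid (Fin k)) (¬? ∘ v∈J?) L!) (All.zip (Allₚ.filter⁺ (¬? ∘ v∈J?) ps , Allₚ.all-filter (¬? ∘ v∈J?) L))) ⟩
    y ℕ.+ x                                                             ≡⟨ ℕₚ.+-comm y x ⟩
    x ℕ.+ y                                                             ∎
    where
    open ℕₚ.≤-Reasoning
    v∈J? : ∀ j → Dec (v ∈ J j)
    v∈J? j = v ∈? J j

  nC0≡1 : ∀ n → n C 0 ≡ 1
  nC0≡1 n = ≡.trans (nCk≡nC[n∸k] {n = n} z≤n) (nCn≡1 n)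

  C-monoˡ-≤ : ∀ s {n n′} → n ℕ.≤ n′ → n C s ℕ.≤ n′ C s
  C-monoˡ-≤ s {n} {n′} n≤n′ = go (ℕₚ.≤⇒≤′ n≤n′)
    where
    step : ∀ s n → n C s ℕ.≤ suc n C s
    step zero    n = ℕₚ.≤-reflexive (≡.trans (nC0≡1 n) (≡.sym (nC0≡1 (suc n))))
    step (suc s) n = ℕₚ.≤-trans (ℕₚ.m≤n+m _ (n C s)) (ℕₚ.≤-reflexive (nCk+nC[k+1]≡[n+1]C[k+1] n s))
    go : ∀ {n′} → n ℕ.≤′ n′ → n C s ℕ.≤ n′ C s
    go ℕ.≤′-refl     = ℕₚ.≤-refl
    go (ℕ.≤′-step h) = ℕₚ.≤-trans (go h) (step s _)

  module _ (J! : ∀ j → Unique (J j)) (ext : ∀ i j → J i ⊆ J j → J j ⊆ J i → i ≡ j) where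

    -- `F` holds the elements already known to lie in `J j`, and `s` elements are still to come from
    -- `B`. Asking whether the head of `B` is one of them yields Pascal's rule.
    AtMost-between : ∀ B s F → Unique F → Unique B → All (λ v → ¬ v ∈ F) B →
      AtMost (λ j → F ⊆ J j × J j ⊆ (F ++ B) × length (J j) ≡ length F ℕ.+ s) (length B C s)
    AtMost-between B zero F F! B! dis = AtMost-⊆ (λ _ → id) (ℕₚ.≤-reflexive (≡.sym (nC0≡1 (length B)))) one
      where
      surj : ∀ i → F ⊆ J i → length (J i) ≡ length F ℕ.+ 0 → J i ⊆ F
      surj i F⊆ eq = pigeonhole-surjective Finₚ._≟_ F! F⊆ (ℕₚ.≤-reflexive (≡.trans eq (ℕₚ.+-identityʳ _)))
      one : AtMost (λ j → F ⊆ J j × J j ⊆ (F ++ B) × length (J j) ≡ length F ℕ.+ 0) 1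
      one [] _ _ = z≤n
      one (_ ∷ []) _ _ = s≤s z≤n
      one (i ∷ j ∷ _) ((i≢j ∷ _) ∷ _) ((F⊆i , _ , ∣i∣) ∷ (F⊆j , _ , ∣j∣) ∷ _) =
        contradiction (ext i j (λ v∈ → F⊆j (surj i F⊆i ∣i∣ v∈)) (λ v∈ → F⊆i (surj j F⊆j ∣j∣ v∈))) i≢j
    AtMost-between [] (suc s) F F! B! dis = AtMost-empty _ λ j (_ , J⊆ , eq) →
      contradiction (ℕₚ.≤-trans (ℕₚ.≤-reflexive (≡.sym eq)) (ℕₚ.≤-trans (pigeonhole (J! j) J⊆)
        (ℕₚ.≤-reflexive (≡.cong length (Listₚ.++-identityʳ F))))) (ℕₚ.<⇒≱ (ℕₚ.m<m+n (length F) (s≤s z≤n)))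
    AtMost-between (v ∷ B) (suc s) F F! (v∉B ∷ B!) (v∉F ∷ dis) =
      AtMost-⊆ (λ _ → id) (ℕₚ.≤-reflexive (≡.trans (ℕₚ.+-comm (length B C suc s) _) (nCk+nC[k+1]≡[n+1]C[k+1] (length B) s)))
        (AtMost-split v
          (AtMost-⊆ (λ j ((F⊆ , J⊆ , eq) , v∉) → F⊆ , (λ x∈ → drop v∉ x∈ (PropMembershipₚ.∈-++⁻ F (J⊆ x∈))) , eq) ℕₚ.≤-refl
            (AtMost-between B (suc s) F F! B! dis))
          (AtMost-⊆ (λ j ((F⊆ , J⊆ , eq) , v∈) → (λ where (here ≡.refl) → v∈; (there x∈) → F⊆ x∈)
              , (λ x∈ → shift (PropMembershipₚ.∈-++⁻ F (J⊆ x∈))) , ≡.trans eq (ℕₚ.+-suc (length F) s)) ℕₚ.≤-refl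
            (AtMost-between B s (v ∷ F) (Allₚ.¬Any⇒All¬ F v∉F ∷ F!) B!
              (All.zipWith (λ (v≢x , x∉F) → λ where (here ≡.refl) → v≢x ≡.refl; (there x∈F) → x∉F x∈F) (v∉B , dis)))))
      where
      drop : ∀ {j x} → ¬ v ∈ J j → x ∈ J j → x ∈ F ⊎ x ∈ (v ∷ B) → x ∈ (F ++ B)
      drop v∉ x∈ (inj₁ x∈F)           = PropMembershipₚ.∈-++⁺ˡ x∈F
      drop v∉ x∈ (inj₂ (here ≡.refl)) = contradiction x∈ v∉
      drop v∉ x∈ (inj₂ (there x∈B))   = PropMembershipₚ.∈-++⁺ʳ F x∈B
      shift : ∀ {x} → x ∈ F ⊎ x ∈ (v ∷ B) → x ∈ (v ∷ F ++ B)
      shift (inj₁ x∈F)         = there (PropMembershipₚ.∈-++⁺ˡ x∈F)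
      shift (inj₂ (here x≡v))  = here x≡v
      shift (inj₂ (there x∈B)) = there (PropMembershipₚ.∈-++⁺ʳ F x∈B)

    AtMost-inside : ∀ s → (∀ j → length (J j) ≡ s) → ∀ B → Unique B → AtMost (λ j → J j ⊆ B) (length B C s)
    AtMost-inside s ∣J∣ B B! = AtMost-⊆ (λ j J⊆ → (λ ()) , J⊆ , ∣J∣ j) ℕₚ.≤-refl
      (AtMost-between B s [] [] B! (All.tabulate λ _ ()))

-- Sums over lists and double counting

sum-map-mono : ∀ {f g : A → ℕ} xs → (∀ {x} → Any (x ≡_) xs → f x ℕ.≤ g x) → sum (map f xs) ℕ.≤ sum (map g xs)
sum-map-mono []       h = z≤n
sum-map-mono (x ∷ xs) h = ℕₚ.+-mono-≤ (h (here ≡.refl)) (sum-map-mono xs (h ∘ there))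

sum-map-+const : ∀ (f : A → ℕ) d xs → sum (map (λ x → f x ℕ.+ d) xs) ≡ sum (map f xs) ℕ.+ length xs ℕ.* d
sum-map-+const f d []       = ≡.refl
sum-map-+const f d (x ∷ xs) rewrite sum-map-+const f d xs =
  rearrange (f x) d (sum (map f xs)) (length xs ℕ.* d)
  where
  rearrange : ∀ a d b e → a ℕ.+ d ℕ.+ (b ℕ.+ e) ≡ a ℕ.+ b ℕ.+ (d ℕ.+ e)
  rearrange = solve-∀

sum-map-const : ∀ d (xs : List A) → sum (map (λ _ → d) xs) ≡ length xs ℕ.* d
sum-map-const d []       = ≡.refl
sum-map-const d (x ∷ xs) = ≡.cong (d ℕ.+_) (sum-map-const d xs)

sum-map-0 : ∀ (xs : List A) → sum (map (λ _ → 0) xs) ≡ 0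
sum-map-0 xs = ≡.trans (sum-map-const 0 xs) (ℕₚ.*-zeroʳ (length xs))

module _ {A : Set ℓa} {B : Set ℓb} {Q : A → B → Set ℓq} (Q? : ∀ x y → Dec (Q x y)) where

  length-filter-cartesianProduct : ∀ xs ys →
    length (filter (λ p → Q? (proj₁ p) (proj₂ p)) (cartesianProduct xs ys)) ≡ sum (map (λ x → length (filter (Q? x) ys)) xs)
  length-filter-cartesianProduct []       ys = ≡.refl
  length-filter-cartesianProduct (x ∷ xs) ys =
    ≡.trans (length-filter-++ (λ p → Q? (proj₁ p) (proj₂ p)) (map (x ,_) ys) (cartesianProduct xs ys))
      (≡.cong₂ ℕ._+_ (length-filter-map (λ p → Q? (proj₁ p) (proj₂ p)) (x ,_) ys) (length-filter-cartesianProduct xs ys))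

  double-count : ∀ xs ys → sum (map (λ x → length (filter (Q? x) ys)) xs)
                         ≡ sum (map (λ y → length (filter (λ x → Q? x y) xs)) ys)
  double-count []       ys = ≡.sym (sum-map-0 ys)
  double-count (x ∷ xs) ys = ≡.trans (≡.cong (length (filter (Q? x) ys) ℕ.+_) (double-count xs ys)) (go ys)
    where
    c : B → ℕ
    c y = length (filter (λ x → Q? x y) xs)
    swap : ∀ a b c → a ℕ.+ (b ℕ.+ c) ≡ b ℕ.+ (a ℕ.+ c)
    swap = solve-∀
    go : ∀ ys → length (filter (Q? x) ys) ℕ.+ sum (map (λ y → length (filter (λ x → Q? x y) xs)) ys)
              ≡ sum (map (λ y → length (filter (λ x → Q? x y) (x ∷ xs))) ys)
    go [] = ≡.refl
    go (y ∷ ys) with Q? x y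
    ... | yes _ = ≡.cong suc (≡.trans (swap (length (filter (Q? x) ys)) (c y) (sum (map c ys))) (≡.cong (c y ℕ.+_) (go ys)))
    ... | no _  = ≡.trans (swap (length (filter (Q? x) ys)) (c y) (sum (map c ys))) (≡.cong (c y ℕ.+_) (go ys))

module _ {A : Set ℓa} {P : Pred A ℓp} {Q : Pred A ℓq} (Q? : Decidable Q) where

  length-filter-remove : ∀ {xs} (x∈ : Any P xs) → length (filter Q? xs) ℕ.≤ length (filter Q? (xs Any.─ x∈)) ℕ.+ 1
  length-filter-remove {x ∷ xs} (here _) with Q? x
  ... | yes _ = ℕₚ.≤-reflexive (ℕₚ.+-comm 1 _)
  ... | no _  = ℕₚ.m≤m+n _ 1
  length-filter-remove {x ∷ xs} (there x∈) with Q? x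
  ... | yes _ = s≤s (length-filter-remove x∈)
  ... | no _  = length-filter-remove x∈

Unique-remove : ∀ {A : Set ℓa} {P : Pred A ℓp} {xs} (x∈ : Any P xs) →
  UniqueS.Unique (≡.setoid A) xs → UniqueS.Unique (≡.setoid A) (xs Any.─ x∈)
Unique-remove (here _)  (_ ∷ xs!)  = xs!
Unique-remove (there p) (x∉ ∷ xs!) = Allₚ.─⁺ p x∉ ∷ Unique-remove p xs!

-- The graph of new sums

module SumGraph {c ℓ} (G : AbelianGroup c ℓ) (_≟_ : Decidable₂ (AbelianGroup._≈_ G))
  {n : ℕ} (y : Fin n → AbelianGroup.Carrier G) (y-injective : ∀ {i j} → AbelianGroup._≈_ G (y i) (y j) → i ≡ j) where

  open AbelianGroup G using (_∙_; _≈_; setoid; refl; sym; trans; ∙-cong; ∙-congˡ; ∙-congʳ; comm) renaming (Carrier to 𝔾)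
  open AbelianGroupProperties G
  open Pollard G _≟_
  open Membership setoid using (_∈_)
  open UniqueS setoid using (Unique)
  open UniqueS (≡.setoid (Fin n)) using () renaming (Unique to Uniqueᵛ)
  open PropMembership using () renaming (_∈_ to _∈ᵛ_)
  open SpreadPairs

  private
    _∈ᵛ?_ : (v : Fin n) (xs : List (Fin n)) → Dec (v ∈ᵛ xs)
    v ∈ᵛ? xs = Any.any? (v Finₚ.≟_) xs

  -- An edge joins `v` and `i` if their sum is not yet in `A`. `deg` counts the edges from `v` into
  -- `B`, and `edges` those from all of `T` into `B`.
  new? : ∀ A v i → Dec (¬ (y v ∙ y i) ∈ A)
  new? A v i = ¬? ((y v ∙ y i) ∈? A)

  deg : List 𝔾 → List (Fin n) → Fin n → ℕ
  deg A B v = length (filter (new? A v) B)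

  edges : List 𝔾 → List (Fin n) → List (Fin n) → ℕ
  edges A B T = sum (map (deg A B) T)

  map-y-unique : ∀ v {B} → Uniqueᵛ B → Unique (map (λ i → y v ∙ y i) B)
  map-y-unique v = Uniqueₚ.map⁺ (≡.setoid (Fin n)) setoid (λ {i} {j} e → y-injective (∙-cancelˡ (y v) (y i) (y j) e))

  old-bound : ∀ A B v → Uniqueᵛ B → length (filter (λ i → (y v ∙ y i) ∈? A) B) ℕ.≤ length A
  old-bound A B v B! = ≡.subst (ℕ._≤ length A) (Listₚ.length-map (λ i → y v ∙ y i) F)
    (SetoidLists.pigeonhole setoid (map-y-unique v (Uniqueₚ.filter⁺ (≡.setoid (Fin n)) (λ i → (y v ∙ y i) ∈? A) B!)) sub)
    where
    F : List (Fin n)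
    F = filter (λ i → (y v ∙ y i) ∈? A) B
    sub : ∀ {x} → x ∈ map (λ i → y v ∙ y i) F → x ∈ A
    sub x∈ = let i , i∈ , x≈ = Membershipₚ.∈-map⁻ (≡.setoid (Fin n)) setoid x∈
             in Membershipₚ.∈-resp-≈ setoid (sym x≈) (proj₂ (PropMembershipₚ.∈-filter⁻ (λ i → (y v ∙ y i) ∈? A) {xs = B} i∈))

  deg-trivial : ∀ A B v → Uniqueᵛ B → length B ℕ.≤ length A ℕ.+ deg A B v
  deg-trivial A B v B! = ℕₚ.≤-trans (ℕₚ.≤-reflexive (length-filter-split (λ i → (y v ∙ y i) ∈? A) B))
    (ℕₚ.+-monoˡ-≤ (deg A B v) (old-bound A B v B!))

  edges-remove : ∀ A B T {P : Pred (Fin n) ℓp} (x∈ : Any P B) → edges A B T ℕ.≤ edges A (B Any.─ x∈) T ℕ.+ length T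
  edges-remove A B T x∈ = begin
    edges A B T  ≤⟨ sum-map-mono T (λ {v} _ → length-filter-remove (new? A v) x∈) ⟩
    sum (map (λ v → deg A (B Any.─ x∈) v ℕ.+ 1) T)         ≡⟨ sum-map-+const (deg A (B Any.─ x∈)) 1 T ⟩
    edges A (B Any.─ x∈) T ℕ.+ length T ℕ.* 1  ≡⟨ ≡.cong (edges A (B Any.─ x∈) T ℕ.+_) (ℕₚ.*-identityʳ (length T)) ⟩
    edges A (B Any.─ x∈) T ℕ.+ length T                    ∎
    where open ℕₚ.≤-Reasoning

  -- Translation by `y v` is injective, so a new element of `A` destroys at most one edge at each
  -- `v`.
  edges-grow : ∀ A N B T → Uniqueᵛ B → edges A B T ℕ.≤ edges (N ++ A) B T ℕ.+ length T ℕ.* length N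
  edges-grow A N B T B! = begin
    edges A B T                                              ≤⟨ sum-map-mono T (λ {v} _ → step v) ⟩
    sum (map (λ v → deg (N ++ A) B v ℕ.+ length N) T)        ≡⟨ sum-map-+const (deg (N ++ A) B) (length N) T ⟩
    edges (N ++ A) B T ℕ.+ length T ℕ.* length N             ∎
    where
    open ℕₚ.≤-Reasoning
    step : ∀ v → deg A B v ℕ.≤ deg (N ++ A) B v ℕ.+ length N
    step v = ℕₚ.≤-trans
      (length-filter-cover (new? A v) (new? (N ++ A) v) (λ i → (y v ∙ y i) ∈? N) cover B)
      (ℕₚ.+-monoʳ-≤ (deg (N ++ A) B v) (old-bound N B v B!))
      where
      cover : ∀ i → ¬ (y v ∙ y i) ∈ A → (¬ (y v ∙ y i) ∈ (N ++ A)) ⊎ ((y v ∙ y i) ∈ N)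
      cover i ∉A with (y v ∙ y i) ∈? N
      ... | yes ∈N = inj₂ ∈N
      ... | no ∉N  = inj₁ λ h → contradiction (Membershipₚ.∈-++⁻ setoid N h) λ where (inj₁ z) → ∉N z; (inj₂ z) → ∉A z

  module _ (A : List 𝔾) (B : List (Fin n)) (B! : Uniqueᵛ B) where

    U : List 𝔾
    U = map y B

    U! : Unique U
    U! = Uniqueₚ.map⁺ (≡.setoid (Fin n)) setoid y-injective B!

    fibres-over : ∀ P t → (∀ x → fibre x P ℕ.≤ t) → ∀ A → length (filter (λ p → total p ∈? A) P) ℕ.≤ length A ℕ.* t
    fibres-over P t fib [] = ℕₚ.≤-reflexive (≡.cong length (Listₚ.filter-none (λ p → total p ∈? []) (All.universal (λ _ ()) P)))
    fibres-over P t fib (x ∷ A) = ℕₚ.≤-trans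
      (length-filter-cover _ (λ p → total p ≟ x) (λ p → total p ∈? A) (λ _ → λ where (here e) → inj₁ e; (there h) → inj₂ h) P)
      (ℕₚ.+-mono-≤ (fib x) (fibres-over P t fib A))

    -- Each element of `A` is the sum of at most `t` of the pairs; the pairs that remain have a sum
    -- outside `A` and are edges.
    spread⇒edges : ∀ {t z} → SpreadPairs U U t z → z ℕ.≤ length A ℕ.* t ℕ.+ edges A B B
    spread⇒edges {t} {z} S = begin
      z                                                                  ≤⟨ size S ⟩
      length (pairs S)  ≡⟨ length-filter-split old? (pairs S) ⟩
      length (filter old? (pairs S)) ℕ.+ length (filter (¬? ∘ old?) (pairs S))
        ≤⟨ ℕₚ.+-mono-≤ (fibres-over (pairs S) t (fibres S) A) (SetoidLists.pigeonhole C² (Uniqueₚ.filter⁺ C² (¬? ∘ old?) (unique S)) sub) ⟩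
      length A ℕ.* t ℕ.+ length (filter (¬? ∘ old?) (cartesianProduct U U))
        ≡⟨ ≡.cong (length A ℕ.* t ℕ.+_) (length-filter-cartesianProduct (λ a b → ¬? ((a ∙ b) ∈? A)) U U) ⟩
      length A ℕ.* t ℕ.+ sum (map (λ u → length (filter (λ b → ¬? ((u ∙ b) ∈? A)) U)) U)
        ≡⟨ ≡.cong (λ z → length A ℕ.* t ℕ.+ sum z) (≡.trans (≡.sym (Listₚ.map-∘ B)) (Listₚ.map-cong (λ v → length-filter-map (λ b → ¬? ((y v ∙ b) ∈? A)) y B) B)) ⟩
      length A ℕ.* t ℕ.+ edges A B B                                     ∎
      where
      open ℕₚ.≤-Reasoning
      old? : ∀ p → Dec (total p ∈ A)
      old? p = total p ∈? A
      resp : ∀ {p q} → Setoid._≈_ C² p q → ¬ total p ∈ A → ¬ total q ∈ A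
      resp e = Membershipₚ.∉-resp-≈ setoid (total-cong e)
      sub : ∀ {p} → Any (Setoid._≈_ C² p) (filter (¬? ∘ old?) (pairs S)) → Any (Setoid._≈_ C² p) (filter (¬? ∘ old?) (cartesianProduct U U))
      sub p∈ = let p∈′ , p∉ = Membershipₚ.∈-filter⁻ C² (¬? ∘ old?) resp {xs = pairs S} p∈
                   u∈ , v∈ = All.lookupₛ C² (λ (e , f) (g , h) → Membershipₚ.∈-resp-≈ setoid e g , Membershipₚ.∈-resp-≈ setoid f h) (inside S) p∈′
               in Membershipₚ.∈-filter⁺ C² (¬? ∘ old?) resp (Membershipₚ.∈-cartesianProduct⁺ setoid setoid u∈ v∈) p∉

    -- Otherwise every vertex of `B` outside `T` has degree below `|B| / c`. At most `|T|` vertices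
    -- are in `T`, each of degree at most `|B|`, so there would be too few edges.
    popular : ∀ c T → length B ℕ.* length B ℕ.+ c ℕ.* (length T ℕ.* length B) ℕ.< c ℕ.* edges A B B →
      ∃[ v ] (v ∈ᵛ B × ¬ v ∈ᵛ T × length B ℕ.≤ c ℕ.* deg A B v)
    popular c T big with Any.any? (λ v → (¬? (v ∈ᵛ? T)) ×-dec (length B ℕₚ.≤? c ℕ.* deg A B v)) B
    ... | yes h = let v , v∈ , v∉ , le = PropMembership.find h in v , v∈ , v∉ , le
    ... | no ¬h = contradiction (go B (Allₚ.¬Any⇒All¬ B ¬h)) (ℕₚ.<⇒≱ (ℕₚ.≤-<-trans (ℕₚ.+-monoʳ-≤ _ (ℕₚ.*-monoʳ-≤ c (ℕₚ.*-monoˡ-≤ (length B) few))) big))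
      where
      open ℕₚ.≤-Reasoning
      few : length (filter (_∈ᵛ? T) B) ℕ.≤ length T
      few = SetoidLists.pigeonhole (≡.setoid (Fin n)) (Uniqueₚ.filter⁺ (≡.setoid (Fin n)) (_∈ᵛ? T) B!)
        λ v∈ → proj₂ (PropMembershipₚ.∈-filter⁻ (_∈ᵛ? T) {xs = B} v∈)
      go : ∀ X → All (λ v → ¬ ((¬ v ∈ᵛ T) × length B ℕ.≤ c ℕ.* deg A B v)) X →
           c ℕ.* edges A B X ℕ.≤ length X ℕ.* length B ℕ.+ c ℕ.* (length (filter (_∈ᵛ? T) X) ℕ.* length B)
      go [] [] = ℕₚ.≤-reflexive (≡.trans (ℕₚ.*-zeroʳ c) (≡.sym (ℕₚ.*-zeroʳ c)))
      go (v ∷ X) (¬p ∷ ¬ps) with v ∈ᵛ? T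
      ... | yes v∈ = begin
        c ℕ.* (deg A B v ℕ.+ edges A B X)            ≡⟨ ℕₚ.*-distribˡ-+ c (deg A B v) _ ⟩
        c ℕ.* deg A B v ℕ.+ c ℕ.* edges A B X  ≤⟨ ℕₚ.+-mono-≤ (ℕₚ.*-monoʳ-≤ c (Listₚ.length-filter (new? A v) B)) (go X ¬ps) ⟩
        c ℕ.* b ℕ.+ (length X ℕ.* b ℕ.+ c ℕ.* (f ℕ.* b))   ≡⟨ arith c b (length X) f ⟩
        length X ℕ.* b ℕ.+ c ℕ.* (b ℕ.+ f ℕ.* b)           ≤⟨ ℕₚ.+-monoˡ-≤ _ (ℕₚ.m≤n+m _ b) ⟩
        b ℕ.+ length X ℕ.* b ℕ.+ c ℕ.* (b ℕ.+ f ℕ.* b)     ∎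
        where
        b = length B
        f = length (filter (_∈ᵛ? T) X)
        arith : ∀ c b x f → c ℕ.* b ℕ.+ (x ℕ.* b ℕ.+ c ℕ.* (f ℕ.* b)) ≡ x ℕ.* b ℕ.+ c ℕ.* (b ℕ.+ f ℕ.* b)
        arith = solve-∀
      ... | no v∉ = begin
        c ℕ.* (deg A B v ℕ.+ edges A B X)            ≡⟨ ℕₚ.*-distribˡ-+ c (deg A B v) _ ⟩
        c ℕ.* deg A B v ℕ.+ c ℕ.* edges A B X  ≤⟨ ℕₚ.+-mono-≤ (ℕₚ.<⇒≤ (ℕₚ.≰⇒> (λ le → ¬p (v∉ , le)))) (go X ¬ps) ⟩
        b ℕ.+ (length X ℕ.* b ℕ.+ c ℕ.* (f ℕ.* b))   ≡⟨ ℕₚ.+-assoc b _ _ ⟨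
        b ℕ.+ length X ℕ.* b ℕ.+ c ℕ.* (f ℕ.* b)     ∎
        where
        b = length B
        f = length (filter (_∈ᵛ? T) X)

-- The recursion for the number of final sets, with `z = |B|`: a negative answer shrinks `B` and
-- keeps the budget `suc q` of positive answers, a positive one keeps `B` and spends one unit.
branching-bound : ∀ z q W → z ℕ.^ suc q ℕ.* W ℕ.+ suc z ℕ.^ q ℕ.* W ℕ.≤ suc z ℕ.^ suc q ℕ.* W
branching-bound z q W = begin
  z ℕ.^ suc q ℕ.* W ℕ.+ suc z ℕ.^ q ℕ.* W      ≡⟨ ℕₚ.*-distribʳ-+ W (z ℕ.^ suc q) (suc z ℕ.^ q) ⟨
  (z ℕ.^ suc q ℕ.+ suc z ℕ.^ q) ℕ.* W  ≤⟨ ℕₚ.*-monoˡ-≤ W (ℕₚ.+-monoˡ-≤ (suc z ℕ.^ q) (ℕₚ.*-monoʳ-≤ z (ℕₚ.^-monoˡ-≤ q (ℕₚ.n≤1+n z)))) ⟩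
  (z ℕ.* suc z ℕ.^ q ℕ.+ suc z ℕ.^ q) ℕ.* W    ≡⟨ ≡.cong (ℕ._* W) (ℕₚ.+-comm (z ℕ.* suc z ℕ.^ q) _) ⟩
  suc z ℕ.^ suc q ℕ.* W                        ∎
  where open ℕₚ.≤-Reasoning

-- The container process

module Containers {c ℓ} (G : AbelianGroup c ℓ) (_≟_ : Decidable₂ (AbelianGroup._≈_ G))
  {n : ℕ} (y : Fin n → AbelianGroup.Carrier G) (y-injective : ∀ {i j} → AbelianGroup._≈_ G (y i) (y j) → i ≡ j)
  {k : ℕ} (J : Fin k → List (Fin n)) where

  open AbelianGroup G using (_∙_; _≈_; setoid; refl; sym; trans; ∙-cong; ∙-congˡ; ∙-congʳ; comm) renaming (Carrier to 𝔾)
  open AbelianGroupProperties G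
  open Membership setoid using (_∈_)
  open UniqueS setoid using (Unique)
  open UniqueS (≡.setoid (Fin n)) using () renaming (Unique to Uniqueᵛ)
  open PropMembership using () renaming (_∈_ to _∈ᵛ_)
  open SumGraph G _≟_ y y-injective
  open Counting J

  SumOf : Fin k → 𝔾 → Set _
  SumOf j a = ∃₂ λ u v → u ∈ᵛ J j × v ∈ᵛ J j × a ≈ y u ∙ y v

  module Algorithm
    (s m N κ D : ℕ)
    (J! : ∀ j → Uniqueᵛ (J j))
    (ext : ∀ i j → J i ⊆ J j → J j ⊆ J i → i ≡ j)
    (∣J∣ : ∀ j → length (J j) ≡ s)
    (small : ∀ j A → Unique A → All (SumOf j) A → length A ℕ.≤ m)
    (0<κ : 0 ℕ.< κ) (0<D : 0 ℕ.< D) (m≤2N : m ℕ.≤ 2 ℕ.* N)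
    (pick : ∀ A B T → Uniqueᵛ B → N ℕ.< length B → length A ℕ.≤ m → length T ℕ.< 2 ℕ.* κ ℕ.* D →
       ∃[ v ] (v ∈ᵛ B × ¬ v ∈ᵛ T × length B ℕ.≤ κ ℕ.* deg A B v))
    where

    b W : ℕ
    b = 2 ℕ.* κ ℕ.* D
    W = N C s

    -- The indices `j` that are consistent with the answers given so far.
    State : List 𝔾 → List (Fin n) → List (Fin n) → Fin k → Set _
    State A B T j = J j ⊆ B × All (_∈ᵛ J j) T × All (SumOf j) A

    leaf : ∀ A B T q → Uniqueᵛ B → length B ℕ.≤ N → AtMost (State A B T) (suc (length B) ℕ.^ q ℕ.* W)
    leaf A B T q B! B≤N = AtMost-⊆ (λ j → proj₁)
      (ℕₚ.≤-trans (C-monoˡ-≤ s B≤N) (ℕₚ.m≤n*m W (suc (length B) ℕ.^ q) {{ℕₚ.m^n≢0 (suc (length B)) q}}))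
      (AtMost-inside J! ext s ∣J∣ B B!)

    overfull : ∀ A B T x → Unique A → m ℕ.< length A → AtMost (State A B T) x
    overfull A B T x A! m<A = AtMost-empty x λ j (_ , _ , sums) → ℕₚ.<⇒≱ m<A (small j A A! sums)

    branch : ∀ A B T v q → (v∈ : v ∈ᵛ B) →
      AtMost (State A (B Any.─ v∈) T) (suc (length (B Any.─ v∈)) ℕ.^ suc q ℕ.* W) →
      AtMost (λ j → State A B T j × v ∈ᵛ J j) (suc (length B) ℕ.^ q ℕ.* W) →
      AtMost (State A B T) (suc (length B) ℕ.^ suc q ℕ.* W)
    branch A B T v q v∈ out in′ = AtMost-⊆ (λ _ → id) (branching-bound (length B) q W)
      (AtMost-split v
        (AtMost-⊆ (λ j ((J⊆ , T⊆ , A⊆) , v∉) → (λ x∈ → SetoidLists.∈-remove (≡.setoid (Fin n)) v∈ (J⊆ x∈) (λ x≡v → v∉ (≡.subst (_∈ᵛ J j) x≡v x∈))) , T⊆ , A⊆)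
          (ℕₚ.≤-reflexive (≡.cong (λ l → l ℕ.^ suc q ℕ.* W) (SetoidLists.length-remove (≡.setoid (Fin n)) v∈))) out)
        in′)

    module Round (ψ : ℕ) where

      -- `ψ` bounds `|B| + m - |A|` at the start of the round, and `l` counts the removals from `B`
      -- and the additions to `A` since then. Each such change costs a vertex of `T` at most one
      -- edge, so the density `1/κ` obtained when `T` was chosen survives up to `|T| l` edges.
      record Inv (A : List 𝔾) (B T : List (Fin n)) (l : ℕ) : Set c where
        field
          potential : length B ℕ.+ m ℕ.+ l ℕ.≤ ψ ℕ.+ length A
          dense     : length T ℕ.* length B ℕ.≤ κ ℕ.* (edges A B T ℕ.+ length T ℕ.* l)

      open Inv

      Inv-remove : ∀ {A B T l v} (v∈ : v ∈ᵛ B) → Inv A B T l → Inv A (B Any.─ v∈) T (suc l)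
      Inv-remove {A} {B} {T} {l} v∈ inv = record
        { potential = ≡.subst (ℕ._≤ ψ ℕ.+ length A) (≡.trans (≡.cong (λ x → x ℕ.+ m ℕ.+ l) (≡.sym len)) (≡.sym (ℕₚ.+-suc _ l))) (potential inv)
        ; dense = begin
            length T ℕ.* length B′  ≤⟨ ℕₚ.*-monoʳ-≤ (length T) (ℕₚ.≤-trans (ℕₚ.n≤1+n _) (ℕₚ.≤-reflexive len)) ⟩
            length T ℕ.* length B                                      ≤⟨ dense inv ⟩
            κ ℕ.* (edges A B T ℕ.+ length T ℕ.* l)  ≤⟨ ℕₚ.*-monoʳ-≤ κ (ℕₚ.+-monoˡ-≤ (length T ℕ.* l) (edges-remove A B T v∈)) ⟩
            κ ℕ.* (edges A B′ T ℕ.+ length T ℕ.+ length T ℕ.* l)  ≡⟨ ≡.cong (κ ℕ.*_) (≡.trans (ℕₚ.+-assoc (edges A B′ T) _ _) (≡.cong (edges A B′ T ℕ.+_) (≡.sym (ℕₚ.*-suc (length T) l)))) ⟩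
            κ ℕ.* (edges A B′ T ℕ.+ length T ℕ.* suc l)                ∎
        }
        where
        open ℕₚ.≤-Reasoning
        B′ : List (Fin n)
        B′ = B Any.─ v∈
        len : suc (length B′) ≡ length B
        len = SetoidLists.length-remove (≡.setoid (Fin n)) v∈

      Inv-grow : ∀ {A B T l} X → Uniqueᵛ B → Inv A B T l → Inv (X ++ A) B T (l ℕ.+ length X)
      Inv-grow {A} {B} {T} {l} X B! inv = record
        { potential = begin
            length B ℕ.+ m ℕ.+ (l ℕ.+ length X)     ≡⟨ ℕₚ.+-assoc (length B ℕ.+ m) l (length X) ⟨
            length B ℕ.+ m ℕ.+ l ℕ.+ length X       ≤⟨ ℕₚ.+-monoˡ-≤ (length X) (potential inv) ⟩
            ψ ℕ.+ length A ℕ.+ length X             ≡⟨ ℕₚ.+-assoc ψ (length A) (length X) ⟩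
            ψ ℕ.+ (length A ℕ.+ length X)  ≡⟨ ≡.cong (ψ ℕ.+_) (≡.trans (ℕₚ.+-comm (length A) (length X)) (≡.sym (Listₚ.length-++ X))) ⟩
            ψ ℕ.+ length (X ++ A)                   ∎
        ; dense = begin
            length T ℕ.* length B                                                           ≤⟨ dense inv ⟩
            κ ℕ.* (edges A B T ℕ.+ length T ℕ.* l)  ≤⟨ ℕₚ.*-monoʳ-≤ κ (ℕₚ.+-monoˡ-≤ (length T ℕ.* l) (edges-grow A X B T B!)) ⟩
            κ ℕ.* (edges (X ++ A) B T ℕ.+ length T ℕ.* length X ℕ.+ length T ℕ.* l)  ≡⟨ ≡.cong (κ ℕ.*_) (arith (edges (X ++ A) B T) (length T) (length X) l) ⟩
            κ ℕ.* (edges (X ++ A) B T ℕ.+ length T ℕ.* (l ℕ.+ length X))                    ∎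
        }
        where
        open ℕₚ.≤-Reasoning
        arith : ∀ e t x l → e ℕ.+ t ℕ.* x ℕ.+ t ℕ.* l ≡ e ℕ.+ t ℕ.* (l ℕ.+ x)
        arith = solve-∀

      Inv-pick : ∀ {A B T l v} → length B ℕ.≤ κ ℕ.* deg A B v → Inv A B T l → Inv A B (v ∷ T) l
      Inv-pick {A} {B} {T} {l} {v} le inv = record
        { potential = potential inv
        ; dense = begin
            length B ℕ.+ length T ℕ.* length B  ≤⟨ ℕₚ.+-mono-≤ le (dense inv) ⟩
            κ ℕ.* deg A B v ℕ.+ κ ℕ.* (edges A B T ℕ.+ length T ℕ.* l)  ≡⟨ ℕₚ.*-distribˡ-+ κ (deg A B v) _ ⟨
            κ ℕ.* (deg A B v ℕ.+ (edges A B T ℕ.+ length T ℕ.* l))  ≤⟨ ℕₚ.*-monoʳ-≤ κ (ℕₚ.≤-trans (ℕₚ.m≤n+m _ l) (ℕₚ.≤-reflexive (arith l (deg A B v) (edges A B T) (length T ℕ.* l)))) ⟩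
            κ ℕ.* (deg A B v ℕ.+ edges A B T ℕ.+ (l ℕ.+ length T ℕ.* l))             ∎
        }
        where
        open ℕₚ.≤-Reasoning
        arith : ∀ l d e x → l ℕ.+ (d ℕ.+ (e ℕ.+ x)) ≡ d ℕ.+ e ℕ.+ (l ℕ.+ x)
        arith = solve-∀

      back : List 𝔾 → List (Fin n) → Fin n → ℕ
      back A T i = length (filter (λ v → new? A v i) T)

      heavy : ∀ A B T → ∃[ i ] (i ∈ᵛ B × D ℕ.≤ back A T i) ⊎ All (λ i → ¬ D ℕ.≤ back A T i) B
      heavy A B T with Any.any? (λ i → D ℕₚ.≤? back A T i) B
      ... | yes h   = inj₁ (PropMembership.find h)
      ... | no none = inj₂ (Allₚ.¬Any⇒All¬ B none)

      edges-sparse : ∀ A B T → All (λ i → ¬ D ℕ.≤ back A T i) B → edges A B T ℕ.≤ length B ℕ.* D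
      edges-sparse A B T sparse = begin
        edges A B T                      ≡⟨ double-count (λ v i → new? A v i) T B ⟩
        sum (map (back A T) B)           ≤⟨ sum-map-mono B (λ i∈ → ℕₚ.<⇒≤ (ℕₚ.≰⇒> (All.lookup sparse i∈))) ⟩
        sum (map (λ _ → D) B)            ≡⟨ sum-map-const D B ⟩
        length B ℕ.* D                   ∎
        where open ℕₚ.≤-Reasoning

      -- This is why `b` is `2 κ D`: a round ends when fewer than `D` edges reach each element of
      -- `B`, which is at most half of the edges that `dense` promises, so the changes counted by
      -- `l` must account for the other half.
      Inv-end : ∀ {A B T l} → length T ≡ b → All (λ i → ¬ D ℕ.≤ back A T i) B → Inv A B T l → length B ℕ.≤ 2 ℕ.* κ ℕ.* l
      Inv-end {A} {B} {T} {l} ∣T∣ sparse inv = ℕₚ.*-cancelˡ-≤ (κ ℕ.* D) {{ℕₚ.m*n≢0 κ D {{ℕ.>-nonZero 0<κ}} {{ℕ.>-nonZero 0<D}}}}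
        (ℕₚ.+-cancelˡ-≤ (κ ℕ.* D ℕ.* length B) _ _ (begin
          κ ℕ.* D ℕ.* length B ℕ.+ κ ℕ.* D ℕ.* length B             ≡⟨ arith₁ κ D (length B) ⟩
          2 ℕ.* κ ℕ.* D ℕ.* length B                                ≡⟨ ≡.cong (ℕ._* length B) ∣T∣ ⟨
          length T ℕ.* length B                                     ≤⟨ dense inv ⟩
          κ ℕ.* (edges A B T ℕ.+ length T ℕ.* l)  ≤⟨ ℕₚ.*-monoʳ-≤ κ (ℕₚ.+-mono-≤ (edges-sparse A B T sparse) (ℕₚ.≤-reflexive (≡.cong (ℕ._* l) ∣T∣))) ⟩
          κ ℕ.* (length B ℕ.* D ℕ.+ 2 ℕ.* κ ℕ.* D ℕ.* l)            ≡⟨ arith₂ κ D (length B) l ⟩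
          κ ℕ.* D ℕ.* length B ℕ.+ κ ℕ.* D ℕ.* (2 ℕ.* κ ℕ.* l)      ∎))
        where
        open ℕₚ.≤-Reasoning
        arith₁ : ∀ κ D B → κ ℕ.* D ℕ.* B ℕ.+ κ ℕ.* D ℕ.* B ≡ 2 ℕ.* κ ℕ.* D ℕ.* B
        arith₁ = solve-∀
        arith₂ : ∀ κ D B l → κ ℕ.* (B ℕ.* D ℕ.+ 2 ℕ.* κ ℕ.* D ℕ.* l) ≡ κ ℕ.* D ℕ.* B ℕ.+ κ ℕ.* D ℕ.* (2 ℕ.* κ ℕ.* l)
        arith₂ = solve-∀

      module _ (q : ℕ) (next : ∀ f A B T l → m ℕ.< length A ℕ.+ f ℕ.* D → Unique A → Uniqueᵛ B → length T ≡ b →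
                  All (λ i → ¬ D ℕ.≤ back A T i) B → Inv A B T l →
                  AtMost (State A B T) (suc (length B) ℕ.^ (f ℕ.+ q) ℕ.* W)) where

        -- `f` bounds the positive answers left to all second phases together, and `q` is reserved
        -- for the first phases of later rounds. A positive answer adds at least `D` elements to
        -- `A`, so with `f` exhausted more than `m` sums are known and no candidate survives. A
        -- negative answer shortens `B`, whose length `x` bounds.
        phase₂ : ∀ f x A B T l → length B ℕ.≤ x → m ℕ.< length A ℕ.+ f ℕ.* D → Unique A → Uniqueᵛ B → Uniqueᵛ T → length T ≡ b →
                 Inv A B T l → AtMost (State A B T) (suc (length B) ℕ.^ (f ℕ.+ q) ℕ.* W)
        phase₂ zero x A B T l B≤x room A! B! T! ∣T∣ inv = overfull A B T _ A! (≡.subst (m ℕ.<_) (ℕₚ.+-identityʳ (length A)) room)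
        phase₂ (suc f) zero A [] T l B≤x room A! B! T! ∣T∣ inv = next (suc f) A [] T l room A! B! ∣T∣ [] inv
        phase₂ (suc f) (suc x) A B T l B≤x room A! B! T! ∣T∣ inv with heavy A B T
        ... | inj₂ none           = next (suc f) A B T l room A! B! ∣T∣ none inv
        ... | inj₁ (i , i∈ , D≤) = branch A B T i (f ℕ.+ q) i∈
          (phase₂ (suc f) x A (B Any.─ i∈) T (suc l) (ℕₚ.≤-pred (≡.subst (ℕ._≤ suc x) (≡.sym (SetoidLists.length-remove (≡.setoid (Fin n)) i∈)) B≤x))
            room A! (Unique-remove i∈ B!) T! ∣T∣ (Inv-remove i∈ inv))
          (AtMost-⊆ (λ j ((J⊆ , T⊆ , A⊆) , i∈J) → J⊆ , T⊆ , Allₚ.++⁺ (sums j T⊆ i∈J) A⊆) ℕₚ.≤-refl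
            (phase₂ f (suc x) (X ++ A) B T (l ℕ.+ length X) B≤x room′ X++A! B! T! ∣T∣ (Inv-grow X B! inv)))
          where
          F : List (Fin n)
          F = filter (λ v → new? A v i) T
          X : List 𝔾
          X = map (λ v → y v ∙ y i) F
          ∣X∣ : length X ≡ back A T i
          ∣X∣ = Listₚ.length-map (λ v → y v ∙ y i) F
          X! : Unique X
          X! = Uniqueₚ.map⁺ (≡.setoid (Fin n)) setoid (λ {u} {v} e → y-injective (∙-cancelʳ (y i) (y u) (y v) e))
                 (Uniqueₚ.filter⁺ (≡.setoid (Fin n)) (λ v → new? A v i) T!)
          X#A : ∀ {x} → x ∈ X × x ∈ A → ⊥
          X#A (x∈X , x∈A) = let v , v∈ , x≈ = Membershipₚ.∈-map⁻ (≡.setoid (Fin n)) setoid x∈X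
            in proj₂ (PropMembershipₚ.∈-filter⁻ (λ v → new? A v i) {xs = T} v∈) (Membershipₚ.∈-resp-≈ setoid x≈ x∈A)
          X++A! : Unique (X ++ A)
          X++A! = Uniqueₚ.++⁺ setoid X! A! X#A
          sums : ∀ j → All (_∈ᵛ J j) T → i ∈ᵛ J j → All (SumOf j) X
          sums j T⊆ i∈J = Allₚ.map⁺ (All.map (λ v∈ → _ , i , v∈ , i∈J , refl) (Allₚ.filter⁺ (λ v → new? A v i) T⊆))
          room′ : m ℕ.< length (X ++ A) ℕ.+ f ℕ.* D
          room′ = ℕₚ.<-≤-trans room (begin
            length A ℕ.+ (D ℕ.+ f ℕ.* D)  ≤⟨ ℕₚ.+-monoʳ-≤ (length A) (ℕₚ.+-monoˡ-≤ (f ℕ.* D) (ℕₚ.≤-trans D≤ (ℕₚ.≤-reflexive (≡.sym ∣X∣)))) ⟩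
            length A ℕ.+ (length X ℕ.+ f ℕ.* D)    ≡⟨ arith (length A) (length X) (f ℕ.* D) ⟩
            length X ℕ.+ length A ℕ.+ f ℕ.* D      ≡⟨ ≡.cong (ℕ._+ f ℕ.* D) (Listₚ.length-++ X) ⟨
            length (X ++ A) ℕ.+ f ℕ.* D            ∎)
            where
            open ℕₚ.≤-Reasoning
            arith : ∀ a x f → a ℕ.+ (x ℕ.+ f) ≡ x ℕ.+ a ℕ.+ f
            arith = solve-∀

        -- `g` elements are still missing from `T`. A positive answer supplies one, a negative one
        -- shortens `B`.
        phase₁ : ∀ f A → m ℕ.< length A ℕ.+ f ℕ.* D → Unique A → ∀ g x B T l → length B ℕ.≤ x → length T ℕ.+ g ≡ b →
                 Uniqueᵛ B → Uniqueᵛ T → Inv A B T l → AtMost (State A B T) (suc (length B) ℕ.^ (g ℕ.+ (f ℕ.+ q)) ℕ.* W)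
        phase₁ f A room A! zero x B T l B≤x ∣T∣ B! T! inv =
          phase₂ f (length B) A B T l ℕₚ.≤-refl room A! B! T! (≡.trans (≡.sym (ℕₚ.+-identityʳ _)) ∣T∣) inv
        phase₁ f A room A! (suc g) zero B T l B≤x ∣T∣ B! T! inv = leaf A B T (suc g ℕ.+ (f ℕ.+ q)) B! (ℕₚ.≤-trans B≤x z≤n)
        phase₁ f A room A! (suc g) (suc x) B T l B≤x ∣T∣ B! T! inv with ℕₚ.≤-<-connex (length B) N | ℕₚ.≤-<-connex (length A) m
        ... | inj₁ B≤N | _        = leaf A B T (suc g ℕ.+ (f ℕ.+ q)) B! B≤N
        ... | inj₂ _   | inj₂ m<A = overfull A B T _ A! m<A
        ... | inj₂ N<B | inj₁ A≤m
          with v , v∈ , v∉T , deg≥ ← pick A B T B! N<B A≤m (≡.subst (length T ℕ.<_) ∣T∣ (ℕₚ.m<m+n (length T) (s≤s z≤n))) =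
          branch A B T v (g ℕ.+ (f ℕ.+ q)) v∈
            (phase₁ f A room A! (suc g) x (B Any.─ v∈) T (suc l) (ℕₚ.≤-pred (≡.subst (ℕ._≤ suc x) (≡.sym (SetoidLists.length-remove (≡.setoid (Fin n)) v∈)) B≤x))
              ∣T∣ (Unique-remove v∈ B!) T! (Inv-remove v∈ inv))
            (AtMost-⊆ (λ j ((J⊆ , T⊆ , A⊆) , v∈J) → J⊆ , v∈J ∷ T⊆ , A⊆) ℕₚ.≤-refl
              (phase₁ f A room A! g (suc x) B (v ∷ T) l B≤x (≡.trans (≡.sym (ℕₚ.+-suc (length T) g)) ∣T∣) B!
                (Allₚ.¬Any⇒All¬ T v∉T ∷ T!) (Inv-pick deg≥ inv)))

    -- Between rounds `T` is dropped but `A` is kept, so `f` is not renewed. The hypothesis on `ψ`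
    -- says that `R` reductions by the factor `6κ / (6κ + 1)` bring it down to `N`; at `R = 0` it
    -- gives `|B| ≤ N`, because `|A| ≤ m`.
    rounds : ∀ R f A B ψ → m ℕ.< length A ℕ.+ f ℕ.* D → Unique A → Uniqueᵛ B → length B ℕ.+ m ℕ.≤ ψ ℕ.+ length A →
      ψ ℕ.* (6 ℕ.* κ) ℕ.^ R ℕ.≤ N ℕ.* suc (6 ℕ.* κ) ℕ.^ R →
      AtMost (State A B []) (suc (length B) ℕ.^ (f ℕ.+ R ℕ.* b) ℕ.* W)
    rounds zero f A B ψ room A! B! pot shrunk with ℕₚ.≤-<-connex (length A) m
    ... | inj₂ m<A = overfull A B [] _ A! m<A
    ... | inj₁ A≤m = leaf A B [] (f ℕ.+ 0) B! (ℕₚ.+-cancelʳ-≤ m _ _ (ℕₚ.≤-trans pot (ℕₚ.+-mono-≤ ψ≤N A≤m)))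
      where
      ψ≤N : ψ ℕ.≤ N
      ψ≤N = ≡.subst₂ ℕ._≤_ (ℕₚ.*-identityʳ ψ) (ℕₚ.*-identityʳ N) shrunk
    rounds (suc R) f A B ψ room A! B! pot shrunk = AtMost-⊆ (λ _ → id)
        (ℕₚ.≤-reflexive (≡.cong (λ e → suc (length B) ℕ.^ e ℕ.* W) (arith b f (R ℕ.* b))))
        (phase₁ (R ℕ.* b) next f A room A! b (length B) B [] 0 ℕₚ.≤-refl ≡.refl B! []
          record { potential = ℕₚ.≤-trans (ℕₚ.≤-reflexive (ℕₚ.+-identityʳ _)) pot ; dense = z≤n })
      where
      open Round ψ
      arith : ∀ b f r → b ℕ.+ (f ℕ.+ r) ≡ f ℕ.+ (b ℕ.+ r)
      arith = solve-∀
      next : ∀ f A B T l → m ℕ.< length A ℕ.+ f ℕ.* D → Unique A → Uniqueᵛ B → length T ≡ b →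
             All (λ i → ¬ D ℕ.≤ back A T i) B → Inv A B T l →
             AtMost (State A B T) (suc (length B) ℕ.^ (f ℕ.+ R ℕ.* b) ℕ.* W)
      next f A B T l room A! B! ∣T∣ sparse inv with ℕₚ.≤-<-connex (length B) N | ℕₚ.≤-<-connex (length A) m
      ... | inj₁ B≤N | _        = leaf A B T (f ℕ.+ R ℕ.* b) B! B≤N
      ... | inj₂ _   | inj₂ m<A = overfull A B T _ A! m<A
      ... | inj₂ N<B | inj₁ A≤m = AtMost-⊆ (λ j (J⊆ , _ , A⊆) → J⊆ , [] , A⊆) ℕₚ.≤-refl
            (rounds R f A B ψ′ room A! B! (ℕₚ.≤-reflexive (≡.sym ψ′+A)) shrunk′)
        where
        open ℕₚ.≤-Reasoning
        d ψ′ : ℕ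
        d = 6 ℕ.* κ
        ψ′ = (length B ℕ.+ m) ℕ.∸ length A
        ψ′+A : ψ′ ℕ.+ length A ≡ length B ℕ.+ m
        ψ′+A = ℕₚ.m∸n+n≡m (ℕₚ.≤-trans A≤m (ℕₚ.m≤n+m m (length B)))
        ψ′+l≤ψ : ψ′ ℕ.+ l ℕ.≤ ψ
        ψ′+l≤ψ = ℕₚ.+-cancelʳ-≤ (length A) _ _ (begin
          ψ′ ℕ.+ l ℕ.+ length A        ≡⟨ swap ψ′ l (length A) ⟩
          ψ′ ℕ.+ length A ℕ.+ l        ≡⟨ ≡.cong (ℕ._+ l) ψ′+A ⟩
          length B ℕ.+ m ℕ.+ l         ≤⟨ Inv.potential inv ⟩
          ψ ℕ.+ length A               ∎)
          where
          swap : ∀ a b c → a ℕ.+ b ℕ.+ c ≡ a ℕ.+ c ℕ.+ b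
          swap = solve-∀
        -- Here the constant 6 arises: `m ≤ 2N < 2|B|` bounds the potential by `3 |B|`, and
        -- `|B| ≤ 2 κ l` at the end of a round.
        ψ′≤dl : ψ′ ℕ.≤ d ℕ.* l
        ψ′≤dl = begin
          ψ′                                   ≤⟨ ℕₚ.m∸n≤m _ (length A) ⟩
          length B ℕ.+ m  ≤⟨ ℕₚ.+-monoʳ-≤ (length B) (ℕₚ.≤-trans m≤2N (ℕₚ.*-monoʳ-≤ 2 (ℕₚ.<⇒≤ N<B))) ⟩
          length B ℕ.+ 2 ℕ.* length B          ≡⟨ ≡.refl ⟩
          3 ℕ.* length B                       ≤⟨ ℕₚ.*-monoʳ-≤ 3 (Inv-end {T = T} ∣T∣ sparse inv) ⟩
          3 ℕ.* (2 ℕ.* κ ℕ.* l)                ≡⟨ six κ l ⟩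
          d ℕ.* l                              ∎
          where
          six : ∀ κ l → 3 ℕ.* (2 ℕ.* κ ℕ.* l) ≡ 6 ℕ.* κ ℕ.* l
          six = solve-∀
        contraction : suc d ℕ.* ψ′ ℕ.≤ d ℕ.* ψ
        contraction = begin
          ψ′ ℕ.+ d ℕ.* ψ′          ≤⟨ ℕₚ.+-monoˡ-≤ (d ℕ.* ψ′) ψ′≤dl ⟩
          d ℕ.* l ℕ.+ d ℕ.* ψ′     ≡⟨ ℕₚ.*-distribˡ-+ d l ψ′ ⟨
          d ℕ.* (l ℕ.+ ψ′)         ≤⟨ ℕₚ.*-monoʳ-≤ d (ℕₚ.≤-trans (ℕₚ.≤-reflexive (ℕₚ.+-comm l ψ′)) ψ′+l≤ψ) ⟩
          d ℕ.* ψ                  ∎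
        shrunk′ : ψ′ ℕ.* d ℕ.^ R ℕ.≤ N ℕ.* suc d ℕ.^ R
        shrunk′ = ℕₚ.*-cancelˡ-≤ (suc d) (begin
          suc d ℕ.* (ψ′ ℕ.* d ℕ.^ R)        ≡⟨ ℕₚ.*-assoc (suc d) ψ′ _ ⟨
          suc d ℕ.* ψ′ ℕ.* d ℕ.^ R          ≤⟨ ℕₚ.*-monoˡ-≤ (d ℕ.^ R) contraction ⟩
          d ℕ.* ψ ℕ.* d ℕ.^ R               ≡⟨ shuffle d ψ (d ℕ.^ R) ⟩
          ψ ℕ.* (d ℕ.* d ℕ.^ R)             ≤⟨ shrunk ⟩
          N ℕ.* (suc d ℕ.* suc d ℕ.^ R)     ≡⟨ shuffle′ N (suc d) (suc d ℕ.^ R) ⟩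
          suc d ℕ.* (N ℕ.* suc d ℕ.^ R)     ∎)
          where
          shuffle : ∀ a b c → a ℕ.* b ℕ.* c ≡ b ℕ.* (a ℕ.* c)
          shuffle = solve-∀
          shuffle′ : ∀ a b c → a ℕ.* (b ℕ.* c) ≡ b ℕ.* (a ℕ.* c)
          shuffle′ = solve-∀

    count : ∀ R f → m ℕ.< f ℕ.* D → (n ℕ.+ m) ℕ.* (6 ℕ.* κ) ℕ.^ R ℕ.≤ N ℕ.* suc (6 ℕ.* κ) ℕ.^ R →
      k ℕ.≤ suc n ℕ.^ (f ℕ.+ R ℕ.* b) ℕ.* (N C s)
    count R f room shrunk = ≡.subst₂ (λ x y → x ℕ.≤ suc y ℕ.^ (f ℕ.+ R ℕ.* b) ℕ.* W)
      (Listₚ.length-tabulate id) (Listₚ.length-tabulate {n = n} id)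
      (rounds R f [] (allFin n) (n ℕ.+ m) room [] (PropUniqueₚ.allFin⁺ n)
        (ℕₚ.≤-reflexive (≡.trans (≡.cong (ℕ._+ m) (Listₚ.length-tabulate {n = n} id)) (≡.sym (ℕₚ.+-identityʳ _)))) shrunk
        (allFin k) (PropUniqueₚ.allFin⁺ k) (All.tabulate λ {j} _ → (λ {v} _ → PropMembershipₚ.∈-allFin v) , [] , []))

-- Bernoulli's inequality `(1 + 1/d)^j ≥ 1 + j/d` at `j = d`, cleared of denominators.
half-bernoulli : ∀ d → d ℕ.> 0 → 2 ℕ.* d ℕ.^ d ℕ.≤ suc d ℕ.^ d
half-bernoulli d 0<d = ℕₚ.*-cancelˡ-≤ d {{ℕ.>-nonZero 0<d}} (begin
  d ℕ.* (2 ℕ.* d ℕ.^ d)      ≡⟨ arith d (d ℕ.^ d) ⟩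
  (d ℕ.+ d) ℕ.* d ℕ.^ d      ≤⟨ go d ⟩
  d ℕ.* suc d ℕ.^ d          ∎)
  where
  open ℕₚ.≤-Reasoning
  arith : ∀ d x → d ℕ.* (2 ℕ.* x) ≡ (d ℕ.+ d) ℕ.* x
  arith = solve-∀
  go : ∀ j → (d ℕ.+ j) ℕ.* d ℕ.^ j ℕ.≤ d ℕ.* suc d ℕ.^ j
  go zero = ℕₚ.≤-reflexive (≡.cong (ℕ._* 1) (ℕₚ.+-identityʳ d))
  go (suc j) = begin
    (d ℕ.+ suc j) ℕ.* (d ℕ.* d ℕ.^ j)                        ≤⟨ ℕₚ.m≤n+m _ (j ℕ.* d ℕ.^ j) ⟩
    j ℕ.* d ℕ.^ j ℕ.+ (d ℕ.+ suc j) ℕ.* (d ℕ.* d ℕ.^ j)      ≡⟨ arith₁ d j (d ℕ.^ j) ⟩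
    suc d ℕ.* ((d ℕ.+ j) ℕ.* d ℕ.^ j)                        ≤⟨ ℕₚ.*-monoʳ-≤ (suc d) (go j) ⟩
    suc d ℕ.* (d ℕ.* suc d ℕ.^ j)                            ≡⟨ arith₂ d (suc d ℕ.^ j) ⟩
    d ℕ.* (suc d ℕ.* suc d ℕ.^ j)                            ∎
    where
    arith₁ : ∀ d j x → j ℕ.* x ℕ.+ (d ℕ.+ suc j) ℕ.* (d ℕ.* x) ≡ suc d ℕ.* ((d ℕ.+ j) ℕ.* x)
    arith₁ = solve-∀
    arith₂ : ∀ d x → suc d ℕ.* (d ℕ.* x) ≡ d ℕ.* (suc d ℕ.* x)
    arith₂ = solve-∀

-- With `d = 6 κ`, every `d` rounds halve the potential, so `d r` rounds divide it by `2^r`.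
half-bernoulli^ : ∀ d r → d ℕ.> 0 → 2 ℕ.^ r ℕ.* d ℕ.^ (d ℕ.* r) ℕ.≤ suc d ℕ.^ (d ℕ.* r)
half-bernoulli^ d zero 0<d rewrite ℕₚ.*-zeroʳ d = ℕₚ.≤-refl
half-bernoulli^ d (suc r) 0<d rewrite ℕₚ.*-suc d r = begin
  2 ℕ.* 2 ℕ.^ r ℕ.* d ℕ.^ (d ℕ.+ d ℕ.* r)  ≡⟨ ≡.cong (2 ℕ.* 2 ℕ.^ r ℕ.*_) (ℕₚ.^-distribˡ-+-* d d (d ℕ.* r)) ⟩
  2 ℕ.* 2 ℕ.^ r ℕ.* (d ℕ.^ d ℕ.* d ℕ.^ (d ℕ.* r))        ≡⟨ arith (2 ℕ.^ r) (d ℕ.^ d) (d ℕ.^ (d ℕ.* r)) ⟩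
  2 ℕ.* d ℕ.^ d ℕ.* (2 ℕ.^ r ℕ.* d ℕ.^ (d ℕ.* r))  ≤⟨ ℕₚ.*-mono-≤ (half-bernoulli d 0<d) (half-bernoulli^ d r 0<d) ⟩
  suc d ℕ.^ d ℕ.* suc d ℕ.^ (d ℕ.* r)                    ≡⟨ ℕₚ.^-distribˡ-+-* (suc d) d (d ℕ.* r) ⟨
  suc d ℕ.^ (d ℕ.+ d ℕ.* r)                              ∎
  where
  open ℕₚ.≤-Reasoning
  arith : ∀ x y z → 2 ℕ.* x ℕ.* (y ℕ.* z) ≡ 2 ℕ.* y ℕ.* (x ℕ.* z)
  arith = solve-∀

-- Supersaturation from Pollard's theorem

module DoublingCount {c ℓ} (G : AbelianGroup c ℓ) (_≟_ : Decidable₂ (AbelianGroup._≈_ G))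
  {n : ℕ} (y : Fin n → AbelianGroup.Carrier G) (y-injective : ∀ {i j} → AbelianGroup._≈_ G (y i) (y j) → i ≡ j)
  (E M β m N D : ℕ)
  (gap : ∀ {H} → Pollard.FiniteSubgroup G _≟_ H → length H ℕ.≤ β ⊎ M ℕ.≤ length H)
  (4≤E : 4 ℕ.≤ E) (0<D : 0 ℕ.< D)
  (N-large : (E ℕ.+ 2) ℕ.* (m ℕ.+ β) ℕ.≤ 2 ℕ.* E ℕ.* N)
  (M-large : (E ℕ.+ 4) ℕ.* m ℕ.≤ E ℕ.* suc M) where

  open Pollard G _≟_ using (SpreadPairs; pollard)
  open SumGraph G _≟_ y y-injective
  open UniqueS (≡.setoid (Fin n)) using () renaming (Unique to Uniqueᵛ)
  open PropMembership using () renaming (_∈_ to _∈ᵛ_)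

  κ b : ℕ
  κ = 4 ℕ.* E ℕ.* E
  b = 2 ℕ.* κ ℕ.* D

  instance
    E≢0 : NonZero E
    E≢0 = ℕ.>-nonZero (ℕₚ.≤-trans (s≤s z≤n) 4≤E)

  4≤κ : 4 ℕ.≤ κ
  4≤κ = ℕₚ.≤-trans (ℕₚ.m≤m*n 4 E) (ℕₚ.m≤m*n (4 ℕ.* E) E)

  0<κ : 0 ℕ.< κ
  0<κ = ℕₚ.≤-trans (s≤s z≤n) 4≤κ

  m≤2N : m ℕ.≤ 2 ℕ.* N
  m≤2N = ℕₚ.*-cancelˡ-≤ E (begin
    E ℕ.* m                        ≤⟨ ℕₚ.*-mono-≤ (ℕₚ.m≤m+n E 2) (ℕₚ.m≤m+n m β) ⟩
    (E ℕ.+ 2) ℕ.* (m ℕ.+ β)        ≤⟨ N-large ⟩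
    2 ℕ.* E ℕ.* N                  ≡⟨ arith E N ⟩
    E ℕ.* (2 ℕ.* N)                ∎)
    where
    open ℕₚ.≤-Reasoning
    arith : ∀ E N → 2 ℕ.* E ℕ.* N ≡ E ℕ.* (2 ℕ.* N)
    arith = solve-∀

  module _ (b-small : κ ℕ.* b ℕ.< N) where

    open ℕₚ.≤-Reasoning

    E≤N : E ℕ.≤ N
    E≤N = begin
      E              ≤⟨ ℕₚ.m≤n*m E (4 ℕ.* E) {{ℕₚ.m*n≢0 4 E}} ⟩
      κ  ≤⟨ ℕₚ.m≤m*n κ b {{ℕₚ.m*n≢0 (2 ℕ.* κ) D {{ℕₚ.m*n≢0 2 κ {{_}} {{ℕ.>-nonZero 0<κ}}}} {{ℕ.>-nonZero 0<D}}}} ⟩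
      κ ℕ.* b        ≤⟨ ℕₚ.<⇒≤ b-small ⟩
      N              ∎

    module _ (u : ℕ) (N<u : N ℕ.< u) (u<2m : u ℕ.< 2 ℕ.* m) where

      t z : ℕ
      t = u ℕ./ E
      z = M ℕ.⊓ ((u ℕ.+ u) ℕ.∸ (t ℕ.+ β))

      tE≤u : t ℕ.* E ℕ.≤ u
      tE≤u = m/n*n≤m u E

      t≤u : t ℕ.≤ u
      t≤u = ℕₚ.≤-trans (ℕₚ.m≤m*n t E) tE≤u

      E≤u : E ℕ.≤ u
      E≤u = ℕₚ.≤-trans E≤N (ℕₚ.<⇒≤ N<u)

      u<[1+t]E : u ℕ.< suc t ℕ.* E
      u<[1+t]E = ≡.subst (ℕ._< suc t ℕ.* E) (≡.sym (m≡m%n+[m/n]*n u E)) (ℕₚ.+-monoˡ-< (t ℕ.* E) (m%n<n u E))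

      0<t : 0 ℕ.< t
      0<t = ℕₚ.n≢0⇒n>0 λ t≡0 → ℕₚ.<⇒≱ (≡.subst (λ x → u ℕ.< suc x ℕ.* E) t≡0 (u<[1+t]E))
        (ℕₚ.≤-trans (ℕₚ.≤-reflexive (ℕₚ.+-identityʳ E)) E≤u)

      u≤2tE : u ℕ.≤ 2 ℕ.* t ℕ.* E
      u≤2tE = ℕₚ.≤-trans (ℕₚ.<⇒≤ (u<[1+t]E)) (ℕₚ.*-monoˡ-≤ E (ℕₚ.≤-trans (ℕₚ.+-monoˡ-≤ t 0<t) (ℕₚ.≤-reflexive (≡.cong (t ℕ.+_) (≡.sym (ℕₚ.+-identityʳ t))))))

      -- Both entries of the minimum exceed `m` by `u / E`. For `M` the surplus `4m / E` covers
      -- `u / E` and the rounding of `M`, as `u` and `E` are at most `2m`. For the other entry the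
      -- factor `1 + 2/E` in `N < u` covers `u / E` and `t ≤ u / E`.
      z-large : E ℕ.* m ℕ.+ u ℕ.≤ E ℕ.* z
      z-large = ≡.subst (E ℕ.* m ℕ.+ u ℕ.≤_) (≡.sym (ℕₚ.*-distribˡ-⊓ E M _)) (ℕₚ.⊓-glb large₁ large₂)
        where
        large₁ : E ℕ.* m ℕ.+ u ℕ.≤ E ℕ.* M
        large₁ = ℕₚ.+-cancelʳ-≤ E _ _ (begin
          E ℕ.* m ℕ.+ u ℕ.+ E                  ≡⟨ ℕₚ.+-assoc (E ℕ.* m) u E ⟩
          E ℕ.* m ℕ.+ (u ℕ.+ E)  ≤⟨ ℕₚ.+-monoʳ-≤ (E ℕ.* m) (ℕₚ.+-mono-≤ (ℕₚ.<⇒≤ u<2m) (ℕₚ.≤-trans E≤u (ℕₚ.<⇒≤ u<2m))) ⟩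
          E ℕ.* m ℕ.+ (2 ℕ.* m ℕ.+ 2 ℕ.* m)    ≡⟨ arith E m ⟩
          (E ℕ.+ 4) ℕ.* m                      ≤⟨ M-large ⟩
          E ℕ.* suc M                          ≡⟨ ≡.trans (ℕₚ.*-suc E M) (ℕₚ.+-comm E _) ⟩
          E ℕ.* M ℕ.+ E                        ∎)
          where
          arith : ∀ E m → E ℕ.* m ℕ.+ (2 ℕ.* m ℕ.+ 2 ℕ.* m) ≡ (E ℕ.+ 4) ℕ.* m
          arith = solve-∀
        core : E ℕ.* (m ℕ.+ β) ℕ.+ 2 ℕ.* u ℕ.≤ E ℕ.* (u ℕ.+ u)
        core = ℕₚ.*-cancelˡ-≤ (E ℕ.+ 2) {{ℕ.>-nonZero (ℕₚ.≤-trans (s≤s z≤n) (ℕₚ.m≤n+m 2 E))}} (begin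
          (E ℕ.+ 2) ℕ.* (E ℕ.* (m ℕ.+ β) ℕ.+ 2 ℕ.* u)                  ≡⟨ arith₁ E (m ℕ.+ β) u ⟩
          E ℕ.* ((E ℕ.+ 2) ℕ.* (m ℕ.+ β)) ℕ.+ 2 ℕ.* u ℕ.* (E ℕ.+ 2)  ≤⟨ ℕₚ.+-mono-≤ (ℕₚ.*-monoʳ-≤ E (ℕₚ.≤-trans N-large (ℕₚ.*-monoʳ-≤ (2 ℕ.* E) (ℕₚ.<⇒≤ N<u))))
                                                                            (ℕₚ.*-monoʳ-≤ (2 ℕ.* u) (ℕₚ.+-monoʳ-≤ E (ℕₚ.≤-trans (s≤s (s≤s z≤n)) 4≤E))) ⟩
          E ℕ.* (2 ℕ.* E ℕ.* u) ℕ.+ 2 ℕ.* u ℕ.* (E ℕ.+ E)              ≡⟨ arith₂ E u ⟩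
          (E ℕ.+ 2) ℕ.* (E ℕ.* (u ℕ.+ u))                              ∎)
          where
          arith₁ : ∀ E x u → (E ℕ.+ 2) ℕ.* (E ℕ.* x ℕ.+ 2 ℕ.* u) ≡ E ℕ.* ((E ℕ.+ 2) ℕ.* x) ℕ.+ 2 ℕ.* u ℕ.* (E ℕ.+ 2)
          arith₁ = solve-∀
          arith₂ : ∀ E u → E ℕ.* (2 ℕ.* E ℕ.* u) ℕ.+ 2 ℕ.* u ℕ.* (E ℕ.+ E) ≡ (E ℕ.+ 2) ℕ.* (E ℕ.* (u ℕ.+ u))
          arith₂ = solve-∀
        large₂ : E ℕ.* m ℕ.+ u ℕ.≤ E ℕ.* ((u ℕ.+ u) ℕ.∸ (t ℕ.+ β))
        large₂ = ≡.subst (E ℕ.* m ℕ.+ u ℕ.≤_) (≡.sym (ℕₚ.*-distribˡ-∸ E (u ℕ.+ u) (t ℕ.+ β))) (ℕₚ.m+n≤o⇒m≤o∸n _ (begin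
          E ℕ.* m ℕ.+ u ℕ.+ E ℕ.* (t ℕ.+ β)       ≡⟨ arith E m u t β ⟩
          E ℕ.* (m ℕ.+ β) ℕ.+ (u ℕ.+ t ℕ.* E)  ≤⟨ ℕₚ.+-monoʳ-≤ (E ℕ.* (m ℕ.+ β)) (ℕₚ.+-monoʳ-≤ u (ℕₚ.≤-trans tE≤u (ℕₚ.m≤m+n u 0))) ⟩
          E ℕ.* (m ℕ.+ β) ℕ.+ 2 ℕ.* u             ≤⟨ core ⟩
          E ℕ.* (u ℕ.+ u)                         ∎))
          where
          arith : ∀ E m u t β → E ℕ.* m ℕ.+ u ℕ.+ E ℕ.* (t ℕ.+ β) ≡ E ℕ.* (m ℕ.+ β) ℕ.+ (u ℕ.+ t ℕ.* E)
          arith = solve-∀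

      -- At least `t (z - m) ≥ t u / E` of Pollard's pairs are edges, and `t ≥ u / (2E)`; hence
      -- `κ = 4 E²`. Of the two copies of `u u`, one serves the average degree in `popular`, the
      -- other makes up for the vertices already in `T`.
      supersaturation : ∀ p a → a ℕ.≤ m → t ℕ.* z ℕ.≤ a ℕ.* t ℕ.+ p → 2 ℕ.* (u ℕ.* u) ℕ.≤ κ ℕ.* p
      supersaturation p a a≤m tz≤ = begin
        2 ℕ.* (u ℕ.* u)                    ≤⟨ ℕₚ.*-monoʳ-≤ 2 (ℕₚ.*-monoˡ-≤ u u≤2tE) ⟩
        2 ℕ.* (2 ℕ.* t ℕ.* E ℕ.* u)        ≡⟨ arith₁ t E u ⟩
        4 ℕ.* E ℕ.* (t ℕ.* u)              ≤⟨ ℕₚ.*-monoʳ-≤ (4 ℕ.* E) tu≤Ep ⟩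
        4 ℕ.* E ℕ.* (E ℕ.* p)              ≡⟨ ℕₚ.*-assoc (4 ℕ.* E) E p ⟨
        κ ℕ.* p                            ∎
        where
        arith₁ : ∀ t E u → 2 ℕ.* (2 ℕ.* t ℕ.* E ℕ.* u) ≡ 4 ℕ.* E ℕ.* (t ℕ.* u)
        arith₁ = solve-∀
        arith₂ : ∀ E m t u → E ℕ.* (m ℕ.* t) ℕ.+ t ℕ.* u ≡ t ℕ.* (E ℕ.* m ℕ.+ u)
        arith₂ = solve-∀
        arith₃ : ∀ t E z → t ℕ.* (E ℕ.* z) ≡ E ℕ.* (t ℕ.* z)
        arith₃ = solve-∀
        tu≤Ep : t ℕ.* u ℕ.≤ E ℕ.* p
        tu≤Ep = ℕₚ.+-cancelˡ-≤ (E ℕ.* (m ℕ.* t)) _ _ (begin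
          E ℕ.* (m ℕ.* t) ℕ.+ t ℕ.* u            ≡⟨ arith₂ E m t u ⟩
          t ℕ.* (E ℕ.* m ℕ.+ u)                  ≤⟨ ℕₚ.*-monoʳ-≤ t z-large ⟩
          t ℕ.* (E ℕ.* z)                        ≡⟨ arith₃ t E z ⟩
          E ℕ.* (t ℕ.* z)  ≤⟨ ℕₚ.*-monoʳ-≤ E (ℕₚ.≤-trans tz≤ (ℕₚ.+-monoˡ-≤ p (ℕₚ.*-monoˡ-≤ t a≤m))) ⟩
          E ℕ.* (m ℕ.* t ℕ.+ p)                  ≡⟨ ℕₚ.*-distribˡ-+ E (m ℕ.* t) p ⟩
          E ℕ.* (m ℕ.* t) ℕ.+ E ℕ.* p            ∎)

    -- If `|B| ≥ 2m`, every `v` has at least `|B| - m ≥ |B| / 2` edges, and any `v` outside `T` will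
    -- do. Below `2m` Pollard's theorem applies.
    pick : ∀ A B T → Uniqueᵛ B → N ℕ.< length B → length A ℕ.≤ m → length T ℕ.< b →
      ∃[ v ] (v ∈ᵛ B × ¬ v ∈ᵛ T × length B ℕ.≤ κ ℕ.* deg A B v)
    pick A B T B! N<B A≤m T<b with ℕₚ.≤-<-connex (2 ℕ.* m) (length B)
    ... | inj₁ 2m≤B = v , v∈ , v∉ , (begin
          length B  ≤⟨ half (length B) (deg A B v) 2m≤B (ℕₚ.≤-trans (deg-trivial A B v B!) (ℕₚ.+-monoˡ-≤ _ A≤m)) ⟩
          2 ℕ.* deg A B v                ≤⟨ ℕₚ.*-monoˡ-≤ (deg A B v) (ℕₚ.≤-trans (s≤s (s≤s z≤n)) 4≤κ) ⟩
          κ ℕ.* deg A B v                ∎)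
      where
      half : ∀ B d → 2 ℕ.* m ℕ.≤ B → B ℕ.≤ m ℕ.+ d → B ℕ.≤ 2 ℕ.* d
      half B d 2m≤B B≤ = ℕₚ.+-cancelˡ-≤ (2 ℕ.* m) _ _ (begin
        2 ℕ.* m ℕ.+ B            ≤⟨ ℕₚ.+-monoˡ-≤ B 2m≤B ⟩
        B ℕ.+ B                  ≤⟨ ℕₚ.+-mono-≤ B≤ B≤ ⟩
        m ℕ.+ d ℕ.+ (m ℕ.+ d)    ≡⟨ arith m d ⟩
        2 ℕ.* m ℕ.+ 2 ℕ.* d      ∎)
        where
        arith : ∀ m d → m ℕ.+ d ℕ.+ (m ℕ.+ d) ≡ 2 ℕ.* m ℕ.+ 2 ℕ.* d
        arith = solve-∀
      T<B : length T ℕ.< length B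
      T<B = ℕₚ.<-trans T<b (ℕₚ.≤-<-trans (ℕₚ.m≤n*m b κ {{ℕ.>-nonZero 0<κ}}) (ℕₚ.<-trans b-small N<B))
      fresh : ∃[ v ] (v ∈ᵛ B × ¬ v ∈ᵛ T)
      fresh with All.all? (λ v → Any.any? (v Finₚ.≟_) T) B
      ... | yes B⊆T = contradiction (SetoidLists.pigeonhole (≡.setoid (Fin n)) B! (All.lookup B⊆T)) (ℕₚ.<⇒≱ T<B)
      ... | no ¬B⊆T = PropMembership.find (Allₚ.¬All⇒Any¬ (λ v → Any.any? (v Finₚ.≟_) T) B ¬B⊆T)
      v = proj₁ fresh
      v∈ = proj₁ (proj₂ fresh)
      v∉ = proj₂ (proj₂ fresh)
    ... | inj₂ B<2m = popular A B B! κ T (begin-strict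
          u ℕ.* u ℕ.+ κ ℕ.* (length T ℕ.* u)     ≡⟨ ≡.cong (u ℕ.* u ℕ.+_) (ℕₚ.*-assoc κ (length T) u) ⟨
          u ℕ.* u ℕ.+ κ ℕ.* length T ℕ.* u  <⟨ ℕₚ.+-monoʳ-< (u ℕ.* u) (ℕₚ.*-monoˡ-< u {{ℕ.>-nonZero (ℕₚ.≤-<-trans z≤n N<B)}}
                                                      (ℕₚ.≤-<-trans (ℕₚ.*-monoʳ-≤ κ (ℕₚ.<⇒≤ T<b)) (ℕₚ.<-trans b-small N<B))) ⟩
          u ℕ.* u ℕ.+ u ℕ.* u                    ≡⟨ ≡.cong (u ℕ.* u ℕ.+_) (ℕₚ.+-identityʳ (u ℕ.* u)) ⟨
          2 ℕ.* (u ℕ.* u)                        ≤⟨ supersaturation u N<B B<2m (edges A B B) (length A) A≤m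
                                                      (spread⇒edges A B B! (≡.subst (λ l → SpreadPairs (U A B B!) (U A B B!) t′ (t′ ℕ.* (M ℕ.⊓ ((l ℕ.+ l) ℕ.∸ (t′ ℕ.+ β))))) ∣U∣
                                                        (pollard M β gap (length (U A B B!)) (U A B B!) (U A B B!) t′ ℕₚ.≤-refl (U! A B B!) (U! A B B!) t≤ t≤))) ⟩
          κ ℕ.* edges A B B                      ∎)
      where
      u = length B
      t′ = t u N<B B<2m
      ∣U∣ : length (U A B B!) ≡ u
      ∣U∣ = Listₚ.length-map y B
      t≤ : t′ ℕ.≤ length (U A B B!)
      t≤ = ℕₚ.≤-trans (t≤u u N<B B<2m) (ℕₚ.≤-reflexive (≡.sym ∣U∣))

    module _ {k : ℕ} (J : Fin k → List (Fin n)) (s : ℕ) where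

      open Counting J using (_⊆_)
      open Containers G _≟_ y y-injective J using (SumOf; module Algorithm)

      doubling-count :
        (∀ j → Uniqueᵛ (J j)) → (∀ i j → J i ⊆ J j → J j ⊆ J i → i ≡ j) → (∀ j → length (J j) ≡ s) →
        (∀ j A → UniqueS.Unique (AbelianGroup.setoid G) A → All (SumOf j) A → length A ℕ.≤ m) →
        ∀ r f → n ℕ.+ 2 ℕ.≤ 2 ℕ.^ r → m ℕ.< f ℕ.* D →
        k ℕ.≤ suc n ℕ.^ (f ℕ.+ 6 ℕ.* κ ℕ.* r ℕ.* b) ℕ.* (N C s)
      doubling-count J! ext ∣J∣ small r f n≤2^r room =
        Algorithm.count s m N κ D J! ext ∣J∣ small 0<κ 0<D m≤2N pick (6 ℕ.* κ ℕ.* r) f room (begin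
          (n ℕ.+ m) ℕ.* d ℕ.^ (d ℕ.* r)           ≤⟨ ℕₚ.*-monoˡ-≤ (d ℕ.^ (d ℕ.* r)) n+m≤ ⟩
          N ℕ.* 2 ℕ.^ r ℕ.* d ℕ.^ (d ℕ.* r)       ≡⟨ ℕₚ.*-assoc N (2 ℕ.^ r) _ ⟩
          N ℕ.* (2 ℕ.^ r ℕ.* d ℕ.^ (d ℕ.* r))  ≤⟨ ℕₚ.*-monoʳ-≤ N (half-bernoulli^ d r (ℕₚ.≤-trans 0<κ (ℕₚ.m≤n*m κ 6))) ⟩
          N ℕ.* suc d ℕ.^ (d ℕ.* r)               ∎)
        where
        d = 6 ℕ.* κ
        -- The initial potential is at most `N (n + 2)`, so `r` halvings with `n + 2 ≤ 2^r` bring it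
        -- down to `N`.
        n+m≤ : n ℕ.+ m ℕ.≤ N ℕ.* 2 ℕ.^ r
        n+m≤ = begin
          n ℕ.+ m  ≤⟨ ℕₚ.+-mono-≤ (ℕₚ.m≤n*m n N {{ℕ.>-nonZero (ℕₚ.≤-<-trans z≤n b-small)}}) (ℕₚ.≤-trans m≤2N (ℕₚ.≤-reflexive (ℕₚ.*-comm 2 N))) ⟩
          N ℕ.* n ℕ.+ N ℕ.* 2      ≡⟨ ℕₚ.*-distribˡ-+ N n 2 ⟨
          N ℕ.* (n ℕ.+ 2)          ≤⟨ ℕₚ.*-monoʳ-≤ N n≤2^r ⟩
          N ℕ.* 2 ℕ.^ r            ∎

-- Decidability of equality in finitely generated abelian groups

-- In the absence of a least `d`, well-founded induction refutes every `P d`.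
¬¬-least : ∀ {p} (P : ℕ → Set p) → ¬ ¬ ((∀ d → ¬ P d) ⊎ ∃[ d ] (P d × (∀ {e} → e ℕ.< d → ¬ P e)))
¬¬-least P k = k (inj₁ (<-rec (λ d → ¬ P d) λ d smaller Pd → k (inj₂ (d , Pd , λ e<d → smaller e<d))))

module GeneratedSubgroup {c ℓ} (G : AbelianGroup c ℓ) where

  open AbelianGroup G renaming (Carrier to 𝔾)
  open AbelianGroupProperties G
  open CommutativeSemigroupProperties commutativeSemigroup using (interchange; x∙yz≈y∙xz)
  open MonoidMult monoid using (×-homo-+; ×-cong; ×-congʳ; ×-assocˡ; ×-homo-1) renaming (_×_ to _·_)
  open SetoidReasoning setoid

  -- In `step`, `x = h + (p - q) g`: the integer coefficient is a difference of naturals.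
  data Generated : List 𝔾 → 𝔾 → Set (c ⊔ ℓ) where
    base : ∀ {x} → x ≈ ε → Generated [] x
    step : ∀ {g gs x h} p q → Generated gs h → x ∙ q · g ≈ h ∙ p · g → Generated (g ∷ gs) x

  Generated-resp : ∀ {gs x y} → x ≈ y → Generated gs x → Generated gs y
  Generated-resp x≈y (base e)       = base (trans (sym x≈y) e)
  Generated-resp x≈y (step p q H e) = step p q H (trans (∙-congʳ (sym x≈y)) e)

  Generated-ε : ∀ gs → Generated gs ε
  Generated-ε []       = base refl
  Generated-ε (g ∷ gs) = step 0 0 (Generated-ε gs) refl

  Generated-∙ : ∀ {gs x y} → Generated gs x → Generated gs y → Generated gs (x ∙ y)
  Generated-∙ (base e) (base f) = base (trans (∙-cong e f) (identityˡ ε))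
  Generated-∙ {g ∷ _} {x} {y} (step {h = h} p q H e) (step {h = h′} p′ q′ H′ e′) = step (p ℕ.+ p′) (q ℕ.+ q′) (Generated-∙ H H′) (begin
    (x ∙ y) ∙ (q ℕ.+ q′) · g          ≈⟨ ∙-congˡ (×-homo-+ g q q′) ⟩
    (x ∙ y) ∙ (q · g ∙ q′ · g)        ≈⟨ interchange x y _ _ ⟩
    (x ∙ q · g) ∙ (y ∙ q′ · g)        ≈⟨ ∙-cong e e′ ⟩
    (h ∙ p · g) ∙ (h′ ∙ p′ · g)       ≈⟨ interchange h _ h′ _ ⟩
    (h ∙ h′) ∙ (p · g ∙ p′ · g)       ≈⟨ ∙-congˡ (×-homo-+ g p p′) ⟨
    (h ∙ h′) ∙ (p ℕ.+ p′) · g         ∎)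

  Generated-⁻¹ : ∀ {gs x} → Generated gs x → Generated gs (x ⁻¹)
  Generated-⁻¹ (base e) = base (trans (⁻¹-cong e) ε⁻¹≈ε)
  Generated-⁻¹ {g ∷ _} {x} (step {h = h} p q H e) = step q p (Generated-⁻¹ H) (begin
    x ⁻¹ ∙ p · g                     ≈⟨ ∙-congˡ (\\-leftDividesʳ h (p · g)) ⟨
    x ⁻¹ ∙ (h ⁻¹ ∙ (h ∙ p · g))      ≈⟨ ∙-congˡ (∙-congˡ e) ⟨
    x ⁻¹ ∙ (h ⁻¹ ∙ (x ∙ q · g))      ≈⟨ x∙yz≈y∙xz (x ⁻¹) (h ⁻¹) _ ⟩
    h ⁻¹ ∙ (x ⁻¹ ∙ (x ∙ q · g))      ≈⟨ ∙-congˡ (\\-leftDividesʳ x (q · g)) ⟩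
    h ⁻¹ ∙ q · g                     ∎)

  Generated-· : ∀ {gs x} a → Generated gs x → Generated gs (a · x)
  Generated-· {gs} zero H    = Generated-ε gs
  Generated-·      (suc a) H = Generated-∙ H (Generated-· a H)

  Generated-there : ∀ {g gs x} → Generated gs x → Generated (g ∷ gs) x
  Generated-there H = step 0 0 H refl

  Generated-here : ∀ g gs → Generated (g ∷ gs) g
  Generated-here g gs = step 1 0 (Generated-ε gs) (trans (identityʳ g) (sym (trans (identityˡ _) (×-homo-1 g))))

  DecidableOn : List 𝔾 → Set _
  DecidableOn gs = ∀ x → Generated gs x → Dec (x ≈ ε)

  ≈-dec : ∀ {gs} → DecidableOn gs → ∀ {x y} → Generated gs x → Generated gs y → Dec (x ≈ y)
  ≈-dec dec {x} {y} X Y = map′ (x∙y⁻¹≈ε⇒x≈y x y) x≈y⇒x∙y⁻¹≈ε (dec (x ∙ y ⁻¹) (Generated-∙ X (Generated-⁻¹ Y)))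

  module _ {gs : List 𝔾} (dec : DecidableOn gs) (g : 𝔾) where

    -- `suc o` is the order of `g` modulo the subgroup generated by `gs`, if finite. Reduce `d`
    -- modulo it: remainder 0 leaves a comparison inside the subgroup, and any other remainder would
    -- contradict minimality. For infinite order no positive multiple of `g` can equal `h`.
    multiple-dec : ((∀ d → ¬ Generated gs (suc d · g)) ⊎ ∃[ d ] (Generated gs (suc d · g) × (∀ {e} → e ℕ.< d → ¬ Generated gs (suc e · g)))) →
                   ∀ d {h} → Generated gs h → Dec (d · g ≈ h)
    multiple-dec _ zero H = ≈-dec dec (Generated-ε gs) H
    multiple-dec (inj₁ none) (suc d) H = no λ e → none d (Generated-resp (sym e) H)
    multiple-dec (inj₂ (o , O , least)) d@(suc _) {h} H = go (d ℕ.% suc o) ≡.refl (m%n<n d (suc o))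
      where
      a = d ℕ./ suc o
      aO : Generated gs (a · (suc o · g))
      aO = Generated-· a O
      split : ∀ r → d ℕ.% suc o ≡ r → d · g ≈ r · g ∙ a · (suc o · g)
      split r eq = begin
        d · g  ≡⟨ ≡.cong (_· g) (≡.trans (m≡m%n+[m/n]*n d (suc o)) (≡.cong (ℕ._+ a ℕ.* suc o) eq)) ⟩
        (r ℕ.+ a ℕ.* suc o) · g             ≈⟨ ×-homo-+ g r (a ℕ.* suc o) ⟩
        r · g ∙ (a ℕ.* suc o) · g           ≈⟨ ∙-congˡ (×-assocˡ g a (suc o)) ⟨
        r · g ∙ a · (suc o · g)             ∎
      go : ∀ r → d ℕ.% suc o ≡ r → r ℕ.< suc o → Dec (d · g ≈ h)
      go zero eq _ = map′ (trans (trans (split 0 eq) (identityˡ _))) (trans (sym (trans (split 0 eq) (identityˡ _)))) (≈-dec dec aO H)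
      go (suc r) eq (s≤s r<o) = no λ e → least r<o (Generated-resp
        (trans (∙-congʳ (trans (sym e) (split (suc r) eq))) (//-rightDividesʳ _ _)) (Generated-∙ H (Generated-⁻¹ aO)))

  ¬¬-decidable : ∀ gs → ¬ ¬ DecidableOn gs
  ¬¬-decidable [] k = k λ where x (base e) → yes e
  ¬¬-decidable (g ∷ gs) k = ¬¬-decidable gs λ dec → ¬¬-least (λ d → Generated gs (suc d · g)) λ order → k (decide dec order)
    where
    decide : DecidableOn gs → _ → DecidableOn (g ∷ gs)
    -- From `x + q g = h + p g`, `x` vanishes exactly when `(q - p) g = h`; the sign of `q - p`
    -- decides whether `h` or its inverse is compared.
    decide dec order x (step {h = h} p q H e) with ℕₚ.≤-total p q
    ... | inj₁ p≤q = map′ to from (multiple-dec dec g order (q ℕ.∸ p) H)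
      where
      d = q ℕ.∸ p
      q·g : q · g ≈ d · g ∙ p · g
      q·g = trans (×-cong (≡.sym (ℕₚ.m∸n+n≡m p≤q)) refl) (×-homo-+ g d p)
      to : d · g ≈ h → x ≈ ε
      to e′ = identityˡ-unique x (q · g) (trans e (trans (∙-congʳ (sym e′)) (sym q·g)))
      from : x ≈ ε → d · g ≈ h
      from x≈ε = ∙-cancelʳ (p · g) _ _ (begin
        d · g ∙ p · g   ≈⟨ q·g ⟨
        q · g           ≈⟨ identityˡ _ ⟨
        ε ∙ q · g       ≈⟨ ∙-congʳ x≈ε ⟨
        x ∙ q · g       ≈⟨ e ⟩
        h ∙ p · g       ∎)
    ... | inj₂ q≤p = map′ to from (multiple-dec dec g order (p ℕ.∸ q) (Generated-⁻¹ H))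
      where
      d = p ℕ.∸ q
      x≈ : x ≈ h ∙ d · g
      x≈ = ∙-cancelʳ (q · g) _ _ (begin
        x ∙ q · g               ≈⟨ e ⟩
        h ∙ p · g               ≈⟨ ∙-congˡ (trans (×-cong (≡.sym (ℕₚ.m∸n+n≡m q≤p)) refl) (×-homo-+ g d q)) ⟩
        h ∙ (d · g ∙ q · g)     ≈⟨ assoc h _ _ ⟨
        (h ∙ d · g) ∙ q · g     ∎)
      to : d · g ≈ h ⁻¹ → x ≈ ε
      to e′ = trans x≈ (trans (∙-congˡ e′) (inverseʳ h))
      from : x ≈ ε → d · g ≈ h ⁻¹
      from x≈ε = inverseʳ-unique h (d · g) (trans (sym x≈) x≈ε)

-- The group of words in the elements of `Y`

module Words {c ℓ} (G : AbelianGroup c ℓ) {n : ℕ} (y : Fin n → AbelianGroup.Carrier G) where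

  open AbelianGroup G
  open GeneratedSubgroup G

  data Word : Set where
    gen   : Fin n → Word
    unit  : Word
    _⊗_   : Word → Word → Word
    inv   : Word → Word

  eval : Word → Carrier
  eval (gen i) = y i
  eval unit    = ε
  eval (w ⊗ v) = eval w ∙ eval v
  eval (inv w) = eval w ⁻¹

  -- A copy of the subgroup generated by `y`, with words compared by value. All its elements are
  -- generated, so the decision procedure covers the whole carrier, whereas equality on `G` itself
  -- may stay undecided.
  wordGroup : AbelianGroup 0ℓ ℓ
  wordGroup = record
    { Carrier = Word
    ; _≈_ = λ w v → eval w ≈ eval v
    ; _∙_ = _⊗_
    ; ε = unit
    ; _⁻¹ = inv
    ; isAbelianGroup = record
      { isGroup = record
        { isMonoid = record
          { isSemigroup = record
            { isMagma = record
              { isEquivalence = record { refl = refl ; sym = sym ; trans = trans }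
              ; ∙-cong = ∙-cong }
            ; assoc = λ u v w → assoc (eval u) (eval v) (eval w) }
          ; identity = (λ w → identityˡ (eval w)) , (λ w → identityʳ (eval w)) }
        ; inverse = (λ w → inverseˡ (eval w)) , (λ w → inverseʳ (eval w))
        ; ⁻¹-cong = ⁻¹-cong }
      ; comm = λ v w → comm (eval v) (eval w) } }

  Generated-y : ∀ i gs → Any (y i ≡_) gs → Generated gs (y i)
  Generated-y i (_ ∷ gs) (here ≡.refl) = Generated-here (y i) gs
  Generated-y i (_ ∷ gs) (there i∈)    = Generated-there (Generated-y i gs i∈)

  Generated-eval : ∀ w → Generated (tabulate y) (eval w)
  Generated-eval (gen i) = Generated-y i (tabulate y) (PropMembershipₚ.∈-tabulate⁺ i)
  Generated-eval unit    = Generated-ε _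
  Generated-eval (w ⊗ v) = Generated-∙ (Generated-eval w) (Generated-eval v)
  Generated-eval (inv w) = Generated-⁻¹ (Generated-eval w)

  ¬¬-word-dec : ¬ ¬ Decidable₂ (AbelianGroup._≈_ wordGroup)
  ¬¬-word-dec k = ¬¬-decidable (tabulate y) λ dec → k λ w v → ≈-dec dec (Generated-eval w) (Generated-eval v)

lookup-injective : ∀ {a ℓ} (S : Setoid a ℓ) {xs} → UniqueS.Unique S xs →
  ∀ i j → Setoid._≈_ S (lookup xs i) (lookup xs j) → i ≡ j
lookup-injective S {_ ∷ _}  (x∉ ∷ xs!) Fin.zero    Fin.zero    e = ≡.refl
lookup-injective S {_ ∷ xs} (x∉ ∷ xs!) Fin.zero  (Fin.suc j) e = contradiction e (All.lookup x∉ (PropMembershipₚ.∈-lookup j))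
lookup-injective S {_ ∷ xs} (x∉ ∷ xs!) (Fin.suc i) Fin.zero  e = contradiction (Setoid.sym S e) (All.lookup x∉ (PropMembershipₚ.∈-lookup i))
lookup-injective S {_ ∷ _}  (x∉ ∷ xs!) (Fin.suc i) (Fin.suc j) e = ≡.cong Fin.suc (lookup-injective S xs! i j e)

-- From words back to subsets of the group

module Transfer {c ℓ} (G : AbelianGroup c ℓ) where

  open AbelianGroup G
  open D.Sets G

  module _ {n : ℕ} (y : Fin n → Carrier) (_≟_ : Decidable₂ (AbelianGroup._≈_ (Words.wordGroup G y))) where

    open Words G y
    open Pollard wordGroup _≟_ using (FiniteSubgroup)

    -- The maximality of `β` speaks of subgroups of `G`, while Pollard's theorem is applied to
    -- words; evaluation carries the stabilisers met there to subgroups of `G` of the same order.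
    subgroupOrder : ∀ {H} → FiniteSubgroup H → SubgroupOrder (length H)
    subgroupOrder {H} sub =
        (λ x → ∃[ i ] (x ≈ eval (lookup H i)))
      , record
        { ∈-resp-≈  = λ x≈y (i , e) → i , trans (sym x≈y) e
        ; ε-closed  = index unit ε-closed
        ; ∙-closed  = λ (i , e) (j , f) → let k , g = index (lookup H i ⊗ lookup H j) (∙-closed {lookup H i} {lookup H j} (∈-lookup i) (∈-lookup j)) in k , trans (∙-cong e f) g
        ; ⁻¹-closed = λ (i , e) → let k , g = index (inv (lookup H i)) (⁻¹-closed {lookup H i} (∈-lookup i)) in k , trans (⁻¹-cong e) g
        }
      , (λ i → eval (lookup H i))
      , lookup-injective (AbelianGroup.setoid wordGroup) unique
      , λ x → mk⇔ id id
      where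
      open FiniteSubgroup sub
      ∈-lookup : ∀ i → Any (λ v → eval (lookup H i) ≈ eval v) H
      ∈-lookup = Membershipₚ.∈-lookup (AbelianGroup.setoid wordGroup) H
      index : ∀ w → Any (λ v → eval w ≈ eval v) H → ∃[ i ] (eval w ≈ eval (lookup H i))
      index w w∈ = Any.index w∈ , Anyₚ.lookup-index w∈

  module _ (E M β m N D : ℕ) (gap : ∀ o → SubgroupOrder o → o ℕ.≤ β ⊎ M ℕ.≤ o)
    (4≤E : 4 ℕ.≤ E) (0<D : 0 ℕ.< D)
    (N-large : (E ℕ.+ 2) ℕ.* (m ℕ.+ β) ℕ.≤ 2 ℕ.* E ℕ.* N)
    (M-large : (E ℕ.+ 4) ℕ.* m ℕ.≤ E ℕ.* suc M)
    {s n : ℕ} (Y : Subset) (cardY : HasCard Y n)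
    {k : ℕ} (A : Fin k → Subset) (A⊆Y : ∀ j → A j ⊆ᵖ Y) (cardA : ∀ j → HasCard (A j) s)
    (distinct : ∀ i j → A i ≐ A j → i ≡ j) where

    private
      y : Fin n → Carrier
      y = proj₁ cardY

      element : ∀ j → Fin s → Carrier
      element j = proj₁ (cardA j)

      element∈ : ∀ j i → A j (element j i)
      element∈ j i = Equivalence.from (proj₂ (proj₂ (cardA j)) (element j i)) (i , refl)

      position : ∀ j i → ∃[ v ] (element j i ≈ y v)
      position j i = Equivalence.to (proj₂ (proj₂ cardY) (element j i)) (A⊆Y j (element∈ j i))

      J : Fin k → List (Fin n)
      J j = tabulate (λ i → proj₁ (position j i))

      ∈J⁻ : ∀ {j v} → Any (v ≡_) (J j) → ∃[ i ] (element j i ≈ y v)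
      ∈J⁻ {j} v∈ with i , ≡.refl ← PropMembershipₚ.∈-tabulate⁻ v∈ = i , proj₂ (position j i)

    J! : ∀ j → UniqueS.Unique (≡.setoid (Fin n)) (J j)
    J! j = PropUniqueₚ.tabulate⁺ λ {a} {b} e → proj₁ (proj₂ (cardA j)) a b
      (trans (proj₂ (position j a)) (trans (reflexive (≡.cong y e)) (sym (proj₂ (position j b)))))

    ext : ∀ i j → Counting._⊆_ J (J i) (J j) → Counting._⊆_ J (J j) (J i) → i ≡ j
    ext i j i⊆j j⊆i = distinct i j (half i j i⊆j , half j i j⊆i)
      where
      half : ∀ i j → Counting._⊆_ J (J i) (J j) → A i ⊆ᵖ A j
      half i j i⊆j {x} x∈ =
        let a , x≈ = Equivalence.to (proj₂ (proj₂ (cardA i)) x) x∈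
            b , b≈ = ∈J⁻ {j} (i⊆j (PropMembershipₚ.∈-tabulate⁺ {f = λ a → proj₁ (position i a)} a))
        in Equivalence.from (proj₂ (proj₂ (cardA j)) x) (b , trans x≈ (trans (proj₂ (position i a)) (sym b≈)))

    doubling-count :
      (∀ j → ∃[ o ] (HasCard (A j ⊞ A j) o × o ℕ.≤ m)) →
      4 ℕ.* E ℕ.* E ℕ.* (2 ℕ.* (4 ℕ.* E ℕ.* E) ℕ.* D) ℕ.< N →
      ∀ r f → n ℕ.+ 2 ℕ.≤ 2 ℕ.^ r → m ℕ.< f ℕ.* D →
      k ℕ.≤ suc n ℕ.^ (f ℕ.+ 6 ℕ.* (4 ℕ.* E ℕ.* E) ℕ.* r ℕ.* (2 ℕ.* (4 ℕ.* E ℕ.* E) ℕ.* D)) ℕ.* (N C s)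
    -- The goal is an inequality of naturals, hence stable, so equality of words may be assumed
    -- decidable.
    doubling-count sums b-small r f n≤2^r room = decidable-stable (_ ℕₚ.≤? _) λ fail → ¬¬-word-dec λ _≟_ → fail
      (DoublingCount.doubling-count wordGroup _≟_ gen (λ {i} {j} → proj₁ (proj₂ cardY) i j)
        E M β m N D (λ sub → gap _ (subgroupOrder y _≟_ sub)) 4≤E 0<D N-large M-large b-small J s
        J! ext (λ j → Listₚ.length-tabulate _) (small _≟_) r f n≤2^r room)
      where
      open Words G y
      small : ∀ _≟_ j X → UniqueS.Unique (AbelianGroup.setoid wordGroup) X →
              All (Containers.SumOf wordGroup _≟_ gen (λ {i} {j} → proj₁ (proj₂ cardY) i j) J j) X → length X ℕ.≤ m
      small _≟_ j X X! sumsOf = ℕₚ.≤-trans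
        (≡.subst₂ ℕ._≤_ (Listₚ.length-map eval X) (Listₚ.length-tabulate z)
          (SetoidLists.pigeonhole setoid (Uniqueₚ.map⁺ (AbelianGroup.setoid wordGroup) setoid id X!) λ x∈ →
            let w , w∈ , x≈ = Membershipₚ.∈-map⁻ (AbelianGroup.setoid wordGroup) setoid x∈
                u , v , u∈ , v∈ , w≈ = All.lookupₛ (AbelianGroup.setoid wordGroup)
                  (λ {w₁} {w₂} e (u , v , u∈ , v∈ , h) → u , v , u∈ , v∈ , trans (sym e) h) sumsOf {w} w∈
                a , a≈ = ∈J⁻ {j} u∈
                b , b≈ = ∈J⁻ {j} v∈
                i , e = Equivalence.to (onto _) (element j a , element j b , element∈ j a , element∈ j b ,
                          trans x≈ (trans w≈ (sym (∙-cong a≈ b≈))))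
            in Membershipₚ.∈-resp-≈ setoid (sym e) (Membershipₚ.∈-tabulate⁺ setoid i)))
        o≤m
        where
        o = proj₁ (sums j)
        z = proj₁ (proj₁ (proj₂ (sums j)))
        onto = proj₂ (proj₂ (proj₁ (proj₂ (sums j))))
        o≤m = proj₂ (proj₂ (sums j))

-- Order and exponential on Cauchy reals

module CauchyReals where

  open D
  open D.CauchyLemmas
  open ℚ-Solver using (solve; _:=_; _:+_; _:*_; _:-_; :-_; con)

  ½+½ : ∀ ε → ½ ℚ.* ε ℚ.+ ½ ℚ.* ε ≡ ε
  ½+½ = solve 1 (λ e → con ½ :* e :+ con ½ :* e := e) ≡.refl

  0<½* : ∀ {ε} → 0ℚ ℚ.< ε → 0ℚ ℚ.< ½ ℚ.* ε
  0<½* = 0<* (ℚₚ.positive⁻¹ ½)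

  ∣-∣≤⇒≤+ : ∀ {p q r} → ∣ p ℚ.- q ∣ ℚ.≤ r → p ℚ.≤ q ℚ.+ r
  ∣-∣≤⇒≤+ {p} {q} {r} h = begin
    p                     ≡⟨ solve 2 (λ p q → p := q :+ (p :- q)) ≡.refl p q ⟩
    q ℚ.+ (p ℚ.- q)       ≤⟨ ℚₚ.+-monoʳ-≤ q (ℚₚ.≤-trans (p≤∣p∣ (p ℚ.- q)) h) ⟩
    q ℚ.+ r               ∎
    where open ℚₚ.≤-Reasoning

  0≤-⇒≤ : ∀ {p q} → 0ℚ ℚ.≤ q ℚ.- p → p ℚ.≤ q
  0≤-⇒≤ {p} {q} h = ≡.subst₂ ℚ._≤_ (ℚₚ.+-identityˡ p) (solve 2 (λ p q → (q :- p) :+ p := q) ≡.refl p q) (ℚₚ.+-monoˡ-≤ p h)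

  ≤⇒0≤- : ∀ {p q} → p ℚ.≤ q → 0ℚ ℚ.≤ q ℚ.- p
  ≤⇒0≤- {p} {q} h = ≡.subst (ℚ._≤ q ℚ.- p) (ℚₚ.+-inverseʳ p) (ℚₚ.+-monoˡ-≤ (ℚ.- p) h)

  p+q≤p⇒q≤0 : ∀ {p q} → p ℚ.+ q ℚ.≤ p → q ℚ.≤ 0ℚ
  p+q≤p⇒q≤0 {p} {q} h = ≡.subst₂ ℚ._≤_ (solve 2 (λ p q → :- p :+ (p :+ q) := q) ≡.refl p q) (ℚₚ.+-inverseˡ p) (ℚₚ.+-monoʳ-≤ (ℚ.- p) h)

  0<⊓ : ∀ {p q} → 0ℚ ℚ.< p → 0ℚ ℚ.< q → 0ℚ ℚ.< p ℚ.⊓ q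
  0<⊓ {p} {q} 0<p 0<q = go (ℚₚ.⊓-sel p q)
    where
    go : p ℚ.⊓ q ≡ p ⊎ p ℚ.⊓ q ≡ q → 0ℚ ℚ.< p ℚ.⊓ q
    go (inj₁ e) = ≡.subst (0ℚ ℚ.<_) (≡.sym e) 0<p
    go (inj₂ e) = ≡.subst (0ℚ ℚ.<_) (≡.sym e) 0<q

  infix 4 _≲_

  -- The constructive content of the negative order relation on ℝ.
  _≲_ : ℝ → ℝ → Set
  x ≲ y = ∀ ε → 0ℚ ℚ.< ε → ∃[ N ] (∀ k → N ℕ.≤ k → seq x k ℚ.≤ seq y k ℚ.+ ε)

  ≲⇒≤ : ∀ {x y} → x ≲ y → x ≤ y
  ≲⇒≤ {x} {y} h (ε , 0<ε , N , f) with h (½ ℚ.* ε) (0<½* 0<ε)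
  ... | M , g = ℚₚ.<-irrefl ≡.refl (ℚₚ.<-≤-trans (0<½* 0<ε) (p+q≤p⇒q≤0 (begin
      (seq y k ℚ.+ ½ ℚ.* ε) ℚ.+ ½ ℚ.* ε      ≡⟨ ℚₚ.+-assoc (seq y k) _ _ ⟩
      seq y k ℚ.+ (½ ℚ.* ε ℚ.+ ½ ℚ.* ε)      ≡⟨ ≡.cong (seq y k ℚ.+_) (½+½ ε) ⟩
      seq y k ℚ.+ ε                          ≤⟨ f k (ℕₚ.m≤m⊔n N M) ⟩
      seq x k                                ≤⟨ g k (ℕₚ.m≤n⊔m N M) ⟩
      seq y k ℚ.+ ½ ℚ.* ε                    ∎)))
    where
    open ℚₚ.≤-Reasoning
    k = N ℕ.⊔ M

  -- Rationals can be compared at the index `N`. If the term of `x` exceeded that of `y` by more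
  -- than `2 δ`, then `y < x`, as both sequences move by at most `δ` afterwards. Otherwise the four
  -- errors `δ` add up to `ε`.
  ≤⇒≲ : ∀ {x y} → x ≤ y → x ≲ y
  ≤⇒≲ {x} {y} x≤y ε 0<ε = N , bound
    where
    open ℚₚ.≤-Reasoning
    δ = ½ ℚ.* (½ ℚ.* ε)
    0<δ : 0ℚ ℚ.< δ
    0<δ = 0<½* (0<½* 0<ε)
    X = cauchy x δ 0<δ
    Y = cauchy y δ 0<δ
    N = proj₁ X ℕ.⊔ proj₁ Y
    near-x : ∀ {k l} → N ℕ.≤ k → N ℕ.≤ l → seq x k ℚ.≤ seq x l ℚ.+ δ
    near-x hk hl = ∣-∣≤⇒≤+ (proj₂ X _ _ (ℕₚ.m⊔n≤o⇒m≤o _ _ hk) (ℕₚ.m⊔n≤o⇒m≤o _ _ hl))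
    near-y : ∀ {k l} → N ℕ.≤ k → N ℕ.≤ l → seq y k ℚ.≤ seq y l ℚ.+ δ
    near-y hk hl = ∣-∣≤⇒≤+ (proj₂ Y _ _ (ℕₚ.m⊔n≤o⇒n≤o (proj₁ X) _ hk) (ℕₚ.m⊔n≤o⇒n≤o (proj₁ X) _ hl))
    sep : seq y N ℚ.+ (δ ℚ.+ δ) ℚ.< seq x N → y < x
    sep lt = gap , ≡.subst (ℚ._< gap) (ℚₚ.+-inverseʳ (seq y N ℚ.+ (δ ℚ.+ δ))) (ℚₚ.+-monoˡ-< (ℚ.- (seq y N ℚ.+ (δ ℚ.+ δ))) lt) , N , λ l hl → begin
      seq y l ℚ.+ gap                      ≤⟨ ℚₚ.+-monoˡ-≤ gap (near-y hl ℕₚ.≤-refl) ⟩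
      seq y N ℚ.+ δ ℚ.+ gap  ≡⟨ solve 3 (λ y d x → y :+ d :+ (x :- (y :+ (d :+ d))) := x :- d) ≡.refl (seq y N) δ (seq x N) ⟩
      seq x N ℚ.- δ                        ≤⟨ ℚₚ.+-monoˡ-≤ (ℚ.- δ) (near-x ℕₚ.≤-refl hl) ⟩
      seq x l ℚ.+ δ ℚ.- δ                  ≡⟨ solve 2 (λ x d → x :+ d :- d := x) ≡.refl (seq x l) δ ⟩
      seq x l                              ∎
      where
      gap = seq x N ℚ.- (seq y N ℚ.+ (δ ℚ.+ δ))
    bound : ∀ k → N ℕ.≤ k → seq x k ℚ.≤ seq y k ℚ.+ ε
    bound k hk = begin
      seq x k                                          ≤⟨ near-x hk ℕₚ.≤-refl ⟩
      seq x N ℚ.+ δ                                    ≤⟨ ℚₚ.+-monoˡ-≤ δ (ℚₚ.≮⇒≥ (λ lt → x≤y (sep lt))) ⟩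
      seq y N ℚ.+ (δ ℚ.+ δ) ℚ.+ δ  ≤⟨ ℚₚ.+-monoˡ-≤ δ (ℚₚ.+-monoˡ-≤ (δ ℚ.+ δ) (near-y ℕₚ.≤-refl hk)) ⟩
      seq y k ℚ.+ δ ℚ.+ (δ ℚ.+ δ) ℚ.+ δ  ≡⟨ solve 2 (λ y e → y :+ con ½ :* (con ½ :* e) :+ (con ½ :* (con ½ :* e) :+ con ½ :* (con ½ :* e)) :+ con ½ :* (con ½ :* e) := y :+ e) ≡.refl (seq y k) ε ⟩
      seq y k ℚ.+ ε                                    ∎

  ≤-pointwise : ∀ {x y} N → (∀ k → N ℕ.≤ k → seq x k ℚ.≤ seq y k) → x ≤ y
  ≤-pointwise {x} {y} N h = ≲⇒≤ {x} {y} λ ε 0<ε → N , λ k hk → ℚₚ.≤-trans (h k hk) (p≤p+q (ℚₚ.<⇒≤ 0<ε))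

  ≈-pointwise : ∀ {x y} → (∀ k → seq x k ≡ seq y k) → x ≈ y
  ≈-pointwise {x} {y} h = ≤-pointwise {x} {y} 0 (λ k _ → ℚₚ.≤-reflexive (h k)) , ≤-pointwise {y} {x} 0 (λ k _ → ℚₚ.≤-reflexive (≡.sym (h k)))

  ≤-refl : ∀ {x} → x ≤ x
  ≤-refl {x} = ≤-pointwise {x} {x} 0 λ _ _ → ℚₚ.≤-refl

  ≤-trans : ∀ {x y z} → x ≤ y → y ≤ z → x ≤ z
  ≤-trans {x} {y} {z} h g = ≲⇒≤ {x} {z} λ ε 0<ε →
    let N , f = ≤⇒≲ {x} {y} h (½ ℚ.* ε) (0<½* 0<ε)
        M , f′ = ≤⇒≲ {y} {z} g (½ ℚ.* ε) (0<½* 0<ε)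
    in N ℕ.⊔ M , λ k hk → ℚₚ.≤-trans (f k (ℕₚ.m⊔n≤o⇒m≤o N M hk))
         (ℚₚ.≤-trans (ℚₚ.+-monoˡ-≤ (½ ℚ.* ε) (f′ k (ℕₚ.m⊔n≤o⇒n≤o N M hk)))
           (ℚₚ.≤-reflexive (solve 2 (λ z e → z :+ con ½ :* e :+ con ½ :* e := z :+ e) ≡.refl (seq z k) ε)))

  ≈-refl : ∀ {x} → x ≈ x
  ≈-refl {x} = ≤-refl {x} , ≤-refl {x}

  ≈-trans : ∀ {x y z} → x ≈ y → y ≈ z → x ≈ z
  ≈-trans {x} {y} {z} (a , b) (c , d) = ≤-trans {x} {y} {z} a c , ≤-trans {z} {y} {x} d b

  <⇒≤ : ∀ {x y} → x < y → x ≤ y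
  <⇒≤ {x} {y} (ε , 0<ε , N , f) = ≤-pointwise {x} {y} N λ k hk → ℚₚ.≤-trans (p≤p+q (ℚₚ.<⇒≤ 0<ε)) (f k hk)

  <-≤-trans : ∀ {x y z} → x < y → y ≤ z → x < z
  <-≤-trans {x} {y} {z} (ε , 0<ε , N , f) y≤z =
    let M , g = ≤⇒≲ {y} {z} y≤z (½ ℚ.* ε) (0<½* 0<ε)
    in ½ ℚ.* ε , 0<½* 0<ε , N ℕ.⊔ M , λ k hk → 0≤-⇒≤ (≡.subst (0ℚ ℚ.≤_)
         (solve 4 (λ x y z e → (z :+ con ½ :* e :- y) :+ (y :- (x :+ e)) := z :- (x :+ con ½ :* e)) ≡.refl (seq x k) (seq y k) (seq z k) ε)
         (ℚₚ.+-mono-≤ (≤⇒0≤- (g k (ℕₚ.m⊔n≤o⇒n≤o N M hk))) (≤⇒0≤- (f k (ℕₚ.m⊔n≤o⇒m≤o N M hk)))))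

  ≤-<-trans : ∀ {x y z} → x ≤ y → y < z → x < z
  ≤-<-trans {x} {y} {z} x≤y (ε , 0<ε , N , f) =
    let M , g = ≤⇒≲ {x} {y} x≤y (½ ℚ.* ε) (0<½* 0<ε)
    in ½ ℚ.* ε , 0<½* 0<ε , N ℕ.⊔ M , λ k hk → 0≤-⇒≤ (≡.subst (0ℚ ℚ.≤_)
         (solve 4 (λ x y z e → (z :- (y :+ e)) :+ (y :+ con ½ :* e :- x) := z :- (x :+ con ½ :* e)) ≡.refl (seq x k) (seq y k) (seq z k) ε)
         (ℚₚ.+-mono-≤ (≤⇒0≤- (f k (ℕₚ.m⊔n≤o⇒m≤o N M hk))) (≤⇒0≤- (g k (ℕₚ.m⊔n≤o⇒n≤o N M hk)))))

  +-mono-≤ : ∀ {w x y z} → w ≤ x → y ≤ z → w + y ≤ x + z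
  +-mono-≤ {w} {x} {y} {z} h g = ≲⇒≤ {w + y} {x + z} λ ε 0<ε →
    let N , f = ≤⇒≲ {w} {x} h (½ ℚ.* ε) (0<½* 0<ε)
        M , f′ = ≤⇒≲ {y} {z} g (½ ℚ.* ε) (0<½* 0<ε)
    in N ℕ.⊔ M , λ k hk → ℚₚ.≤-trans (ℚₚ.+-mono-≤ (f k (ℕₚ.m⊔n≤o⇒m≤o N M hk)) (f′ k (ℕₚ.m⊔n≤o⇒n≤o N M hk)))
         (ℚₚ.≤-reflexive (solve 3 (λ x z e → (x :+ con ½ :* e) :+ (z :+ con ½ :* e) := (x :+ z) :+ e) ≡.refl (seq x k) (seq z k) ε))

  x≤y⇒0≤y-x : ∀ {x y} → x ≤ y → 0ℝ ≤ y - x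
  x≤y⇒0≤y-x {x} {y} h = ≤-trans {0ℝ} {x + - x} {y - x}
    (≤-pointwise {0ℝ} {x + - x} 0 λ k _ → ℚₚ.≤-reflexive (≡.sym (ℚₚ.+-inverseʳ (seq x k)))) (+-mono-≤ {x} {y} {(- x)} {(- x)} h (≤-refl {(- x)}))

  0≤y-x⇒x≤y : ∀ {x y} → 0ℝ ≤ y - x → x ≤ y
  0≤y-x⇒x≤y {x} {y} h = ≤-trans {x} {0ℝ + x} {y} (≤-pointwise {x} {0ℝ + x} 0 λ k _ → ℚₚ.≤-reflexive (≡.sym (ℚₚ.+-identityˡ (seq x k))))
    (≤-trans {0ℝ + x} {(y - x) + x} {y} (+-mono-≤ {0ℝ} {y - x} {x} {x} h (≤-refl {x}))
      (≤-pointwise {(y - x) + x} {y} 0 λ k _ → ℚₚ.≤-reflexive (solve 2 (λ x y → (y :- x) :+ x := y) ≡.refl (seq x k) (seq y k))))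

  boundedᵘ : ∀ x → ∃[ Q ] (0ℚ ℚ.< Q × ∃[ N ] (∀ k → N ℕ.≤ k → ∣ seq x k ∣ ℚ.≤ Q))
  boundedᵘ x = bounded {seq x} (cauchy x)

  0≤x*y : ∀ {x y} → 0ℝ ≤ x → 0ℝ ≤ y → 0ℝ ≤ x * y
  0≤x*y {x} {y} hx hy = ≲⇒≤ {0ℝ} {x * y} (go′ (boundedᵘ x) (boundedᵘ y))
    where
    open ℚₚ.≤-Reasoning
    go′ : ∃[ Q ] (0ℚ ℚ.< Q × ∃[ N ] (∀ k → N ℕ.≤ k → ∣ seq x k ∣ ℚ.≤ Q)) →
          ∃[ Q ] (0ℚ ℚ.< Q × ∃[ N ] (∀ k → N ℕ.≤ k → ∣ seq y k ∣ ℚ.≤ Q)) → 0ℝ ≲ x * y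
    go′ (Q , 0<Q , N₁ , fx) (Q′ , 0<Q′ , N₂ , fy) ε 0<ε = N₁ ℕ.⊔ N₂ ℕ.⊔ (proj₁ X ℕ.⊔ proj₁ Y) , bound
      where
      c = Q ℚ.+ Q′ ℚ.+ 1ℚ
      0<c : 0ℚ ℚ.< c
      0<c = ℚₚ.<-≤-trans 0<1 (≡.subst (ℚ._≤ c) (ℚₚ.+-identityˡ 1ℚ) (ℚₚ.+-monoˡ-≤ 1ℚ (ℚₚ.≤-trans (ℚₚ.<⇒≤ 0<Q) (p≤p+q (ℚₚ.<⇒≤ 0<Q′)))))
      -- Small enough that the correction `δ (a + b + δ)` in the product of the shifted terms is at
      -- most `δ c ≤ ε`.
      δ = 1ℚ ℚ.⊓ (1/⁺ c 0<c ℚ.* ε)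
      0<δ : 0ℚ ℚ.< δ
      0<δ = 0<⊓ 0<1 (0<* (0<1/⁺ c 0<c) 0<ε)
      X = ≤⇒≲ {0ℝ} {x} hx δ 0<δ
      Y = ≤⇒≲ {0ℝ} {y} hy δ 0<δ
      bound : ∀ k → N₁ ℕ.⊔ N₂ ℕ.⊔ (proj₁ X ℕ.⊔ proj₁ Y) ℕ.≤ k → 0ℚ ℚ.≤ seq x k ℚ.* seq y k ℚ.+ ε
      bound k hk = begin
        0ℚ  ≤⟨ 0≤* (proj₂ X k (ℕₚ.m⊔n≤o⇒m≤o (proj₁ X) _ h₂)) (proj₂ Y k (ℕₚ.m⊔n≤o⇒n≤o (proj₁ X) _ h₂)) ⟩
        (a ℚ.+ δ) ℚ.* (b ℚ.+ δ)  ≡⟨ solve 3 (λ a b d → (a :+ d) :* (b :+ d) := a :* b :+ d :* (a :+ b :+ d)) ≡.refl a b δ ⟩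
        a ℚ.* b ℚ.+ δ ℚ.* (a ℚ.+ b ℚ.+ δ)  ≤⟨ ℚₚ.+-monoʳ-≤ (a ℚ.* b) (*-monoʳ (ℚₚ.<⇒≤ 0<δ) (ℚₚ.+-mono-≤ (ℚₚ.+-mono-≤
                                                                     (ℚₚ.≤-trans (p≤∣p∣ a) (fx k (ℕₚ.m⊔n≤o⇒m≤o N₁ N₂ h₁))) (ℚₚ.≤-trans (p≤∣p∣ b) (fy k (ℕₚ.m⊔n≤o⇒n≤o N₁ N₂ h₁)))) (ℚₚ.p⊓q≤p 1ℚ (1/⁺ c 0<c ℚ.* ε)))) ⟩
        a ℚ.* b ℚ.+ δ ℚ.* c  ≤⟨ ℚₚ.+-monoʳ-≤ (a ℚ.* b) (*-monoˡ (ℚₚ.<⇒≤ 0<c) (ℚₚ.p⊓q≤q 1ℚ (1/⁺ c 0<c ℚ.* ε))) ⟩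
        a ℚ.* b ℚ.+ 1/⁺ c 0<c ℚ.* ε ℚ.* c  ≡⟨ ≡.cong (a ℚ.* b ℚ.+_) (≡.trans (solve 3 (λ i e c → i :* e :* c := (c :* i) :* e) ≡.refl (1/⁺ c 0<c) ε c) (≡.trans (≡.cong (ℚ._* ε) (*-1/⁺ c 0<c)) (ℚₚ.*-identityˡ ε))) ⟩
        a ℚ.* b ℚ.+ ε                                           ∎
        where
        a = seq x k
        b = seq y k
        h₁ = ℕₚ.m⊔n≤o⇒m≤o (N₁ ℕ.⊔ N₂) _ hk
        h₂ = ℕₚ.m⊔n≤o⇒n≤o (N₁ ℕ.⊔ N₂) _ hk

  *-monoʳ-≤ : ∀ {x y z} → 0ℝ ≤ z → x ≤ y → z * x ≤ z * y
  *-monoʳ-≤ {x} {y} {z} 0≤z x≤y = 0≤y-x⇒x≤y {z * x} {z * y} (≤-trans {0ℝ} {z * (y - x)} {z * y - z * x} (0≤x*y {z} {y - x} 0≤z (x≤y⇒0≤y-x {x} {y} x≤y))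
    (≤-pointwise {z * (y - x)} {z * y - z * x} 0 λ k _ → ℚₚ.≤-reflexive (solve 3 (λ x y z → z :* (y :- x) := z :* y :- z :* x) ≡.refl (seq x k) (seq y k) (seq z k))))

  *-comm : ∀ x y → x * y ≈ y * x
  *-comm x y = ≈-pointwise {x * y} {y * x} λ k → ℚₚ.*-comm (seq x k) (seq y k)

  *-monoˡ-≤ : ∀ {x y z} → 0ℝ ≤ z → x ≤ y → x * z ≤ y * z
  *-monoˡ-≤ {x} {y} {z} 0≤z x≤y = ≤-trans {x * z} {z * x} {y * z} (proj₁ (*-comm x z)) (≤-trans {z * x} {z * y} {y * z} (*-monoʳ-≤ {x} {y} {z} 0≤z x≤y) (proj₁ (*-comm z y)))

  *-congˡ : ∀ {x y z} → x ≈ y → z * x ≈ z * y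
  *-congˡ {x} {y} {z} (h , g) = half x y h g , half y x g h
    where
    open ℚₚ.≤-Reasoning
    half : ∀ x y → x ≤ y → y ≤ x → z * x ≤ z * y
    half x y h g = ≲⇒≤ {z * x} {z * y} (go (boundedᵘ z))
      where
      go : ∃[ Q ] (0ℚ ℚ.< Q × ∃[ N ] (∀ k → N ℕ.≤ k → ∣ seq z k ∣ ℚ.≤ Q)) → z * x ≲ z * y
      go (Q , 0<Q , N₁ , fz) ε 0<ε = N₁ ℕ.⊔ (proj₁ X ℕ.⊔ proj₁ Y) , bound
        where
        δ = 1/⁺ Q 0<Q ℚ.* ε
        0<δ : 0ℚ ℚ.< δ
        0<δ = 0<* (0<1/⁺ Q 0<Q) 0<ε
        X = ≤⇒≲ {x} {y} h δ 0<δ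
        Y = ≤⇒≲ {y} {x} g δ 0<δ
        bound : ∀ k → N₁ ℕ.⊔ (proj₁ X ℕ.⊔ proj₁ Y) ℕ.≤ k → seq z k ℚ.* seq x k ℚ.≤ seq z k ℚ.* seq y k ℚ.+ ε
        bound k hk = begin
          c ℚ.* a  ≡⟨ solve 3 (λ a b c → c :* a := c :* b :+ c :* (a :- b)) ≡.refl a b c ⟩
          c ℚ.* b ℚ.+ c ℚ.* (a ℚ.- b)        ≤⟨ ℚₚ.+-monoʳ-≤ (c ℚ.* b) (p≤∣p∣ (c ℚ.* (a ℚ.- b))) ⟩
          c ℚ.* b ℚ.+ ∣ c ℚ.* (a ℚ.- b) ∣    ≡⟨ ≡.cong (c ℚ.* b ℚ.+_) (ℚₚ.∣p*q∣≡∣p∣*∣q∣ c (a ℚ.- b)) ⟩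
          c ℚ.* b ℚ.+ ∣ c ∣ ℚ.* ∣ a ℚ.- b ∣  ≤⟨ ℚₚ.+-monoʳ-≤ (c ℚ.* b) (*-mono (ℚₚ.0≤∣p∣ c) (ℚₚ.<⇒≤ 0<δ) (fz k h₁) (∣∣-≤ (close a b (proj₂ X k (ℕₚ.m⊔n≤o⇒m≤o (proj₁ X) _ h₂)))
                                                   (≡.subst (ℚ._≤ δ) (≡.sym (-‿flip a b)) (close b a (proj₂ Y k (ℕₚ.m⊔n≤o⇒n≤o (proj₁ X) _ h₂)))))) ⟩
          c ℚ.* b ℚ.+ Q ℚ.* δ  ≡⟨ ≡.cong (c ℚ.* b ℚ.+_) (≡.trans (≡.sym (ℚₚ.*-assoc Q (1/⁺ Q 0<Q) ε)) (≡.trans (≡.cong (ℚ._* ε) (*-1/⁺ Q 0<Q)) (ℚₚ.*-identityˡ ε))) ⟩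
          c ℚ.* b ℚ.+ ε                      ∎
          where
          a = seq x k
          b = seq y k
          c = seq z k
          h₁ = ℕₚ.m⊔n≤o⇒m≤o N₁ _ hk
          h₂ = ℕₚ.m⊔n≤o⇒n≤o N₁ _ hk
          close : ∀ a b → a ℚ.≤ b ℚ.+ δ → a ℚ.- b ℚ.≤ δ
          close a b le = 0≤-⇒≤ (≡.subst (0ℚ ℚ.≤_) (solve 3 (λ a b d → (b :+ d) :- a := d :- (a :- b)) ≡.refl a b δ) (≤⇒0≤- le))

  *-cong : ∀ {w x y z} → w ≈ x → y ≈ z → w * y ≈ x * z
  *-cong {w} {x} {y} {z} w≈x y≈z = ≈-trans {w * y} {w * z} {x * z} (*-congˡ {y} {z} {w} y≈z)
    (≈-trans {w * z} {z * w} {x * z} (*-comm w z) (≈-trans {z * w} {z * x} {x * z} (*-congˡ {w} {x} {z} w≈x) (*-comm z x)))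

  *-monoʳ-< : ∀ {x y z} → 0ℝ < z → x < y → z * x < z * y
  *-monoʳ-< {x} {y} {z} (ε , 0<ε , N , f) (δ , 0<δ , M , g) = ε ℚ.* δ , 0<* 0<ε 0<δ , N ℕ.⊔ M , λ k hk →
    let ε≤z = ≡.subst (ℚ._≤ seq z k) (ℚₚ.+-identityˡ ε) (f k (ℕₚ.m⊔n≤o⇒m≤o N M hk))
        δ≤ = 0≤-⇒≤ (≡.subst (0ℚ ℚ.≤_) (solve 3 (λ x y d → y :- (x :+ d) := (y :- x) :- d) ≡.refl (seq x k) (seq y k) δ) (≤⇒0≤- (g k (ℕₚ.m⊔n≤o⇒n≤o N M hk))))
    in 0≤-⇒≤ (≡.subst (0ℚ ℚ.≤_)
         (solve 4 (λ x y z e → z :* (y :- x) :- e := z :* y :- (z :* x :+ e)) ≡.refl (seq x k) (seq y k) (seq z k) (ε ℚ.* δ))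
         (≤⇒0≤- (*-mono (ℚₚ.<⇒≤ 0<ε) (ℚₚ.≤-trans (ℚₚ.<⇒≤ 0<δ) δ≤) ε≤z δ≤)))

  +-mono-<-≤ : ∀ {w x y z} → w < x → y ≤ z → w + y < x + z
  +-mono-<-≤ {w} {x} {y} {z} (ε , 0<ε , N , f) y≤z = <-≤-trans {w + y} {x + y} {x + z}
    (ε , 0<ε , N , λ k hk → ≡.subst (ℚ._≤ seq x k ℚ.+ seq y k) (solve 3 (λ w y e → (w :+ e) :+ y := (w :+ y) :+ e) ≡.refl (seq w k) (seq y k) ε) (ℚₚ.+-monoˡ-≤ (seq y k) (f k hk)))
    (+-mono-≤ {x} {x} {y} {z} (≤-refl {x}) y≤z)

  -- Products of exponential series

  ∑≤ : (ℕ → ℚ) → ℕ → ℚ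
  ∑≤ f zero    = f 0
  ∑≤ f (suc k) = ∑≤ f k ℚ.+ f (suc k)

  conv : (ℕ → ℚ) → (ℕ → ℚ) → ℕ → ℚ
  conv f g zero    = f 0 ℚ.* g 0
  conv f g (suc i) = f 0 ℚ.* g (suc i) ℚ.+ conv (f ∘ suc) g i

  ∑≤-cong : ∀ {f g} → (∀ i → f i ≡ g i) → ∀ k → ∑≤ f k ≡ ∑≤ g k
  ∑≤-cong h zero    = h 0
  ∑≤-cong h (suc k) = ≡.cong₂ ℚ._+_ (∑≤-cong h k) (h (suc k))

  ∑≤-head : ∀ f k → ∑≤ f (suc k) ≡ f 0 ℚ.+ ∑≤ (f ∘ suc) k
  ∑≤-head f zero    = ≡.refl
  ∑≤-head f (suc k) = ≡.trans (≡.cong (ℚ._+ f (suc (suc k))) (∑≤-head f k)) (ℚₚ.+-assoc (f 0) (∑≤ (f ∘ suc) k) _)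

  expSum≡∑≤ : ∀ q k → expSum q k ≡ ∑≤ (expTerm q) k
  expSum≡∑≤ q zero    = ≡.refl
  expSum≡∑≤ q (suc k) = ≡.cong (ℚ._+ expTerm q (suc k)) (expSum≡∑≤ q k)

  ∑≤-conv : ∀ f g k → ∑≤ (conv f g) (suc k) ≡ f 0 ℚ.* ∑≤ g (suc k) ℚ.+ ∑≤ (conv (f ∘ suc) g) k
  ∑≤-conv f g zero  = solve 4 (λ a b c d → a :* b :+ (a :* c :+ d :* b) := a :* (b :+ c) :+ d :* b) ≡.refl (f 0) (g 0) (g 1) (f 1)
  ∑≤-conv f g (suc k) = ≡.trans (≡.cong (ℚ._+ conv f g (suc (suc k))) (∑≤-conv f g k))
    (solve 5 (λ a S c X y → a :* S :+ X :+ (a :* c :+ y) := a :* (S :+ c) :+ (X :+ y)) ≡.refl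
      (f 0) (∑≤ g (suc k)) (g (suc (suc k))) (∑≤ (conv (f ∘ suc) g) k) (conv (f ∘ suc) g (suc k)))

  conv-cong : ∀ {f f′ g g′} → (∀ i → f i ≡ f′ i) → (∀ i → g i ≡ g′ i) → ∀ i → conv f g i ≡ conv f′ g′ i
  conv-cong hf hg zero    = ≡.cong₂ ℚ._*_ (hf 0) (hg 0)
  conv-cong hf hg (suc i) = ≡.cong₂ ℚ._+_ (≡.cong₂ ℚ._*_ (hf 0) (hg (suc i))) (conv-cong (hf ∘ suc) hg i)

  conv-+ˡ : ∀ f f′ g i → conv (λ a → f a ℚ.+ f′ a) g i ≡ conv f g i ℚ.+ conv f′ g i
  conv-+ˡ f f′ g zero    = ℚₚ.*-distribʳ-+ (g 0) (f 0) (f′ 0)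
  conv-+ˡ f f′ g (suc i) = ≡.trans (≡.cong₂ ℚ._+_ (ℚₚ.*-distribʳ-+ (g (suc i)) (f 0) (f′ 0)) (conv-+ˡ (f ∘ suc) (f′ ∘ suc) g i))
    (solve 4 (λ a b c d → (a :+ b) :+ (c :+ d) := (a :+ c) :+ (b :+ d)) ≡.refl (f 0 ℚ.* g (suc i)) (f′ 0 ℚ.* g (suc i)) (conv (f ∘ suc) g i) (conv (f′ ∘ suc) g i))

  conv-*ˡ : ∀ p f g i → conv (λ a → p ℚ.* f a) g i ≡ p ℚ.* conv f g i
  conv-*ˡ p f g zero    = ℚₚ.*-assoc p (f 0) (g 0)
  conv-*ˡ p f g (suc i) = ≡.trans (≡.cong₂ ℚ._+_ (ℚₚ.*-assoc p (f 0) (g (suc i))) (conv-*ˡ p (f ∘ suc) g i)) (≡.sym (ℚₚ.*-distribˡ-+ p _ _))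

  conv-*ʳ : ∀ p f g i → conv f (λ b → p ℚ.* g b) i ≡ p ℚ.* conv f g i
  conv-*ʳ p f g zero    = solve 3 (λ p a b → a :* (p :* b) := p :* (a :* b)) ≡.refl p (f 0) (g 0)
  conv-*ʳ p f g (suc i) = ≡.trans (≡.cong (f 0 ℚ.* (p ℚ.* g (suc i)) ℚ.+_) (conv-*ʳ p (f ∘ suc) g i))
    (solve 4 (λ p a b c → a :* (p :* b) :+ p :* c := p :* (a :* b :+ c)) ≡.refl p (f 0) (g (suc i)) (conv (f ∘ suc) g i))

  conv-shiftʳ : ∀ f g i → conv f g (suc i) ≡ conv f (g ∘ suc) i ℚ.+ f (suc i) ℚ.* g 0
  conv-shiftʳ f g zero    = ≡.refl
  conv-shiftʳ f g (suc i) = ≡.trans (≡.cong (f 0 ℚ.* g (suc (suc i)) ℚ.+_) (conv-shiftʳ (f ∘ suc) g i))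
    (≡.sym (ℚₚ.+-assoc (f 0 ℚ.* g (suc (suc i))) (conv (f ∘ suc) (g ∘ suc) i) _))

  -- The Leibniz rule for the operator x · d/dx on power series.
  leibniz : ∀ f g i → ι i ℚ.* conv f g i ≡ conv (λ a → ι a ℚ.* f a) g i ℚ.+ conv f (λ b → ι b ℚ.* g b) i
  leibniz f g zero    = ≡.trans (ℚₚ.*-zeroˡ (f 0 ℚ.* g 0))
    (≡.sym (≡.trans (≡.cong₂ ℚ._+_ (≡.trans (≡.cong (ℚ._* g 0) (ℚₚ.*-zeroˡ (f 0))) (ℚₚ.*-zeroˡ (g 0))) (≡.trans (≡.cong (f 0 ℚ.*_) (ℚₚ.*-zeroˡ (g 0))) (ℚₚ.*-zeroʳ (f 0)))) (ℚₚ.+-identityˡ 0ℚ)))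
  leibniz f g (suc i) = begin-equality
    ι (suc i) ℚ.* (f 0 ℚ.* g (suc i) ℚ.+ c)
      ≡⟨ ℚₚ.*-distribˡ-+ (ι (suc i)) (f 0 ℚ.* g (suc i)) c ⟩
    ι (suc i) ℚ.* (f 0 ℚ.* g (suc i)) ℚ.+ ι (suc i) ℚ.* c
      ≡⟨ ≡.cong (λ z → ι (suc i) ℚ.* (f 0 ℚ.* g (suc i)) ℚ.+ z ℚ.* c) (ι-suc i) ⟩
    ι (suc i) ℚ.* (f 0 ℚ.* g (suc i)) ℚ.+ (1ℚ ℚ.+ ι i) ℚ.* c
      ≡⟨ solve 5 (λ n a b c m → n :* (a :* b) :+ (con 1ℚ :+ m) :* c := a :* (n :* b) :+ (c :+ m :* c)) ≡.refl (ι (suc i)) (f 0) (g (suc i)) c (ι i) ⟩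
    f 0 ℚ.* (ι (suc i) ℚ.* g (suc i)) ℚ.+ (c ℚ.+ ι i ℚ.* c)
      ≡⟨ ≡.cong (λ z → f 0 ℚ.* (ι (suc i) ℚ.* g (suc i)) ℚ.+ (c ℚ.+ z)) (leibniz (f ∘ suc) g i) ⟩
    f 0 ℚ.* (ι (suc i) ℚ.* g (suc i)) ℚ.+ (c ℚ.+ (conv (λ a → ι a ℚ.* f (suc a)) g i ℚ.+ d))
      ≡⟨ solve 4 (λ x c u d → x :+ (c :+ (u :+ d)) := (c :+ u) :+ (x :+ d)) ≡.refl (f 0 ℚ.* (ι (suc i) ℚ.* g (suc i))) c (conv (λ a → ι a ℚ.* f (suc a)) g i) d ⟩
    (c ℚ.+ conv (λ a → ι a ℚ.* f (suc a)) g i) ℚ.+ (f 0 ℚ.* (ι (suc i) ℚ.* g (suc i)) ℚ.+ d)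
      ≡⟨ ≡.cong (ℚ._+ (f 0 ℚ.* (ι (suc i) ℚ.* g (suc i)) ℚ.+ d)) (≡.trans (≡.sym (conv-+ˡ (f ∘ suc) (λ a → ι a ℚ.* f (suc a)) g i))
           (conv-cong {g = g} (λ a → ≡.trans (solve 2 (λ x n → x :+ n :* x := (con 1ℚ :+ n) :* x) ≡.refl (f (suc a)) (ι a)) (≡.cong (ℚ._* f (suc a)) (≡.sym (ι-suc a)))) (λ _ → ≡.refl) i)) ⟩
    conv (λ a → ι (suc a) ℚ.* f (suc a)) g i ℚ.+ (f 0 ℚ.* (ι (suc i) ℚ.* g (suc i)) ℚ.+ d)
      ≡⟨ ≡.cong (ℚ._+ (f 0 ℚ.* (ι (suc i) ℚ.* g (suc i)) ℚ.+ d)) (≡.sym (≡.trans (≡.cong (ℚ._+ conv (λ a → ι (suc a) ℚ.* f (suc a)) g i) (≡.trans (≡.cong (ℚ._* g (suc i)) (ℚₚ.*-zeroˡ (f 0))) (ℚₚ.*-zeroˡ (g (suc i))))) (ℚₚ.+-identityˡ (conv (λ a → ι (suc a) ℚ.* f (suc a)) g i)))) ⟩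
    conv (λ a → ι a ℚ.* f a) g (suc i) ℚ.+ conv f (λ b → ι b ℚ.* g b) (suc i) ∎
    where
    open ℚₚ.≤-Reasoning
    c = conv (f ∘ suc) g i
    d = conv (f ∘ suc) (λ b → ι b ℚ.* g b) i

  expTerm-step : ∀ q i → ι (suc i) ℚ.* expTerm q (suc i) ≡ q ℚ.* expTerm q i
  expTerm-step q i = ≡.trans (solve 4 (λ n t q r → n :* (t :* (q :* r)) := (n :* r) :* (q :* t)) ≡.refl (ι (suc i)) (expTerm q i) q (recip i))
    (≡.trans (≡.cong (ℚ._* (q ℚ.* expTerm q i)) (ι*recip i)) (ℚₚ.*-identityˡ _))

  -- By the Leibniz rule the convolution satisfies `(i + 1) c′ = (p + q) c`, which is the recurrence
  -- of the terms of `exp (p + q)`; the binomial theorem is thereby bypassed.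
  conv-exp : ∀ p q i → conv (expTerm p) (expTerm q) i ≡ expTerm (p ℚ.+ q) i
  conv-exp p q zero    = ≡.refl
  conv-exp p q (suc i) = begin-equality
    c′  ≡⟨ ≡.sym (≡.trans (≡.sym (ℚₚ.*-assoc (recip i) (ι (suc i)) c′)) (≡.trans (≡.cong (ℚ._* c′) (≡.trans (ℚₚ.*-comm (recip i) (ι (suc i))) (ι*recip i))) (ℚₚ.*-identityˡ c′))) ⟩
    recip i ℚ.* (ι (suc i) ℚ.* c′)                  ≡⟨ ≡.cong (recip i ℚ.*_) weighted ⟩
    recip i ℚ.* ((p ℚ.+ q) ℚ.* c)  ≡⟨ solve 3 (λ r s c → r :* (s :* c) := c :* (s :* r)) ≡.refl (recip i) (p ℚ.+ q) c ⟩
    c ℚ.* ((p ℚ.+ q) ℚ.* recip i)  ≡⟨ ≡.cong (ℚ._* ((p ℚ.+ q) ℚ.* recip i)) (conv-exp p q i) ⟩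
    expTerm (p ℚ.+ q) (suc i)                       ∎
    where
    open ℚₚ.≤-Reasoning
    c  = conv (expTerm p) (expTerm q) i
    c′ = conv (expTerm p) (expTerm q) (suc i)
    left : conv (λ a → ι a ℚ.* expTerm p a) (expTerm q) (suc i) ≡ p ℚ.* c
    left = ≡.trans (≡.trans (≡.cong (ℚ._+ conv (λ a → ι (suc a) ℚ.* expTerm p (suc a)) (expTerm q) i) (≡.trans (≡.cong (ℚ._* expTerm q (suc i)) (ℚₚ.*-zeroˡ 1ℚ)) (ℚₚ.*-zeroˡ (expTerm q (suc i))))) (ℚₚ.+-identityˡ _))
      (≡.trans (conv-cong {g = expTerm q} (expTerm-step p) (λ _ → ≡.refl) i) (conv-*ˡ p (expTerm p) (expTerm q) i))
    right : conv (expTerm p) (λ b → ι b ℚ.* expTerm q b) (suc i) ≡ q ℚ.* c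
    right = ≡.trans (conv-shiftʳ (expTerm p) (λ b → ι b ℚ.* expTerm q b) i)
      (≡.trans (≡.cong (conv (expTerm p) (λ b → ι (suc b) ℚ.* expTerm q (suc b)) i ℚ.+_) (≡.trans (≡.cong (expTerm p (suc i) ℚ.*_) (ℚₚ.*-zeroˡ 1ℚ)) (ℚₚ.*-zeroʳ (expTerm p (suc i)))))
        (≡.trans (ℚₚ.+-identityʳ _) (≡.trans (conv-cong {f = expTerm p} (λ _ → ≡.refl) (expTerm-step q) i) (conv-*ʳ q (expTerm p) (expTerm q) i))))
    weighted : ι (suc i) ℚ.* c′ ≡ (p ℚ.+ q) ℚ.* c
    weighted = ≡.trans (leibniz (expTerm p) (expTerm q) (suc i)) (≡.trans (≡.cong₂ ℚ._+_ left right) (≡.sym (ℚₚ.*-distribʳ-+ c p q)))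

  module _ {g G : ℕ → ℚ} (g≤G : ∀ i → ∣ g i ∣ ℚ.≤ G i) where

    open ℚₚ.≤-Reasoning

    ∑≤-tail : ∀ k d → ∣ ∑≤ g (d ℕ.+ k) ℚ.- ∑≤ g k ∣ ℚ.≤ ∑≤ G (d ℕ.+ k) ℚ.- ∑≤ G k
    ∑≤-tail k zero  = ℚₚ.≤-reflexive (≡.trans (≡.cong ∣_∣ (ℚₚ.+-inverseʳ (∑≤ g k))) (≡.sym (ℚₚ.+-inverseʳ (∑≤ G k))))
    ∑≤-tail k (suc d) = begin
      ∣ ∑≤ g (d ℕ.+ k) ℚ.+ t ℚ.- ∑≤ g k ∣  ≡⟨ ≡.cong ∣_∣ (solve 3 (λ a t c → a :+ t :- c := (a :- c) :+ t) ≡.refl (∑≤ g (d ℕ.+ k)) t (∑≤ g k)) ⟩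
      ∣ (∑≤ g (d ℕ.+ k) ℚ.- ∑≤ g k) ℚ.+ t ∣  ≤⟨ ℚₚ.∣p+q∣≤∣p∣+∣q∣ (∑≤ g (d ℕ.+ k) ℚ.- ∑≤ g k) t ⟩
      ∣ ∑≤ g (d ℕ.+ k) ℚ.- ∑≤ g k ∣ ℚ.+ ∣ t ∣  ≤⟨ ℚₚ.+-mono-≤ (∑≤-tail k d) (g≤G (suc (d ℕ.+ k))) ⟩
      (∑≤ G (d ℕ.+ k) ℚ.- ∑≤ G k) ℚ.+ T  ≡⟨ solve 3 (λ a t c → (a :- c) :+ t := a :+ t :- c) ≡.refl (∑≤ G (d ℕ.+ k)) T (∑≤ G k) ⟩
      ∑≤ G (d ℕ.+ k) ℚ.+ T ℚ.- ∑≤ G k                        ∎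
      where
      t = g (suc (d ℕ.+ k))
      T = G (suc (d ℕ.+ k))

    ∑≤-tail′ : ∀ {k K} → k ℕ.≤ K → ∣ ∑≤ g K ℚ.- ∑≤ g k ∣ ℚ.≤ ∑≤ G K ℚ.- ∑≤ G k
    ∑≤-tail′ {k} {K} k≤K = ≡.subst (λ K → ∣ ∑≤ g K ℚ.- ∑≤ g k ∣ ℚ.≤ ∑≤ G K ℚ.- ∑≤ G k) (ℕₚ.m∸n+n≡m k≤K) (∑≤-tail k (K ℕ.∸ k))

    -- The difference is the sum of `f a * g b` over `a ≤ k`, `b ≤ K` and `a + b > k`, each
    -- dominated by `F a * G b`. The bounds `k` and `K` are separate because shifting `f` lowers
    -- only `k`.
    cauchy-product : ∀ {f F} → (∀ i → ∣ f i ∣ ℚ.≤ F i) → ∀ {k K} → k ℕ.≤ K →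
      ∣ ∑≤ f k ℚ.* ∑≤ g K ℚ.- ∑≤ (conv f g) k ∣ ℚ.≤ ∑≤ F k ℚ.* ∑≤ G K ℚ.- ∑≤ (conv F G) k
    cauchy-product {f} {F} f≤F {zero} {K} k≤K = begin
      ∣ f 0 ℚ.* ∑≤ g K ℚ.- f 0 ℚ.* g 0 ∣  ≡⟨ ≡.cong ∣_∣ (solve 3 (λ a b c → a :* b :- a :* c := a :* (b :- c)) ≡.refl (f 0) (∑≤ g K) (g 0)) ⟩
      ∣ f 0 ℚ.* (∑≤ g K ℚ.- g 0) ∣                  ≡⟨ ℚₚ.∣p*q∣≡∣p∣*∣q∣ (f 0) _ ⟩
      ∣ f 0 ∣ ℚ.* ∣ ∑≤ g K ℚ.- g 0 ∣  ≤⟨ *-mono (ℚₚ.0≤∣p∣ (f 0)) (ℚₚ.≤-trans (ℚₚ.0≤∣p∣ _) (∑≤-tail′ k≤K)) (f≤F 0) (∑≤-tail′ k≤K) ⟩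
      F 0 ℚ.* (∑≤ G K ℚ.- G 0)  ≡⟨ solve 3 (λ a b c → a :* (b :- c) := a :* b :- a :* c) ≡.refl (F 0) (∑≤ G K) (G 0) ⟩
      F 0 ℚ.* ∑≤ G K ℚ.- F 0 ℚ.* G 0                ∎
    cauchy-product {f} {F} f≤F {suc k} {K} k<K = begin
      ∣ ∑≤ f (suc k) ℚ.* ∑≤ g K ℚ.- ∑≤ (conv f g) (suc k) ∣        ≡⟨ ≡.cong ∣_∣ (split f g) ⟩
      ∣ f 0 ℚ.* (∑≤ g K ℚ.- ∑≤ g (suc k)) ℚ.+ r ∣  ≤⟨ ℚₚ.∣p+q∣≤∣p∣+∣q∣ (f 0 ℚ.* (∑≤ g K ℚ.- ∑≤ g (suc k))) r ⟩
      ∣ f 0 ℚ.* (∑≤ g K ℚ.- ∑≤ g (suc k)) ∣ ℚ.+ ∣ r ∣  ≡⟨ ≡.cong (ℚ._+ ∣ r ∣) (ℚₚ.∣p*q∣≡∣p∣*∣q∣ (f 0) _) ⟩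
      ∣ f 0 ∣ ℚ.* ∣ ∑≤ g K ℚ.- ∑≤ g (suc k) ∣ ℚ.+ ∣ r ∣  ≤⟨ ℚₚ.+-mono-≤ (*-mono (ℚₚ.0≤∣p∣ (f 0)) (ℚₚ.≤-trans (ℚₚ.0≤∣p∣ _) (∑≤-tail′ k<K)) (f≤F 0) (∑≤-tail′ k<K))
                                                                        (cauchy-product (f≤F ∘ suc) (ℕₚ.≤-trans (ℕₚ.n≤1+n k) k<K)) ⟩
      F 0 ℚ.* (∑≤ G K ℚ.- ∑≤ G (suc k)) ℚ.+ R                      ≡⟨ split F G ⟨
      ∑≤ F (suc k) ℚ.* ∑≤ G K ℚ.- ∑≤ (conv F G) (suc k)            ∎
      where
      r = ∑≤ (f ∘ suc) k ℚ.* ∑≤ g K ℚ.- ∑≤ (conv (f ∘ suc) g) k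
      R = ∑≤ (F ∘ suc) k ℚ.* ∑≤ G K ℚ.- ∑≤ (conv (F ∘ suc) G) k
      split : ∀ f g → ∑≤ f (suc k) ℚ.* ∑≤ g K ℚ.- ∑≤ (conv f g) (suc k)
            ≡ f 0 ℚ.* (∑≤ g K ℚ.- ∑≤ g (suc k)) ℚ.+ (∑≤ (f ∘ suc) k ℚ.* ∑≤ g K ℚ.- ∑≤ (conv (f ∘ suc) g) k)
      split f g = ≡.trans (≡.cong₂ (λ a b → a ℚ.* ∑≤ g K ℚ.- b) (∑≤-head f k) (∑≤-conv f g k))
        (solve 5 (λ a s G g c → (a :+ s) :* G :- (a :* g :+ c) := a :* (G :- g) :+ (s :* G :- c)) ≡.refl
          (f 0) (∑≤ (f ∘ suc) k) (∑≤ g K) (∑≤ g (suc k)) (∑≤ (conv (f ∘ suc) g) k))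

  module _ {G : ℕ → ℚ} (0≤G : ∀ i → 0ℚ ℚ.≤ G i) where

    0≤conv : ∀ {F} → (∀ i → 0ℚ ℚ.≤ F i) → ∀ i → 0ℚ ℚ.≤ conv F G i
    0≤conv 0≤F zero    = 0≤* (0≤F 0) (0≤G 0)
    0≤conv 0≤F (suc i) = ℚₚ.≤-trans (0≤* (0≤F 0) (0≤G (suc i))) (p≤p+q (0≤conv (0≤F ∘ suc) i))

    0≤∑≤ : ∀ {F} → (∀ i → 0ℚ ℚ.≤ F i) → ∀ k → 0ℚ ℚ.≤ ∑≤ F k
    0≤∑≤ 0≤F zero    = 0≤F 0
    0≤∑≤ 0≤F (suc k) = ℚₚ.≤-trans (0≤∑≤ 0≤F k) (p≤p+q (0≤F (suc k)))

    ∑≤-mono : ∀ a b → ∑≤ G b ℚ.≤ ∑≤ G (a ℕ.+ b)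
    ∑≤-mono zero    b = ℚₚ.≤-refl
    ∑≤-mono (suc a) b = ℚₚ.≤-trans (∑≤-mono a b) (p≤p+q (0≤G (suc (a ℕ.+ b))))

    -- Every product of a term of index at most `a` with one of index at most `b` occurs in the
    -- convolution up to `a + b`, whose other terms are nonnegative.
    product≤conv : ∀ {F} → (∀ i → 0ℚ ℚ.≤ F i) → ∀ a b → ∑≤ F a ℚ.* ∑≤ G b ℚ.≤ ∑≤ (conv F G) (a ℕ.+ b)
    product≤conv     0≤F zero zero    = ℚₚ.≤-refl
    product≤conv {F} 0≤F zero (suc b) = ℚₚ.≤-trans (p≤p+q (0≤∑≤ (0≤conv (0≤F ∘ suc)) b)) (ℚₚ.≤-reflexive (≡.sym (∑≤-conv F G b)))
    product≤conv {F} 0≤F (suc a) b = begin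
      ∑≤ F (suc a) ℚ.* ∑≤ G b  ≡⟨ ≡.cong (ℚ._* ∑≤ G b) (∑≤-head F a) ⟩
      (F 0 ℚ.+ ∑≤ (F ∘ suc) a) ℚ.* ∑≤ G b  ≡⟨ ℚₚ.*-distribʳ-+ (∑≤ G b) (F 0) _ ⟩
      F 0 ℚ.* ∑≤ G b ℚ.+ ∑≤ (F ∘ suc) a ℚ.* ∑≤ G b  ≤⟨ ℚₚ.+-mono-≤ (*-monoʳ (0≤F 0) (∑≤-mono (suc a) b)) (product≤conv (0≤F ∘ suc) a b) ⟩
      F 0 ℚ.* ∑≤ G (suc (a ℕ.+ b)) ℚ.+ ∑≤ (conv (F ∘ suc) G) (a ℕ.+ b)     ≡⟨ ∑≤-conv F G (a ℕ.+ b) ⟨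
      ∑≤ (conv F G) (suc (a ℕ.+ b))                                        ∎
      where open ℚₚ.≤-Reasoning

  ι-+ : ∀ m n → ι (m ℕ.+ n) ≡ ι m ℚ.+ ι n
  ι-+ zero    n = ≡.sym (ℚₚ.+-identityˡ (ι n))
  ι-+ (suc m) n = ≡.trans (ι-suc (m ℕ.+ n)) (≡.trans (≡.cong (1ℚ ℚ.+_) (ι-+ m n))
    (≡.trans (≡.sym (ℚₚ.+-assoc 1ℚ (ι m) (ι n))) (≡.cong (ℚ._+ ι n) (≡.sym (ι-suc m)))))

  -- The error is majorised by the one for `ι B` and `ι B′`, which is at most the stretch from `k`
  -- to `2k` of the series at `ι (B + B′)` and so tends to 0.
  exp-product-error : ∀ B B′ p q → ∣ p ∣ ℚ.≤ ι B → ∣ q ∣ ℚ.≤ ι B′ → ∀ k →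
    ∣ expSum p k ℚ.* expSum q k ℚ.- expSum (p ℚ.+ q) k ∣ ℚ.≤ expSum (ι (B ℕ.+ B′)) (k ℕ.+ k) ℚ.- expSum (ι (B ℕ.+ B′)) k
  exp-product-error B B′ p q hp hq k = begin
    ∣ expSum p k ℚ.* expSum q k ℚ.- expSum (p ℚ.+ q) k ∣
      ≡⟨ ≡.cong₂ (λ a b → ∣ a ℚ.- b ∣) (≡.cong₂ ℚ._*_ (expSum≡∑≤ p k) (expSum≡∑≤ q k)) (conv≡ p q k) ⟩
    ∣ ∑≤ (expTerm p) k ℚ.* ∑≤ (expTerm q) k ℚ.- ∑≤ (conv (expTerm p) (expTerm q)) k ∣
      ≤⟨ cauchy-product (ExpSeries.expTerm-≤ B′ q hq) (ExpSeries.expTerm-≤ B p hp) {k} {k} ℕₚ.≤-refl ⟩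
    ∑≤ F k ℚ.* ∑≤ H k ℚ.- ∑≤ (conv F H) k
      ≤⟨ ℚₚ.+-monoˡ-≤ (ℚ.- ∑≤ (conv F H) k) (product≤conv (ExpSeries.0≤T B′) (ExpSeries.0≤T B) k k) ⟩
    ∑≤ (conv F H) (k ℕ.+ k) ℚ.- ∑≤ (conv F H) k
      ≡⟨ ≡.cong₂ ℚ._-_ (≡.trans (≡.sym (conv≡ (ι B) (ι B′) (k ℕ.+ k))) (≡.cong (λ z → expSum z (k ℕ.+ k)) (≡.sym (ι-+ B B′)))) (≡.trans (≡.sym (conv≡ (ι B) (ι B′) k)) (≡.cong (λ z → expSum z k) (≡.sym (ι-+ B B′)))) ⟩
    expSum (ι (B ℕ.+ B′)) (k ℕ.+ k) ℚ.- expSum (ι (B ℕ.+ B′)) k ∎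
    where
    open ℚₚ.≤-Reasoning
    F = expTerm (ι B)
    H = expTerm (ι B′)
    conv≡ : ∀ p q k → expSum (p ℚ.+ q) k ≡ ∑≤ (conv (expTerm p) (expTerm q)) k
    conv≡ p q k = ≡.trans (expSum≡∑≤ (p ℚ.+ q) k) (∑≤-cong (λ i → ≡.sym (conv-exp p q i)) k)

  ≈-close : ∀ {x y} → (∀ ε → 0ℚ ℚ.< ε → ∃[ N ] (∀ k → N ℕ.≤ k → ∣ seq x k ℚ.- seq y k ∣ ℚ.≤ ε)) → x ≈ y
  ≈-close {x} {y} h =
      ≲⇒≤ {x} {y} (λ ε 0<ε → proj₁ (h ε 0<ε) , λ k hk → ∣-∣≤⇒≤+ (proj₂ (h ε 0<ε) k hk))
    , ≲⇒≤ {y} {x} (λ ε 0<ε → proj₁ (h ε 0<ε) , λ k hk → ∣-∣≤⇒≤+ (≡.subst (ℚ._≤ ε) (∣-∣-sym (seq x k) (seq y k)) (proj₂ (h ε 0<ε) k hk)))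

  exp-+ : ∀ x y → exp x * exp y ≈ exp (x + y)
  exp-+ x y = ≈-close {exp x * exp y} {exp (x + y)} (go (boundedℕ {seq x} (cauchy x)) (boundedℕ {seq y} (cauchy y)))
    where
    go : ∃[ B ] ∃[ N ] (∀ k → N ℕ.≤ k → ∣ seq x k ∣ ℚ.≤ ι (suc B)) → ∃[ B ] ∃[ N ] (∀ k → N ℕ.≤ k → ∣ seq y k ∣ ℚ.≤ ι (suc B)) →
         ∀ ε → 0ℚ ℚ.< ε → ∃[ N ] (∀ k → N ℕ.≤ k → ∣ seq (exp x * exp y) k ℚ.- seq (exp (x + y)) k ∣ ℚ.≤ ε)
    go (B , N , f) (B′ , N′ , g) ε 0<ε = N ℕ.⊔ N′ ℕ.⊔ M , λ k hk →
      let h₁ = ℕₚ.m⊔n≤o⇒m≤o (N ℕ.⊔ N′) M hk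
          h₂ = ℕₚ.m⊔n≤o⇒n≤o (N ℕ.⊔ N′) M hk
      in ℚₚ.≤-trans (exp-product-error (suc B) (suc B′) (seq x k) (seq y k) (f k (ℕₚ.m⊔n≤o⇒m≤o N N′ h₁)) (g k (ℕₚ.m⊔n≤o⇒n≤o N N′ h₁)) k)
           (ℚₚ.≤-trans (p≤∣p∣ _) (proj₂ Q (k ℕ.+ k) k (ℕₚ.≤-trans h₂ (ℕₚ.m≤m+n k k)) h₂))
      where
      Q = ExpSeries.S-cauchy (suc B ℕ.+ suc B′) ε 0<ε
      M = proj₁ Q

  exp-cong : ∀ {x y} → x ≈ y → exp x ≈ exp y
  exp-cong {x} {y} (x≤y , y≤x) = ≈-close {exp x} {exp y} (go (boundedℕ {seq x} (cauchy x)) (boundedℕ {seq y} (cauchy y)))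
    where
    open ℚₚ.≤-Reasoning
    go : ∃[ B ] ∃[ N ] (∀ k → N ℕ.≤ k → ∣ seq x k ∣ ℚ.≤ ι (suc B)) → ∃[ B ] ∃[ N ] (∀ k → N ℕ.≤ k → ∣ seq y k ∣ ℚ.≤ ι (suc B)) →
         ∀ ε → 0ℚ ℚ.< ε → ∃[ N ] (∀ k → N ℕ.≤ k → ∣ seq (exp x) k ℚ.- seq (exp y) k ∣ ℚ.≤ ε)
    go (B , N , f) (B′ , N′ , g) = go′ (bounded {ExpSeries.S b} (ExpSeries.S-cauchy b))
      where
      b : ℕ
      b = suc B ℕ.+ suc B′
      go′ : ∃[ Q ] (0ℚ ℚ.< Q × ∃[ N ] (∀ k → N ℕ.≤ k → ∣ ExpSeries.S b k ∣ ℚ.≤ Q)) →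
            ∀ ε → 0ℚ ℚ.< ε → ∃[ N ] (∀ k → N ℕ.≤ k → ∣ seq (exp x) k ℚ.- seq (exp y) k ∣ ℚ.≤ ε)
      go′ (Q , 0<Q , N″ , s) ε 0<ε = N ℕ.⊔ N′ ℕ.⊔ N″ ℕ.⊔ (proj₁ X ℕ.⊔ proj₁ Y) , bound
        where
        δ = 1/⁺ Q 0<Q ℚ.* ε
        0<δ : 0ℚ ℚ.< δ
        0<δ = 0<* (0<1/⁺ Q 0<Q) 0<ε
        X = ≤⇒≲ {x} {y} x≤y δ 0<δ
        Y = ≤⇒≲ {y} {x} y≤x δ 0<δ
        close : ∀ a b → a ℚ.≤ b ℚ.+ δ → a ℚ.- b ℚ.≤ δ
        close a b le = 0≤-⇒≤ (≡.subst (0ℚ ℚ.≤_) (solve 3 (λ a b d → (b :+ d) :- a := d :- (a :- b)) ≡.refl a b δ) (≤⇒0≤- le))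
        bound : ∀ k → N ℕ.⊔ N′ ℕ.⊔ N″ ℕ.⊔ (proj₁ X ℕ.⊔ proj₁ Y) ℕ.≤ k → ∣ expSum (seq x k) k ℚ.- expSum (seq y k) k ∣ ℚ.≤ ε
        bound k hk = begin
          ∣ expSum (seq x k) k ℚ.- expSum (seq y k) k ∣  ≤⟨ ExpSeries.expSum-lipschitz b (seq x k) (seq y k)
              (ℚₚ.≤-trans (f k (ℕₚ.m⊔n≤o⇒m≤o N N′ (ℕₚ.m⊔n≤o⇒m≤o (N ℕ.⊔ N′) N″ h₁))) (ι-mono (ℕₚ.m≤m+n (suc B) (suc B′))))
              (ℚₚ.≤-trans (g k (ℕₚ.m⊔n≤o⇒n≤o N N′ (ℕₚ.m⊔n≤o⇒m≤o (N ℕ.⊔ N′) N″ h₁))) (ι-mono (ℕₚ.m≤n+m (suc B′) (suc B)))) k ⟩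
          ExpSeries.S b k ℚ.* ∣ seq x k ℚ.- seq y k ∣  ≤⟨ *-monoˡ (ℚₚ.0≤∣p∣ _) (ℚₚ.≤-trans (p≤∣p∣ _) (s k (ℕₚ.m⊔n≤o⇒n≤o (N ℕ.⊔ N′) N″ h₁))) ⟩
          Q ℚ.* ∣ seq x k ℚ.- seq y k ∣  ≤⟨ *-monoʳ (ℚₚ.<⇒≤ 0<Q) (∣∣-≤ (close (seq x k) (seq y k) (proj₂ X k (ℕₚ.m⊔n≤o⇒m≤o (proj₁ X) _ h₂)))
                                                                      (≡.subst (ℚ._≤ δ) (≡.sym (-‿flip (seq x k) (seq y k))) (close (seq y k) (seq x k) (proj₂ Y k (ℕₚ.m⊔n≤o⇒n≤o (proj₁ X) _ h₂))))) ⟩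
          Q ℚ.* δ  ≡⟨ ≡.trans (≡.sym (ℚₚ.*-assoc Q (1/⁺ Q 0<Q) ε)) (≡.trans (≡.cong (ℚ._* ε) (*-1/⁺ Q 0<Q)) (ℚₚ.*-identityˡ ε)) ⟩
          ε                                                      ∎
          where
          h₁ = ℕₚ.m⊔n≤o⇒m≤o (N ℕ.⊔ N′ ℕ.⊔ N″) _ hk
          h₂ = ℕₚ.m⊔n≤o⇒n≤o (N ℕ.⊔ N′ ℕ.⊔ N″) _ hk

  0≤expTerm : ∀ {q} → 0ℚ ℚ.≤ q → ∀ i → 0ℚ ℚ.≤ expTerm q i
  0≤expTerm 0≤q zero    = 0≤1
  0≤expTerm 0≤q (suc i) = 0≤* (0≤expTerm 0≤q i) (0≤* 0≤q (0≤recip i))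

  expTerm-1 : ∀ q → expTerm q 1 ≡ q
  expTerm-1 q = ≡.trans (ℚₚ.*-identityˡ _) (ℚₚ.*-identityʳ q)

  1+q≤expSum : ∀ {q} → 0ℚ ℚ.≤ q → ∀ k → 1ℚ ℚ.+ q ℚ.≤ expSum q (suc k)
  1+q≤expSum {q} 0≤q zero    = ℚₚ.≤-reflexive (≡.cong (1ℚ ℚ.+_) (≡.sym (expTerm-1 q)))
  1+q≤expSum     0≤q (suc k) = ℚₚ.≤-trans (1+q≤expSum 0≤q k) (p≤p+q (0≤expTerm 0≤q (suc (suc k))))

  -- For 0 ≤ q ≤ ½ each term of the series is at most half of the previous one.
  expSum≤1+2q : ∀ {q} → 0ℚ ℚ.≤ q → q ℚ.≤ ½ → ∀ k → expSum q k ℚ.≤ 1ℚ ℚ.+ (q ℚ.+ q)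
  expSum≤1+2q {q} 0≤q q≤½ zero    = p≤p+q (ℚₚ.≤-trans 0≤q (p≤p+q 0≤q))
  expSum≤1+2q {q} 0≤q q≤½ (suc k) = ℚₚ.≤-trans (p≤p+q (0≤expTerm 0≤q (suc k))) (go k)
    where
    open ℚₚ.≤-Reasoning
    halve : ∀ i → expTerm q (suc i) ℚ.+ expTerm q (suc i) ℚ.≤ expTerm q i
    halve i = begin
      t ℚ.* (q ℚ.* recip i) ℚ.+ t ℚ.* (q ℚ.* recip i)  ≡⟨ solve 3 (λ t q r → t :* (q :* r) :+ t :* (q :* r) := t :* (r :* (q :+ q))) ≡.refl t q (recip i) ⟩
      t ℚ.* (recip i ℚ.* (q ℚ.+ q))  ≤⟨ *-monoʳ (0≤expTerm 0≤q i) (*-mono (0≤recip i) 0≤1 recip≤1 (ℚₚ.+-mono-≤ q≤½ q≤½)) ⟩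
      t ℚ.* (1ℚ ℚ.* 1ℚ)                                 ≡⟨ ℚₚ.*-identityʳ t ⟩
      t                                                 ∎
      where
      t = expTerm q i
      recip≤1 : recip i ℚ.≤ 1ℚ
      recip≤1 = begin
        recip i                      ≡⟨ ℚₚ.*-identityˡ (recip i) ⟨
        1ℚ ℚ.* recip i               ≤⟨ *-monoˡ (0≤recip i) (ι-mono {1} {suc i} (s≤s z≤n)) ⟩
        ι (suc i) ℚ.* recip i        ≡⟨ ι*recip i ⟩
        1ℚ                           ∎
    go : ∀ k → expSum q (suc k) ℚ.+ expTerm q (suc k) ℚ.≤ 1ℚ ℚ.+ (q ℚ.+ q)
    go zero    = ℚₚ.≤-reflexive (≡.trans (≡.cong (λ z → 1ℚ ℚ.+ z ℚ.+ z) (expTerm-1 q)) (ℚₚ.+-assoc 1ℚ q q))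
    go (suc k) = begin
      expSum q (suc k) ℚ.+ t ℚ.+ t                ≡⟨ ℚₚ.+-assoc (expSum q (suc k)) t t ⟩
      expSum q (suc k) ℚ.+ (t ℚ.+ t)              ≤⟨ ℚₚ.+-monoʳ-≤ (expSum q (suc k)) (halve (suc k)) ⟩
      expSum q (suc k) ℚ.+ expTerm q (suc k)      ≤⟨ go k ⟩
      1ℚ ℚ.+ (q ℚ.+ q)                            ∎
      where t = expTerm q (suc (suc k))

  exp-rational-≤ : ∀ {q} → 0ℚ ℚ.≤ q → q ℚ.≤ ½ → exp (fromℚ q) ≤ fromℚ (1ℚ ℚ.+ (q ℚ.+ q))
  exp-rational-≤ {q} 0≤q q≤½ = ≤-pointwise {exp (fromℚ q)} {fromℚ (1ℚ ℚ.+ (q ℚ.+ q))} 0 λ k _ → expSum≤1+2q 0≤q q≤½ k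

  neg-involutive : ∀ q → ℚ.- (ℚ.- q) ≡ q
  neg-involutive = solve 1 (λ q → :- (:- q) := q) ≡.refl

  1+x≤exp : ∀ {x} → 0ℝ ≤ x → 1ℝ + x ≤ exp x
  1+x≤exp {x} 0≤x = ≤-trans {1ℝ + x} {1ℝ + x⁺} {exp x} (+-mono-≤ {1ℝ} {1ℝ} {x} {x⁺} (≤-refl {1ℝ}) (proj₁ x≈x⁺))
    (≤-trans {1ℝ + x⁺} {exp x⁺} {exp x} (≤-pointwise {1ℝ + x⁺} {exp x⁺} 1 λ where (suc k) _ → 1+q≤expSum (0≤x⁺ (suc k)) k)
      (proj₂ (exp-cong {x} {x⁺} x≈x⁺)))
    where
    -- The maximum of `x` and 0, expressed through `⊓`. A nonnegative real may have negative terms,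
    -- but the termwise estimate needs nonnegative ones.
    x⁺ : ℝ
    x⁺ = - ((- x) ⊓ 0ℝ)
    0≤x⁺ : ∀ k → 0ℚ ℚ.≤ seq x⁺ k
    0≤x⁺ k = ℚₚ.neg-antimono-≤ (ℚₚ.p⊓q≤q (ℚ.- seq x k) 0ℚ)
    -x≤0 : - x ≤ 0ℝ
    -x≤0 = 0≤y-x⇒x≤y {(- x)} {0ℝ} (≤-trans {0ℝ} {x} {0ℝ - (- x)} 0≤x (≤-pointwise {x} {0ℝ - (- x)} 0 λ k _ →
      ℚₚ.≤-reflexive (solve 1 (λ x → x := con 0ℚ :- (:- x)) ≡.refl (seq x k))))
    x≈x⁺ : x ≈ x⁺
    x≈x⁺ = ≤-pointwise {x} {x⁺} 0 (λ k _ → ≡.subst (ℚ._≤ seq x⁺ k) (neg-involutive (seq x k)) (ℚₚ.neg-antimono-≤ (ℚₚ.p⊓q≤p (ℚ.- seq x k) 0ℚ)))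
         , ≲⇒≤ {x⁺} {x} λ ε 0<ε → let N , f = ≤⇒≲ {(- x)} {0ℝ} -x≤0 ε 0<ε in N , λ k hk → small k ε 0<ε (f k hk)
      where
      small : ∀ k ε → 0ℚ ℚ.< ε → ℚ.- seq x k ℚ.≤ 0ℚ ℚ.+ ε → seq x⁺ k ℚ.≤ seq x k ℚ.+ ε
      small k ε 0<ε le = go (ℚₚ.⊓-sel (ℚ.- seq x k) 0ℚ)
        where
        go : (ℚ.- seq x k) ℚ.⊓ 0ℚ ≡ ℚ.- seq x k ⊎ (ℚ.- seq x k) ℚ.⊓ 0ℚ ≡ 0ℚ → seq x⁺ k ℚ.≤ seq x k ℚ.+ ε
        go (inj₁ e) = ≡.subst (ℚ._≤ seq x k ℚ.+ ε) (≡.sym (≡.trans (≡.cong ℚ.-_ e) (neg-involutive (seq x k)))) (p≤p+q (ℚₚ.<⇒≤ 0<ε))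
        go (inj₂ e) = ≡.subst (ℚ._≤ seq x k ℚ.+ ε) (≡.sym (≡.cong ℚ.-_ e)) (0≤-⇒≤ (≡.subst (0ℚ ℚ.≤_)
          (solve 2 (λ x e → (con 0ℚ :+ e) :- (:- x) := (x :+ e) :- con 0ℚ) ≡.refl (seq x k) ε) (≤⇒0≤- le)))

-- The reals as an ordered ring with a solver

module Reals where

  open D using (ℝ; seq; cauchy; ι; recip)
  open D.CauchyLemmas

  infix 4 _⊑_ _≋_ _⊏_

  -- Record versions of the relations on ℝ: unlike the negations and existentials that they
  -- wrap, they let the two reals be inferred from a proof.

  record _⊑_ (x y : ℝ) : Set where
    constructor ⊑⟨_⟩
    field get : x D.≤ y

  record _≋_ (x y : ℝ) : Set where
    constructor ≋⟨_⟩
    field get : x D.≈ y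

  record _⊏_ (x y : ℝ) : Set where
    constructor ⊏⟨_⟩
    field get : x D.< y

  ⊑-refl : ∀ {x} → x ⊑ x
  ⊑-refl {x} = ⊑⟨ CauchyReals.≤-refl {x} ⟩

  ⊑-trans : ∀ {x y z} → x ⊑ y → y ⊑ z → x ⊑ z
  ⊑-trans {x} {y} {z} ⊑⟨ h ⟩ ⊑⟨ g ⟩ = ⊑⟨ CauchyReals.≤-trans {x} {y} {z} h g ⟩

  ≋⇒⊑ : ∀ {x y} → x ≋ y → x ⊑ y
  ≋⇒⊑ ≋⟨ h ⟩ = ⊑⟨ proj₁ h ⟩

  ≋-refl : ∀ {x} → x ≋ x
  ≋-refl {x} = ≋⟨ CauchyReals.≈-refl {x} ⟩

  ≋-sym : ∀ {x y} → x ≋ y → y ≋ x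
  ≋-sym ≋⟨ h ⟩ = ≋⟨ Product.swap h ⟩

  ≋-trans : ∀ {x y z} → x ≋ y → y ≋ z → x ≋ z
  ≋-trans {x} {y} {z} ≋⟨ h ⟩ ≋⟨ g ⟩ = ≋⟨ CauchyReals.≈-trans {x} {y} {z} h g ⟩

  ⊑-antisym : ∀ {x y} → x ⊑ y → y ⊑ x → x ≋ y
  ⊑-antisym ⊑⟨ h ⟩ ⊑⟨ g ⟩ = ≋⟨ h , g ⟩

  ℝ-poset : Poset 0ℓ 0ℓ 0ℓ
  ℝ-poset = record
    { Carrier = ℝ ; _≈_ = _≋_ ; _≤_ = _⊑_
    ; isPartialOrder = record
      { isPreorder = record
        { isEquivalence = record { refl = ≋-refl ; sym = ≋-sym ; trans = ≋-trans }
        ; reflexive = ≋⇒⊑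
        ; trans = ⊑-trans }
      ; antisym = ⊑-antisym } }

  module ℝ-Reasoning = PartialOrderReasoning ℝ-poset

  ⊏⇒⊑ : ∀ {x y} → x ⊏ y → x ⊑ y
  ⊏⇒⊑ {x} {y} ⊏⟨ h ⟩ = ⊑⟨ CauchyReals.<⇒≤ {x} {y} h ⟩

  ⊏-⊑-trans : ∀ {x y z} → x ⊏ y → y ⊑ z → x ⊏ z
  ⊏-⊑-trans {x} {y} {z} ⊏⟨ h ⟩ ⊑⟨ g ⟩ = ⊏⟨ CauchyReals.<-≤-trans {x} {y} {z} h g ⟩

  ⊑-⊏-trans : ∀ {x y z} → x ⊑ y → y ⊏ z → x ⊏ z
  ⊑-⊏-trans {x} {y} {z} ⊑⟨ h ⟩ ⊏⟨ g ⟩ = ⊏⟨ CauchyReals.≤-<-trans {x} {y} {z} h g ⟩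

  ⊏⇒¬⊒ : ∀ {x y} → x ⊏ y → ¬ y ⊑ x
  ⊏⇒¬⊒ ⊏⟨ h ⟩ ⊑⟨ g ⟩ = g h

  ¬⊏⇒⊒ : ∀ {x y} → ¬ x ⊏ y → y ⊑ x
  ¬⊏⇒⊒ h = ⊑⟨ (λ g → h ⊏⟨ g ⟩) ⟩

  ⊑-stable : ∀ {x y} → ¬ ¬ (x ⊑ y) → x ⊑ y
  ⊑-stable h = ¬⊏⇒⊒ λ y<x → h (⊏⇒¬⊒ y<x)

  infix  8 -_
  infixr 8 _^_
  infixl 7 _*_
  infixl 6 _+_ _-_

  -- The operations are made opaque: otherwise unification unfolds them to Cauchy sequences.

  opaque

    _+_ _*_ : ℝ → ℝ → ℝ
    _+_ = D._+_
    _*_ = D._*_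

    -_ exp : ℝ → ℝ
    -_  = D.-_
    exp = D.exp

    fromℚ : ℚ → ℝ
    fromℚ = D.fromℚ

  _-_ : ℝ → ℝ → ℝ
  x - y = x + - y

  _^_ : ℝ → ℕ → ℝ
  x ^ zero  = fromℚ 1ℚ
  x ^ suc k = x * x ^ k

  fromℕ : ℕ → ℝ
  fromℕ n = fromℚ (ι n)

  0ℝ 1ℝ : ℝ
  0ℝ = fromℚ 0ℚ
  1ℝ = fromℚ 1ℚ

  opaque
    unfolding _+_

    private
      pw : ∀ {x y} → (∀ k → seq x k ≡ seq y k) → x ≋ y
      pw {x} {y} h = ≋⟨ CauchyReals.≈-pointwise {x} {y} h ⟩

    ⊑-+ : ∀ {w x y z} → w ⊑ x → y ⊑ z → w + y ⊑ x + z
    ⊑-+ {w} {x} {y} {z} ⊑⟨ h ⟩ ⊑⟨ g ⟩ = ⊑⟨ CauchyReals.+-mono-≤ {w} {x} {y} {z} h g ⟩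

    ⊏-+ : ∀ {w x y z} → w ⊏ x → y ⊑ z → w + y ⊏ x + z
    ⊏-+ {w} {x} {y} {z} ⊏⟨ h ⟩ ⊑⟨ g ⟩ = ⊏⟨ CauchyReals.+-mono-<-≤ {w} {x} {y} {z} h g ⟩

    ≋-* : ∀ {w x y z} → w ≋ x → y ≋ z → w * y ≋ x * z
    ≋-* {w} {x} {y} {z} ≋⟨ h ⟩ ≋⟨ g ⟩ = ≋⟨ CauchyReals.*-cong {w} {x} {y} {z} h g ⟩

    0⊑* : ∀ {x y} → 0ℝ ⊑ x → 0ℝ ⊑ y → 0ℝ ⊑ x * y
    0⊑* {x} {y} ⊑⟨ h ⟩ ⊑⟨ g ⟩ = ⊑⟨ CauchyReals.0≤x*y {x} {y} h g ⟩

    ⊑-*ˡ : ∀ {x y z} → 0ℝ ⊑ z → x ⊑ y → z * x ⊑ z * y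
    ⊑-*ˡ {x} {y} {z} ⊑⟨ h ⟩ ⊑⟨ g ⟩ = ⊑⟨ CauchyReals.*-monoʳ-≤ {x} {y} {z} h g ⟩

    ⊏-*ˡ : ∀ {x y z} → 0ℝ ⊏ z → x ⊏ y → z * x ⊏ z * y
    ⊏-*ˡ {x} {y} {z} ⊏⟨ h ⟩ ⊏⟨ g ⟩ = ⊏⟨ CauchyReals.*-monoʳ-< {x} {y} {z} h g ⟩

    ⊑⇒0⊑- : ∀ {x y} → x ⊑ y → 0ℝ ⊑ y - x
    ⊑⇒0⊑- {x} {y} ⊑⟨ h ⟩ = ⊑⟨ CauchyReals.x≤y⇒0≤y-x {x} {y} h ⟩

    0⊑-⇒⊑ : ∀ {x y} → 0ℝ ⊑ y - x → x ⊑ y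
    0⊑-⇒⊑ {x} {y} ⊑⟨ h ⟩ = ⊑⟨ CauchyReals.0≤y-x⇒x≤y {x} {y} h ⟩

    +-assoc : ∀ x y z → (x + y) + z ≋ x + (y + z)
    +-assoc x y z = pw {(x + y) + z} {x + (y + z)} λ k → ℚₚ.+-assoc (seq x k) (seq y k) (seq z k)

    +-comm : ∀ x y → x + y ≋ y + x
    +-comm x y = pw {x + y} {y + x} λ k → ℚₚ.+-comm (seq x k) (seq y k)

    +-identityˡ : ∀ x → 0ℝ + x ≋ x
    +-identityˡ x = pw {0ℝ + x} {x} λ k → ℚₚ.+-identityˡ (seq x k)

    +-inverseʳ : ∀ x → x + - x ≋ 0ℝ
    +-inverseʳ x = pw {x + - x} {0ℝ} λ k → ℚₚ.+-inverseʳ (seq x k)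

    *-assoc : ∀ x y z → (x * y) * z ≋ x * (y * z)
    *-assoc x y z = pw {(x * y) * z} {x * (y * z)} λ k → ℚₚ.*-assoc (seq x k) (seq y k) (seq z k)

    *-comm : ∀ x y → x * y ≋ y * x
    *-comm x y = pw {x * y} {y * x} λ k → ℚₚ.*-comm (seq x k) (seq y k)

    *-identityˡ : ∀ x → 1ℝ * x ≋ x
    *-identityˡ x = pw {1ℝ * x} {x} λ k → ℚₚ.*-identityˡ (seq x k)

    *-distribˡ-+ : ∀ x y z → x * (y + z) ≋ x * y + x * z
    *-distribˡ-+ x y z = pw {x * (y + z)} {x * y + x * z} λ k → ℚₚ.*-distribˡ-+ (seq x k) (seq y k) (seq z k)

    fromℚ-+ : ∀ p q → fromℚ (p ℚ.+ q) ≋ fromℚ p + fromℚ q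
    fromℚ-+ p q = pw {fromℚ (p ℚ.+ q)} {fromℚ p + fromℚ q} λ _ → ≡.refl

    fromℚ-* : ∀ p q → fromℚ (p ℚ.* q) ≋ fromℚ p * fromℚ q
    fromℚ-* p q = pw {fromℚ (p ℚ.* q)} {fromℚ p * fromℚ q} λ _ → ≡.refl

    fromℚ-neg : ∀ p → fromℚ (ℚ.- p) ≋ - fromℚ p
    fromℚ-neg p = pw {fromℚ (ℚ.- p)} { - fromℚ p} λ _ → ≡.refl

    fromℚ-mono : ∀ {p q} → p ℚ.≤ q → fromℚ p ⊑ fromℚ q
    fromℚ-mono {p} {q} h = ⊑⟨ CauchyReals.≤-pointwise {fromℚ p} {fromℚ q} 0 (λ _ _ → h) ⟩

    fromℚ-⊏ : ∀ {p} → 0ℚ ℚ.< p → 0ℝ ⊏ fromℚ p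
    fromℚ-⊏ {p} h = ⊏⟨ p , h , 0 , (λ _ _ → ℚₚ.≤-reflexive (ℚₚ.+-identityˡ p)) ⟩

    fromℕ-suc-⊏ : ∀ n → fromℕ n ⊏ fromℕ (suc n)
    fromℕ-suc-⊏ n = ⊏⟨ 1ℚ , 0<1 , 0 , (λ _ _ → ℚₚ.≤-reflexive (≡.trans (ℚₚ.+-comm (ι n) 1ℚ) (≡.sym (ι-suc n)))) ⟩

    archimedean-ℝ : ∀ x {y} → 0ℝ ⊏ y → ∃[ p ] (x ⊏ fromℕ p * y)
    archimedean-ℝ x {y} ⊏⟨ ε , 0<ε , N , f ⟩ = go (boundedℕ {seq x} (cauchy x))
      where
      go : ∃[ B ] ∃[ M ] (∀ k → M ℕ.≤ k → ∣ seq x k ∣ ℚ.≤ ι (suc B)) → ∃[ p ] (x ⊏ fromℕ p * y)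
      go (B , M , g) = p , ⊏⟨ 1ℚ , 0<1 , N ℕ.⊔ M , (λ k hk → begin
          seq x k ℚ.+ 1ℚ  ≤⟨ ℚₚ.+-monoˡ-≤ 1ℚ (ℚₚ.≤-trans (p≤∣p∣ (seq x k)) (g k (ℕₚ.m⊔n≤o⇒n≤o N M hk))) ⟩
          ι (suc B) ℚ.+ 1ℚ            ≤⟨ proj₂ (archimedean* (ι (suc B) ℚ.+ 1ℚ) ε 0<ε) ⟩
          ι p ℚ.* ε  ≤⟨ *-monoʳ (0≤ι p) (≡.subst (ℚ._≤ seq y k) (ℚₚ.+-identityˡ ε) (f k (ℕₚ.m⊔n≤o⇒m≤o N M hk))) ⟩
          ι p ℚ.* seq y k             ∎) ⟩
        where
        open ℚₚ.≤-Reasoning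
        p : ℕ
        p = proj₁ (archimedean* (ι (suc B) ℚ.+ 1ℚ) ε 0<ε)

    exp-+ : ∀ x y → exp x * exp y ≋ exp (x + y)
    exp-+ x y = ≋⟨ CauchyReals.exp-+ x y ⟩

    exp-cong : ∀ {x y} → x ≋ y → exp x ≋ exp y
    exp-cong {x} {y} ≋⟨ h ⟩ = ≋⟨ CauchyReals.exp-cong {x} {y} h ⟩

    1+x⊑exp : ∀ {x} → 0ℝ ⊑ x → 1ℝ + x ⊑ exp x
    1+x⊑exp {x} ⊑⟨ h ⟩ = ⊑⟨ CauchyReals.1+x≤exp {x} h ⟩

    exp-rational-⊑ : ∀ {q} → 0ℚ ℚ.≤ q → q ℚ.≤ ½ → exp (fromℚ q) ⊑ fromℚ (1ℚ ℚ.+ (q ℚ.+ q))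
    exp-rational-⊑ h g = ⊑⟨ CauchyReals.exp-rational-≤ h g ⟩

  ≋-+ : ∀ {w x y z} → w ≋ x → y ≋ z → w + y ≋ x + z
  ≋-+ h g = ⊑-antisym (⊑-+ (≋⇒⊑ h) (≋⇒⊑ g)) (⊑-+ (≋⇒⊑ (≋-sym h)) (≋⇒⊑ (≋-sym g)))

  *-identityʳ : ∀ x → x * 1ℝ ≋ x
  *-identityʳ x = ≋-trans (*-comm x 1ℝ) (*-identityˡ x)

  +-identityʳ : ∀ x → x + 0ℝ ≋ x
  +-identityʳ x = ≋-trans (+-comm x 0ℝ) (+-identityˡ x)

  +-inverseˡ : ∀ x → - x + x ≋ 0ℝ
  +-inverseˡ x = ≋-trans (+-comm (- x) x) (+-inverseʳ x)

  *-distribʳ-+ : ∀ x y z → (y + z) * x ≋ y * x + z * x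
  *-distribʳ-+ x y z = ≋-trans (*-comm (y + z) x) (≋-trans (*-distribˡ-+ x y z) (≋-+ (*-comm x y) (*-comm x z)))

  -‿cong : ∀ {x y} → x ≋ y → - x ≋ - y
  -‿cong {x} {y} h = ≋-trans (≋-sym (+-identityʳ (- x))) (≋-trans (≋-+ ≋-refl (≋-sym (+-inverseʳ y)))
    (≋-trans (≋-sym (+-assoc (- x) y (- y))) (≋-trans (≋-+ (≋-trans (≋-+ ≋-refl (≋-sym h)) (+-inverseˡ x)) ≋-refl) (+-identityˡ (- y)))))

  ℝ-commutativeRing : CommutativeRing 0ℓ 0ℓ
  ℝ-commutativeRing = record
    { Carrier = ℝ ; _≈_ = _≋_ ; _+_ = _+_ ; _*_ = _*_ ; -_ = -_ ; 0# = 0ℝ ; 1# = 1ℝ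
    ; isCommutativeRing = record
      { isRing = record
        { +-isAbelianGroup = record
          { isGroup = record
            { isMonoid = record
              { isSemigroup = record
                { isMagma = record
                  { isEquivalence = record { refl = ≋-refl ; sym = ≋-sym ; trans = ≋-trans }
                  ; ∙-cong = ≋-+ }
                ; assoc = +-assoc }
              ; identity = +-identityˡ , +-identityʳ }
            ; inverse = +-inverseˡ , +-inverseʳ
            ; ⁻¹-cong = -‿cong }
          ; comm = +-comm }
        ; *-cong = ≋-*
        ; *-assoc = *-assoc
        ; *-identity = *-identityˡ , *-identityʳ
        ; distrib = *-distribˡ-+ , *-distribʳ-+ }
      ; *-comm = *-comm } }

  module ℝ-Solver where

    ring : ACR.AlmostCommutativeRing 0ℓ 0ℓ
    ring = ACR.fromCommutativeRing ℝ-commutativeRing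

    embedding : ℚₚ.+-*-rawRing ACR.-Raw-AlmostCommutative⟶ ring
    embedding = record
      { ⟦_⟧ = fromℚ ; +-homo = fromℚ-+ ; *-homo = fromℚ-* ; -‿homo = fromℚ-neg ; 0-homo = ≋-refl ; 1-homo = ≋-refl }

    coefficient≟ : ∀ p q → Maybe (fromℚ p ≋ fromℚ q)
    coefficient≟ p q with p ℚₚ.≟ q
    ... | yes ≡.refl = just ≋-refl
    ... | no _       = nothing

    open RingSolver ℚₚ.+-*-rawRing ring embedding coefficient≟ public
      using (solve; _:=_; _:+_; _:*_; _:-_; con; Polynomial)

    infixr 9 _:^_

    _:^_ : ∀ {n} → Polynomial n → ℕ → Polynomial n
    p :^ zero  = con 1ℚ
    p :^ suc k = p :* p :^ k

  open ℝ-Solver using (solve; _:=_; _:+_; _:*_; _:-_; con)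

  ⊑-*ʳ : ∀ {x y z} → 0ℝ ⊑ z → x ⊑ y → x * z ⊑ y * z
  ⊑-*ʳ {x} {y} {z} h g = ⊑-trans (≋⇒⊑ (*-comm x z)) (⊑-trans (⊑-*ˡ h g) (≋⇒⊑ (*-comm z y)))

  ⊑-* : ∀ {w x y z} → 0ℝ ⊑ w → 0ℝ ⊑ y → w ⊑ x → y ⊑ z → w * y ⊑ x * z
  ⊑-* 0⊑w 0⊑y h g = ⊑-trans (⊑-*ˡ 0⊑w g) (⊑-*ʳ (⊑-trans 0⊑y g) h)

  ⊑-cancelˡ : ∀ {x y z} → 0ℝ ⊏ z → z * x ⊑ z * y → x ⊑ y
  ⊑-cancelˡ 0<z h = ¬⊏⇒⊒ λ y<x → ⊏⇒¬⊒ (⊏-*ˡ 0<z y<x) h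

  x⊑x+y : ∀ {x y} → 0ℝ ⊑ y → x ⊑ x + y
  x⊑x+y {x} h = ⊑-trans (≋⇒⊑ (≋-sym (+-identityʳ x))) (⊑-+ ⊑-refl h)

  ⊑-+⇒-⊑ : ∀ {x y z} → x ⊑ y + z → x - y ⊑ z
  ⊑-+⇒-⊑ {x} {y} {z} h = 0⊑-⇒⊑ (⊑-trans (⊑⇒0⊑- h) (≋⇒⊑ (solve 3 (λ x y z → (y :+ z) :- x := z :- (x :- y)) ≋-refl x y z)))

  ⊏⇒0⊏- : ∀ {x y} → x ⊏ y → 0ℝ ⊏ y - x
  ⊏⇒0⊏- {x} {y} h = ⊑-⊏-trans (≋⇒⊑ (≋-sym (+-inverseʳ x))) (⊏-+ h ⊑-refl)

  0⊏1 : 0ℝ ⊏ 1ℝ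
  0⊏1 = fromℕ-suc-⊏ 0

  0⊑1 : 0ℝ ⊑ 1ℝ
  0⊑1 = ⊏⇒⊑ 0⊏1

  0⊏* : ∀ {x y} → 0ℝ ⊏ x → 0ℝ ⊏ y → 0ℝ ⊏ x * y
  0⊏* {x} {y} h g = ⊑-⊏-trans (≋⇒⊑ (solve 1 (λ x → con 0ℚ := x :* con 0ℚ) ≋-refl x)) (⊏-*ˡ h g)

  ^-nonneg : ∀ {x} n → 0ℝ ⊑ x → 0ℝ ⊑ x ^ n
  ^-nonneg zero    h = 0⊑1
  ^-nonneg (suc n) h = 0⊑* h (^-nonneg n h)

  ^-pos : ∀ {x} n → 0ℝ ⊏ x → 0ℝ ⊏ x ^ n
  ^-pos zero    h = 0⊏1
  ^-pos (suc n) h = 0⊏* h (^-pos n h)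

  ^-mono-⊑ : ∀ {x y} n → 0ℝ ⊑ x → x ⊑ y → x ^ n ⊑ y ^ n
  ^-mono-⊑ zero    0⊑x h = ⊑-refl
  ^-mono-⊑ (suc n) 0⊑x h = ⊑-* 0⊑x (^-nonneg n 0⊑x) h (^-mono-⊑ n 0⊑x h)

  ^-cancel-⊑ : ∀ {x y} n → 0ℝ ⊑ y → x ^ suc n ⊑ y ^ suc n → x ⊑ y
  ^-cancel-⊑ {x} {y} n 0⊑y h = ¬⊏⇒⊒ λ y<x → ⊏⇒¬⊒ (strict y<x) h
    where
    strict : y ⊏ x → y ^ suc n ⊏ x ^ suc n
    strict y<x = ⊑-⊏-trans (⊑-*ˡ 0⊑y (^-mono-⊑ n 0⊑y (⊏⇒⊑ y<x)))
      (⊑-⊏-trans (≋⇒⊑ (*-comm y (x ^ n))) (⊏-⊑-trans (⊏-*ˡ (^-pos n (⊑-⊏-trans 0⊑y y<x)) y<x) (≋⇒⊑ (*-comm (x ^ n) x))))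

  ^-cong : ∀ {x y} n → x ≋ y → x ^ n ≋ y ^ n
  ^-cong zero    h = ≋-refl
  ^-cong (suc n) h = ≋-* h (^-cong n h)

  ^-distrib-* : ∀ x y n → (x * y) ^ n ≋ x ^ n * y ^ n
  ^-distrib-* x y zero    = ≋-sym (*-identityˡ 1ℝ)
  ^-distrib-* x y (suc n) = ≋-trans (≋-* ≋-refl (^-distrib-* x y n))
    (solve 4 (λ x y a b → (x :* y) :* (a :* b) := (x :* a) :* (y :* b)) ≋-refl x y (x ^ n) (y ^ n))

  fromℕ-+ : ∀ a b → fromℕ (a ℕ.+ b) ≋ fromℕ a + fromℕ b
  fromℕ-+ a b = ≡.subst (λ q → fromℚ q ≋ fromℕ a + fromℕ b) (≡.sym (CauchyReals.ι-+ a b)) (fromℚ-+ (ι a) (ι b))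

  fromℕ-suc : ∀ n → fromℕ (suc n) ≋ 1ℝ + fromℕ n
  fromℕ-suc n = fromℕ-+ 1 n

  fromℕ-* : ∀ a b → fromℕ (a ℕ.* b) ≋ fromℕ a * fromℕ b
  fromℕ-* zero    b = solve 1 (λ b → con 0ℚ := con 0ℚ :* b) ≋-refl (fromℕ b)
  fromℕ-* (suc a) b = ≋-trans (fromℕ-+ b (a ℕ.* b)) (≋-trans (≋-+ ≋-refl (fromℕ-* a b))
    (≋-trans (solve 2 (λ a b → b :+ a :* b := (con 1ℚ :+ a) :* b) ≋-refl (fromℕ a) (fromℕ b)) (≋-* (≋-sym (fromℕ-suc a)) ≋-refl)))

  fromℕ-^ : ∀ a n → fromℕ (a ℕ.^ n) ≋ fromℕ a ^ n
  fromℕ-^ a zero    = ≋-refl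
  fromℕ-^ a (suc n) = ≋-trans (fromℕ-* a (a ℕ.^ n)) (≋-* ≋-refl (fromℕ-^ a n))

  0⊑fromℕ : ∀ n → 0ℝ ⊑ fromℕ n
  0⊑fromℕ n = fromℚ-mono (0≤ι n)

  fromℕ-mono : ∀ {a b} → a ℕ.≤ b → fromℕ a ⊑ fromℕ b
  fromℕ-mono h = fromℚ-mono (ι-mono h)

  0⊏fromℕ : ∀ {n} → 0 ℕ.< n → 0ℝ ⊏ fromℕ n
  0⊏fromℕ h = ⊏-⊑-trans (fromℕ-suc-⊏ 0) (fromℕ-mono h)

  fromℕ-cancel-< : ∀ {a b} → fromℕ a ⊏ fromℕ b → a ℕ.< b
  fromℕ-cancel-< h = ℕₚ.≰⇒> λ b≤a → ⊏⇒¬⊒ h (fromℕ-mono b≤a)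

  fromℕ-cancel-≤ : ∀ {a b} → fromℕ a ⊑ fromℕ b → a ℕ.≤ b
  fromℕ-cancel-≤ h = ℕₚ.≮⇒≥ λ b<a → ⊏⇒¬⊒ (⊏-⊑-trans (fromℕ-suc-⊏ _) (fromℕ-mono b<a)) h

  -- The floor of `x / y`, one less than the least `p` with `x < p y`. The order on the reals is not
  -- decided, so the floor is only found up to double negation.
  ¬¬-quotient : ∀ {x y} → 0ℝ ⊑ x → 0ℝ ⊏ y → ¬ ¬ (∃[ p ] (fromℕ p * y ⊑ x × x ⊏ fromℕ (suc p) * y))
  ¬¬-quotient {x} {y} 0⊑x 0<y k = ¬¬-least (λ p → x ⊏ fromℕ p * y) λ where
    (inj₁ none) → let p , x< = archimedean-ℝ x 0<y in none p x<
    (inj₂ (zero , x< , _)) → ⊏⇒¬⊒ (⊏-⊑-trans x< (≋⇒⊑ (solve 1 (λ y → con 0ℚ :* y := con 0ℚ) ≋-refl y))) 0⊑x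
    (inj₂ (suc p , x< , least)) → k (p , ¬⊏⇒⊒ (least {p} ℕₚ.≤-refl) , x<)

  1⊑exp : ∀ {x} → 0ℝ ⊑ x → 1ℝ ⊑ exp x
  1⊑exp h = ⊑-trans (x⊑x+y h) (1+x⊑exp h)

  0⊑exp : ∀ {x} → 0ℝ ⊑ x → 0ℝ ⊑ exp x
  0⊑exp h = ⊑-trans 0⊑1 (1⊑exp h)

  exp-split : ∀ x y → exp y ≋ exp x * exp (y - x)
  exp-split x y = ≋-trans (exp-cong (solve 2 (λ x y → y := x :+ (y :- x)) ≋-refl x y)) (≋-sym (exp-+ x (y - x)))

  exp-mono : ∀ {x y} → 0ℝ ⊑ x → x ⊑ y → exp x ⊑ exp y
  exp-mono {x} {y} 0⊑x x⊑y = begin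
    exp x                     ≈⟨ *-identityʳ (exp x) ⟨
    exp x * 1ℝ                ≤⟨ ⊑-*ˡ (0⊑exp 0⊑x) (1⊑exp (⊑⇒0⊑- x⊑y)) ⟩
    exp x * exp (y - x)       ≈⟨ exp-split x y ⟨
    exp y                     ∎
    where open ℝ-Reasoning

  exp-cancel : ∀ {x y} → 0ℝ ⊏ exp y → exp x ⊑ exp y → x ⊑ y
  exp-cancel {x} {y} 0<ey h = ¬⊏⇒⊒ λ y<x → ⊏⇒¬⊒ (bigger y<x) h
    where
    bigger : y ⊏ x → exp y ⊏ exp x
    bigger y<x = ⊑-⊏-trans (≋⇒⊑ (≋-sym (*-identityʳ (exp y)))) (⊏-⊑-trans
      (⊏-*ˡ 0<ey (⊑-⊏-trans (≋⇒⊑ (≋-sym (+-identityˡ 1ℝ))) (⊏-⊑-trans (⊏-+ (⊏⇒0⊏- y<x) (⊑-refl {1ℝ})) (≋⇒⊑ (+-comm (x - y) 1ℝ)))))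
      (⊑-trans (⊑-*ˡ (⊏⇒⊑ 0<ey) (1+x⊑exp (⊑⇒0⊑- (⊏⇒⊑ y<x)))) (≋⇒⊑ (≋-sym (exp-split y x)))))

  exp-0 : exp 0ℝ ≋ 1ℝ
  exp-0 = ⊑-antisym (exp-rational-⊑ ℚₚ.≤-refl (ℚₚ.nonNegative⁻¹ ½)) (1⊑exp ⊑-refl)

  exp-^ : ∀ x n → exp x ^ n ≋ exp (fromℕ n * x)
  exp-^ x zero    = ≋-trans (≋-sym exp-0) (exp-cong (solve 1 (λ x → con 0ℚ := con 0ℚ :* x) ≋-refl x))
  exp-^ x (suc n) = ≋-trans (≋-* ≋-refl (exp-^ x n)) (≋-trans (exp-+ x (fromℕ n * x)) (exp-cong
    (≋-trans (solve 2 (λ x n → x :+ n :* x := (con 1ℚ :+ n) :* x) ≋-refl x (fromℕ n)) (≋-* (≋-sym (fromℕ-suc n)) ≋-refl))))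

  -- Falling factorials and binomial coefficients

  fallingFactorial : ℝ → ℕ → ℝ
  fallingFactorial x zero    = 1ℝ
  fallingFactorial x (suc k) = fallingFactorial x k * (x - fromℕ k)

  FF-suc : ∀ x s → fallingFactorial (1ℝ + x) (suc s) ≋ (1ℝ + x) * fallingFactorial x s
  FF-suc x zero    = solve 1 (λ x → con 1ℚ :* ((con 1ℚ :+ x) :- con 0ℚ) := (con 1ℚ :+ x) :* con 1ℚ) ≋-refl x
  FF-suc x (suc s) = ≋-trans (≋-* (FF-suc x s) (≋-+ ≋-refl (-‿cong (fromℕ-suc s))))
    (solve 3 (λ x f s → ((con 1ℚ :+ x) :* f) :* ((con 1ℚ :+ x) :- (con 1ℚ :+ s)) := (con 1ℚ :+ x) :* (f :* (x :- s))) ≋-refl x (fallingFactorial x s) (fromℕ s))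

  FF-cong : ∀ {x y} s → x ≋ y → fallingFactorial x s ≋ fallingFactorial y s
  FF-cong zero    h = ≋-refl
  FF-cong (suc s) h = ≋-* (FF-cong s h) (≋-+ h ≋-refl)

  FF-0 : ∀ s → fallingFactorial 0ℝ (suc s) ≋ 0ℝ
  FF-0 zero    = solve 0 (con 1ℚ :* (con 0ℚ :- con 0ℚ) := con 0ℚ) ≋-refl
  FF-0 (suc s) = ≋-trans (≋-* (FF-0 s) ≋-refl) (solve 1 (λ x → con 0ℚ :* (con 0ℚ :- x) := con 0ℚ) ≋-refl (fromℕ (suc s)))

  -- Pascal's rule against `FF-suc`, which splits off the first factor of the falling factorial
  -- where its definition splits off the last: `(1 + s) + (n - s) = 1 + n`.
  C-FF : ∀ n s → fromℕ (n C s) * fromℕ (s !) ≋ fallingFactorial (fromℕ n) s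
  C-FF n zero = ≡.subst (λ z → fromℕ z * fromℕ 1 ≋ 1ℝ) (≡.sym (≡.trans (nCk≡nC[n∸k] {n = n} z≤n) (nCn≡1 n))) (*-identityˡ 1ℝ)
  C-FF zero (suc s) = ≡.subst (λ z → fromℕ z * fromℕ (suc s !) ≋ fallingFactorial (fromℕ 0) (suc s)) (≡.sym (k>n⇒nCk≡0 {0} {suc s} (s≤s z≤n)))
    (≋-trans (solve 1 (λ x → con 0ℚ :* x := con 0ℚ) ≋-refl (fromℕ (suc s !))) (≋-sym (FF-0 s)))
  C-FF (suc n) (suc s) = begin-equality
    fromℕ (suc n C suc s) * fromℕ (suc s !)
      ≡⟨ ≡.cong (λ z → fromℕ z * fromℕ (suc s !)) (nCk+nC[k+1]≡[n+1]C[k+1] n s) ⟨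
    fromℕ (n C s ℕ.+ n C suc s) * fromℕ (suc s !)
      ≈⟨ ≋-* (fromℕ-+ (n C s) (n C suc s)) ≋-refl ⟩
    (fromℕ (n C s) + fromℕ (n C suc s)) * fromℕ (suc s !)
      ≈⟨ *-distribʳ-+ (fromℕ (suc s !)) (fromℕ (n C s)) (fromℕ (n C suc s)) ⟩
    fromℕ (n C s) * fromℕ (suc s !) + fromℕ (n C suc s) * fromℕ (suc s !)
      ≈⟨ ≋-+ (≋-* ≋-refl (≋-trans (fromℕ-* (suc s) (s !)) (≋-* (fromℕ-suc s) ≋-refl))) (C-FF n (suc s)) ⟩
    fromℕ (n C s) * ((1ℝ + fromℕ s) * fromℕ (s !)) + F * (fromℕ n - fromℕ s)
      ≈⟨ solve 5 (λ c s f F n → c :* ((con 1ℚ :+ s) :* f) :+ F :* (n :- s) := (con 1ℚ :+ s) :* (c :* f) :+ F :* (n :- s)) ≋-refl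
           (fromℕ (n C s)) (fromℕ s) (fromℕ (s !)) F (fromℕ n) ⟩
    (1ℝ + fromℕ s) * (fromℕ (n C s) * fromℕ (s !)) + F * (fromℕ n - fromℕ s)
      ≈⟨ ≋-+ (≋-* ≋-refl (C-FF n s)) ≋-refl ⟩
    (1ℝ + fromℕ s) * F + F * (fromℕ n - fromℕ s)
      ≈⟨ solve 3 (λ s f n → (con 1ℚ :+ s) :* f :+ f :* (n :- s) := (con 1ℚ :+ n) :* f) ≋-refl (fromℕ s) F (fromℕ n) ⟩
    (1ℝ + fromℕ n) * F
      ≈⟨ FF-suc (fromℕ n) s ⟨
    fallingFactorial (1ℝ + fromℕ n) (suc s)
      ≈⟨ FF-cong (suc s) (fromℕ-suc n) ⟨
    fallingFactorial (fromℕ (suc n)) (suc s) ∎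
    where
    open ℝ-Reasoning
    F = fallingFactorial (fromℕ n) s

  1/n : (n : ℕ) .{{_ : ℕ.NonZero n}} → ℚ
  1/n n = + 1 ℚ./ n

  1/n≡recip : ∀ i → 1/n (suc i) ≡ recip i
  1/n≡recip i = ℚₚ.normalize-coprime (1-coprimeTo (suc i))

  n*1/n : ∀ n .{{_ : ℕ.NonZero n}} → fromℕ n * fromℚ (1/n n) ≋ 1ℝ
  n*1/n (suc i) = ≋-trans (≋-sym (fromℚ-* (ι (suc i)) (1/n (suc i))))
    (≡.subst (λ q → fromℚ q ≋ 1ℝ) (≡.sym (≡.trans (≡.cong (ι (suc i) ℚ.*_) (1/n≡recip i)) (ι*recip i))) ≋-refl)

  0⊑1/n : ∀ n .{{_ : ℕ.NonZero n}} → 0ℝ ⊑ fromℚ (1/n n)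
  0⊑1/n (suc i) = fromℚ-mono (≡.subst (0ℚ ℚ.≤_) (≡.sym (1/n≡recip i)) (0≤recip i))

  binomial : ℝ → ℕ → ℝ
  binomial x s = fallingFactorial x s * fromℚ (1/n (s !) {{s ℕₚ.!≢0}})

  C-binomial : ∀ n s → fromℕ (n C s) ≋ binomial (fromℕ n) s
  C-binomial n s = begin-equality
    fromℕ (n C s)                          ≈⟨ *-identityʳ (fromℕ (n C s)) ⟨
    fromℕ (n C s) * 1ℝ                     ≈⟨ ≋-* ≋-refl (n*1/n (s !) {{s ℕₚ.!≢0}}) ⟨
    fromℕ (n C s) * (fromℕ (s !) * r)      ≈⟨ *-assoc (fromℕ (n C s)) (fromℕ (s !)) r ⟨
    fromℕ (n C s) * fromℕ (s !) * r        ≈⟨ ≋-* (C-FF n s) ≋-refl ⟩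
    binomial (fromℕ n) s                   ∎
    where
    open ℝ-Reasoning
    r = fromℚ (1/n (s !) {{s ℕₚ.!≢0}})

  ∑< : (ℕ → ℝ) → ℕ → ℝ
  ∑< θ zero    = 0ℝ
  ∑< θ (suc j) = ∑< θ j + θ j

  module _ {x y : ℝ} (θ : ℕ → ℝ) (s : ℕ) (0⊑θ : ∀ i → i ℕ.< s → 0ℝ ⊑ θ i)
    (0⊑y : ∀ i → i ℕ.< s → 0ℝ ⊑ y - fromℕ i) (0⊑x : ∀ i → i ℕ.< s → 0ℝ ⊑ x - fromℕ i)
    (close : ∀ i → i ℕ.< s → y - x ⊑ θ i * (x - fromℕ i)) where

    open ℝ-Reasoning

    0⊑∑< : ∀ j → j ℕ.≤ s → 0ℝ ⊑ ∑< θ j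
    0⊑∑< zero    _   = ⊑-refl
    0⊑∑< (suc j) j<s = ⊑-trans (0⊑∑< j (ℕₚ.<⇒≤ j<s)) (x⊑x+y (0⊑θ j j<s))

    0⊑FF : ∀ j → j ℕ.≤ s → 0ℝ ⊑ fallingFactorial x j
    0⊑FF zero    _   = 0⊑1
    0⊑FF (suc j) j<s = 0⊑* (0⊑FF j (ℕₚ.<⇒≤ j<s)) (0⊑x j j<s)

    FF-ratio : ∀ j → j ℕ.≤ s → fallingFactorial y j ⊑ exp (∑< θ j) * fallingFactorial x j
    FF-ratio zero _ = ⊑-trans (1⊑exp ⊑-refl) (≋⇒⊑ (≋-sym (*-identityʳ _)))
    FF-ratio (suc j) j<s = begin
      fallingFactorial y j * (y - fromℕ j)
        ≤⟨ ⊑-*ʳ (0⊑y j j<s) (FF-ratio j (ℕₚ.<⇒≤ j<s)) ⟩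
      exp (∑< θ j) * F * (y - fromℕ j)
        ≤⟨ ⊑-*ˡ (0⊑* (0⊑exp (0⊑∑< j (ℕₚ.<⇒≤ j<s))) (0⊑FF j (ℕₚ.<⇒≤ j<s))) factor ⟩
      exp (∑< θ j) * F * (exp (θ j) * (x - fromℕ j))
        ≈⟨ solve 4 (λ a f b z → a :* f :* (b :* z) := (a :* b) :* (f :* z)) ≋-refl (exp (∑< θ j)) F (exp (θ j)) (x - fromℕ j) ⟩
      exp (∑< θ j) * exp (θ j) * (F * (x - fromℕ j))
        ≈⟨ ≋-* (exp-+ (∑< θ j) (θ j)) ≋-refl ⟩
      exp (∑< θ j + θ j) * (F * (x - fromℕ j)) ∎
      where
      F = fallingFactorial x j
      factor : y - fromℕ j ⊑ exp (θ j) * (x - fromℕ j)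
      factor = begin
        y - fromℕ j  ≈⟨ solve 3 (λ y x j → y :- j := (y :- x) :+ (x :- j)) ≋-refl y x (fromℕ j) ⟩
        (y - x) + (x - fromℕ j)                       ≤⟨ ⊑-+ (close j j<s) ⊑-refl ⟩
        θ j * (x - fromℕ j) + (x - fromℕ j)  ≈⟨ solve 2 (λ t z → t :* z :+ z := (con 1ℚ :+ t) :* z) ≋-refl (θ j) (x - fromℕ j) ⟩
        (1ℝ + θ j) * (x - fromℕ j)                    ≤⟨ ⊑-*ʳ (0⊑x j j<s) (1+x⊑exp (0⊑θ j j<s)) ⟩
        exp (θ j) * (x - fromℕ j)                     ∎

    binomial-ratio : binomial y s ⊑ exp (∑< θ s) * binomial x s
    binomial-ratio = ⊑-trans (⊑-*ʳ (0⊑1/n (s !) {{s ℕₚ.!≢0}}) (FF-ratio s ℕₚ.≤-refl)) (≋⇒⊑ (*-assoc _ _ _))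

-- The choice of the parameters

module Estimates where

  open D using (ℝ; seq; ι; recip)
  open D.CauchyLemmas using (0≤recip; ι*recip; ι-mono)
  open Reals
  open ℝ-Solver using (solve; _:=_; _:+_; _:*_; _:-_; con; _:^_)

  ⌊log₂⌋ : ∀ n → 1 ℕ.≤ n → ∃[ r ] (2 ℕ.^ r ℕ.≤ n × n ℕ.< 2 ℕ.^ suc r)
  ⌊log₂⌋ (suc zero)    _ = 0 , s≤s z≤n , s≤s (s≤s z≤n)
  ⌊log₂⌋ (suc (suc n)) _ with r , 2^r≤ , <2^ ← ⌊log₂⌋ (suc n) (s≤s z≤n) with ℕₚ.m≤n⇒m<n∨m≡n <2^
  ... | inj₁ lt = r , ℕₚ.m≤n⇒m≤1+n 2^r≤ , lt
  ... | inj₂ eq = suc r , ℕₚ.≤-reflexive (≡.sym eq) , ℕₚ.<-≤-trans (ℕₚ.≤-reflexive (≡.cong suc eq))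
          (ℕₚ.≤-trans (ℕₚ.+-monoˡ-≤ (2 ℕ.^ suc r) (ℕₚ.m^n>0 2 (suc r))) (ℕₚ.≤-reflexive (≡.cong (2 ℕ.^ suc r ℕ.+_) (≡.sym (ℕₚ.+-identityʳ _)))))

  n<[1+n/d]*d : ∀ n d .{{_ : ℕ.NonZero d}} → n ℕ.< suc (n ℕ./ d) ℕ.* d
  n<[1+n/d]*d n d = ≡.subst (ℕ._< suc (n ℕ./ d) ℕ.* d) (≡.sym (m≡m%n+[m/n]*n n d)) (ℕₚ.+-monoˡ-< (n ℕ./ d ℕ.* d) (m%n<n n d))

  fromℕ-⊑ : ∀ {a b x y} → fromℕ a ≋ x → fromℕ b ≋ y → a ℕ.≤ b → x ⊑ y
  fromℕ-⊑ hx hy h = ⊑-trans (≋⇒⊑ (≋-sym hx)) (⊑-trans (fromℕ-mono h) (≋⇒⊑ hy))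

  1⊑* : ∀ {x y} → 1ℝ ⊑ x → 1ℝ ⊑ y → 1ℝ ⊑ x * y
  1⊑* h g = ⊑-trans (≋⇒⊑ (≋-sym (*-identityˡ 1ℝ))) (⊑-* 0⊑1 0⊑1 h g)

  x⊑x*y : ∀ {x y} → 0ℝ ⊑ x → 1ℝ ⊑ y → x ⊑ x * y
  x⊑x*y {x} h g = ⊑-trans (≋⇒⊑ (≋-sym (*-identityʳ x))) (⊑-*ˡ h g)

  x⊑y*x : ∀ {x y} → 0ℝ ⊑ x → 1ℝ ⊑ y → x ⊑ y * x
  x⊑y*x {x} {y} h g = ⊑-trans (x⊑x*y h g) (≋⇒⊑ (*-comm x y))

  numeral : ∀ a b → a ℕ.≤ b → fromℕ a ⊑ fromℕ b
  numeral a b = fromℕ-mono {a} {b}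

  0⊏½ : 0ℝ ⊏ fromℚ ½
  0⊏½ = fromℚ-⊏ (ℚₚ.positive⁻¹ ½)

  0⊑½ : 0ℝ ⊑ fromℚ ½
  0⊑½ = ⊏⇒⊑ 0⊏½

  module Setup (k w σ : ℝ) (1⊑k : 1ℝ ⊑ k) (½⊑w : fromℚ ½ ⊑ w) (64kw⊑σ : fromℕ 64 * (k * w) ⊑ σ) where

    open ℝ-Reasoning

    0⊑k : 0ℝ ⊑ k
    0⊑k = ⊑-trans 0⊑1 1⊑k

    0⊑w : 0ℝ ⊑ w
    0⊑w = ⊑-trans 0⊑½ ½⊑w

    0⊏k : 0ℝ ⊏ k
    0⊏k = ⊏-⊑-trans 0⊏1 1⊑k

    0⊏w : 0ℝ ⊏ w
    0⊏w = ⊏-⊑-trans 0⊏½ ½⊑w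

    0⊏kw : 0ℝ ⊏ k * w
    0⊏kw = 0⊏* 0⊏k 0⊏w

    0⊑kw : 0ℝ ⊑ k * w
    0⊑kw = ⊏⇒⊑ 0⊏kw

    ½⊑kw : fromℚ ½ ⊑ k * w
    ½⊑kw = ⊑-trans ½⊑w (x⊑y*x 0⊑w 1⊑k)

    32⊑σ : fromℕ 32 ⊑ σ
    32⊑σ = ⊑-trans (≋⇒⊑ (solve 0 (con (ι 32) := con (ι 64) :* con ½) ≋-refl)) (⊑-trans (⊑-*ˡ (0⊑fromℕ 64) ½⊑kw) 64kw⊑σ)

    1⊑σ : 1ℝ ⊑ σ
    1⊑σ = ⊑-trans (numeral 1 32 (s≤s z≤n)) 32⊑σ

    0⊑σ : 0ℝ ⊑ σ
    0⊑σ = ⊑-trans 0⊑1 1⊑σ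

    -- With `k`, `w`, `σ` in the roles of `K^(1/6)`, `√(log n)` and `s^(1/6)`: `E` will be near
    -- `σ / z`, `p` is `√(Ks)`, and `q` is the scale `K^(1/6) s^(5/6) √(log n)` of the final
    -- exponent.
    z p q : ℝ
    z = fromℕ 16 * (k * w)
    p = k ^ 3 * σ ^ 3
    q = k * σ ^ 5 * w

    0⊏z : 0ℝ ⊏ z
    0⊏z = 0⊏* (0⊏fromℕ (s≤s z≤n)) 0⊏kw

    z⊑σ : z ⊑ σ
    z⊑σ = ⊑-trans (⊑-*ʳ 0⊑kw (numeral 16 64 (ℕₚ.m≤m+n 16 48))) 64kw⊑σ

    1⊑k³ : 1ℝ ⊑ k ^ 3
    1⊑k³ = 1⊑* 1⊑k (1⊑* 1⊑k (1⊑* 1⊑k ⊑-refl))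

    σσ⊑p : fromℕ 32 * (σ * σ) ⊑ p
    σσ⊑p = begin
      fromℕ 32 * (σ * σ)   ≤⟨ ⊑-*ʳ (0⊑* 0⊑σ 0⊑σ) 32⊑σ ⟩
      σ * (σ * σ)          ≈⟨ solve 1 (λ s → s :* (s :* s) := s :^ 3) ≋-refl σ ⟩
      σ ^ 3                ≤⟨ x⊑y*x (^-nonneg 3 0⊑σ) 1⊑k³ ⟩
      p                    ∎

    1⊑σσ : 1ℝ ⊑ σ * σ
    1⊑σσ = 1⊑* 1⊑σ 1⊑σ

    0⊑σσ : 0ℝ ⊑ σ * σ
    0⊑σσ = ⊑-trans 0⊑1 1⊑σσ

    1⊑p : 1ℝ ⊑ p
    1⊑p = ⊑-trans (1⊑* (numeral 1 32 (s≤s z≤n)) 1⊑σσ) σσ⊑p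

    0⊑p : 0ℝ ⊑ p
    0⊑p = ⊑-trans 0⊑1 1⊑p

    0⊏p : 0ℝ ⊏ p
    0⊏p = ⊏-⊑-trans 0⊏1 1⊑p

    -- `e` is `⌊σ / z⌋ + 1`. As `z ≤ σ`, this is at most `2σ / z`, and `64 k w ≤ σ` makes it at
    -- least 4.
    ¬¬-E : ¬ ¬ (∃[ e ] (σ ⊑ z * fromℕ e × fromℕ 8 * (k * w) * fromℕ e ⊑ σ × 4 ℕ.≤ e))
    ¬¬-E ret = ¬¬-quotient 0⊑σ 0⊏z λ (e′ , e′z⊑σ , σ⊏) →
      let σ⊑ = ⊑-trans (⊏⇒⊑ σ⊏) (≋⇒⊑ (*-comm (fromℕ (suc e′)) z)) in ret (suc e′ , σ⊑ , upper e′ e′z⊑σ ,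
        fromℕ-cancel-≤ {4} {suc e′} (⊑-cancelˡ 0⊏z (⊑-trans (≋⇒⊑ (solve 1 (λ x → con (ι 16) :* x :* con (ι 4) := con (ι 64) :* x) ≋-refl (k * w))) (⊑-trans 64kw⊑σ σ⊑))))
      where
      upper : ∀ e′ → fromℕ e′ * z ⊑ σ → fromℕ 8 * (k * w) * fromℕ (suc e′) ⊑ σ
      upper e′ h = begin
        fromℕ 8 * (k * w) * fromℕ (suc e′)      ≈⟨ ≋-* ≋-refl (fromℕ-suc e′) ⟩
        fromℕ 8 * (k * w) * (1ℝ + fromℕ e′)  ≈⟨ solve 2 (λ x e → con (ι 8) :* x :* (con 1ℚ :+ e) := con ½ :* (con (ι 16) :* x :+ e :* (con (ι 16) :* x))) ≋-refl (k * w) (fromℕ e′) ⟩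
        fromℚ ½ * (z + fromℕ e′ * z)            ≤⟨ ⊑-*ˡ 0⊑½ (⊑-+ z⊑σ h) ⟩
        fromℚ ½ * (σ + σ)                       ≈⟨ solve 1 (λ s → con ½ :* (s :+ s) := s) ≋-refl σ ⟩
        σ                                       ∎

    module ChosenE (e : ℕ) (σ⊑zE : σ ⊑ z * fromℕ e) (8kwE⊑σ : fromℕ 8 * (k * w) * fromℕ e ⊑ σ) (4≤e : 4 ℕ.≤ e) where

      E c : ℝ
      E = fromℕ e

      κ : ℕ
      κ = 4 ℕ.* e ℕ.* e

      c = fromℕ κ

      c≋ : c ≋ fromℕ 4 * E * E
      c≋ = ≋-trans (fromℕ-* (4 ℕ.* e) e) (≋-* (fromℕ-* 4 e) ≋-refl)

      0⊑c : 0ℝ ⊑ c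
      0⊑c = 0⊑fromℕ κ

      0⊑E : 0ℝ ⊑ E
      0⊑E = 0⊑fromℕ e

      zE⊑2σ : z * E ⊑ fromℕ 2 * σ
      zE⊑2σ = ⊑-trans (≋⇒⊑ (solve 2 (λ x e → con (ι 16) :* x :* e := con (ι 2) :* (con (ι 8) :* x :* e)) ≋-refl (k * w) E)) (⊑-*ˡ (0⊑fromℕ 2) 8kwE⊑σ)

      κ-bound : fromℕ 16 * (k * k) * (w * w) * c ⊑ σ * σ
      κ-bound = begin
        fromℕ 16 * (k * k) * (w * w) * c                           ≈⟨ ≋-* ≋-refl c≋ ⟩
        fromℕ 16 * (k * k) * (w * w) * (fromℕ 4 * E * E)  ≈⟨ solve 3 (λ k w e → con (ι 16) :* (k :* k) :* (w :* w) :* (con (ι 4) :* e :* e) := (con (ι 8) :* (k :* w) :* e) :* (con (ι 8) :* (k :* w) :* e)) ≋-refl k w E ⟩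
        (fromℕ 8 * (k * w) * E) * (fromℕ 8 * (k * w) * E)          ≤⟨ ⊑-* 0⊑8 0⊑8 8kwE⊑σ 8kwE⊑σ ⟩
        σ * σ                                                      ∎
        where
        0⊑8 : 0ℝ ⊑ fromℕ 8 * (k * w) * E
        0⊑8 = 0⊑* (0⊑* (0⊑fromℕ 8) 0⊑kw) 0⊑E

      κ-bound′ : ∀ {x} → 0ℝ ⊑ x → x ⊑ w * w → fromℕ 16 * x * c ⊑ σ * σ
      κ-bound′ {x} 0⊑x x⊑ww = begin
        fromℕ 16 * x * c  ≤⟨ ⊑-*ʳ 0⊑c (⊑-* (0⊑fromℕ 16) 0⊑x (x⊑x*y (0⊑fromℕ 16) (1⊑* 1⊑k 1⊑k)) x⊑ww) ⟩
        fromℕ 16 * (k * k) * (w * w) * c       ≤⟨ κ-bound ⟩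
        σ * σ                                  ∎

      8wc⊑σσ : fromℕ 8 * (w * c) ⊑ σ * σ
      8wc⊑σσ = ⊑-trans (≋⇒⊑ (solve 2 (λ w c → con (ι 8) :* (w :* c) := con (ι 16) :* (con ½ :* w) :* c) ≋-refl w c))
        (κ-bound′ (0⊑* 0⊑½ 0⊑w) (⊑-*ʳ 0⊑w ½⊑w))

      4c⊑σσ : fromℕ 4 * c ⊑ σ * σ
      4c⊑σσ = ⊑-trans (≋⇒⊑ (solve 1 (λ c → con (ι 4) :* c := con (ι 16) :* (con ½ :* con ½) :* c) ≋-refl c))
        (κ-bound′ (0⊑* 0⊑½ 0⊑½) (⊑-* 0⊑½ 0⊑½ ½⊑w ½⊑w))

      64≤κ : 64 ℕ.≤ κ
      64≤κ = ℕₚ.*-mono-≤ (ℕₚ.*-monoʳ-≤ 4 4≤e) 4≤e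

      1⊑cw : 1ℝ ⊑ c * w
      1⊑cw = ⊑-trans (⊑-trans (numeral 1 32 (s≤s z≤n)) (≋⇒⊑ (solve 0 (con (ι 32) := con (ι 64) :* con ½) ≋-refl))) (⊑-* (0⊑fromℕ 64) 0⊑½ (fromℕ-mono {64} {κ} 64≤κ) ½⊑w)

      0⊏cw : 0ℝ ⊏ c * w
      0⊏cw = ⊏-⊑-trans 0⊏1 1⊑cw

      -- Makes the quotient `p / (c w)` at least 1, so that `D` is positive.
      cw⊑p : c * w ⊑ p
      cw⊑p = begin
        c * w                    ≤⟨ x⊑y*x (⊏⇒⊑ 0⊏cw) (numeral 1 8 (s≤s z≤n)) ⟩
        fromℕ 8 * (c * w)        ≈⟨ ≋-* ≋-refl (*-comm c w) ⟩
        fromℕ 8 * (w * c)        ≤⟨ 8wc⊑σσ ⟩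
        σ * σ                    ≤⟨ x⊑y*x 0⊑σσ (numeral 1 32 (s≤s z≤n)) ⟩
        fromℕ 32 * (σ * σ)       ≤⟨ σσ⊑p ⟩
        p                        ∎

      -- `D` is `⌊p / (κ w)⌋`, the value that equalises `p² / D` and `κ² D w²`, the orders of the
      -- positive answers in the second and in the first phases. The factor 2 in the last bound
      -- covers the rounding.
      ¬¬-D : ¬ ¬ (∃[ d ] (0 ℕ.< d × fromℕ d * (c * w) ⊑ p × p ⊑ fromℕ 2 * fromℕ d * (c * w)))
      ¬¬-D ret = ¬¬-quotient 0⊑p 0⊏cw λ where
        (zero , _ , p⊏) → ⊏⇒¬⊒ (⊏-⊑-trans p⊏ (≋⇒⊑ (*-identityˡ (c * w)))) cw⊑p
        (d@(suc d′) , dcw⊑p , p⊏) → ret (d , s≤s z≤n , dcw⊑p , ⊑-trans (⊏⇒⊑ p⊏)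
          (⊑-*ʳ (⊏⇒⊑ 0⊏cw) (fromℕ-⊑ {suc d} {2 ℕ.* d} ≋-refl (fromℕ-* 2 d) (ℕₚ.≤-trans (ℕₚ.+-monoˡ-≤ d {1} {d} (s≤s z≤n)) (ℕₚ.≤-reflexive (≡.cong (d ℕ.+_) (≡.sym (ℕₚ.+-identityʳ d))))))))

      module ChosenD (d : ℕ) (0<d : 0 ℕ.< d) (dcw⊑p : fromℕ d * (c * w) ⊑ p) (p⊑2dcw : p ⊑ fromℕ 2 * fromℕ d * (c * w)) where

        Δ : ℝ
        Δ = fromℕ d

        0⊑Δ : 0ℝ ⊑ Δ
        0⊑Δ = 0⊑fromℕ d

        b : ℕ
        b = 2 ℕ.* κ ℕ.* d

        b≋ : fromℕ b ≋ fromℕ 2 * c * Δ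
        b≋ = ≋-trans (fromℕ-* (2 ℕ.* κ) d) (≋-* (fromℕ-* 2 κ) ≋-refl)

        κb⊑ : fromℕ (κ ℕ.* b) ⊑ σ * σ * p
        κb⊑ = begin
          fromℕ (κ ℕ.* b)                                   ≈⟨ ≋-trans (fromℕ-* κ b) (≋-* ≋-refl b≋) ⟩
          c * (fromℕ 2 * c * Δ)  ≈⟨ solve 2 (λ c d → c :* (con (ι 2) :* c :* d) := (con (ι 4) :* c) :* (d :* (c :* con ½))) ≋-refl c Δ ⟩
          (fromℕ 4 * c) * (Δ * (c * fromℚ ½))  ≤⟨ ⊑-* (0⊑* (0⊑fromℕ 4) 0⊑c) (0⊑* 0⊑Δ (0⊑* 0⊑c 0⊑½)) 4c⊑σσ (⊑-trans (⊑-*ˡ 0⊑Δ (⊑-*ˡ 0⊑c ½⊑w)) dcw⊑p) ⟩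
          σ * σ * p                                         ∎

        -- `κ b = 2 κ² D` is at most `σ² p`, whereas `N ≥ m / 2` is about `p² / 2`, and `p ≥ 32 σ²`.
        b-small : ∀ m N → m ℕ.≤ 2 ℕ.* N → p * p ⊏ fromℕ (suc m) → κ ℕ.* b ℕ.< N
        b-small m N m≤2N pp⊏ = ℕₚ.≰⇒> λ N≤ → ⊏⇒¬⊒ pp⊏ (begin
          fromℕ (suc m)                                          ≈⟨ fromℕ-suc m ⟩
          1ℝ + fromℕ m  ≤⟨ ⊑-+ ⊑-refl (⊑-trans (fromℕ-mono {m} {2 ℕ.* (κ ℕ.* b)} (ℕₚ.≤-trans m≤2N (ℕₚ.*-monoʳ-≤ 2 N≤))) (≋⇒⊑ (fromℕ-* 2 (κ ℕ.* b)))) ⟩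
          1ℝ + fromℕ 2 * fromℕ (κ ℕ.* b)  ≤⟨ ⊑-+ (1⊑* 1⊑σσ 1⊑p) (⊑-*ˡ (0⊑fromℕ 2) κb⊑) ⟩
          σ * σ * p + fromℕ 2 * (σ * σ * p)  ≈⟨ solve 1 (λ x → x :+ con (ι 2) :* x := con (ι 3) :* x) ≋-refl (σ * σ * p) ⟩
          fromℕ 3 * (σ * σ * p)  ≤⟨ ⊑-*ʳ (0⊑* 0⊑σσ 0⊑p) (numeral 3 32 (s≤s (s≤s (s≤s z≤n)))) ⟩
          fromℕ 32 * (σ * σ * p)                                 ≈⟨ *-assoc (fromℕ 32) (σ * σ) p ⟨
          fromℕ 32 * (σ * σ) * p                                 ≤⟨ ⊑-*ʳ 0⊑p σσ⊑p ⟩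
          p * p                                                  ∎)

        -- `f` is at most `(m + D) / D`, where `m + D ≤ 2p²` and `1 / D ≤ 2 κ w / p`.
        fuel-bound : ∀ m f → fromℕ m ⊑ p * p → f ℕ.* d ℕ.≤ m ℕ.+ d → fromℕ f ⊑ fromℕ 4 * c * w * p
        fuel-bound m f m⊑ fd≤ = ⊑-cancelˡ 0⊏p (begin
          p * F                                            ≤⟨ ⊑-*ʳ (0⊑fromℕ f) p⊑2dcw ⟩
          fromℕ 2 * Δ * (c * w) * F  ≈⟨ solve 4 (λ d c w f → con (ι 2) :* d :* (c :* w) :* f := con (ι 2) :* (c :* w) :* (f :* d)) ≋-refl Δ c w F ⟩
          fromℕ 2 * (c * w) * (F * Δ)  ≤⟨ ⊑-*ˡ 0⊑2cw (fromℕ-⊑ {f ℕ.* d} {m ℕ.+ d} (fromℕ-* f d) (fromℕ-+ m d) fd≤) ⟩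
          fromℕ 2 * (c * w) * (fromℕ m + Δ)                ≤⟨ ⊑-*ˡ 0⊑2cw (⊑-+ m⊑ Δ⊑pp) ⟩
          fromℕ 2 * (c * w) * (p * p + p * p)  ≈⟨ solve 3 (λ c w p → con (ι 2) :* (c :* w) :* (p :* p :+ p :* p) := p :* (con (ι 4) :* c :* w :* p)) ≋-refl c w p ⟩
          p * (fromℕ 4 * c * w * p)                        ∎)
          where
          F = fromℕ f
          0⊑2cw : 0ℝ ⊑ fromℕ 2 * (c * w)
          0⊑2cw = 0⊑* (0⊑fromℕ 2) (⊏⇒⊑ 0⊏cw)
          Δ⊑pp : Δ ⊑ p * p
          Δ⊑pp = ⊑-trans (x⊑x*y 0⊑Δ 1⊑cw) (⊑-trans dcw⊑p (x⊑x*y 0⊑p 1⊑p))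

        -- The product is `12 κ² r D`; `D κ w ≤ p` and `r ≤ 6 w²` leave `72 κ w p`.
        rounds-bound : ∀ r → fromℕ r ⊑ fromℕ 6 * (w * w) → fromℕ (6 ℕ.* κ ℕ.* r ℕ.* b) ⊑ fromℕ 72 * c * w * p
        rounds-bound r r⊑ = ⊑-cancelˡ 0⊏w (begin
          w * fromℕ (6 ℕ.* κ ℕ.* r ℕ.* b)  ≈⟨ ≋-* ≋-refl (≋-trans (fromℕ-* (6 ℕ.* κ ℕ.* r) b) (≋-* (≋-trans (fromℕ-* (6 ℕ.* κ) r) (≋-* (fromℕ-* 6 κ) ≋-refl)) b≋)) ⟩
          w * (fromℕ 6 * c * fromℕ r * (fromℕ 2 * c * Δ))  ≈⟨ solve 4 (λ w c r d → w :* (con (ι 6) :* c :* r :* (con (ι 2) :* c :* d)) := (con (ι 12) :* c) :* r :* (d :* (c :* w))) ≋-refl w c (fromℕ r) Δ ⟩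
          (fromℕ 12 * c) * fromℕ r * (Δ * (c * w))  ≤⟨ ⊑-* (0⊑* 0⊑12c (0⊑fromℕ r)) (0⊑* 0⊑Δ (⊏⇒⊑ 0⊏cw)) (⊑-*ˡ 0⊑12c r⊑) dcw⊑p ⟩
          (fromℕ 12 * c) * (fromℕ 6 * (w * w)) * p  ≈⟨ solve 3 (λ w c p → (con (ι 12) :* c) :* (con (ι 6) :* (w :* w)) :* p := w :* (con (ι 72) :* c :* w :* p)) ≋-refl w c p ⟩
          w * (fromℕ 72 * c * w * p)                           ∎)
          where
          0⊑12c : 0ℝ ⊑ fromℕ 12 * c
          0⊑12c = 0⊑* (0⊑fromℕ 12) 0⊑c

        -- `w * w` is `log n`, and the factor 2 comes from `n + 1 ≤ n²`: thus `(n + 1)^Φ` will be at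
        -- most `exp (10 q)`.
        exponent-bound : ∀ Φ → fromℕ Φ ⊑ fromℕ 76 * c * w * p → fromℕ (2 ℕ.* Φ) * (w * w) ⊑ fromℕ 10 * q
        exponent-bound Φ Φ⊑ = begin
          fromℕ (2 ℕ.* Φ) * (w * w)                                            ≈⟨ ≋-* (fromℕ-* 2 Φ) ≋-refl ⟩
          fromℕ 2 * fromℕ Φ * (w * w)  ≤⟨ ⊑-*ʳ (0⊑* 0⊑w 0⊑w) (⊑-*ˡ (0⊑fromℕ 2) Φ⊑) ⟩
          -- Rounding 76 up to 80 makes the total `160 = 10 * 16`, which fits the factor 16 in
          -- `κ-bound`.
          fromℕ 2 * (fromℕ 76 * c * w * p) * (w * w)  ≤⟨ ⊑-*ʳ (0⊑* 0⊑w 0⊑w) (⊑-*ˡ (0⊑fromℕ 2) (⊑-*ʳ 0⊑p (⊑-*ʳ 0⊑w (⊑-*ʳ 0⊑c (numeral 76 80 (ℕₚ.m≤m+n 76 4)))))) ⟩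
          fromℕ 2 * (fromℕ 80 * c * w * (k ^ 3 * σ ^ 3)) * (w * w)  ≈⟨ solve 4 (λ k w c s → con (ι 2) :* (con (ι 80) :* c :* w :* (k :^ 3 :* s :^ 3)) :* (w :* w)
                                                                                    := con (ι 10) :* (k :* s :^ 3 :* w) :* (con (ι 16) :* (k :* k) :* (w :* w) :* c)) ≋-refl k w c σ ⟩
          fromℕ 10 * (k * σ ^ 3 * w) * (fromℕ 16 * (k * k) * (w * w) * c)  ≤⟨ ⊑-*ˡ (0⊑* (0⊑fromℕ 10) (0⊑* (0⊑* 0⊑k (^-nonneg 3 0⊑σ)) 0⊑w)) κ-bound ⟩
          fromℕ 10 * (k * σ ^ 3 * w) * (σ * σ)  ≈⟨ solve 3 (λ k w s → con (ι 10) :* (k :* s :^ 3 :* w) :* (s :* s) := con (ι 10) :* (k :* s :^ 5 :* w)) ≋-refl k w σ ⟩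
          fromℕ 10 * q                                                         ∎

      -- The last hypothesis says that N is (E + 2)(m + β) / 2E, rounded up.
      N-bound : ∀ {x s} m β N → fromℕ s ≋ σ ^ 6 → fromℕ s ⊑ x → fromℕ (m ℕ.+ β) ⊑ fromℕ 2 * x →
        N ℕ.* (2 ℕ.* e) ℕ.≤ (e ℕ.+ 2) ℕ.* (m ℕ.+ β) ℕ.+ 2 ℕ.* e →
        fromℕ s * (fromℕ N - x) ⊑ fromℕ 48 * q * x
      N-bound {x} {s} m β N s≋ s⊑x mβ⊑ N≤ = ⊑-stable λ ret → ¬¬-excluded-middle λ dec → ret (cases dec)
        where
        Ν = fromℕ N
        0⊑x : 0ℝ ⊑ x
        0⊑x = ⊑-trans (0⊑fromℕ s) s⊑x
        0⊑q : 0ℝ ⊑ q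
        0⊑q = 0⊑* (0⊑* 0⊑k (^-nonneg 5 0⊑σ)) 0⊑w
        negative : ¬ x ⊏ Ν → fromℕ s * (Ν - x) ⊑ fromℕ 48 * q * x
        negative ¬x⊏N = (⊑-trans (⊑-*ˡ (0⊑fromℕ s) (⊑-+⇒-⊑ (⊑-trans (¬⊏⇒⊒ ¬x⊏N) (≋⇒⊑ (≋-sym (+-identityʳ x))))))
             (⊑-trans (≋⇒⊑ (solve 1 (λ s → s :* con 0ℚ := con 0ℚ) ≋-refl (fromℕ s))) (0⊑* (0⊑* (0⊑fromℕ 48) 0⊑q) 0⊑x)))
        -- `m + β ≤ 2x` turns the main part of `N` into `(1 + 2/E) x`; the final `E` pays for
        -- rounding up.
        EN : E * (Ν - x) ⊑ fromℕ 2 * x + E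
        EN = ⊑-trans (≋⇒⊑ (solve 3 (λ e n x → e :* (n :- x) := e :* n :- e :* x) ≋-refl E Ν x)) (⊑-+⇒-⊑ (begin
          E * Ν  ≈⟨ solve 2 (λ e n → e :* n := con ½ :* (n :* (con (ι 2) :* e))) ≋-refl E Ν ⟩
          fromℚ ½ * (Ν * (fromℕ 2 * E))  ≤⟨ ⊑-*ˡ 0⊑½ (fromℕ-⊑ {N ℕ.* (2 ℕ.* e)} {(e ℕ.+ 2) ℕ.* (m ℕ.+ β) ℕ.+ 2 ℕ.* e}
                                                                    (≋-trans (fromℕ-* N (2 ℕ.* e)) (≋-* ≋-refl (fromℕ-* 2 e)))
                                                                    (≋-trans (fromℕ-+ ((e ℕ.+ 2) ℕ.* (m ℕ.+ β)) (2 ℕ.* e)) (≋-+ (≋-trans (fromℕ-* (e ℕ.+ 2) (m ℕ.+ β)) (≋-* (fromℕ-+ e 2) ≋-refl)) (fromℕ-* 2 e))) N≤) ⟩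
          fromℚ ½ * ((E + fromℕ 2) * fromℕ (m ℕ.+ β) + fromℕ 2 * E)  ≤⟨ ⊑-*ˡ 0⊑½ (⊑-+ (⊑-*ˡ (⊑-trans 0⊑E (x⊑x+y (0⊑fromℕ 2))) mβ⊑) ⊑-refl) ⟩
          fromℚ ½ * ((E + fromℕ 2) * (fromℕ 2 * x) + fromℕ 2 * E)  ≈⟨ solve 2 (λ e x → con ½ :* ((e :+ con (ι 2)) :* (con (ι 2) :* x) :+ con (ι 2) :* e) := e :* x :+ (con (ι 2) :* x :+ e)) ≋-refl E x ⟩
          E * x + (fromℕ 2 * x + E)                            ∎))
        σ⊑x : σ ⊑ x
        σ⊑x = begin
          σ                    ≤⟨ x⊑x*y 0⊑σ (1⊑* 1⊑σ (1⊑* 1⊑σ (1⊑* 1⊑σ (1⊑* 1⊑σ (1⊑* 1⊑σ ⊑-refl))))) ⟩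
          σ ^ 6                ≈⟨ s≋ ⟨
          fromℕ s              ≤⟨ s⊑x ⟩
          x                    ∎
        2σ⊑zx : fromℕ 2 * σ ⊑ z * x
        2σ⊑zx = begin
          fromℕ 2 * σ                          ≤⟨ ⊑-* (0⊑fromℕ 2) 0⊑σ (numeral 2 8 (s≤s (s≤s z≤n))) σ⊑x ⟩
          fromℕ 8 * x  ≈⟨ ≋-* (solve 0 (con (ι 8) := con (ι 16) :* con ½) ≋-refl) ≋-refl ⟩
          fromℕ 16 * fromℚ ½ * x               ≤⟨ ⊑-*ʳ 0⊑x (⊑-*ˡ (0⊑fromℕ 16) ½⊑kw) ⟩
          z * x                                ∎
        -- `48 = 3 * 16`: two shares of `z x` come from the excess `2x / E` and one from the
        -- rounding, since `z E ≤ 2σ ≤ z x`.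
        positive : 0ℝ ⊑ Ν - x → fromℕ s * (Ν - x) ⊑ fromℕ 48 * q * x
        positive 0⊑N-x = begin
          fromℕ s * (Ν - x)                           ≈⟨ ≋-* s≋ ≋-refl ⟩
          σ ^ 6 * (Ν - x)  ≈⟨ solve 2 (λ s y → s :^ 6 :* y := s :^ 5 :* (s :* y)) ≋-refl σ (Ν - x) ⟩
          σ ^ 5 * (σ * (Ν - x))                       ≤⟨ ⊑-*ˡ (^-nonneg 5 0⊑σ) (begin
            σ * (Ν - x)                                 ≤⟨ ⊑-*ʳ 0⊑N-x σ⊑zE ⟩
            z * E * (Ν - x)                             ≈⟨ *-assoc z E (Ν - x) ⟩
            z * (E * (Ν - x))                           ≤⟨ ⊑-*ˡ (⊏⇒⊑ 0⊏z) EN ⟩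
            z * (fromℕ 2 * x + E)  ≈⟨ solve 3 (λ z x e → z :* (con (ι 2) :* x :+ e) := con (ι 2) :* (z :* x) :+ z :* e) ≋-refl z x E ⟩
            fromℕ 2 * (z * x) + z * E                   ≤⟨ ⊑-+ ⊑-refl (⊑-trans zE⊑2σ 2σ⊑zx) ⟩
            fromℕ 2 * (z * x) + z * x                   ∎) ⟩
          σ ^ 5 * (fromℕ 2 * (z * x) + z * x)  ≈⟨ solve 4 (λ s k w x → s :^ 5 :* (con (ι 2) :* (con (ι 16) :* (k :* w) :* x) :+ con (ι 16) :* (k :* w) :* x) := con (ι 48) :* (k :* s :^ 5 :* w) :* x) ≋-refl σ k w x ⟩
          fromℕ 48 * q * x                            ∎

        cases : Dec (x ⊏ Ν) → fromℕ s * (Ν - x) ⊑ fromℕ 48 * q * x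
        cases (yes x⊏N) = positive (⊑⇒0⊑- (⊏⇒⊑ x⊏N))
        cases (no ¬x⊏N) = negative ¬x⊏N

      -- The origin of the argument of `β`: `M ≤ Ks + 4Ks / E`, and `σ ≤ 16 k w E` turns `4Ks / E`
      -- into `64 k w Ks / σ`, which is `64 k^7 σ^5 w`.
      M-bound : ∀ {Ks} m M → 0ℝ ⊑ Ks → Ks ≋ k ^ 6 * σ ^ 6 → fromℕ m ⊑ Ks → e ℕ.* M ℕ.≤ (e ℕ.+ 4) ℕ.* m →
        fromℕ M ⊑ Ks + fromℕ 64 * k ^ 7 * σ ^ 5 * w
      M-bound {Ks} m M 0⊑Ks Ks≋ m⊑ M≤ = ⊑-cancelˡ (0⊏fromℕ (ℕₚ.≤-trans (s≤s z≤n) 4≤e)) (begin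
        E * fromℕ M  ≤⟨ fromℕ-⊑ {e ℕ.* M} {(e ℕ.+ 4) ℕ.* m} (fromℕ-* e M) (≋-trans (fromℕ-* (e ℕ.+ 4) m) (≋-* (fromℕ-+ e 4) ≋-refl)) M≤ ⟩
        (E + fromℕ 4) * fromℕ m  ≤⟨ ⊑-*ˡ (⊑-trans 0⊑E (x⊑x+y (0⊑fromℕ 4))) m⊑ ⟩
        (E + fromℕ 4) * Ks  ≈⟨ solve 2 (λ e x → (e :+ con (ι 4)) :* x := e :* x :+ con (ι 4) :* x) ≋-refl E Ks ⟩
        E * Ks + fromℕ 4 * Ks  ≈⟨ ≋-+ ≋-refl (≋-trans (≋-* ≋-refl Ks≋) (solve 2 (λ k s → con (ι 4) :* (k :^ 6 :* s :^ 6) := s :* (con (ι 4) :* k :^ 6 :* s :^ 5)) ≋-refl k σ)) ⟩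
        E * Ks + σ * (fromℕ 4 * k ^ 6 * σ ^ 5)  ≤⟨ ⊑-+ ⊑-refl (⊑-*ʳ (0⊑* (0⊑* (0⊑fromℕ 4) (^-nonneg 6 0⊑k)) (^-nonneg 5 0⊑σ)) σ⊑zE) ⟩
        E * Ks + z * E * (fromℕ 4 * k ^ 6 * σ ^ 5)  ≈⟨ solve 5 (λ e x k s w → e :* x :+ (con (ι 16) :* (k :* w)) :* e :* (con (ι 4) :* k :^ 6 :* s :^ 5)
                                                                      := e :* (x :+ con (ι 64) :* k :^ 7 :* s :^ 5 :* w)) ≋-refl E Ks k σ w ⟩
        E * (Ks + fromℕ 64 * k ^ 7 * σ ^ 5 * w)                  ∎)

  ∑<-const : ∀ θ j → ∑< (λ _ → θ) j ≋ fromℕ j * θ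
  ∑<-const θ zero    = solve 1 (λ t → con 0ℚ := con 0ℚ :* t) ≋-refl θ
  ∑<-const θ (suc j) = ≋-trans (≋-+ (∑<-const θ j) ≋-refl) (≋-trans (solve 2 (λ t j → j :* t :+ t := (con 1ℚ :+ j) :* t) ≋-refl θ (fromℕ j)) (≋-* (≋-sym (fromℕ-suc j)) ≋-refl))

  ∑<-* : ∀ a θ j → ∑< (λ i → a * θ i) j ≋ a * ∑< θ j
  ∑<-* a θ zero    = solve 1 (λ a → con 0ℚ := a :* con 0ℚ) ≋-refl a
  ∑<-* a θ (suc j) = ≋-trans (≋-+ (∑<-* a θ j) ≋-refl) (≋-sym (*-distribˡ-+ a (∑< θ j) (θ j)))

  0⊑-fromℕ : ∀ {x s} → fromℕ s ⊑ x → ∀ i → i ℕ.< s → 0ℝ ⊑ x - fromℕ i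
  0⊑-fromℕ {x} {s} s⊑x i i<s = ⊑⇒0⊑- (⊑-trans (fromℕ-mono {i} {s} (ℕₚ.<⇒≤ i<s)) s⊑x)

  -- The harmonic sum, for the case of `λ` equal to `log s`

  module Harmonic (s : ℕ) where

    open ℝ-Reasoning

    -- 1 / (s - i)
    h : ℕ → ℝ
    h i = fromℚ (recip (s ℕ.∸ suc i))

    0⊑h : ∀ i → 0ℝ ⊑ h i
    0⊑h i = fromℚ-mono (0≤recip (s ℕ.∸ suc i))

    h-inverse : ∀ i → i ℕ.< s → fromℕ (s ℕ.∸ i) * h i ≋ 1ℝ
    h-inverse i i<s = ≡.subst (λ t → fromℕ t * h i ≋ 1ℝ) (≡.sym (ℕₚ.+-∸-assoc 1 i<s))
      (≋-trans (≋-sym (fromℚ-* (ι (suc (s ℕ.∸ suc i))) (recip (s ℕ.∸ suc i)))) (≡.subst (λ q → fromℚ q ≋ 1ℝ) (≡.sym (ι*recip (s ℕ.∸ suc i))) ≋-refl))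

    recip≤1 : ∀ i → recip i ℚ.≤ 1ℚ
    recip≤1 i = ℚₚ.≤-trans (ℚₚ.≤-reflexive (≡.sym (ℚₚ.*-identityˡ (recip i))))
      (ℚₚ.≤-trans (D.CauchyLemmas.*-monoˡ (0≤recip i) (ι-mono {1} {suc i} (s≤s z≤n))) (ℚₚ.≤-reflexive (ι*recip i)))

    -- The upper bound `exp q ≤ 1 + 2q` is available for `q ≤ ½`, hence the halved argument.
    exp-½h : ∀ i → exp (fromℚ ½ * h i) ⊑ 1ℝ + h i
    exp-½h i = begin
      exp (fromℚ ½ * h i)                              ≈⟨ exp-cong (fromℚ-* ½ r) ⟨
      exp (fromℚ (½ ℚ.* r))                            ≤⟨ exp-rational-⊑ 0≤½r ½r≤½ ⟩
      fromℚ (1ℚ ℚ.+ (½ ℚ.* r ℚ.+ ½ ℚ.* r))  ≈⟨ ≋-trans (fromℚ-+ 1ℚ _) (≋-+ ≋-refl (fromℚ-+ (½ ℚ.* r) (½ ℚ.* r))) ⟩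
      1ℝ + (fromℚ (½ ℚ.* r) + fromℚ (½ ℚ.* r))         ≈⟨ ≋-+ ≋-refl (≋-+ (fromℚ-* ½ r) (fromℚ-* ½ r)) ⟩
      1ℝ + (fromℚ ½ * h i + fromℚ ½ * h i)  ≈⟨ solve 1 (λ h → con 1ℚ :+ (con ½ :* h :+ con ½ :* h) := con 1ℚ :+ h) ≋-refl (h i) ⟩
      1ℝ + h i                                         ∎
      where
      r = recip (s ℕ.∸ suc i)
      0≤½r : 0ℚ ℚ.≤ ½ ℚ.* r
      0≤½r = D.CauchyLemmas.0≤* (ℚₚ.nonNegative⁻¹ ½) (0≤recip (s ℕ.∸ suc i))
      ½r≤½ : ½ ℚ.* r ℚ.≤ ½
      ½r≤½ = ℚₚ.≤-trans (D.CauchyLemmas.*-monoʳ {½} (ℚₚ.nonNegative⁻¹ ½) (recip≤1 (s ℕ.∸ suc i))) (ℚₚ.≤-reflexive (ℚₚ.*-identityʳ ½))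

    0⊑∑h : ∀ j → 0ℝ ⊑ ∑< h j
    0⊑∑h zero    = ⊑-refl
    0⊑∑h (suc j) = ⊑-trans (0⊑∑h j) (x⊑x+y (0⊑h j))

    -- The product of 1 + 1/(s - i) over i < j telescopes to (s + 1)/(s + 1 - j).
    telescope : ∀ j → j ℕ.≤ s → exp (fromℚ ½ * ∑< h j) * fromℕ (suc (s ℕ.∸ j)) ⊑ fromℕ (suc s)
    telescope zero _ = ⊑-trans (⊑-*ʳ (0⊑fromℕ (suc s)) (≋⇒⊑ (≋-trans (exp-cong (solve 0 (con ½ :* con 0ℚ := con 0ℚ) ≋-refl)) exp-0))) (≋⇒⊑ (*-identityˡ (fromℕ (suc s))))
    telescope (suc j) j<s = begin
      exp (fromℚ ½ * (∑< h j + h j)) * fromℕ (suc (s ℕ.∸ suc j))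
        ≡⟨ ≡.cong (λ t → exp (fromℚ ½ * (∑< h j + h j)) * fromℕ t) (ℕₚ.+-∸-assoc 1 j<s) ⟨
      exp (fromℚ ½ * (∑< h j + h j)) * t
        ≈⟨ ≋-* (≋-trans (exp-cong (*-distribˡ-+ (fromℚ ½) (∑< h j) (h j))) (≋-sym (exp-+ (fromℚ ½ * ∑< h j) (fromℚ ½ * h j)))) ≋-refl ⟩
      X * exp (fromℚ ½ * h j) * t
        ≤⟨ ⊑-*ʳ (0⊑fromℕ (s ℕ.∸ j)) (⊑-*ˡ (0⊑exp (0⊑* (0⊑½) (0⊑∑h j))) (exp-½h j)) ⟩
      X * (1ℝ + h j) * t
        ≈⟨ solve 3 (λ x h t → x :* (con 1ℚ :+ h) :* t := x :* (t :* h :+ t)) ≋-refl X (h j) t ⟩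
      X * (t * h j + t)
        ≈⟨ ≋-* ≋-refl (≋-trans (≋-+ (h-inverse j j<s) ≋-refl) (≋-sym (fromℕ-suc (s ℕ.∸ j)))) ⟩
      X * fromℕ (suc (s ℕ.∸ j))
        ≤⟨ telescope j (ℕₚ.<⇒≤ j<s) ⟩
      fromℕ (suc s) ∎
      where
      X = exp (fromℚ ½ * ∑< h j)
      t = fromℕ (s ℕ.∸ j)

    -- The whole telescoped product is `s + 1 ≤ s² = exp (2l)`, so half of the harmonic sum is at
    -- most `2l`.
    harmonic-bound : 2 ℕ.≤ s → ∀ {l} → exp l ≋ fromℕ s → ∑< h s ⊑ fromℕ 4 * l
    harmonic-bound 2≤s {l} el = begin
      ∑< h s                            ≈⟨ solve 1 (λ h → h := con (ι 2) :* (con ½ :* h)) ≋-refl (∑< h s) ⟩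
      fromℕ 2 * (fromℚ ½ * ∑< h s)  ≤⟨ ⊑-*ˡ (0⊑fromℕ 2) (exp-cancel (⊏-⊑-trans (0⊏* 0⊏s 0⊏s) (≋⇒⊑ ss)) (begin
        exp (fromℚ ½ * ∑< h s)                             ≈⟨ *-identityʳ _ ⟨
        exp (fromℚ ½ * ∑< h s) * fromℕ 1  ≡⟨ ≡.cong (λ t → exp (fromℚ ½ * ∑< h s) * fromℕ (suc t)) (ℕₚ.n∸n≡0 s) ⟨
        exp (fromℚ ½ * ∑< h s) * fromℕ (suc (s ℕ.∸ s))     ≤⟨ telescope s ℕₚ.≤-refl ⟩
        fromℕ (suc s)                                      ≤⟨ fromℕ-mono {suc s} {s ℕ.* s} s+1≤ss ⟩
        fromℕ (s ℕ.* s)                                    ≈⟨ ≋-trans (fromℕ-* s s) ss ⟩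
        exp (l + l)                                        ∎)) ⟩
      fromℕ 2 * (l + l)                 ≈⟨ solve 1 (λ l → con (ι 2) :* (l :+ l) := con (ι 4) :* l) ≋-refl l ⟩
      fromℕ 4 * l                       ∎
      where
      0⊏s : 0ℝ ⊏ fromℕ s
      0⊏s = 0⊏fromℕ (ℕₚ.≤-trans (s≤s z≤n) 2≤s)
      ss : fromℕ s * fromℕ s ≋ exp (l + l)
      ss = ≋-trans (≋-* (≋-sym el) (≋-sym el)) (exp-+ l l)
      s+1≤ss : suc s ℕ.≤ s ℕ.* s
      s+1≤ss = ℕₚ.≤-trans (ℕₚ.+-monoˡ-≤ s (ℕₚ.≤-trans (s≤s z≤n) 2≤s)) (ℕₚ.≤-trans (ℕₚ.≤-reflexive (≡.cong (s ℕ.+_) (≡.sym (ℕₚ.+-identityʳ s)))) (ℕₚ.*-monoˡ-≤ s 2≤s))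

  -- The quotient of the binomial coefficients

  module Ratio (s N : ℕ) (0<s : 0 ℕ.< s) (s≤N : s ℕ.≤ N) {x q : ℝ} (0⊑q : 0ℝ ⊑ q)
    (s⊑x : fromℕ s ⊑ x) (N-bound : fromℕ s * (fromℕ N - x) ⊑ fromℕ 48 * q * x) where

    open ℝ-Reasoning

    private
      S = fromℕ s
      Ν = fromℕ N
      ρ = fromℚ (1/n s {{ℕ.>-nonZero 0<s}})
      0⊏S : 0ℝ ⊏ S
      0⊏S = 0⊏fromℕ 0<s
      Sρ : S * ρ ≋ 1ℝ
      Sρ = n*1/n s {{ℕ.>-nonZero 0<s}}
      0⊑x-i : ∀ i → i ℕ.< s → 0ℝ ⊑ x - fromℕ i
      0⊑x-i = 0⊑-fromℕ {x} {s} s⊑x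
      0⊑N-i : ∀ i → i ℕ.< s → 0ℝ ⊑ Ν - fromℕ i
      0⊑N-i = 0⊑-fromℕ {Ν} {s} (fromℕ-mono {s} {N} s≤N)
      0⊑48q : 0ℝ ⊑ fromℕ 48 * q
      0⊑48q = 0⊑* (0⊑fromℕ 48) 0⊑q

    0⊑binomial : 0ℝ ⊑ binomial x s
    0⊑binomial = 0⊑* (0⊑FF {x} {x} (λ _ → 0ℝ) s (λ _ _ → ⊑-refl) 0⊑x-i 0⊑x-i
      (λ i i<s → ≋⇒⊑ (solve 2 (λ x i → x :- x := con 0ℚ :* (x :- i)) ≋-refl x (fromℕ i))) s ℕₚ.≤-refl) (0⊑1/n (s !) {{s ℕₚ.!≢0}})

    -- `i < s` and `Ks ≤ 2x` give `x ≤ l (x - i)` with `l = K / (K - 2)`, so one `θ = 48 q l / s`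
    -- serves all `s` factors.
    ratio-large : ∀ {K l} → 0ℝ ⊑ K → 0ℝ ⊏ K - fromℕ 2 → l * (K - fromℕ 2) ≋ K → 0ℝ ⊑ l → K * S ⊑ fromℕ 2 * x →
      binomial Ν s ⊑ exp (fromℕ 48 * l * q) * binomial x s
    ratio-large {K} {l} 0⊑K 0⊏K-2 lK 0⊑l KS⊑2x = ⊑-trans
        (binomial-ratio {x} {Ν} (λ _ → θ) s (λ _ _ → 0⊑θ) 0⊑N-i 0⊑x-i close)
        (≋⇒⊑ (≋-* (exp-cong (≋-trans (∑<-const θ s) total)) ≋-refl))
      where
      θ = fromℕ 48 * q * l * ρ
      0⊑θ : 0ℝ ⊑ θ
      0⊑θ = 0⊑* (0⊑* 0⊑48q 0⊑l) (0⊑1/n s {{ℕ.>-nonZero 0<s}})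
      total : S * θ ≋ fromℕ 48 * l * q
      total = ≋-trans (solve 4 (λ s q l r → s :* (con (ι 48) :* q :* l :* r) := con (ι 48) :* l :* q :* (s :* r)) ≋-refl S q l ρ) (≋-trans (≋-* ≋-refl Sρ) (*-identityʳ _))
      x⊑l : ∀ i → i ℕ.< s → x ⊑ l * (x - fromℕ i)
      x⊑l i i<s = ⊑-cancelˡ 0⊏K-2 (begin
        (K - fromℕ 2) * x  ≈⟨ solve 2 (λ K x → (K :- con (ι 2)) :* x := K :* x :- con (ι 2) :* x) ≋-refl K x ⟩
        K * x - fromℕ 2 * x  ≤⟨ ⊑-+⇒-⊑ (⊑-trans (≋⇒⊑ (solve 2 (λ a b → a := b :+ (a :- b)) ≋-refl (K * x) (K * fromℕ i))) (⊑-+ (⊑-trans (⊑-*ˡ 0⊑K (fromℕ-mono {i} {s} (ℕₚ.<⇒≤ i<s))) KS⊑2x) ⊑-refl)) ⟩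
        K * x - K * fromℕ i  ≈⟨ solve 3 (λ K x i → K :* x :- K :* i := K :* (x :- i)) ≋-refl K x (fromℕ i) ⟩
        K * (x - fromℕ i)                         ≈⟨ ≋-* lK ≋-refl ⟨
        l * (K - fromℕ 2) * (x - fromℕ i)  ≈⟨ solve 3 (λ l k y → l :* k :* y := k :* (l :* y)) ≋-refl l (K - fromℕ 2) (x - fromℕ i) ⟩
        (K - fromℕ 2) * (l * (x - fromℕ i))       ∎)
      close : ∀ i → i ℕ.< s → Ν - x ⊑ θ * (x - fromℕ i)
      close i i<s = ⊑-cancelˡ 0⊏S (begin
        S * (Ν - x)                                          ≤⟨ N-bound ⟩
        fromℕ 48 * q * x                                     ≤⟨ ⊑-*ˡ 0⊑48q (x⊑l i i<s) ⟩
        fromℕ 48 * q * (l * (x - fromℕ i))                   ≈⟨ *-identityʳ _ ⟨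
        fromℕ 48 * q * (l * (x - fromℕ i)) * 1ℝ              ≈⟨ ≋-* ≋-refl Sρ ⟨
        fromℕ 48 * q * (l * (x - fromℕ i)) * (S * ρ)  ≈⟨ solve 5 (λ q l y s r → con (ι 48) :* q :* (l :* y) :* (s :* r) := s :* (con (ι 48) :* q :* l :* r :* y)) ≋-refl q l (x - fromℕ i) S ρ ⟩
        S * (θ * (x - fromℕ i))                              ∎)

    -- `s ≤ x` gives `x (s - i) ≤ s (x - i)`, so `θ i = 48 q / (s - i)` suffices even if `x` is
    -- close to `s`. The harmonic sum contributes `4 log s`, and `192 = 48 * 4`.
    ratio-log : ∀ {l} → 2 ℕ.≤ s → exp l ≋ S → binomial Ν s ⊑ exp (fromℕ 192 * l * q) * binomial x s
    ratio-log {l} 2≤s el = ⊑-trans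
        (binomial-ratio {x} {Ν} θ s (λ i _ → 0⊑θ i) 0⊑N-i 0⊑x-i close)
        (⊑-*ʳ 0⊑binomial (exp-mono (0⊑∑< {x} {Ν} θ s (λ i _ → 0⊑θ i) 0⊑N-i 0⊑x-i close s ℕₚ.≤-refl) (begin
          ∑< θ s                              ≈⟨ ∑<-* (fromℕ 48 * q) h s ⟩
          fromℕ 48 * q * ∑< h s               ≤⟨ ⊑-*ˡ 0⊑48q (harmonic-bound 2≤s el) ⟩
          fromℕ 48 * q * (fromℕ 4 * l)  ≈⟨ solve 2 (λ q l → con (ι 48) :* q :* (con (ι 4) :* l) := con (ι 192) :* l :* q) ≋-refl q l ⟩
          fromℕ 192 * l * q                   ∎)))
      where
      open Harmonic s
      θ : ℕ → ℝ
      θ i = fromℕ 48 * q * h i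
      0⊑θ : ∀ i → 0ℝ ⊑ θ i
      0⊑θ i = 0⊑* 0⊑48q (0⊑h i)
      close : ∀ i → i ℕ.< s → Ν - x ⊑ θ i * (x - fromℕ i)
      close i i<s = ⊑-cancelˡ 0⊏S (⊑-cancelˡ (0⊏fromℕ (ℕₚ.m<n⇒0<n∸m i<s)) (begin
        t * (S * (Ν - x))                                       ≤⟨ ⊑-*ˡ (0⊑fromℕ (s ℕ.∸ i)) N-bound ⟩
        t * (fromℕ 48 * q * x)  ≈⟨ solve 3 (λ t q x → t :* (con (ι 48) :* q :* x) := con (ι 48) :* q :* (x :* t)) ≋-refl t q x ⟩
        fromℕ 48 * q * (x * t)                                  ≤⟨ ⊑-*ˡ 0⊑48q xt⊑ ⟩
        fromℕ 48 * q * (S * (x - fromℕ i))                      ≈⟨ *-identityʳ _ ⟨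
        fromℕ 48 * q * (S * (x - fromℕ i)) * 1ℝ                 ≈⟨ ≋-* ≋-refl (h-inverse i i<s) ⟨
        fromℕ 48 * q * (S * (x - fromℕ i)) * (t * h i)  ≈⟨ solve 5 (λ q s y t h → con (ι 48) :* q :* (s :* y) :* (t :* h) := t :* (s :* (con (ι 48) :* q :* h :* y))) ≋-refl q S (x - fromℕ i) t (h i) ⟩
        t * (S * (θ i * (x - fromℕ i)))                         ∎))
        where
        t = fromℕ (s ℕ.∸ i)
        t≋ : S ≋ t + fromℕ i
        t≋ = ≋-trans (≡.subst (λ a → S ≋ fromℕ a) (≡.sym (ℕₚ.m∸n+n≡m (ℕₚ.<⇒≤ i<s))) ≋-refl) (fromℕ-+ (s ℕ.∸ i) i)
        xt⊑ : x * t ⊑ S * (x - fromℕ i)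
        xt⊑ = begin
          x * t  ≈⟨ solve 3 (λ x t i → x :* t := x :* (t :+ i) :- x :* i) ≋-refl x t (fromℕ i) ⟩
          x * (t + fromℕ i) - x * fromℕ i                   ≈⟨ ≋-+ (≋-* ≋-refl (≋-sym t≋)) ≋-refl ⟩
          x * S - x * fromℕ i  ≤⟨ ⊑-+⇒-⊑ (⊑-trans (≋⇒⊑ (solve 3 (λ x s i → x :* s := s :* i :+ s :* (x :- i)) ≋-refl x S (fromℕ i))) (⊑-+ (⊑-*ʳ (0⊑fromℕ i) s⊑x) ⊑-refl)) ⟩
          S * (x - fromℕ i)                                 ∎

  ½⊑log : ∀ {n L} → 2 ℕ.≤ n → exp L ≋ fromℕ n → fromℚ ½ ⊑ L
  ½⊑log {n} {L} 2≤n exp-L = exp-cancel (⊏-⊑-trans (0⊏fromℕ (ℕₚ.≤-trans (s≤s z≤n) 2≤n)) (≋⇒⊑ (≋-sym exp-L))) (begin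
    exp (fromℚ ½)       ≤⟨ exp-rational-⊑ {½} (ℚₚ.nonNegative⁻¹ ½) ℚₚ.≤-refl ⟩
    fromℕ 2             ≤⟨ fromℕ-mono {2} {n} 2≤n ⟩
    fromℕ n             ≈⟨ exp-L ⟨
    exp L               ∎)
    where open ℝ-Reasoning

  module Rounding (e d m β n : ℕ) (4≤e : 4 ℕ.≤ e) (0<d : 0 ℕ.< d) (2≤n : 2 ℕ.≤ n) where

    instance
      e≢0 : ℕ.NonZero e
      e≢0 = ℕ.>-nonZero (ℕₚ.≤-trans (s≤s z≤n) 4≤e)

      e+e≢0 : ℕ.NonZero (2 ℕ.* e)
      e+e≢0 = ℕₚ.m*n≢0 2 e

      d≢0 : ℕ.NonZero d
      d≢0 = ℕ.>-nonZero 0<d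

    X N M f r₀ r : ℕ
    X = (e ℕ.+ 2) ℕ.* (m ℕ.+ β)
    N = suc (X ℕ./ (2 ℕ.* e))
    M = (e ℕ.+ 4) ℕ.* m ℕ./ e
    f = suc (m ℕ./ d)
    r₀ = proj₁ (⌊log₂⌋ n (ℕₚ.≤-trans (s≤s z≤n) 2≤n))
    -- Two more than `⌊log₂ n⌋`, to leave room for `n + 2` instead of `n`.
    r = r₀ ℕ.+ 2

    2^r₀≤n : 2 ℕ.^ r₀ ℕ.≤ n
    2^r₀≤n = proj₁ (proj₂ (⌊log₂⌋ n (ℕₚ.≤-trans (s≤s z≤n) 2≤n)))

    n+2≤2^r : n ℕ.+ 2 ℕ.≤ 2 ℕ.^ r
    n+2≤2^r = ℕₚ.≤-trans (ℕₚ.+-mono-≤ (ℕₚ.<⇒≤ n<) (ℕₚ.*-monoʳ-≤ 2 (ℕₚ.m^n>0 2 r₀)))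
      (ℕₚ.≤-reflexive (≡.trans (double (2 ℕ.^ r₀)) (≡.sym (ℕₚ.^-distribˡ-+-* 2 r₀ 2))))
      where
      n< : n ℕ.< 2 ℕ.^ suc r₀
      n< = proj₂ (proj₂ (⌊log₂⌋ n (ℕₚ.≤-trans (s≤s z≤n) 2≤n)))
      double : ∀ t → 2 ℕ.* t ℕ.+ 2 ℕ.* t ≡ t ℕ.* 4
      double = solve-∀

    N-large : X ℕ.≤ 2 ℕ.* e ℕ.* N
    N-large = ℕₚ.≤-trans (ℕₚ.<⇒≤ (n<[1+n/d]*d X (2 ℕ.* e))) (ℕₚ.≤-reflexive (ℕₚ.*-comm N (2 ℕ.* e)))

    N-small : N ℕ.* (2 ℕ.* e) ℕ.≤ X ℕ.+ 2 ℕ.* e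
    N-small = ℕₚ.≤-trans (ℕₚ.+-monoʳ-≤ (2 ℕ.* e) (m/n*n≤m X (2 ℕ.* e))) (ℕₚ.≤-reflexive (ℕₚ.+-comm (2 ℕ.* e) X))

    M-large : (e ℕ.+ 4) ℕ.* m ℕ.≤ e ℕ.* suc M
    M-large = ℕₚ.≤-trans (ℕₚ.<⇒≤ (n<[1+n/d]*d ((e ℕ.+ 4) ℕ.* m) e)) (ℕₚ.≤-reflexive (ℕₚ.*-comm (suc M) e))

    M-small : e ℕ.* M ℕ.≤ (e ℕ.+ 4) ℕ.* m
    M-small = ℕₚ.≤-trans (ℕₚ.≤-reflexive (ℕₚ.*-comm e M)) (m/n*n≤m ((e ℕ.+ 4) ℕ.* m) e)

    f-large : m ℕ.< f ℕ.* d
    f-large = n<[1+n/d]*d m d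

    f-small : f ℕ.* d ℕ.≤ m ℕ.+ d
    f-small = ℕₚ.≤-trans (ℕₚ.+-monoʳ-≤ d (m/n*n≤m m d)) (ℕₚ.≤-reflexive (ℕₚ.+-comm d m))

    m≤2N : m ℕ.≤ 2 ℕ.* N
    m≤2N = ℕₚ.*-cancelˡ-≤ e (ℕₚ.≤-trans (ℕₚ.*-mono-≤ (ℕₚ.m≤m+n e 2) (ℕₚ.m≤m+n m β)) (ℕₚ.≤-trans N-large (ℕₚ.≤-reflexive (arith e N))))
      where
      arith : ∀ e N → 2 ℕ.* e ℕ.* N ≡ e ℕ.* (2 ℕ.* N)
      arith = solve-∀

  -- The bound for `n ≥ 2`

  module Main {g ℓ} (G : AbelianGroup g ℓ) where

    open D.Sets G
    open ℝ-Reasoning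

    module _ (s n : ℕ) (0<s : 0 ℕ.< s) (2≤n : 2 ℕ.≤ n) (K L l w k σ lam : ℝ)
      (exp-L : exp L ≋ fromℕ n) (exp-l : exp l ≋ fromℕ s) (ww≋L : w * w ≋ L) (k⁶≋K : k ^ 6 ≋ K) (σ⁶≋s : σ ^ 6 ≋ fromℕ s)
      (0⊑w : 0ℝ ⊑ w) (0⊑k : 0ℝ ⊑ k) (2⊑K : fromℕ 2 ⊑ K) (64kw⊑σ : fromℕ 64 * (k * w) ⊑ σ)
      (lam-value : lam ≋ l ⊎ (0ℝ ⊏ K - fromℕ 2 × lam * (K - fromℕ 2) ≋ K)) where

      ½⊑L : fromℚ ½ ⊑ L
      ½⊑L = ½⊑log 2≤n exp-L

      ½⊑w : fromℚ ½ ⊑ w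
      ½⊑w = ^-cancel-⊑ 1 0⊑w (begin
        fromℚ ½ ^ 2                    ≤⟨ x⊑x+y {fromℚ ½ ^ 2} {fromℚ ½ ^ 2} (^-nonneg 2 0⊑½) ⟩
        fromℚ ½ ^ 2 + fromℚ ½ ^ 2      ≈⟨ solve 0 (con ½ :^ 2 :+ con ½ :^ 2 := con ½) ≋-refl ⟩
        fromℚ ½                        ≤⟨ ½⊑L ⟩
        L                              ≈⟨ ww≋L ⟨
        w * w                          ≈⟨ solve 1 (λ w → w :* w := w :^ 2) ≋-refl w ⟩
        w ^ 2                          ∎)

      1⊑k : 1ℝ ⊑ k
      1⊑k = ^-cancel-⊑ 5 0⊑k (begin
        1ℝ ^ 6        ≈⟨ solve 0 (con 1ℚ :^ 6 := con 1ℚ) ≋-refl ⟩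
        1ℝ            ≤⟨ numeral 1 2 (s≤s z≤n) ⟩
        fromℕ 2       ≤⟨ 2⊑K ⟩
        K             ≈⟨ k⁶≋K ⟨
        k ^ 6         ∎)

      z p q : ℝ
      z = fromℕ 16 * (k * w)
      p = k ^ 3 * σ ^ 3
      q = k * σ ^ 5 * w

      32⊑σ : fromℕ 32 ⊑ σ
      32⊑σ = Setup.32⊑σ k w σ 1⊑k ½⊑w 64kw⊑σ

      1⊑σ : 1ℝ ⊑ σ
      1⊑σ = Setup.1⊑σ k w σ 1⊑k ½⊑w 64kw⊑σ

      0⊑σ : 0ℝ ⊑ σ
      0⊑σ = ⊑-trans 0⊑1 1⊑σ

      0⊑K : 0ℝ ⊑ K
      0⊑K = ⊑-trans (0⊑fromℕ 2) 2⊑K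

      0⊑q : 0ℝ ⊑ q
      0⊑q = 0⊑* (0⊑* 0⊑k (^-nonneg 5 0⊑σ)) 0⊑w

      4⊑s : fromℕ 4 ⊑ fromℕ s
      4⊑s = begin
        fromℕ 4       ≤⟨ numeral 4 32 (ℕₚ.m≤m+n 4 28) ⟩
        fromℕ 32      ≤⟨ 32⊑σ ⟩
        σ             ≤⟨ x⊑x*y 0⊑σ (1⊑* 1⊑σ (1⊑* 1⊑σ (1⊑* 1⊑σ (1⊑* 1⊑σ (1⊑* 1⊑σ ⊑-refl))))) ⟩
        σ ^ 6         ≈⟨ σ⁶≋s ⟩
        fromℕ s       ∎

      2≤s : 2 ℕ.≤ s
      2≤s = ℕₚ.≤-trans (s≤s (s≤s z≤n)) (fromℕ-cancel-≤ {4} {s} 4⊑s)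

      1⊑l : 1ℝ ⊑ l
      1⊑l = exp-cancel (⊏-⊑-trans (0⊏fromℕ 0<s) (≋⇒⊑ (≋-sym exp-l))) (begin
        exp 1ℝ                              ≈⟨ exp-cong (solve 0 (con 1ℚ := con ½ :+ con ½) ≋-refl) ⟩
        exp (fromℚ ½ + fromℚ ½)             ≈⟨ exp-+ (fromℚ ½) (fromℚ ½) ⟨
        exp (fromℚ ½) * exp (fromℚ ½)       ≤⟨ ⊑-* 0⊑e 0⊑e e⊑2 e⊑2 ⟩
        fromℕ 2 * fromℕ 2                   ≈⟨ fromℕ-* 2 2 ⟨
        fromℕ 4                             ≤⟨ 4⊑s ⟩
        fromℕ s                             ≈⟨ exp-l ⟨
        exp l                               ∎)
        where
        0⊑e : 0ℝ ⊑ exp (fromℚ ½)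
        0⊑e = 0⊑exp 0⊑½
        e⊑2 : exp (fromℚ ½) ⊑ fromℕ 2
        e⊑2 = exp-rational-⊑ {½} (ℚₚ.nonNegative⁻¹ ½) ℚₚ.≤-refl

      -- Allows the container exponent `10 q`, in which `λ` does not occur, to be absorbed in a
      -- multiple of `λ q`.
      1⊑lam : 1ℝ ⊑ lam
      1⊑lam = go lam-value
        where
        go : lam ≋ l ⊎ (0ℝ ⊏ K - fromℕ 2 × lam * (K - fromℕ 2) ≋ K) → 1ℝ ⊑ lam
        go (inj₁ e) = ⊑-trans 1⊑l (≋⇒⊑ (≋-sym e))
        go (inj₂ (0⊏K-2 , e)) = ⊑-cancelˡ 0⊏K-2 (begin
          (K - fromℕ 2) * 1ℝ          ≈⟨ *-identityʳ (K - fromℕ 2) ⟩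
          K - fromℕ 2                 ≤⟨ ⊑-+⇒-⊑ (⊑-trans (x⊑x+y (0⊑fromℕ 2)) (≋⇒⊑ (+-comm K (fromℕ 2)))) ⟩
          K                           ≈⟨ e ⟨
          lam * (K - fromℕ 2)         ≈⟨ *-comm lam (K - fromℕ 2) ⟩
          (K - fromℕ 2) * lam         ∎)

      0⊑lam : 0ℝ ⊑ lam
      0⊑lam = ⊑-trans 0⊑1 1⊑lam

      0⊑lam*q : 0ℝ ⊑ lam * q
      0⊑lam*q = 0⊑* 0⊑lam 0⊑q

      KS : ℝ
      KS = K * fromℕ s

      KS≋ : KS ≋ k ^ 6 * σ ^ 6
      KS≋ = ≋-* (≋-sym k⁶≋K) (≋-sym σ⁶≋s)

      KS≋pp : KS ≋ p * p
      KS≋pp = ≋-trans KS≋ (solve 2 (λ k s → k :^ 6 :* s :^ 6 := (k :^ 3 :* s :^ 3) :* (k :^ 3 :* s :^ 3)) ≋-refl k σ)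

      0⊑KS : 0ℝ ⊑ KS
      0⊑KS = 0⊑* 0⊑K (0⊑fromℕ s)

      module _ (β : ℕ) (β-max : ∀ o → SubgroupOrder o → fromℕ o ⊑ KS + fromℕ 64 * k ^ 7 * σ ^ 5 * w → o ℕ.≤ β)
        (Y : Subset) (cardY : HasCard Y n) where

        x : ℝ
        x = fromℚ ½ * (KS + fromℕ β)

        2x≋ : fromℕ 2 * x ≋ KS + fromℕ β
        2x≋ = solve 1 (λ y → con (ι 2) :* (con ½ :* y) := y) ≋-refl (KS + fromℕ β)

        KS⊑2x : KS ⊑ fromℕ 2 * x
        KS⊑2x = ⊑-trans (x⊑x+y (0⊑fromℕ β)) (≋⇒⊑ (≋-sym 2x≋))

        s⊑x : fromℕ s ⊑ x
        s⊑x = ⊑-cancelˡ (0⊏fromℕ {2} (s≤s z≤n)) (⊑-trans (⊑-*ʳ (0⊑fromℕ s) 2⊑K) KS⊑2x)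

        module _ {cnt : ℕ} (A : Fin cnt → Subset) (A⊆Y : ∀ j → A j ⊆ᵖ Y) (cardA : ∀ j → HasCard (A j) s)
          (sums : ∀ j → ∃[ o ] (HasCard (A j ⊞ A j) o × fromℕ o ⊑ KS)) (distinct : ∀ i j → A i ≐ A j → i ≡ j) where

          -- `exp ½ ≤ 2` gives `r ≤ 2 log n`, and `log n ≥ ½` turns the extra 2 into `4 log n`.
          log-bound : ∀ r → 2 ℕ.^ r ℕ.≤ n → fromℕ (r ℕ.+ 2) ⊑ fromℕ 6 * (w * w)
          log-bound r 2^r≤n = begin
            fromℕ (r ℕ.+ 2)                         ≈⟨ fromℕ-+ r 2 ⟩
            fromℕ r + fromℕ 2  ≈⟨ solve 1 (λ r → r :+ con (ι 2) := con (ι 2) :* (r :* con ½) :+ con (ι 4) :* con ½) ≋-refl (fromℕ r) ⟩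
            fromℕ 2 * (fromℕ r * fromℚ ½) + fromℕ 4 * fromℚ ½  ≤⟨ ⊑-+ (⊑-*ˡ (0⊑fromℕ 2) r½⊑L) (⊑-*ˡ (0⊑fromℕ 4) ½⊑L) ⟩
            fromℕ 2 * L + fromℕ 4 * L  ≈⟨ solve 1 (λ y → con (ι 2) :* y :+ con (ι 4) :* y := con (ι 6) :* y) ≋-refl L ⟩
            fromℕ 6 * L                             ≈⟨ ≋-* ≋-refl ww≋L ⟨
            fromℕ 6 * (w * w)                       ∎
            where
            r½⊑L : fromℕ r * fromℚ ½ ⊑ L
            r½⊑L = exp-cancel (⊏-⊑-trans (0⊏fromℕ (ℕₚ.≤-trans (s≤s z≤n) 2≤n)) (≋⇒⊑ (≋-sym exp-L))) (begin
              exp (fromℕ r * fromℚ ½)       ≈⟨ exp-^ (fromℚ ½) r ⟨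
              exp (fromℚ ½) ^ r  ≤⟨ ^-mono-⊑ r (0⊑exp 0⊑½) (exp-rational-⊑ {½} (ℚₚ.nonNegative⁻¹ ½) ℚₚ.≤-refl) ⟩
              fromℕ 2 ^ r                   ≈⟨ fromℕ-^ 2 r ⟨
              fromℕ (2 ℕ.^ r)               ≤⟨ fromℕ-mono {2 ℕ.^ r} {n} 2^r≤n ⟩
              fromℕ n                       ≈⟨ exp-L ⟨
              exp L                         ∎)

          bound : ℝ
          bound = exp (fromℕ 512 * lam * q) * binomial x s

          combine : ∀ Φ N → s ℕ.≤ N → fromℕ (2 ℕ.* Φ) * (w * w) ⊑ fromℕ 10 * q → fromℕ s * (fromℕ N - x) ⊑ fromℕ 48 * q * x →
            cnt ℕ.≤ suc n ℕ.^ Φ ℕ.* (N C s) → fromℕ cnt ⊑ bound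
          combine Φ N s≤N Φ⊑ N⊑ cnt≤ = begin
            fromℕ cnt  ≤⟨ fromℕ-mono {cnt} {suc n ℕ.^ Φ ℕ.* (N C s)} cnt≤ ⟩
            fromℕ (suc n ℕ.^ Φ ℕ.* (N C s))                                ≈⟨ fromℕ-* (suc n ℕ.^ Φ) (N C s) ⟩
            fromℕ (suc n ℕ.^ Φ) * fromℕ (N C s)  ≤⟨ ⊑-* (0⊑fromℕ (suc n ℕ.^ Φ)) (0⊑fromℕ (N C s)) containers (⊑-trans (≋⇒⊑ (C-binomial N s)) ratio) ⟩
            exp (fromℕ 10 * lam * q) * (exp (fromℕ 192 * lam * q) * binomial x s)
              ≈⟨ *-assoc _ _ _ ⟨
            exp (fromℕ 10 * lam * q) * exp (fromℕ 192 * lam * q) * binomial x s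
              ≈⟨ ≋-* (≋-trans (exp-+ _ _) (exp-cong (solve 2 (λ a b → con (ι 10) :* a :* b :+ con (ι 192) :* a :* b := con (ι 202) :* (a :* b)) ≋-refl lam q))) ≋-refl ⟩
            -- 10 for the number of final sets plus 192 for the quotient of the binomial
            -- coefficients, well below `2^9`.
            exp (fromℕ 202 * (lam * q)) * binomial x s
              ≤⟨ ⊑-*ʳ 0⊑binomial (exp-mono (0⊑* (0⊑fromℕ 202) 0⊑lam*q) (⊑-trans (⊑-*ʳ 0⊑lam*q (numeral 202 512 (ℕₚ.m≤m+n 202 310))) (≋⇒⊑ (≋-sym (*-assoc (fromℕ 512) lam q))))) ⟩
            bound                                                          ∎
            where
            open Ratio s N 0<s s≤N 0⊑q s⊑x N⊑
            ratio : binomial (fromℕ N) s ⊑ exp (fromℕ 192 * lam * q) * binomial x s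
            ratio = go lam-value
              where
              go : lam ≋ l ⊎ (0ℝ ⊏ K - fromℕ 2 × lam * (K - fromℕ 2) ≋ K) → binomial (fromℕ N) s ⊑ exp (fromℕ 192 * lam * q) * binomial x s
              go (inj₁ e) = ratio-log 2≤s (≋-trans (exp-cong e) exp-l)
              go (inj₂ (0⊏K-2 , e)) = ⊑-trans (ratio-large 0⊑K 0⊏K-2 e 0⊑lam KS⊑2x)
                (⊑-*ʳ 0⊑binomial (exp-mono (0⊑* (0⊑* (0⊑fromℕ 48) 0⊑lam) 0⊑q) (⊑-*ʳ 0⊑q (⊑-*ʳ 0⊑lam (numeral 48 192 (ℕₚ.m≤m+n 48 144))))))
            containers : fromℕ (suc n ℕ.^ Φ) ⊑ exp (fromℕ 10 * lam * q)
            containers = begin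
              fromℕ (suc n ℕ.^ Φ)                ≤⟨ fromℕ-mono {suc n ℕ.^ Φ} {n ℕ.^ (2 ℕ.* Φ)} n+1≤n² ⟩
              fromℕ (n ℕ.^ (2 ℕ.* Φ))            ≈⟨ fromℕ-^ n (2 ℕ.* Φ) ⟩
              fromℕ n ^ (2 ℕ.* Φ)                ≈⟨ ^-cong (2 ℕ.* Φ) exp-L ⟨
              exp L ^ (2 ℕ.* Φ)                  ≈⟨ exp-^ L (2 ℕ.* Φ) ⟩
              exp (fromℕ (2 ℕ.* Φ) * L)  ≤⟨ exp-mono (0⊑* (0⊑fromℕ (2 ℕ.* Φ)) (⊑-trans 0⊑½ ½⊑L)) (begin
                fromℕ (2 ℕ.* Φ) * L                ≈⟨ ≋-* ≋-refl ww≋L ⟨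
                fromℕ (2 ℕ.* Φ) * (w * w)          ≤⟨ Φ⊑ ⟩
                fromℕ 10 * q                       ≤⟨ ⊑-*ʳ 0⊑q (x⊑x*y (0⊑fromℕ 10) 1⊑lam) ⟩
                fromℕ 10 * lam * q                 ∎) ⟩
              exp (fromℕ 10 * lam * q)           ∎
              where
              n+1≤n² : suc n ℕ.^ Φ ℕ.≤ n ℕ.^ (2 ℕ.* Φ)
              n+1≤n² = ℕₚ.≤-trans (ℕₚ.^-monoˡ-≤ Φ (ℕₚ.≤-trans (ℕₚ.+-monoˡ-≤ n (ℕₚ.≤-trans (s≤s z≤n) 2≤n))
                (ℕₚ.≤-trans (ℕₚ.≤-reflexive (n+n n)) (ℕₚ.*-mono-≤ 2≤n (ℕₚ.≤-reflexive (≡.sym (ℕₚ.*-identityʳ n))))))) (ℕₚ.≤-reflexive (ℕₚ.^-*-assoc n 2 Φ))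
                where
                n+n : ∀ n → n ℕ.+ n ≡ 2 ℕ.* n
                n+n = solve-∀

          parameters-bound : ∀ e → σ ⊑ z * fromℕ e → fromℕ 8 * (k * w) * fromℕ e ⊑ σ → 4 ℕ.≤ e →
            ∀ d → 0 ℕ.< d → fromℕ d * (fromℕ (4 ℕ.* e ℕ.* e) * w) ⊑ p → p ⊑ fromℕ 2 * fromℕ d * (fromℕ (4 ℕ.* e ℕ.* e) * w) →
            ∀ m → fromℕ m ⊑ KS → KS ⊏ fromℕ (suc m) → fromℕ cnt ⊑ bound
          parameters-bound e σ⊑zE 8kwE⊑σ 4≤e d 0<d dcw⊑p p⊑2dcw m m⊑KS KS⊏ =
            combine (f ℕ.+ 6 ℕ.* κ ℕ.* r ℕ.* b) N s≤N
              (Setup.ChosenE.ChosenD.exponent-bound k w σ 1⊑k ½⊑w 64kw⊑σ e σ⊑zE 8kwE⊑σ 4≤e d 0<d dcw⊑p p⊑2dcw (f ℕ.+ 6 ℕ.* κ ℕ.* r ℕ.* b) (begin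
                fromℕ (f ℕ.+ 6 ℕ.* κ ℕ.* r ℕ.* b)                ≈⟨ fromℕ-+ f (6 ℕ.* κ ℕ.* r ℕ.* b) ⟩
                fromℕ f + fromℕ (6 ℕ.* κ ℕ.* r ℕ.* b)            ≤⟨ ⊑-+
                  (Setup.ChosenE.ChosenD.fuel-bound k w σ 1⊑k ½⊑w 64kw⊑σ e σ⊑zE 8kwE⊑σ 4≤e d 0<d dcw⊑p p⊑2dcw m f m⊑pp (Rounding.f-small e d m β n 4≤e 0<d 2≤n))
                  (Setup.ChosenE.ChosenD.rounds-bound k w σ 1⊑k ½⊑w 64kw⊑σ e σ⊑zE 8kwE⊑σ 4≤e d 0<d dcw⊑p p⊑2dcw r (log-bound r₀ (Rounding.2^r₀≤n e d m β n 4≤e 0<d 2≤n))) ⟩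
                fromℕ 4 * c * w * p + fromℕ 72 * c * w * p  ≈⟨ solve 3 (λ c w p → con (ι 4) :* c :* w :* p :+ con (ι 72) :* c :* w :* p := con (ι 76) :* c :* w :* p) ≋-refl c w p ⟩
                fromℕ 76 * c * w * p                             ∎))
              (Setup.ChosenE.N-bound k w σ 1⊑k ½⊑w 64kw⊑σ e σ⊑zE 8kwE⊑σ 4≤e {x} {s} m β N (≋-sym σ⁶≋s) s⊑x mβ⊑ (Rounding.N-small e d m β n 4≤e 0<d 2≤n))
              (Transfer.doubling-count G e M β m N d gap 4≤e 0<d (Rounding.N-large e d m β n 4≤e 0<d 2≤n) (Rounding.M-large e d m β n 4≤e 0<d 2≤n)
                Y cardY A A⊆Y cardA distinct sums′
                (Setup.ChosenE.ChosenD.b-small k w σ 1⊑k ½⊑w 64kw⊑σ e σ⊑zE 8kwE⊑σ 4≤e d 0<d dcw⊑p p⊑2dcw m N (Rounding.m≤2N e d m β n 4≤e 0<d 2≤n)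
                  (⊑-⊏-trans (≋⇒⊑ (≋-sym KS≋pp)) KS⊏))
                r f (Rounding.n+2≤2^r e d m β n 4≤e 0<d 2≤n) (Rounding.f-large e d m β n 4≤e 0<d 2≤n))
            where
            κ b N M f r₀ r : ℕ
            κ  = 4 ℕ.* e ℕ.* e
            b  = 2 ℕ.* κ ℕ.* d
            N  = Rounding.N e d m β n 4≤e 0<d 2≤n
            M  = Rounding.M e d m β n 4≤e 0<d 2≤n
            f  = Rounding.f e d m β n 4≤e 0<d 2≤n
            r₀ = Rounding.r₀ e d m β n 4≤e 0<d 2≤n
            r  = Rounding.r e d m β n 4≤e 0<d 2≤n
            c : ℝ
            c = fromℕ κ
            m⊑pp : fromℕ m ⊑ p * p
            m⊑pp = ⊑-trans m⊑KS (≋⇒⊑ KS≋pp)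
            -- `2s ≤ Ks < m + 1` gives `2s ≤ m ≤ 2N`, so every factor of the larger falling
            -- factorial is nonnegative.
            s≤N : s ℕ.≤ N
            s≤N = ℕₚ.*-cancelˡ-≤ 2 (ℕₚ.≤-trans (ℕₚ.≤-pred (fromℕ-cancel-< {2 ℕ.* s} {suc m}
              (⊑-⊏-trans (⊑-trans (≋⇒⊑ (fromℕ-* 2 s)) (⊑-*ʳ (0⊑fromℕ s) 2⊑K)) KS⊏))) (Rounding.m≤2N e d m β n 4≤e 0<d 2≤n))
            mβ⊑ : fromℕ (m ℕ.+ β) ⊑ fromℕ 2 * x
            mβ⊑ = ⊑-trans (≋⇒⊑ (fromℕ-+ m β)) (⊑-trans (⊑-+ m⊑KS ⊑-refl) (≋⇒⊑ (≋-sym 2x≋)))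
            -- An order up to `M` is below the argument of `β`, so it is at most `β` by maximality.
            gap : ∀ o → SubgroupOrder o → o ℕ.≤ β ⊎ M ℕ.≤ o
            gap o H with ℕₚ.≤-total M o
            ... | inj₁ M≤o = inj₂ M≤o
            ... | inj₂ o≤M = inj₁ (β-max o H (⊑-trans (fromℕ-mono {o} {M} o≤M)
              (Setup.ChosenE.M-bound k w σ 1⊑k ½⊑w 64kw⊑σ e σ⊑zE 8kwE⊑σ 4≤e {KS} m M 0⊑KS KS≋ m⊑KS (Rounding.M-small e d m β n 4≤e 0<d 2≤n))))
            sums′ : ∀ j → ∃[ o ] (HasCard (A j ⊞ A j) o × o ℕ.≤ m)
            sums′ j = let o , card , o⊑ = sums j in o , card , ℕₚ.≤-pred (fromℕ-cancel-< {o} {suc m} (⊑-⊏-trans o⊑ KS⊏))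

          count-bound : fromℕ cnt ⊑ bound
          -- The goal is a negative inequality, so the three rounded quotients, the last of which is
          -- `m = ⌊Ks⌋`, may be taken out of their double negations.
          count-bound = ⊑-stable λ ret → Setup.¬¬-E k w σ 1⊑k ½⊑w 64kw⊑σ λ (e , σ⊑zE , 8kwE⊑σ , 4≤e) →
            Setup.ChosenE.¬¬-D k w σ 1⊑k ½⊑w 64kw⊑σ e σ⊑zE 8kwE⊑σ 4≤e λ (d , 0<d , dcw⊑p , p⊑2dcw) →
            ¬¬-quotient 0⊑KS 0⊏1 λ (m , m⊑ , m⊐) → ret (parameters-bound e σ⊑zE 8kwE⊑σ 4≤e d 0<d dcw⊑p p⊑2dcw m
              (⊑-trans (≋⇒⊑ (≋-sym (*-identityʳ (fromℕ m)))) m⊑) (⊏-⊑-trans m⊐ (≋⇒⊑ (*-identityʳ (fromℕ (suc m))))))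

  -- Translation to the given reals, and the case `n = 1`

  ≤⇒⊓≈ˡ : ∀ {x y} → x D.≤ y → (x D.⊓ y) D.≈ x
  ≤⇒⊓≈ˡ {x} {y} x≤y = CauchyReals.≤-pointwise {x D.⊓ y} {x} 0 (λ k _ → ℚₚ.p⊓q≤p (seq x k) (seq y k))
    , CauchyReals.≲⇒≤ {x} {x D.⊓ y} λ ε 0<ε → let N , f = CauchyReals.≤⇒≲ {x} {y} x≤y ε 0<ε in N , λ k hk →
        ≡.subst (seq x k ℚ.≤_) (≡.sym (ℚₚ.mono-≤-distrib-⊓ (ℚₚ.+-monoˡ-≤ ε) (seq x k) (seq y k))) (ℚₚ.⊓-glb (D.CauchyLemmas.p≤p+q (ℚₚ.<⇒≤ 0<ε)) (f k hk))

  ≤⇒⊓≈ʳ : ∀ {x y} → y D.≤ x → (x D.⊓ y) D.≈ y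
  ≤⇒⊓≈ʳ {x} {y} y≤x = CauchyReals.≤-pointwise {x D.⊓ y} {y} 0 (λ k _ → ℚₚ.p⊓q≤q (seq x k) (seq y k))
    , CauchyReals.≲⇒≤ {y} {x D.⊓ y} λ ε 0<ε → let N , f = CauchyReals.≤⇒≲ {y} {x} y≤x ε 0<ε in N , λ k hk →
        ≡.subst (seq y k ℚ.≤_) (≡.sym (ℚₚ.mono-≤-distrib-⊓ (ℚₚ.+-monoˡ-≤ ε) (seq x k) (seq y k))) (ℚₚ.⊓-glb (f k hk) (D.CauchyLemmas.p≤p+q (ℚₚ.<⇒≤ 0<ε)))

  opaque
    unfolding _+_

    -- Under `unfolding` the opaque operations are definitionally the given ones; these equations
    -- make that fact usable outside the block.
    +≡ : ∀ x y → x D.+ y ≡ x + y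
    +≡ x y = ≡.refl

    *≡ : ∀ x y → x D.* y ≡ x * y
    *≡ x y = ≡.refl

    -≡ : ∀ x → D.- x ≡ - x
    -≡ x = ≡.refl

    exp≡ : ∀ x → D.exp x ≡ exp x
    exp≡ x = ≡.refl

    fromℚ≡ : ∀ q → D.fromℚ q ≡ fromℚ q
    fromℚ≡ q = ≡.refl

  fromℕ≡ : ∀ n → D.fromℕ n ≡ fromℕ n
  fromℕ≡ n = fromℚ≡ (ι n)

  ^≡ : ∀ x n → x D.^ n ≡ x ^ n
  ^≡ x zero    = fromℚ≡ 1ℚ
  ^≡ x (suc n) = ≡.trans (*≡ x (x D.^ n)) (≡.cong (x *_) (^≡ x n))

  -≡₂ : ∀ x y → x D.- y ≡ x - y
  -≡₂ x y = ≡.trans (+≡ x (D.- y)) (≡.cong (λ z → x + z) (-≡ y))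

  FF≡ : ∀ x s → D.fallingFactorial x s ≡ fallingFactorial x s
  FF≡ x zero    = fromℚ≡ 1ℚ
  FF≡ x (suc s) = ≡.trans (*≡ (D.fallingFactorial x s) (x D.- D.fromℕ s))
    (≡.cong₂ _*_ (FF≡ x s) (≡.trans (-≡₂ x (D.fromℕ s)) (≡.cong (λ y → x - y) (fromℕ≡ s))))

  binomial≡ : ∀ x s → D.binomial x s ≡ binomial x s
  binomial≡ x s = scaled ((+ 1 ℚ./ (s !)) {{s ℕₚ.!≢0}})
    where
    scaled : ∀ r → D.fallingFactorial x s D.* D.fromℚ r ≡ fallingFactorial x s * fromℚ r
    scaled r = ≡.trans (*≡ (D.fallingFactorial x s) (D.fromℚ r)) (≡.cong₂ _*_ (FF≡ x s) (fromℚ≡ r))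

  to-≋ : ∀ {x x′ y y′} → x ≡ x′ → y ≡ y′ → x D.≈ y → x′ ≋ y′
  to-≋ ≡.refl ≡.refl h = ≋⟨ h ⟩

  to-⊑ : ∀ {x x′ y y′} → x ≡ x′ → y ≡ y′ → x D.≤ y → x′ ⊑ y′
  to-⊑ ≡.refl ≡.refl h = ⊑⟨ h ⟩

  to-⊏ : ∀ {x x′ y y′} → x ≡ x′ → y ≡ y′ → x D.< y → x′ ⊏ y′
  to-⊏ ≡.refl ≡.refl h = ⊏⟨ h ⟩

  from-⊑ : ∀ {x x′ y y′} → x ≡ x′ → y ≡ y′ → x′ ⊑ y′ → x D.≤ y
  from-⊑ ≡.refl ≡.refl ⊑⟨ h ⟩ = h

  from-⊏ : ∀ {x x′ y y′} → x ≡ x′ → y ≡ y′ → x′ ⊏ y′ → x D.< y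
  from-⊏ ≡.refl ≡.refl ⊏⟨ h ⟩ = h

  -- From the index `N` on the terms of `x` are at least `ε`, so the cut-off in `recipℝ` has no
  -- effect.
  recip-inverse : ∀ {x x′} → x ≡ x′ → (pos : D.0ℝ D.< x) → D.recipℝ x pos * x′ ≋ 1ℝ
  recip-inverse {x} ≡.refl pos@(ε , 0<ε , N , low) = to-≋ (*≡ (D.recipℝ x pos) x) (fromℚ≡ 1ℚ)
      ( CauchyReals.≤-pointwise {D.recipℝ x pos D.* x} {D.1ℝ} N (λ k hk → ℚₚ.≤-reflexive (eq k hk))
      , CauchyReals.≤-pointwise {D.1ℝ} {D.recipℝ x pos D.* x} N (λ k hk → ℚₚ.≤-reflexive (≡.sym (eq k hk))))
    where
    open D.CauchyLemmas
    eq : ∀ k → N ℕ.≤ k → 1/⁺ (seq x k ℚ.⊔ ε) (0<⊔ (seq x k) ε 0<ε) ℚ.* seq x k ≡ 1ℚ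
    eq k hk = ≡.trans (ℚₚ.*-comm (1/⁺ (seq x k ℚ.⊔ ε) (0<⊔ (seq x k) ε 0<ε)) (seq x k))
      (≡.trans (≡.cong (ℚ._* 1/⁺ (seq x k ℚ.⊔ ε) (0<⊔ (seq x k) ε 0<ε)) (≡.sym (ℚₚ.p≥q⇒p⊔q≡p (≡.subst (ℚ._≤ seq x k) (ℚₚ.+-identityˡ ε) (low k hk)))))
        (*-1/⁺ (seq x k ℚ.⊔ ε) (0<⊔ (seq x k) ε 0<ε)))

  1^n≋1 : ∀ n → 1ℝ ^ n ≋ 1ℝ
  1^n≋1 zero    = ≋-refl
  1^n≋1 (suc n) = ≋-trans (*-identityˡ _) (1^n≋1 n)

  2^n½^n : ∀ n → fromℕ 2 ^ n * fromℚ ½ ^ n ≋ 1ℝ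
  2^n½^n n = ≋-trans (≋-sym (^-distrib-* (fromℕ 2) (fromℚ ½) n)) (≋-trans (^-cong n (solve 0 (con (ι 2) :* con ½ := con 1ℚ) ≋-refl)) (1^n≋1 n))

  module _ where

    open ℝ-Reasoning

    -- K < 2⁻³⁶ s / L³ says that (64 k w)⁶ < σ⁶.
    size-condition : ∀ {s : ℕ} {K L w k σ R : ℝ} → 0ℝ ⊑ L → 0ℝ ⊑ σ → w * w ≋ L → k ^ 6 ≋ K → σ ^ 6 ≋ fromℕ s →
      R * L ^ 3 ≋ 1ℝ → K ⊑ fromℚ ½ ^ 36 * (fromℕ s * R) → fromℕ 64 * (k * w) ⊑ σ
    size-condition {s} {K} {L} {w} {k} {σ} {R} 0⊑L 0⊑σ ww≋L k⁶≋K σ⁶≋s RL³ K⊑ = ^-cancel-⊑ 5 0⊑σ (begin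
      (fromℕ 64 * (k * w)) ^ 6  ≈⟨ ^-distrib-* (fromℕ 64) (k * w) 6 ⟩
      fromℕ 64 ^ 6 * (k * w) ^ 6  ≈⟨ ≋-* (≋-trans (≋-sym (fromℕ-^ 64 6)) (fromℕ-^ 2 36)) (solve 2 (λ k w → (k :* w) :^ 6 := k :^ 6 :* (w :* w) :^ 3) ≋-refl k w) ⟩
      fromℕ 2 ^ 36 * (k ^ 6 * (w * w) ^ 3)  ≈⟨ ≋-* ≋-refl (≋-* k⁶≋K (^-cong 3 ww≋L)) ⟩
      fromℕ 2 ^ 36 * (K * L ^ 3)  ≤⟨ ⊑-*ˡ (^-nonneg 36 (0⊑fromℕ 2)) (⊑-*ʳ (^-nonneg 3 0⊑L) K⊑) ⟩
      fromℕ 2 ^ 36 * (fromℚ ½ ^ 36 * (fromℕ s * R) * L ^ 3)  ≈⟨ solve 5 (λ a b s r l → a :* (b :* (s :* r) :* l) := (a :* b) :* s :* (r :* l)) ≋-refl (fromℕ 2 ^ 36) (fromℚ ½ ^ 36) (fromℕ s) R (L ^ 3) ⟩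
      (fromℕ 2 ^ 36 * fromℚ ½ ^ 36) * fromℕ s * (R * L ^ 3)  ≈⟨ ≋-* (≋-* (2^n½^n 36) ≋-refl) RL³ ⟩
      1ℝ * fromℕ s * 1ℝ  ≈⟨ ≋-trans (*-identityʳ _) (*-identityˡ _) ⟩
      fromℕ s                                                             ≈⟨ σ⁶≋s ⟨
      σ ^ 6                                                               ∎)

    -- Compares with the coefficient of `s` over `s`, which is 1; as `s ≤ x`, all `θ` can be 0.
    1⊑binomial : ∀ {x} s → fromℕ s ⊑ x → 1ℝ ⊑ binomial x s
    1⊑binomial {x} s s⊑x = begin
      1ℝ                                        ≡⟨ ≡.cong fromℕ (nCn≡1 s) ⟨
      fromℕ (s C s)                             ≈⟨ C-binomial s s ⟩
      binomial (fromℕ s) s  ≤⟨ binomial-ratio {x} {fromℕ s} (λ _ → 0ℝ) s (λ _ _ → ⊑-refl) (0⊑-fromℕ {fromℕ s} {s} ⊑-refl) (0⊑-fromℕ {x} {s} s⊑x)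
                                                     (λ i _ → ⊑-trans (⊑-+⇒-⊑ (⊑-trans s⊑x (≋⇒⊑ (≋-sym (+-identityʳ x))))) (≋⇒⊑ (solve 1 (λ y → con 0ℚ := con 0ℚ :* y) ≋-refl (x - fromℕ i)))) ⟩
      exp (∑< (λ _ → 0ℝ) s) * binomial x s  ≈⟨ ≋-* (≋-trans (exp-cong (≋-trans (∑<-const 0ℝ s) (solve 1 (λ s → s :* con 0ℚ := con 0ℚ) ≋-refl (fromℕ s)))) exp-0) ≋-refl ⟩
      1ℝ * binomial x s                         ≈⟨ *-identityˡ _ ⟩
      binomial x s                              ∎

    -- `1 + L ≤ exp L = 1` forces `log 1 = 0`; the exponent in the claimed bound then vanishes.
    w≋0 : ∀ {L w} → exp L ≋ fromℕ 1 → w * w ≋ L → 0ℝ ⊑ w → w ≋ 0ℝ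
    w≋0 {L} {w} exp-L ww≋L 0⊑w = ⊑-antisym (^-cancel-⊑ 1 ⊑-refl (begin
      w ^ 2                 ≈⟨ solve 1 (λ w → w :^ 2 := w :* w) ≋-refl w ⟩
      w * w                 ≈⟨ ww≋L ⟩
      L                     ≈⟨ solve 1 (λ y → y := (con 1ℚ :+ y) :- con 1ℚ) ≋-refl L ⟩
      1ℝ + L - 1ℝ           ≤⟨ ⊑-+ (⊑-trans (1+x⊑exp 0⊑L) (≋⇒⊑ exp-L)) ⊑-refl ⟩
      1ℝ - 1ℝ               ≈⟨ solve 0 (con 1ℚ :- con 1ℚ := con 0ℚ :^ 2) ≋-refl ⟩
      0ℝ ^ 2                ∎)) 0⊑w
      where
      0⊑L : 0ℝ ⊑ L
      0⊑L = ⊑-trans (0⊑* 0⊑w 0⊑w) (≋⇒⊑ ww≋L)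

  module Singleton {g ℓ} (G : AbelianGroup g ℓ) where

    open AbelianGroup G using (trans; sym; refl)
    open D.Sets G

    -- For `n = 1` the logarithm is 0, and no comparison of `K` with `s` is available. Instead, each
    -- set is nonempty and contained in the single point `Y`, so any two of them coincide.
    at-most-one : ∀ {s cnt} → 0 ℕ.< s → (Y : Subset) → HasCard Y 1 → (A : Fin cnt → Subset) → (∀ j → A j ⊆ᵖ Y) →
      (∀ j → HasCard (A j) s) → (∀ i j → A i ≐ A j → i ≡ j) → cnt ℕ.≤ 1
    at-most-one {cnt = zero} _ _ _ _ _ _ _ = z≤n
    at-most-one {cnt = suc zero} _ _ _ _ _ _ _ = s≤s z≤n
    at-most-one {suc s} {suc (suc cnt)} _ Y (y , _ , Y⇔) A A⊆Y cardA distinct =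
      contradiction (distinct Fin.zero (Fin.suc Fin.zero) (half Fin.zero (Fin.suc Fin.zero) , half (Fin.suc Fin.zero) Fin.zero)) λ ()
      where
      is-y : ∀ {x} → Y x → AbelianGroup._≈_ G x (y Fin.zero)
      is-y x∈ with Equivalence.to (Y⇔ _) x∈
      ... | Fin.zero , e = e
      half : ∀ i j → A i ⊆ᵖ A j
      half i j {x} x∈ = Equivalence.from (proj₂ (proj₂ (cardA j)) x)
        (Fin.zero , trans (is-y (A⊆Y i x∈)) (sym (is-y (A⊆Y j (Equivalence.from (proj₂ (proj₂ (cardA j)) _) (Fin.zero , refl))))))

  +≡₂ : ∀ x y {x′ y′} → x ≡ x′ → y ≡ y′ → x D.+ y ≡ x′ + y′
  +≡₂ x y ≡.refl ≡.refl = +≡ x y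

  *≡₂ : ∀ x y {x′ y′} → x ≡ x′ → y ≡ y′ → x D.* y ≡ x′ * y′
  *≡₂ x y ≡.refl ≡.refl = *≡ x y

  ^≡₂ : ∀ x n {x′} → x ≡ x′ → x D.^ n ≡ x′ ^ n
  ^≡₂ x n ≡.refl = ^≡ x n

  module _ (s β : ℕ) (K k σ w lam : ℝ) where

    threshold≡ : K D.* D.fromℕ s D.+ D.2ℝ D.^ 6 D.* k D.^ 7 D.* σ D.^ 5 D.* w
               ≡ K * fromℕ s + fromℕ 2 ^ 6 * k ^ 7 * σ ^ 5 * w
    threshold≡ = +≡₂ (K D.* D.fromℕ s) (D.2ℝ D.^ 6 D.* k D.^ 7 D.* σ D.^ 5 D.* w)
      (*≡₂ K (D.fromℕ s) ≡.refl (fromℕ≡ s))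
      (*≡₂ (D.2ℝ D.^ 6 D.* k D.^ 7 D.* σ D.^ 5) w
        (*≡₂ (D.2ℝ D.^ 6 D.* k D.^ 7) (σ D.^ 5)
          (*≡₂ (D.2ℝ D.^ 6) (k D.^ 7) (^≡₂ D.2ℝ 6 (fromℕ≡ 2)) (^≡ k 7)) (^≡ σ 5)) ≡.refl)

    exponent≡ : D.2ℝ D.^ 9 D.* lam D.* k D.* σ D.^ 5 D.* w ≡ fromℕ 2 ^ 9 * lam * k * σ ^ 5 * w
    exponent≡ = *≡₂ (D.2ℝ D.^ 9 D.* lam D.* k D.* σ D.^ 5) w
      (*≡₂ (D.2ℝ D.^ 9 D.* lam D.* k) (σ D.^ 5)
        (*≡₂ (D.2ℝ D.^ 9 D.* lam) k (*≡₂ (D.2ℝ D.^ 9) lam (^≡₂ D.2ℝ 9 (fromℕ≡ 2)) ≡.refl) ≡.refl) (^≡ σ 5)) ≡.refl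

    half-sum≡ : D.½ℝ D.* (K D.* D.fromℕ s D.+ D.fromℕ β) ≡ fromℚ ½ * (K * fromℕ s + fromℕ β)
    half-sum≡ = *≡₂ D.½ℝ (K D.* D.fromℕ s D.+ D.fromℕ β) (fromℚ≡ ½)
      (+≡₂ (K D.* D.fromℕ s) (D.fromℕ β) (*≡₂ K (D.fromℕ s) ≡.refl (fromℕ≡ s)) (fromℕ≡ β))

    bound≡ : D.exp (D.2ℝ D.^ 9 D.* lam D.* k D.* σ D.^ 5 D.* w) D.* D.binomial (D.½ℝ D.* (K D.* D.fromℕ s D.+ D.fromℕ β)) s
           ≡ exp (fromℕ 2 ^ 9 * lam * k * σ ^ 5 * w) * binomial (fromℚ ½ * (K * fromℕ s + fromℕ β)) s
    bound≡ = *≡₂ (D.exp (D.2ℝ D.^ 9 D.* lam D.* k D.* σ D.^ 5 D.* w)) (D.binomial (D.½ℝ D.* (K D.* D.fromℕ s D.+ D.fromℕ β)) s)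
      (≡.trans (exp≡ (D.2ℝ D.^ 9 D.* lam D.* k D.* σ D.^ 5 D.* w)) (≡.cong exp exponent≡))
      (≡.trans (binomial≡ (D.½ℝ D.* (K D.* D.fromℕ s D.+ D.fromℕ β)) s) (≡.cong (λ x → binomial x s) half-sum≡))

  from-0⊏ : ∀ {x x′} → x ≡ x′ → 0ℝ ⊏ x′ → D.0ℝ D.< x
  from-0⊏ {x} {x′} e h = from-⊏ {D.0ℝ} {0ℝ} {x} {x′} (fromℚ≡ 0ℚ) e h

  -- Whether `K > 2`, and which entry of the minimum is smaller, can be decided only under double
  -- negation. In the case of the quotient the equation is cleared of the reciprocal, the form that
  -- `ratio-large` uses.
  ¬¬-lam : ∀ {K l lam} → fromℕ 2 ⊑ K → D.IsMinQuotient K l lam → ¬ ¬ (lam ≋ l ⊎ (0ℝ ⊏ K - fromℕ 2 × lam * (K - fromℕ 2) ≋ K))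
  ¬¬-lam {K} {l} {lam} 2⊑K (at-2 , above-2) ret = ¬¬-excluded-middle λ where
      (no ¬0⊏) → ret (inj₁ ≋⟨ at-2 (at-most-2 ¬0⊏) ⟩)
      (yes 0⊏) → ¬¬-excluded-middle λ dec → ret (minimum 0⊏ dec)
    where
    K-2≡ : K D.- D.2ℝ ≡ K - fromℕ 2
    K-2≡ = ≡.trans (-≡₂ K D.2ℝ) (≡.cong (λ y → K - y) (fromℕ≡ 2))
    at-most-2 : ¬ 0ℝ ⊏ K - fromℕ 2 → K D.≈ D.2ℝ
    at-most-2 ¬0⊏ = from-⊑ {K} {K} {D.2ℝ} {fromℕ 2} ≡.refl (fromℕ≡ 2) (¬⊏⇒⊒ λ 2⊏K → ¬0⊏ (⊏⇒0⊏- 2⊏K))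
                  , from-⊑ {D.2ℝ} {fromℕ 2} {K} {K} (fromℕ≡ 2) ≡.refl 2⊑K
    module _ (0⊏ : 0ℝ ⊏ K - fromℕ 2) where
      open ℝ-Reasoning
      pos : D.0ℝ D.< K D.- D.2ℝ
      pos = from-0⊏ {K D.- D.2ℝ} {K - fromℕ 2} K-2≡ 0⊏
      R a : ℝ
      R = D.recipℝ (K D.- D.2ℝ) pos
      a = K D.* R
      lam≋ : lam ≋ a D.⊓ l
      lam≋ = ≋⟨ above-2 pos ⟩
      quotient : a ≋ lam → lam * (K - fromℕ 2) ≋ K
      quotient a≋lam = begin-equality
        lam * (K - fromℕ 2)             ≈⟨ ≋-* a≋lam ≋-refl ⟨
        a * (K - fromℕ 2)               ≡⟨ ≡.cong (λ y → y * (K - fromℕ 2)) (*≡ K R) ⟩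
        K * R * (K - fromℕ 2)           ≈⟨ *-assoc K R (K - fromℕ 2) ⟩
        K * (R * (K - fromℕ 2))         ≈⟨ ≋-* ≋-refl (recip-inverse {K D.- D.2ℝ} {K - fromℕ 2} K-2≡ pos) ⟩
        K * 1ℝ                          ≈⟨ *-identityʳ K ⟩
        K                               ∎
      minimum : Dec (a ⊑ l) → lam ≋ l ⊎ (0ℝ ⊏ K - fromℕ 2 × lam * (K - fromℕ 2) ≋ K)
      minimum (yes ⊑⟨ a≤l ⟩) = inj₂ (0⊏ , quotient (≋-trans (≋-sym (≋⟨_⟩ {a D.⊓ l} {a} (≤⇒⊓≈ˡ {a} {l} a≤l))) (≋-sym lam≋)))
      minimum (no a⋢l) = inj₁ (≋-trans lam≋ (≋⟨_⟩ {a D.⊓ l} {l} (≤⇒⊓≈ʳ {a} {l} λ a<l → a⋢l ⊑⟨ CauchyReals.<⇒≤ {a} {l} a<l ⟩)))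

  module _ {g ℓ} (G : AbelianGroup g ℓ) (s n : ℕ) (0<s : 0 ℕ.< s) (0<n : 0 ℕ.< n) (K L l w k σ : ℝ)
    (log-n : D.IsLog (D.fromℕ n) L) (log-s : D.IsLog (D.fromℕ s) l)
    (root-w : D.IsRoot 2 L w) (root-k : D.IsRoot 6 K k) (root-σ : D.IsRoot 6 (D.fromℕ s) σ)
    (2≤K : D.2ℝ D.≤ K)
    (K-small : (pos : D.0ℝ D.< L D.^ 3) → K D.< D.½ℝ D.^ 36 D.* (D.fromℕ s D.÷ L D.^ 3 [ pos ])) where

    open D.Sets G
    open ℝ-Reasoning

    exp-L : exp L ≋ fromℕ n
    exp-L = to-≋ {D.exp L} {exp L} {D.fromℕ n} {fromℕ n} (exp≡ L) (fromℕ≡ n) log-n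

    exp-l : exp l ≋ fromℕ s
    exp-l = to-≋ {D.exp l} {exp l} {D.fromℕ s} {fromℕ s} (exp≡ l) (fromℕ≡ s) log-s

    0⊑w : 0ℝ ⊑ w
    0⊑w = to-⊑ {D.0ℝ} {0ℝ} {w} {w} (fromℚ≡ 0ℚ) ≡.refl (proj₁ root-w)

    0⊑k : 0ℝ ⊑ k
    0⊑k = to-⊑ {D.0ℝ} {0ℝ} {k} {k} (fromℚ≡ 0ℚ) ≡.refl (proj₁ root-k)

    0⊑σ : 0ℝ ⊑ σ
    0⊑σ = to-⊑ {D.0ℝ} {0ℝ} {σ} {σ} (fromℚ≡ 0ℚ) ≡.refl (proj₁ root-σ)

    ww≋L : w * w ≋ L
    ww≋L = ≋-trans (solve 1 (λ w → w :* w := w :^ 2) ≋-refl w) (to-≋ {w D.^ 2} {w ^ 2} {L} {L} (^≡ w 2) ≡.refl (proj₂ root-w))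

    k⁶≋K : k ^ 6 ≋ K
    k⁶≋K = to-≋ {k D.^ 6} {k ^ 6} {K} {K} (^≡ k 6) ≡.refl (proj₂ root-k)

    σ⁶≋s : σ ^ 6 ≋ fromℕ s
    σ⁶≋s = to-≋ {σ D.^ 6} {σ ^ 6} {D.fromℕ s} {fromℕ s} (^≡ σ 6) (fromℕ≡ s) (proj₂ root-σ)

    2⊑K : fromℕ 2 ⊑ K
    2⊑K = to-⊑ {D.2ℝ} {fromℕ 2} {K} {K} (fromℕ≡ 2) ≡.refl 2≤K

    64kw⊑σ : 2 ℕ.≤ n → fromℕ 64 * (k * w) ⊑ σ
    64kw⊑σ 2≤n = size-condition {s} {K} {L} {w} {k} {σ} {R} (⊏⇒⊑ 0⊏L) 0⊑σ ww≋L k⁶≋K σ⁶≋s (recip-inverse {L D.^ 3} {L ^ 3} (^≡ L 3) pos)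
      (⊏⇒⊑ (to-⊏ {K} {K} {D.½ℝ D.^ 36 D.* (D.fromℕ s D.* R)} {fromℚ ½ ^ 36 * (fromℕ s * R)} ≡.refl
        (*≡₂ (D.½ℝ D.^ 36) (D.fromℕ s D.* R) (^≡₂ D.½ℝ 36 (fromℚ≡ ½)) (*≡₂ (D.fromℕ s) R (fromℕ≡ s) ≡.refl)) (K-small pos)))
      where
      0⊏L : 0ℝ ⊏ L
      0⊏L = ⊏-⊑-trans 0⊏½ (½⊑log 2≤n exp-L)
      pos : D.0ℝ D.< L D.^ 3
      pos = from-0⊏ {L D.^ 3} {L ^ 3} (^≡ L 3) (^-pos 3 0⊏L)
      R : ℝ
      R = D.recipℝ (L D.^ 3) pos

    module _ (Y : Subset) (cardY : HasCard Y n) (β : ℕ)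
      (β-max : ∀ o → SubgroupOrder o → D.fromℕ o D.≤ K D.* D.fromℕ s D.+ D.2ℝ D.^ 6 D.* k D.^ 7 D.* σ D.^ 5 D.* w → o ℕ.≤ β)
      (lam : ℝ) (min : D.IsMinQuotient K l lam)
      {cnt : ℕ} (A : Fin cnt → Subset) (A⊆Y : ∀ j → A j ⊆ᵖ Y) (cardA : ∀ j → HasCard (A j) s)
      (sums : ∀ j → ∃[ o ] (HasCard (A j ⊞ A j) o × D.fromℕ o D.≤ K D.* D.fromℕ s))
      (distinct : ∀ i j → A i ≐ A j → i ≡ j) where

      x : ℝ
      x = fromℚ ½ * (K * fromℕ s + fromℕ β)

      exponent : ℝ
      exponent = fromℕ 2 ^ 9 * lam * k * σ ^ 5 * w

      single : n ≡ 1 → fromℕ cnt ⊑ exp exponent * binomial x s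
      single ≡.refl = begin
        fromℕ cnt  ≤⟨ fromℕ-mono {cnt} {1} (Singleton.at-most-one G 0<s Y cardY A A⊆Y cardA distinct) ⟩
        1ℝ                                 ≤⟨ 1⊑binomial s s⊑x ⟩
        binomial x s                       ≈⟨ *-identityˡ _ ⟨
        1ℝ * binomial x s  ≈⟨ ≋-* (≋-trans (exp-cong (≋-trans (≋-* ≋-refl (w≋0 exp-L ww≋L 0⊑w)) (solve 1 (λ y → y :* con 0ℚ := con 0ℚ) ≋-refl (fromℕ 2 ^ 9 * lam * k * σ ^ 5)))) exp-0) ≋-refl ⟨
        exp exponent * binomial x s        ∎
        where
        s⊑x : fromℕ s ⊑ x
        s⊑x = begin
          fromℕ s  ≈⟨ solve 1 (λ s → s := con ½ :* (con (ι 2) :* s :+ con 0ℚ)) ≋-refl (fromℕ s) ⟩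
          fromℚ ½ * (fromℕ 2 * fromℕ s + 0ℝ)  ≤⟨ ⊑-*ˡ (⊏⇒⊑ 0⊏½) (⊑-+ (⊑-*ʳ (0⊑fromℕ s) 2⊑K) (0⊑fromℕ β)) ⟩
          x                                              ∎

      several : 2 ℕ.≤ n → fromℕ cnt ⊑ exp exponent * binomial x s
      several 2≤n = ⊑-trans (⊑-stable λ ret → ¬¬-lam 2⊑K min λ lam-value → ret
          (Main.count-bound G s n 0<s 2≤n K L l w k σ lam exp-L exp-l ww≋L k⁶≋K σ⁶≋s 0⊑w 0⊑k 2⊑K (64kw⊑σ 2≤n) lam-value β β-max′ Y cardY A A⊆Y cardA sums′ distinct))
        (≋⇒⊑ (≋-* (exp-cong (≋-trans (solve 4 (λ a k s w → con (ι 512) :* a :* (k :* s :* w) := con (ι 512) :* a :* k :* s :* w) ≋-refl lam k (σ ^ 5) w)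
          (≋-* (≋-* (≋-* (≋-* (fromℕ-^ 2 9) ≋-refl) ≋-refl) ≋-refl) ≋-refl))) ≋-refl))
        where
        β-max′ : ∀ o → SubgroupOrder o → fromℕ o ⊑ K * fromℕ s + fromℕ 64 * k ^ 7 * σ ^ 5 * w → o ℕ.≤ β
        β-max′ o H o⊑ = β-max o H (from-⊑ {D.fromℕ o} {fromℕ o} {K D.* D.fromℕ s D.+ D.2ℝ D.^ 6 D.* k D.^ 7 D.* σ D.^ 5 D.* w} {K * fromℕ s + fromℕ 2 ^ 6 * k ^ 7 * σ ^ 5 * w}
          (fromℕ≡ o) (threshold≡ s β K k σ w lam)
          (⊑-trans o⊑ (≋⇒⊑ (≋-+ ≋-refl (≋-* (≋-* (≋-* (fromℕ-^ 2 6) ≋-refl) ≋-refl) ≋-refl)))))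
        sums′ : ∀ j → ∃[ o ] (HasCard (A j ⊞ A j) o × fromℕ o ⊑ K * fromℕ s)
        sums′ j = let o , card , o≤ = sums j in o , card ,
          to-⊑ {D.fromℕ o} {fromℕ o} {K D.* D.fromℕ s} {K * fromℕ s} (fromℕ≡ o) (*≡₂ K (D.fromℕ s) ≡.refl (fromℕ≡ s)) o≤

      number-bound : fromℕ cnt ⊑ exp exponent * binomial x s
      number-bound = go (ℕₚ.m≤n⇒m<n∨m≡n 0<n)
        where
        go : 2 ℕ.≤ n ⊎ 1 ≡ n → fromℕ cnt ⊑ exp exponent * binomial x s
        go (inj₁ 2≤n) = several 2≤n
        go (inj₂ e)   = single (≡.sym e)

      number-bound-D : D.fromℕ cnt D.≤ D.exp (D.2ℝ D.^ 9 D.* lam D.* k D.* σ D.^ 5 D.* w)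
                         D.* D.binomial (D.½ℝ D.* (K D.* D.fromℕ s D.+ D.fromℕ β)) s
      number-bound-D = from-⊑ {D.fromℕ cnt} {fromℕ cnt}
        {D.exp (D.2ℝ D.^ 9 D.* lam D.* k D.* σ D.^ 5 D.* w) D.* D.binomial (D.½ℝ D.* (K D.* D.fromℕ s D.+ D.fromℕ β)) s}
        {exp exponent * binomial x s} (fromℕ≡ cnt) (bound≡ s β K k σ w lam) number-bound

open import Defs
open import Relation.Unary using (_⊆_)

theorem4p1 : ∀ {c ℓ} (G : AbelianGroup c ℓ) → let open Sets G in
    (s n : ℕ) → 0 ℕ.< s → 0 ℕ.< n →
    (K : ℝ) →
    (log-n log-s √log-n K^⅙ s^⅙ : ℝ) →
    IsLog (fromℕ n) log-n →
    IsLog (fromℕ s) log-s →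
    IsRoot 2 log-n √log-n →
    IsRoot 6 K K^⅙ →
    IsRoot 6 (fromℕ s) s^⅙ →
    2ℝ ≤ K →
    ((pos : 0ℝ < log-n ^ 3) → K < ½ℝ ^ 36 * (fromℕ s ÷ log-n ^ 3 [ pos ])) →
    (Y : Subset) → HasCard Y n →
    (β : ℕ) → IsBeta (K * fromℕ s + 2ℝ ^ 6 * K^⅙ ^ 7 * s^⅙ ^ 5 * √log-n) β →
    (lam : ℝ) → IsMinQuotient K log-s lam →
    NumberAtMost
    (λ J → J ⊆ Y × HasCard J s × (∃[ m ] (HasCard (J ⊞ J) m × fromℕ m ≤ K * fromℕ s)))
    (exp (2ℝ ^ 9 * lam * K^⅙ * s^⅙ ^ 5 * √log-n)
    * binomial (½ℝ * (K * fromℕ s + fromℕ β)) s)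
theorem4p1 G s n 0<s 0<n K log-n log-s √log-n K^⅙ s^⅙ is-log-n is-log-s is-√ is-K^⅙ is-s^⅙ 2≤K K-small
  Y cardY β is-β lam is-lam cnt A P distinct =
  Estimates.number-bound-D G s n 0<s 0<n K log-n log-s √log-n K^⅙ s^⅙ is-log-n is-log-s is-√ is-K^⅙ is-s^⅙ 2≤K K-small
    Y cardY β (proj₂ is-β) lam is-lam A (λ j → proj₁ (P j)) (λ j → proj₁ (proj₂ (P j))) (λ j → proj₂ (proj₂ (P j))) distinct
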